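{- There exists an absolute constant $C>0$ and an algorithm which, given any instance $(G,w,(p_e)_{e\in E})$ of the weighted stochastic matching problem (and without any knowledge of the realization $\mathcal{G}$), outputs a subgraph $Q$ of $G$ of maximum degree at most $C/p$, where $p=\min_{e\in E}p_e$, such that $$\mathbb{E}\big[w(\mu(Q\cap\mathcal{G}))\big]\ \ge\ 0.681\cdot \mathbb{E}\big[w(\mu(\mathcal{G}))\big].$$
   Context: An instance of the weighted stochastic matching problem consists of a finite graph $G=(V,E)$, nonnegative edge weights $w=(w_e)_{e\in E}$ and probabilities $p_e\in(0,1]$ for $e\in E$. The realization $\mathcal{G}$ is the random subgraph of $G$ that contains each edge $e$ independently with probability $p_e$. For a set of edges $M$, $w(M)=\sum_{e\in M}w_e$, and $\mu(\cdot)$ denotes a fixed deterministic algorithm returning a maximum-weight matching of a given graph. The subgraph $Q$ must be chosen independently of $\mathcal{G}$ (non-adaptively); $Q\cap\mathcal{G}$ is the set of realized edges of $Q$. The constant $C$ does not depend on $n=|V|$, on $G$, on $w$ or on the $p_e$.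
   Formalization: The edge weights w_e and the probabilities p_e are taken to be rational numbers instead of real numbers. -}

module Defs where

open import Data.Bool using (Bool; true; false; if_then_else_; _∧_; _∨_; not)
open import Data.Nat as ℕ using (ℕ; zero; suc)
open import Data.Fin using (Fin; _≟_)
open import Data.Fin.Base using () renaming (zero to fz; suc to fs)
open import Data.Vec using (Vec; []; _∷_; lookup; zipWith; tabulate)
open import Data.List using (List; []; _∷_; map; concatMap; foldr; allFin; filter)
open import Data.Integer using (+_)
open import Data.Rational using (ℚ; 0ℚ; 1ℚ; _+_; _*_; _-_; _≤_; _<_; _⊔_; _⊓_; _/_)
open import Data.Product using (_×_; _,_)
open import Data.Sum using (_⊎_)
open import Relation.Nullary using (¬_; does)
open import Relation.Binary.PropositionalEquality using (_≡_; _≢_)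

ℕtoℚ : ℕ → ℚ
ℕtoℚ k = + k / 1

record Instance : Set where
  field
    n : ℕ
    m : ℕ
    end₁ : Fin m → Fin n
    end₂ : Fin m → Fin n
    loopless : ∀ e → end₁ e ≢ end₂ e
    noParallel : ∀ e f → ((end₁ e ≡ end₁ f × end₂ e ≡ end₂ f)
                          ⊎ (end₁ e ≡ end₂ f × end₂ e ≡ end₁ f)) → e ≡ f
    w : Fin m → ℚ
    w-nonneg : ∀ e → 0ℚ ≤ w e
    p : Fin m → ℚ
    p-pos : ∀ e → 0ℚ < p e
    p-le1 : ∀ e → p e ≤ 1ℚ

open Instance public

-- a set of edges (subgraph on the same vertex set) = characteristic vector
EdgeSet : ℕ → Set
EdgeSet m = Vec Bool m

_∈ₑ_ : ∀ {m} → Fin m → EdgeSet m → Bool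
e ∈ₑ S = lookup S e

_∩ₑ_ : ∀ {m} → EdgeSet m → EdgeSet m → EdgeSet m
_∩ₑ_ = zipWith _∧_

allEdgeSets : (m : ℕ) → List (EdgeSet m)
allEdgeSets zero = [] ∷ []
allEdgeSets (suc m) = concatMap (λ S → (true ∷ S) ∷ (false ∷ S) ∷ []) (allEdgeSets m)

sumℚ : List ℚ → ℚ
sumℚ = foldr _+_ 0ℚ

maxℚ : List ℚ → ℚ   -- max with 0 (used for nonnegative quantities)
maxℚ = foldr _⊔_ 0ℚ

weight : (I : Instance) → EdgeSet (m I) → ℚ
weight I S = sumℚ (map (λ e → if e ∈ₑ S then w I e else 0ℚ) (allFin (m I)))

touches : (I : Instance) → Fin (m I) → Fin (m I) → Bool
touches I e f = does (end₁ I e ≟ end₁ I f) ∨ does (end₁ I e ≟ end₂ I f)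
              ∨ does (end₂ I e ≟ end₁ I f) ∨ does (end₂ I e ≟ end₂ I f)

isMatching : (I : Instance) → EdgeSet (m I) → Bool
isMatching I S = foldr _∧_ true
  (concatMap (λ e → map (λ f → not (e ∈ₑ S ∧ f ∈ₑ S ∧ not (does (e ≟ f)) ∧ touches I e f))
                        (allFin (m I))) (allFin (m I)))

_⊆ₑ_ : ∀ {m} → EdgeSet m → EdgeSet m → Bool
_⊆ₑ_ {m} S T = foldr _∧_ true (map (λ e → not (e ∈ₑ S) ∨ e ∈ₑ T) (allFin m))

-- w(μ(H)): weight of a maximum-weight matching of the subgraph H
-- (independent of how μ breaks ties)
mwm : (I : Instance) → EdgeSet (m I) → ℚ
mwm I H = maxℚ (map (λ M → if (M ⊆ₑ H) ∧ isMatching I M then weight I M else 0ℚ)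
                    (allEdgeSets (m I)))

prob : (I : Instance) → EdgeSet (m I) → ℚ
prob I R = foldr _*_ 1ℚ
  (map (λ e → if e ∈ₑ R then p I e else 1ℚ - p I e) (allFin (m I)))

𝔼 : (I : Instance) → (EdgeSet (m I) → ℚ) → ℚ
𝔼 I f = sumℚ (map (λ R → prob I R * f R) (allEdgeSets (m I)))

degree : (I : Instance) → EdgeSet (m I) → Fin (n I) → ℕ
degree I Q x = foldr ℕ._+_ 0
  (map (λ e → if e ∈ₑ Q ∧ (does (end₁ I e ≟ x) ∨ does (end₂ I e ≟ x)) then 1 else 0)
       (allFin (m I)))

-- p = min_e p_e  (defined as 1 when E is empty; irrelevant then)
pmin : Instance → ℚ
pmin I = foldr _⊓_ 1ℚ (map (p I) (allFin (m I)))

-- Let x e be the probability that e lies in the optimum of the realization.  The edges with x e ≥ τ p e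
-- are crucial and are all kept; every other edge is queried with probability x e / (τ p e), and the
-- vertices with too many queried edges are rare and pruned.  The expected matching is bounded from below
-- by two schemes, used with weights 2/3 and 1/3.
--
-- First scheme: redraw the realization of the minor edges, take the crucial part of the optimum with a
-- fractional value θ that grows with the crucial loads of the two ends, and complete it on the minor
-- edges by the smaller residual capacity.  Second scheme: split the vertices at random into senders and
-- receivers; each sender proposes along the crucial edge at it in the optimum of its own sample of the
-- realization, the heavier of two conflicting proposals wins, and the minor edges between the vertices
-- without proposals are scaled up.  By Efron–Stein the resulting minor loads are concentrated.
--
-- A fractional solution on the minor edges survives sampling because its loads concentrate (Chebyshev),
-- and becomes a matching after restriction to a random bipartition that the crucial matching crosses.
-- Edge by edge, the mixture of the two schemes covers a proportion of x e exceeding 0.681; for the minor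
-- edges this is a polynomial inequality in the crucial loads of the two ends.
module Submission where

open import Defs
open import Data.Bool as Bool using (Bool; true; false; if_then_else_; _∧_; _∨_; not; _xor_)
open import Data.Bool.Properties using (∨-zeroʳ)
open import Data.Empty using (⊥; ⊥-elim)
open import Data.Fin using (Fin; _≟_; toℕ)
open import Data.Fin.Base using () renaming (zero to fz; suc to fs)
open import Data.Fin.Properties using (any?; all?; toℕ-injective)
open import Data.Integer as ℤ using ()
import Data.Integer.Properties as ℤP
open import Data.List as List using (List; []; _∷_; map; foldr; allFin; concatMap; _++_)
open import Data.List.Membership.Propositional using (_∈_)
open import Data.List.Membership.Propositional.Properties using (∈-map⁺; ∈-map⁻)
open import Data.List.Properties using (map-tabulate)
open import Data.List.Relation.Unary.Any using (here; there)
open import Data.Nat as ℕ using (ℕ; zero; suc; z≤n; s≤s)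
import Data.Nat.Properties as ℕP
open import Data.Nat.Solver using () renaming (module +-*-Solver to NS)
open import Data.Product using (Σ; _×_; _,_; proj₁; proj₂)
open import Data.Rational using (ℚ; 0ℚ; 1ℚ; ½; mkℚ; toℚᵘ; _+_; _*_; _-_; -_; _≤_; _<_; _⊓_; _/_; 1/_; nonNegative; Positive; positive)
open import Data.Rational.Properties hiding (_≟_)
open import Data.Rational.Solver
import Data.Rational.Unnormalised.Base as UB
import Data.Rational.Unnormalised.Properties as U
open import Data.Sum using (_⊎_; inj₁; inj₂)
open import Data.Vec using (Vec; []; _∷_; lookup; tabulate; _[_]≔_; replicate)
open import Data.Vec.Properties using (lookup∘tabulate; lookup-replicate; lookup-zipWith; lookup∘update; lookup∘update′)
open import Function using (id)
open import Relation.Binary.PropositionalEquality using (_≡_; _≢_; refl; sym; trans; cong; cong₂; subst; ≢-sym)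
open import Relation.Nullary using (Dec; yes; no; does)
open import Relation.Nullary.Decidable using (dec-true; dec-false; toWitness)

open +-*-Solver

-- The subgraph is found by exhaustive search under the degree bound; the random queries only
-- witness that a good candidate exists.
--
-- Two obstacles shape the analysis. Rounding a fractional matching of a nonbipartite graph can lose
-- a constant factor. Random sides avoid this at almost no cost: minor edges are tiny, so doubling
-- those that cross nearly preserves every load. Secondly, the events that the two ends of a minor
-- edge are covered by crucial edges of the optimum may be arbitrarily correlated. The first scheme
-- therefore uses only their marginals, through linear minorants of a minimum; the second limits the
-- dependence by independent samples, which makes loads concentrate, and divides by the probability
-- that both ends stay free.
--
-- On a crucial edge whose end loads add up to s the schemes yield, with conflict losses
-- redistributed, 25/32 + s/32 and 1/2 - s/16, so s cancels in the mixture and 11/16 remains. For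
-- minor edges the mixture yields at least 0.683 before the sampling losses, and four factors 1 - ε
-- leave more than 0.681. The variance terms are made negligible by the choice of τ.

private variable
  k l : ℕ
  Ω Ω′ : Set

-- Ordered-field arithmetic

0≤1 : 0ℚ ≤ 1ℚ
0≤1 = nonNegative⁻¹ 1ℚ

0≤½ : 0ℚ ≤ ½
0≤½ = nonNegative⁻¹ ½

≡⇒≤ : ∀ {x y} → x ≡ y → x ≤ y
≡⇒≤ refl = ≤-refl

≤-resp : ∀ {a b c d} → a ≡ b → c ≡ d → a ≤ c → b ≤ d
≤-resp refl refl h = h

infixr 6 _⊕_
infixr 7 _⊗_

_⊕_ : ∀ {x y} → 0ℚ ≤ x → 0ℚ ≤ y → 0ℚ ≤ x + y
p ⊕ q = ≤-resp (+-identityˡ 0ℚ) refl (+-mono-≤ p q)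

_⊗_ : ∀ {x y} → 0ℚ ≤ x → 0ℚ ≤ y → 0ℚ ≤ x * y
_⊗_ {x} {y} p q = subst (_≤ x * y) (*-zeroʳ x) (*-monoˡ-≤-nonNeg x {{nonNegative p}} q)

gap : ∀ {x y} → x ≤ y → 0ℚ ≤ y - x
gap {x} {y} p = subst (_≤ y - x) (+-inverseʳ x) (+-monoˡ-≤ (- x) p)

-- Workhorse for inequalities: the difference is exhibited as a combination of visibly nonnegative
-- products, assembled with `_⊕_` and `_⊗_`, and the identity is left to the ring solver.
by-gap : ∀ {x y d} → 0ℚ ≤ d → d ≡ y - x → x ≤ y
by-gap {x} {y} {d} p e = ≤-resp (+-identityˡ x) (trans (cong (_+ x) e) (lem y x)) (+-monoˡ-≤ x p)
  where
  lem : ∀ y x → y - x + x ≡ y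
  lem = solve 2 (λ y x → y :- x :+ x := y) refl

sq : ℚ → ℚ
sq x = x * x

0≤sq : ∀ x → 0ℚ ≤ sq x
0≤sq x with ≤-total 0ℚ x
... | inj₁ p = p ⊗ p
... | inj₂ p = subst (0ℚ ≤_) (lem x) (neg ⊗ neg)
  where
  neg : 0ℚ ≤ 0ℚ - x
  neg = gap p
  lem : ∀ x → (0ℚ - x) * (0ℚ - x) ≡ x * x
  lem = solve 1 (λ x → (con 0ℚ :- x) :* (con 0ℚ :- x) := x :* x) refl

*-mono-nn : ∀ {a b c d} → 0ℚ ≤ a → a ≤ b → 0ℚ ≤ c → c ≤ d → a * c ≤ b * d
*-mono-nn {a} {b} {c} {d} 0≤a a≤b 0≤c c≤d =
  by-gap (gap a≤b ⊗ ≤-trans 0≤c c≤d ⊕ 0≤a ⊗ gap c≤d) (lem a b c d)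
  where
  lem : ∀ a b c d → (b - a) * d + a * (d - c) ≡ b * d - a * c
  lem = solve 4 (λ a b c d → (b :- a) :* d :+ a :* (d :- c) := b :* d :- a :* c) refl

*-monoʳ-nn : ∀ {a b} c → 0ℚ ≤ c → a ≤ b → c * a ≤ c * b
*-monoʳ-nn c p = *-monoˡ-≤-nonNeg c {{nonNegative p}}

*-monoˡ-nn : ∀ {a b} c → 0ℚ ≤ c → a ≤ b → a * c ≤ b * c
*-monoˡ-nn c p = *-monoʳ-≤-nonNeg c {{nonNegative p}}

*≤1 : ∀ {a b} → 0ℚ ≤ a → b ≤ 1ℚ → a * b ≤ a
*≤1 {a} {b} 0≤a b≤1 = ≤-trans (*-monoʳ-nn a 0≤a b≤1) (≡⇒≤ (*-identityʳ a))

*-cancel : ∀ {a b} c → 0ℚ < c → c * a ≤ c * b → a ≤ b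
*-cancel c p = *-cancelˡ-≤-pos c {{positive p}}

abstract
  -- Only the defining equation is used later; sealing the definition keeps division from unfolding
  -- in large terms.
  recip : ∀ q → 0ℚ < q → Σ ℚ λ r → (0ℚ < r) × (q * r ≡ 1ℚ)
  recip q 0<q = 1/ q , positive⁻¹ (1/ q) {{1/pos⇒pos q}} , *-inverseʳ q
    where
      instance
        pos : Positive q
        pos = positive 0<q
        nz : Data.Rational.NonZero q
        nz = pos⇒nonZero q

-- Finite sums

∑ : (Fin k → ℚ) → ℚ
∑ {zero}  f = 0ℚ
∑ {suc k} f = f fz + ∑ (λ i → f (fs i))

∑-cong : {f g : Fin k → ℚ} → (∀ i → f i ≡ g i) → ∑ f ≡ ∑ g
∑-cong {zero}  h = refl
∑-cong {suc k} h = cong₂ _+_ (h fz) (∑-cong (λ i → h (fs i)))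

∑-mono : {f g : Fin k → ℚ} → (∀ i → f i ≤ g i) → ∑ f ≤ ∑ g
∑-mono {zero}  h = ≤-refl
∑-mono {suc k} h = +-mono-≤ (h fz) (∑-mono (λ i → h (fs i)))

∑-0 : ∑ {k} (λ _ → 0ℚ) ≡ 0ℚ
∑-0 {zero}  = refl
∑-0 {suc k} = trans (+-identityˡ _) (∑-0 {k})

∑-nn : {f : Fin k → ℚ} → (∀ i → 0ℚ ≤ f i) → 0ℚ ≤ ∑ f
∑-nn {k} h = ≤-resp (∑-0 {k}) refl (∑-mono h)

∑-+ : (f g : Fin k → ℚ) → ∑ (λ i → f i + g i) ≡ ∑ f + ∑ g
∑-+ {zero}  f g = refl
∑-+ {suc k} f g = trans (cong (λ z → f fz + g fz + z) (∑-+ (λ i → f (fs i)) (λ i → g (fs i)))) (lem (f fz) (g fz) (∑ (λ i → f (fs i))) (∑ (λ i → g (fs i))))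
  where
  lem : ∀ a b c d → a + b + (c + d) ≡ a + c + (b + d)
  lem = solve 4 (λ a b c d → a :+ b :+ (c :+ d) := a :+ c :+ (b :+ d)) refl

∑-*ˡ : ∀ c (f : Fin k → ℚ) → ∑ (λ i → c * f i) ≡ c * ∑ f
∑-*ˡ {zero}  c f = sym (*-zeroʳ c)
∑-*ˡ {suc k} c f = trans (cong (c * f fz +_) (∑-*ˡ c (λ i → f (fs i)))) (sym (*-distribˡ-+ c _ _))

∑-*ʳ : ∀ c (f : Fin k → ℚ) → ∑ (λ i → f i * c) ≡ ∑ f * c
∑-*ʳ c f = trans (∑-cong (λ i → *-comm (f i) c)) (trans (∑-*ˡ c f) (*-comm c _))

∑-- : (f g : Fin k → ℚ) → ∑ (λ i → f i - g i) ≡ ∑ f - ∑ g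
∑-- f g = trans (∑-+ f (λ i → - g i)) (cong (λ z → ∑ f + z)
  (trans (∑-cong (λ i → lem (g i))) (trans (∑-*ˡ (- 1ℚ) g) (sym (lem (∑ g))))))
  where
  lem : ∀ x → - x ≡ (- 1ℚ) * x
  lem = solve 1 (λ x → :- x := con (- 1ℚ) :* x) refl

∑-swap : (f : Fin k → Fin l → ℚ) → ∑ (λ i → ∑ (λ j → f i j)) ≡ ∑ (λ j → ∑ (λ i → f i j))
∑-swap {zero}  {l} f = sym (∑-0 {l})
∑-swap {suc k} f = trans (cong (∑ (f fz) +_) (∑-swap (λ i → f (fs i)))) (sym (∑-+ (f fz) _))

∑-term : {f : Fin k → ℚ} → (∀ i → 0ℚ ≤ f i) → ∀ i → f i ≤ ∑ f
∑-term {suc k} {f} h fz = by-gap (∑-nn (λ i → h (fs i))) (lem (f fz) (∑ (λ i → f (fs i))))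
  where
  lem : ∀ a b → b ≡ a + b - a
  lem = solve 2 (λ a b → b := a :+ b :- a) refl
∑-term {suc k} {f} h (fs i) = ≤-trans (∑-term (λ j → h (fs j)) i) (by-gap (h fz) (lem (f fz) (∑ (λ i → f (fs i)))))
  where
  lem : ∀ a b → a ≡ a + b - b
  lem = solve 2 (λ a b → a := a :+ b :- b) refl

∑-zero : {f : Fin k → ℚ} → (∀ i → f i ≡ 0ℚ) → ∑ f ≡ 0ℚ
∑-zero {k} h = trans (∑-cong h) (∑-0 {k})

ℕtoℚ-suc : ∀ k → ℕtoℚ (suc k) ≡ 1ℚ + ℕtoℚ k
ℕtoℚ-suc k = sym (toℚᵘ-injective (U.≃-trans (toℚᵘ-homo-+ 1ℚ (ℕtoℚ k))
  (U.≃-trans (U.+-congʳ (toℚᵘ 1ℚ) (toℚᵘ-fromℚᵘ (UB.mkℚᵘ (ℤ.+ k) 0)))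
  (U.≃-trans (UB.*≡* eq) (U.≃-sym (toℚᵘ-fromℚᵘ (UB.mkℚᵘ (ℤ.+ suc k) 0)))))))
  where
  eq : (ℤ.+ 1 ℤ.* ℤ.+ 1 ℤ.+ ℤ.+ k ℤ.* ℤ.+ 1) ℤ.* ℤ.+ 1 ≡ ℤ.+ suc k ℤ.* ℤ.+ 1
  eq = cong (ℤ._* ℤ.+ 1) (cong (λ z → ℤ.+ 1 ℤ.+ z) (ℤP.*-identityʳ (ℤ.+ k)))

-- Finite probability distributions

-- Trees of biased coins instead of lists of weighted outcomes: expectation is a structural
-- recursion, its laws are short inductions, and dependent experiments compose by `bind`. Different
-- leaves may carry the same outcome.
data D (Ω : Set) : Set where
  ret  : Ω → D Ω
  flip : (π : ℚ) → 0ℚ ≤ π → π ≤ 1ℚ → D Ω → D Ω → D Ω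

E : D Ω → (Ω → ℚ) → ℚ
E (ret x)          f = f x
E (flip π _ _ a b) f = π * E a f + (1ℚ - π) * E b f

bind : D Ω → (Ω → D Ω′) → D Ω′
bind (ret x)          h = h x
bind (flip π p q a b) h = flip π p q (bind a h) (bind b h)

E-bind : (d : D Ω) (h : Ω → D Ω′) (f : Ω′ → ℚ) → E (bind d h) f ≡ E d (λ x → E (h x) f)
E-bind (ret x)          h f = refl
E-bind (flip π _ _ a b) h f = cong₂ (λ y z → π * y + (1ℚ - π) * z) (E-bind a h f) (E-bind b h f)

E-cong : (d : D Ω) {f g : Ω → ℚ} → (∀ x → f x ≡ g x) → E d f ≡ E d g
E-cong (ret x)          h = h x
E-cong (flip π _ _ a b) h = cong₂ (λ y z → π * y + (1ℚ - π) * z) (E-cong a h) (E-cong b h)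

E-mono : (d : D Ω) {f g : Ω → ℚ} → (∀ x → f x ≤ g x) → E d f ≤ E d g
E-mono (ret x)          h = h x
E-mono (flip π p q a b) h =
  +-mono-≤ (*-monoʳ-nn π p (E-mono a h)) (*-monoʳ-nn (1ℚ - π) (gap q) (E-mono b h))

E-const : (d : D Ω) (c : ℚ) → E d (λ _ → c) ≡ c
E-const (ret x)          c = refl
E-const (flip π _ _ a b) c =
  trans (cong₂ (λ y z → π * y + (1ℚ - π) * z) (E-const a c) (E-const b c)) (lem π c)
  where
  lem : ∀ π c → π * c + (1ℚ - π) * c ≡ c
  lem = solve 2 (λ π c → π :* c :+ (con 1ℚ :- π) :* c := c) refl

E-+ : (d : D Ω) (f g : Ω → ℚ) → E d (λ x → f x + g x) ≡ E d f + E d g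
E-+ (ret x)          f g = refl
E-+ (flip π _ _ a b) f g =
  trans (cong₂ (λ y z → π * y + (1ℚ - π) * z) (E-+ a f g) (E-+ b f g))
        (lem π (E a f) (E a g) (E b f) (E b g))
  where
  lem : ∀ π a b c d → π * (a + b) + (1ℚ - π) * (c + d) ≡ π * a + (1ℚ - π) * c + (π * b + (1ℚ - π) * d)
  lem = solve 5 (λ π a b c d → π :* (a :+ b) :+ (con 1ℚ :- π) :* (c :+ d) := π :* a :+ (con 1ℚ :- π) :* c :+ (π :* b :+ (con 1ℚ :- π) :* d)) refl

E-*ˡ : (d : D Ω) (c : ℚ) (f : Ω → ℚ) → E d (λ x → c * f x) ≡ c * E d f
E-*ˡ (ret x)          c f = refl
E-*ˡ (flip π _ _ a b) c f =
  trans (cong₂ (λ y z → π * y + (1ℚ - π) * z) (E-*ˡ a c f) (E-*ˡ b c f)) (lem π c (E a f) (E b f))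
  where
  lem : ∀ π c x y → π * (c * x) + (1ℚ - π) * (c * y) ≡ c * (π * x + (1ℚ - π) * y)
  lem = solve 4 (λ π c x y → π :* (c :* x) :+ (con 1ℚ :- π) :* (c :* y) := c :* (π :* x :+ (con 1ℚ :- π) :* y)) refl

E-*ʳ : (d : D Ω) (c : ℚ) (f : Ω → ℚ) → E d (λ x → f x * c) ≡ E d f * c
E-*ʳ d c f = trans (E-cong d (λ x → *-comm (f x) c)) (trans (E-*ˡ d c f) (*-comm c (E d f)))

E-- : (d : D Ω) (f g : Ω → ℚ) → E d (λ x → f x - g x) ≡ E d f - E d g
E-- (ret x)          f g = refl
E-- (flip π _ _ a b) f g =
  trans (cong₂ (λ y z → π * y + (1ℚ - π) * z) (E-- a f g) (E-- b f g))
        (lem π (E a f) (E a g) (E b f) (E b g))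
  where
  lem : ∀ π a b c d → π * (a - b) + (1ℚ - π) * (c - d) ≡ π * a + (1ℚ - π) * c - (π * b + (1ℚ - π) * d)
  lem = solve 5 (λ π a b c d → π :* (a :- b) :+ (con 1ℚ :- π) :* (c :- d) := π :* a :+ (con 1ℚ :- π) :* c :- (π :* b :+ (con 1ℚ :- π) :* d)) refl

E-nn : (d : D Ω) {f : Ω → ℚ} → (∀ x → 0ℚ ≤ f x) → 0ℚ ≤ E d f
E-nn d h = ≤-resp (E-const d 0ℚ) refl (E-mono d h)

E-≤ : (d : D Ω) {f : Ω → ℚ} (c : ℚ) → (∀ x → f x ≤ c) → E d f ≤ c
E-≤ d c h = ≤-resp refl (E-const d c) (E-mono d h)

E-≥ : (d : D Ω) {f : Ω → ℚ} (c : ℚ) → (∀ x → c ≤ f x) → c ≤ E d f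
E-≥ d c h = ≤-resp (E-const d c) refl (E-mono d h)

E-∑ : (d : D Ω) (f : Fin k → Ω → ℚ) → E d (λ x → ∑ (λ i → f i x)) ≡ ∑ (λ i → E d (f i))
E-∑ {k = zero}  d f = E-const d 0ℚ
E-∑ {k = suc k} d f =
  trans (E-+ d (f fz) (λ x → ∑ (λ i → f (fs i) x))) (cong (λ z → E d (f fz) + z) (E-∑ d (λ i → f (fs i))))

-- Fubini: independent experiments appear as nested expectations, whose order may be exchanged.
E-comm : (a : D Ω) (b : D Ω′) (f : Ω → Ω′ → ℚ) → E a (λ x → E b (f x)) ≡ E b (λ y → E a (λ x → f x y))
E-comm (ret x)          b f = refl
E-comm (flip π _ _ a c) b f =
  trans (cong₂ (λ y z → π * y + (1ℚ - π) * z) (E-comm a b f) (E-comm c b f))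
  (sym (trans (E-+ b (λ y → π * E a (λ x → f x y)) (λ y → (1ℚ - π) * E c (λ x → f x y)))
       (cong₂ _+_ (E-*ˡ b π (λ y → E a (λ x → f x y))) (E-*ˡ b (1ℚ - π) (λ y → E c (λ x → f x y))))))

-- Second moments

-- Bias and variance: the mean square deviation from `c` is the variance plus the squared distance
-- of the mean from `c`. `Var-nn` and `Var-≤` are two readings of this.
E-sq-shift : (d : D Ω) (f : Ω → ℚ) (c : ℚ) →
             E d (λ x → sq (f x - c)) ≡ E d (λ x → sq (f x)) - sq (E d f) + sq (E d f - c)
E-sq-shift d f c =
  trans (E-cong d (λ x → lem₁ (f x) c))
  (trans (E-+ d (λ x → sq (f x)) (λ x → c * c + (- 1ℚ - 1ℚ) * c * f x))
  (trans (cong (λ z → E d (λ x → sq (f x)) + z)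
    (trans (E-+ d (λ _ → c * c) (λ x → (- 1ℚ - 1ℚ) * c * f x))
      (cong₂ _+_ (E-const d (c * c)) (E-*ˡ d ((- 1ℚ - 1ℚ) * c) f))))
  (lem₂ (E d (λ x → sq (f x))) (E d f) c)))
  where
  lem₁ : ∀ x c → sq (x - c) ≡ sq x + (c * c + (- 1ℚ - 1ℚ) * c * x)
  lem₁ = solve 2 (λ x c → (x :- c) :* (x :- c) := x :* x :+ (c :* c :+ (con (- 1ℚ) :- con 1ℚ) :* c :* x)) refl
  lem₂ : ∀ s m c → s + (c * c + (- 1ℚ - 1ℚ) * c * m) ≡ s - sq m + sq (m - c)
  lem₂ = solve 3 (λ s m c → s :+ (c :* c :+ (con (- 1ℚ) :- con 1ℚ) :* c :* m) := s :- m :* m :+ (m :- c) :* (m :- c)) refl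

Var : D Ω → (Ω → ℚ) → ℚ
Var d f = E d (λ x → sq (f x)) - sq (E d f)

Var-nn : (d : D Ω) (f : Ω → ℚ) → 0ℚ ≤ Var d f
Var-nn d f = ≤-resp refl (trans (E-sq-shift d f (E d f)) (lem (Var d f) (E d f)))
                    (E-nn d (λ x → 0≤sq (f x - E d f)))
  where
  lem : ∀ v m → v + sq (m - m) ≡ v
  lem = solve 2 (λ v m → v :+ (m :- m) :* (m :- m) := v) refl

Var-≤ : (d : D Ω) (f : Ω → ℚ) (c : ℚ) → Var d f ≤ E d (λ x → sq (f x - c))
Var-≤ d f c = by-gap (0≤sq (E d f - c)) (trans (lem (Var d f) (sq (E d f - c))) (cong (λ z → z - Var d f) (sym (E-sq-shift d f c))))
  where
  lem : ∀ v s → s ≡ v + s - v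
  lem = solve 2 (λ v s → s := v :+ s :- v) refl

jensen : (d : D Ω) (f : Ω → ℚ) → sq (E d f) ≤ E d (λ x → sq (f x))
jensen d f = by-gap (Var-nn d f) refl

-- Law of total variance for two independent experiments; the left side is the variance on the pair,
-- written with nested expectations.
Var-nest : (a : D Ω) (b : D Ω′) (f : Ω → Ω′ → ℚ) →
           E a (λ x → E b (λ y → sq (f x y))) - sq (E a (λ x → E b (f x)))
           ≡ E a (λ x → Var b (f x)) + Var a (λ x → E b (f x))
Var-nest a b f =
  trans (lem (E a (λ x → E b (λ y → sq (f x y)))) (E a (λ x → sq (E b (f x)))) (sq (E a (λ x → E b (f x)))))
        (cong (λ z → z + Var a (λ x → E b (f x))) (sym (E-- a (λ x → E b (λ y → sq (f x y))) (λ x → sq (E b (f x))))))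
  where
  lem : ∀ p q r → p - r ≡ p - q + (q - r)
  lem = solve 3 (λ p q r → p :- r := p :- q :+ (q :- r)) refl

-- Product distributions

prod : (Fin k → D Ω) → D (Vec Ω k)
prod {zero}  ds = ret []
prod {suc k} ds = bind (ds fz) λ x → bind (prod (λ i → ds (fs i))) λ v → ret (x ∷ v)

E-prod : (ds : Fin (suc k) → D Ω) (f : Vec Ω (suc k) → ℚ) →
         E (prod ds) f ≡ E (ds fz) (λ x → E (prod (λ i → ds (fs i))) (λ v → f (x ∷ v)))
E-prod ds f = trans (E-bind (ds fz) _ f) (E-cong (ds fz) (λ x → E-bind (prod (λ i → ds (fs i))) _ f))

-- One coordinate of an independent family may be overwritten by a fresh draw. This serves as
-- conditioning: marginals, events on one coin and forced coordinates are read off from it.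
resample : (ds : Fin k → D Ω) (i : Fin k) (f : Vec Ω k → ℚ) →
           E (prod ds) f ≡ E (prod ds) (λ v → E (ds i) (λ x → f (v [ i ]≔ x)))
resample {suc k} ds fz f =
  trans (E-prod ds f)
  (trans (E-comm (ds fz) (prod (λ i → ds (fs i))) (λ x v → f (x ∷ v)))
  (trans (sym (E-const (ds fz) _)) (sym (E-prod ds _))))
resample {suc k} ds (fs i) f =
  trans (E-prod ds f)
  (trans (E-cong (ds fz) (λ x → resample (λ j → ds (fs j)) i (λ v → f (x ∷ v)))) (sym (E-prod ds _)))

-- Each coordinate is compared with a fixed reference value rather than with an independent copy.
-- Induction by the law of total variance: the inner variance is the induction hypothesis, and the
-- variance of the conditional mean is at most its mean square distance from its value at `x₀ fz`,
-- which Jensen moves inside. With an empty reference, as for sampled edges and proposals, a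
-- coordinate is charged only for what it contributes.
efron-stein : (ds : Fin k → D Ω) (x₀ : Fin k → Ω) (f : Vec Ω k → ℚ) →
              Var (prod ds) f ≤ ∑ (λ i → E (prod ds) (λ v → sq (f v - f (v [ i ]≔ x₀ i))))
efron-stein {zero}  ds x₀ f = ≡⇒≤ (lem (f []))
  where
  lem : ∀ a → sq a - sq a ≡ 0ℚ
  lem = solve 1 (λ a → a :* a :- a :* a := con 0ℚ) refl
efron-stein {suc k} {Ω} ds x₀ f =
  ≤-resp (sym split) refl
  (≤-trans (+-mono-≤ tail head) (≡⇒≤ (+-comm (∑ (λ i → term (fs i))) (term fz))))
  where
  d₀ : D Ω
  d₀ = ds fz
  d₁ : D (Vec Ω k)
  d₁ = prod (λ i → ds (fs i))
  term : Fin (suc k) → ℚ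
  term i = E (prod ds) (λ v → sq (f v - f (v [ i ]≔ x₀ i)))
  split : Var (prod ds) f ≡ E d₀ (λ x → Var d₁ (λ v → f (x ∷ v))) + Var d₀ (λ x → E d₁ (λ v → f (x ∷ v)))
  split = trans (cong₂ (λ a b → a - sq b) (E-prod ds (λ v → sq (f v))) (E-prod ds f))
                (Var-nest d₀ d₁ (λ x v → f (x ∷ v)))
  tail : E d₀ (λ x → Var d₁ (λ v → f (x ∷ v))) ≤ ∑ (λ i → term (fs i))
  tail = ≤-trans (E-mono d₀ (λ x → efron-stein (λ i → ds (fs i)) (λ i → x₀ (fs i)) (λ v → f (x ∷ v))))
    (≡⇒≤ (trans (E-∑ d₀ (λ i x → E d₁ (λ v → sq (f (x ∷ v) - f (x ∷ (v [ i ]≔ x₀ (fs i))))))) (∑-cong (λ i → sym (E-prod ds (λ v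
        → sq (f v - f (v [ fs i ]≔ x₀ (fs i)))))))))
  head : Var d₀ (λ x → E d₁ (λ v → f (x ∷ v))) ≤ term fz
  head = ≤-trans (Var-≤ d₀ (λ x → E d₁ (λ v → f (x ∷ v))) (E d₁ (λ v → f (x₀ fz ∷ v))))
    (≤-trans (E-mono d₀ (λ x → ≤-trans
        (≡⇒≤ (cong sq (sym (E-- d₁ (λ v → f (x ∷ v)) (λ v → f (x₀ fz ∷ v))))))
        (jensen d₁ (λ v → f (x ∷ v) - f (x₀ fz ∷ v)))))
      (≡⇒≤ (sym (E-prod ds (λ v → sq (f v - f (v [ fz ]≔ x₀ fz)))))))

mix : (Fin k → Bool) → Vec Ω k → Vec Ω k → Vec Ω k
mix c []      []      = []
mix c (x ∷ S) (y ∷ R) = (if c fz then x else y) ∷ mix (λ i → c (fs i)) S R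

lookup-mix : (c : Fin k → Bool) (S R : Vec Ω k) (i : Fin k) →
             lookup (mix c S R) i ≡ (if c i then lookup S i else lookup R i)
lookup-mix c (x ∷ S) (y ∷ R) fz     = refl
lookup-mix c (x ∷ S) (y ∷ R) (fs i) = lookup-mix (λ i → c (fs i)) S R i

-- Each coordinate comes from one of two independent copies, and the choice is fixed in advance, so
-- the law is unchanged. This allows the crucial edges to be held fixed while the minor edges are
-- redrawn.
E-mix : (ds : Fin k → D Ω) (c : Fin k → Bool) (f : Vec Ω k → ℚ) →
        E (prod ds) f ≡ E (prod ds) (λ S → E (prod ds) (λ R → f (mix c S R)))
E-mix {zero}  ds c f = refl
E-mix {suc k} {Ω} ds c f =
  trans (E-prod ds f) (trans (go (c fz) refl) (sym (trans (E-prod ds _)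
    (E-cong d₀ (λ x → E-cong d₁ (λ S → E-prod ds _))))))
  where
  d₀ : D Ω
  d₀ = ds fz
  d₁ : D (Vec Ω k)
  d₁ = prod (λ i → ds (fs i))
  c₁ : Fin k → Bool
  c₁ i = c (fs i)
  go : ∀ b → c fz ≡ b →
       E d₀ (λ x → E d₁ (λ v → f (x ∷ v))) ≡
       E d₀ (λ x → E d₁ (λ S → E d₀ (λ y → E d₁ (λ R → f ((if c fz then x else y) ∷ mix c₁ S R)))))
  go true e rewrite e = E-cong d₀ (λ x → trans (E-mix (λ i → ds (fs i)) c₁ (λ v → f (x ∷ v)))
    (E-cong d₁ (λ S → sym (E-const d₀ _))))
  go false e rewrite e = trans (E-cong d₀ (λ y → E-mix (λ i → ds (fs i)) c₁ (λ v → f (y ∷ v))))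
    (trans (E-comm d₀ d₁ _) (sym (E-const d₀ _)))

-- The coordinates of S₁, …, S_l, each used where owned, the remaining ones coming from R.
combine : (Fin l → Fin k → Bool) → Vec (Vec Ω k) l → Vec Ω k → Vec Ω k
combine ow []       R = R
combine ow (S ∷ Ss) R = mix (ow fz) S (combine (λ v → ow (fs v)) Ss R)

E-combine : (ds : Fin k → D Ω) (ow : Fin l → Fin k → Bool) (f : Vec Ω k → ℚ) →
            E (prod ds) f ≡
            E (prod {l} (λ _ → prod ds)) (λ Ss → E (prod ds) (λ R → f (combine ow Ss R)))
E-combine {l = zero}  ds ow f = refl
E-combine {l = suc l} ds ow f = trans (E-mix ds (ow fz) f)
  (trans (E-cong (prod ds) (λ S → E-combine ds (λ v → ow (fs v)) (λ R → f (mix (ow fz) S R))))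
         (sym (E-prod (λ _ → prod ds) _)))

-- The nesting of `mix` gives a coordinate to its first owner, hence the hypothesis that `v` is the
-- only one.
lookup-combine : (ow : Fin l → Fin k → Bool) (Ss : Vec (Vec Ω k) l) (R : Vec Ω k) (v : Fin l) (e : Fin k) →
                 ow v e ≡ true → (∀ u → ow u e ≡ true → u ≡ v) →
                 lookup (combine ow Ss R) e ≡ lookup (lookup Ss v) e
lookup-combine ow (S ∷ Ss) R fz e o uniq
  rewrite lookup-mix (ow fz) S (combine (λ v → ow (fs v)) Ss R) e | o = refl
lookup-combine ow (S ∷ Ss) R (fs v) e o uniq
  rewrite lookup-mix (ow fz) S (combine (λ v → ow (fs v)) Ss R) e with ow fz e in eq
... | true  with uniq fz eq
...   | ()
lookup-combine ow (S ∷ Ss) R (fs v) e o uniq | false =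
  lookup-combine (λ v → ow (fs v)) Ss R v e o (λ u p → suc-inj (uniq (fs u) p))
  where
  suc-inj : ∀ {n} {a b : Fin n} → fs a ≡ fs b → a ≡ b
  suc-inj refl = refl

-- Booleans and indicators

ι : Bool → ℚ
ι true  = 1ℚ
ι false = 0ℚ

0≤ι : ∀ b → 0ℚ ≤ ι b
0≤ι true  = 0≤1
0≤ι false = ≤-refl

ι≤1 : ∀ b → ι b ≤ 1ℚ
ι≤1 true  = ≤-refl
ι≤1 false = 0≤1

ι-∧ : ∀ a b → ι (a ∧ b) ≡ ι a * ι b
ι-∧ true  b = sym (*-identityˡ (ι b))
ι-∧ false b = sym (*-zeroˡ (ι b))

ι-mono : ∀ {a b} → (a ≡ true → b ≡ true) → ι a ≤ ι b
ι-mono {true}  {b} h rewrite h refl = ≤-refl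
ι-mono {false} {b} h = 0≤ι b

true≢false : ∀ {b} → b ≡ true → b ≡ false → ⊥
true≢false refl ()

∧-true : ∀ {a b} → a ∧ b ≡ true → (a ≡ true) × (b ≡ true)
∧-true {true} {true} refl = refl , refl

∨-true : ∀ {a b} → a ∨ b ≡ true → (a ≡ true) ⊎ (b ≡ true)
∨-true {true}  h = inj₁ refl
∨-true {false} h = inj₂ h

_==_ : Fin k → Fin k → Bool
i == j = does (i ≟ j)

==-true : {i j : Fin k} → (i == j) ≡ true → i ≡ j
==-true {i = i} {j} h with i ≟ j
... | yes p = p
... | no _ with h
...   | ()

==-refl : (i : Fin k) → (i == i) ≡ true
==-refl i = dec-true (i ≟ i) refl

==-≢ : {i j : Fin k} → i ≢ j → (i == j) ≡ false
==-≢ {i = i} {j} h = dec-false (i ≟ j) h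

decb : ∀ b → (b ≡ true) ⊎ (b ≡ false)
decb true  = inj₁ refl
decb false = inj₂ refl

∑-== : (i : Fin k) (f : Fin k → ℚ) → ∑ (λ j → ι (i == j) * f j) ≡ f i
∑-== {suc k} fz f =
  trans (cong₂ _+_ (*-identityˡ (f fz)) (∑-zero (λ j → *-zeroˡ (f (fs j))))) (+-identityʳ (f fz))
∑-== {suc k} (fs i) f =
  trans (cong₂ _+_ (*-zeroˡ (f fz)) (trans (∑-cong (λ j → cong (λ b → ι b * f (fs j)) (fs-== i j)))
    (∑-== i (λ j → f (fs j))))) (+-identityˡ (f (fs i)))
  where
  fs-== : (i j : Fin k) → (fs i == fs j) ≡ (i == j)
  fs-== i j with i ≟ j
  ... | yes p = refl
  ... | no p  = refl

-- At most one term survives. This is how a matching condition, or the absence of parallel edges,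
-- turns into a bound on a sum.
∑-unique : (P : Fin k → Bool) (f : Fin k → ℚ) (c : ℚ) → 0ℚ ≤ c → (∀ i → P i ≡ true → f i ≤ c) →
           (∀ i j → P i ≡ true → P j ≡ true → i ≡ j) → ∑ (λ i → ι (P i) * f i) ≤ c
∑-unique {zero}  P f c 0≤c h u = 0≤c
∑-unique {suc k} P f c 0≤c h u with decb (P fz)
... | inj₁ e = ≤-resp (sym (cong₂ _+_ (trans (cong (λ b → ι b * f fz) e) (*-identityˡ (f fz))) rest))
                      (+-identityʳ c) (+-mono-≤ (h fz e) (≤-refl {0ℚ}))
  where
  others : ∀ j → P (fs j) ≡ false
  others j with decb (P (fs j))
  ... | inj₂ r = r
  ... | inj₁ r with u fz (fs j) e r
  ...   | ()
  rest : ∑ (λ j → ι (P (fs j)) * f (fs j)) ≡ 0ℚ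
  rest = ∑-zero (λ j → trans (cong (λ b → ι b * f (fs j)) (others j)) (*-zeroˡ (f (fs j))))
... | inj₂ e = ≤-resp (sym (trans (cong (λ z → z + ∑ (λ j → ι (P (fs j)) * f (fs j)))
                                   (trans (cong (λ b → ι b * f fz) e) (*-zeroˡ (f fz)))) (+-identityˡ _))) refl
                      (∑-unique (λ i → P (fs i)) (λ i → f (fs i)) c 0≤c (λ i → h (fs i))
                        (λ i j p q → fs-inj (u (fs i) (fs j) p q)))
  where
  fs-inj : ∀ {i j : Fin k} → fs i ≡ fs j → i ≡ j
  fs-inj refl = refl

-- The list-based quantities of the statement as sums over Fin

sum-allFin : (f : Fin k → ℚ) → sumℚ (map f (allFin k)) ≡ ∑ f
sum-allFin {k} f = trans (cong sumℚ (map-tabulate id f)) (go f)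
  where
  go : ∀ {k} (f : Fin k → ℚ) → sumℚ (List.tabulate f) ≡ ∑ f
  go {zero}  f = refl
  go {suc k} f = cong (λ z → f fz + z) (go (λ i → f (fs i)))

all-tabulate⁻ : (f : Fin k → Bool) → foldr _∧_ true (map f (allFin k)) ≡ true → ∀ i → f i ≡ true
all-tabulate⁻ {k} f h = go f (subst (λ l → foldr _∧_ true l ≡ true) (map-tabulate id f) h)
  where
  go : ∀ {k} (f : Fin k → Bool) → foldr _∧_ true (List.tabulate f) ≡ true → ∀ i → f i ≡ true
  go {suc k} f h fz     = proj₁ (∧-true h)
  go {suc k} f h (fs i) = go (λ j → f (fs j)) (proj₂ (∧-true {f fz} h)) i

all-tabulate⁺ : (f : Fin k → Bool) → (∀ i → f i ≡ true) → foldr _∧_ true (map f (allFin k)) ≡ true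
all-tabulate⁺ {k} f h = subst (λ l → foldr _∧_ true l ≡ true) (sym (map-tabulate id f)) (go f h)
  where
  go : ∀ {k} (f : Fin k → Bool) → (∀ i → f i ≡ true) → foldr _∧_ true (List.tabulate f) ≡ true
  go {zero}  f h = refl
  go {suc k} f h = cong₂ _∧_ (h fz) (go (λ j → f (fs j)) (λ j → h (fs j)))

foldr-∧-++ : ∀ xs ys → foldr _∧_ true (xs ++ ys) ≡ foldr _∧_ true xs ∧ foldr _∧_ true ys
foldr-∧-++ []           ys = refl
foldr-∧-++ (true ∷ xs)  ys = foldr-∧-++ xs ys
foldr-∧-++ (false ∷ xs) ys = refl

foldr-∧-concatMap : (g : Ω → List Bool) (xs : List Ω) →
                    foldr _∧_ true (concatMap g xs) ≡ foldr _∧_ true (map (λ x → foldr _∧_ true (g x)) xs)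
foldr-∧-concatMap g []       = refl
foldr-∧-concatMap g (x ∷ xs) = trans (foldr-∧-++ (g x) (concatMap g xs))
  (cong (foldr _∧_ true (g x) ∧_) (foldr-∧-concatMap g xs))

bern : (π : ℚ) → 0ℚ ≤ π → π ≤ 1ℚ → D Bool
bern π p q = flip π p q (ret true) (ret false)

∏ : (Fin k → ℚ) → ℚ
∏ {zero}  f = 1ℚ
∏ {suc k} f = f fz * ∏ (λ i → f (fs i))

∏-allFin : (f : Fin k → ℚ) → foldr _*_ 1ℚ (map f (allFin k)) ≡ ∏ f
∏-allFin {k} f = trans (cong (foldr _*_ 1ℚ) (map-tabulate id f)) (go f)
  where
  go : ∀ {k} (f : Fin k → ℚ) → foldr _*_ 1ℚ (List.tabulate f) ≡ ∏ f
  go {zero}  f = refl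
  go {suc k} f = cong (λ z → f fz * z) (go (λ i → f (fs i)))

sum-pairs : (h : Vec Bool (suc k) → ℚ) (l : List (Vec Bool k)) →
  sumℚ (map h (concatMap (λ S → (true ∷ S) ∷ (false ∷ S) ∷ []) l)) ≡
  sumℚ (map (λ S → h (true ∷ S)) l) + sumℚ (map (λ S → h (false ∷ S)) l)
sum-pairs h []      = refl
sum-pairs h (S ∷ l) = trans (cong (λ z → h (true ∷ S) + (h (false ∷ S) + z)) (sum-pairs h l))
  (lem (h (true ∷ S)) (h (false ∷ S)) (sumℚ (map (λ S → h (true ∷ S)) l)) (sumℚ (map (λ S → h (false ∷ S)) l)))
  where
  lem : ∀ a b c d → a + (b + (c + d)) ≡ a + c + (b + d)
  lem = solve 4 (λ a b c d → a :+ (b :+ (c :+ d)) := a :+ c :+ (b :+ d)) refl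

sum-map-*ˡ : (c : ℚ) (g h : Ω → ℚ) (l : List Ω) → (∀ x → g x ≡ c * h x) → sumℚ (map g l) ≡ c * sumℚ (map h l)
sum-map-*ˡ c g h []      e = sym (*-zeroʳ c)
sum-map-*ˡ c g h (x ∷ l) e = trans (cong₂ _+_ (e x) (sum-map-*ˡ c g h l e)) (sym (*-distribˡ-+ c (h x) (sumℚ (map h l))))

sum-map-cong : (g h : Ω → ℚ) (l : List Ω) → (∀ x → g x ≡ h x) → sumℚ (map g l) ≡ sumℚ (map h l)
sum-map-cong g h []      e = refl
sum-map-cong g h (x ∷ l) e = cong₂ _+_ (e x) (sum-map-cong g h l e)

-- The enumeration splits on the first edge exactly as `prod` flips its first coin, so the weighted
-- sum of the statement and the nested expectation agree branch by branch.
sum-allEdgeSets : (p : Fin k → ℚ) (p₀ : ∀ e → 0ℚ ≤ p e) (p₁ : ∀ e → p e ≤ 1ℚ) (f : Vec Bool k → ℚ) →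
  sumℚ (map (λ R → ∏ (λ e → if lookup R e then p e else 1ℚ - p e) * f R) (allEdgeSets k)) ≡
  E (prod (λ e → bern (p e) (p₀ e) (p₁ e))) f
sum-allEdgeSets {zero}  p p₀ p₁ f = trans (+-identityʳ (1ℚ * f [])) (*-identityˡ (f []))
sum-allEdgeSets {suc k} p p₀ p₁ f =
  trans (sum-pairs (λ R → weightOf R * f R) (allEdgeSets k))
  (trans (cong₂ _+_
    (sum-map-*ˡ (p fz) _ (λ S → rest S * f (true ∷ S)) (allEdgeSets k) (λ S → *-assoc (p fz) (rest S) (f (true ∷ S))))
    (sum-map-*ˡ (1ℚ - p fz) _ (λ S → rest S * f (false ∷ S)) (allEdgeSets k) (λ S → *-assoc (1ℚ - p fz) (rest S) (f (false ∷ S)))))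
  (trans (cong₂ (λ a b → p fz * a + (1ℚ - p fz) * b)
    (sum-allEdgeSets (λ e → p (fs e)) (λ e → p₀ (fs e)) (λ e → p₁ (fs e)) (λ S → f (true ∷ S)))
    (sum-allEdgeSets (λ e → p (fs e)) (λ e → p₀ (fs e)) (λ e → p₁ (fs e)) (λ S → f (false ∷ S))))
  (sym (E-prod (λ e → bern (p e) (p₀ e) (p₁ e)) f))))
  where
  weightOf : Vec Bool (suc k) → ℚ
  weightOf R = ∏ (λ e → if lookup R e then p e else 1ℚ - p e)
  rest : Vec Bool k → ℚ
  rest S = ∏ (λ e → if lookup S e then p (fs e) else 1ℚ - p (fs e))

allEdgeSets-complete : (S : Vec Bool k) → S ∈ allEdgeSets k
allEdgeSets-complete []      = here refl
allEdgeSets-complete {suc k} (b ∷ S) = go b (allEdgeSets k) (allEdgeSets-complete S)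
  where
  go : ∀ b l → S ∈ l → (b ∷ S) ∈ concatMap (λ S → (true ∷ S) ∷ (false ∷ S) ∷ []) l
  go true  (_ ∷ l) (here refl) = here refl
  go false (_ ∷ l) (here refl) = there (here refl)
  go b     (_ ∷ l) (there h)   = there (there (go b l h))

maxℚ-ub : ∀ {x l} → x ∈ l → x ≤ maxℚ l
maxℚ-ub {x} {y ∷ l} (here refl) = p≤p⊔q x (maxℚ l)
maxℚ-ub {x} {y ∷ l} (there h)   = ≤-trans (maxℚ-ub h) (p≤q⊔p y (maxℚ l))

maxℚ-sel : ∀ l → (maxℚ l ≡ 0ℚ) ⊎ (maxℚ l ∈ l)
maxℚ-sel []      = inj₁ refl
maxℚ-sel (x ∷ l) with ⊔-sel x (maxℚ l)
... | inj₁ e = inj₂ (here e)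
... | inj₂ e with maxℚ-sel l
...   | inj₁ z = inj₁ (trans e z)
...   | inj₂ h = inj₂ (there (subst (_∈ l) (sym e) h))

-- Matchings of an instance

inc : (I : Instance) → Fin (m I) → Fin (n I) → Bool
inc I e u = (end₁ I e == u) ∨ (end₂ I e == u)

inc₁ : (I : Instance) (e : Fin (m I)) → inc I e (end₁ I e) ≡ true
inc₁ I e = cong (_∨ (end₂ I e == end₁ I e)) (==-refl (end₁ I e))

inc₂ : (I : Instance) (e : Fin (m I)) → inc I e (end₂ I e) ≡ true
inc₂ I e = trans (cong ((end₁ I e == end₂ I e) ∨_) (==-refl (end₂ I e))) (∨-zeroʳ _)

inc-cases : (I : Instance) {e : Fin (m I)} {u : Fin (n I)} →
            inc I e u ≡ true → (end₁ I e ≡ u) ⊎ (end₂ I e ≡ u)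
inc-cases I h with ∨-true h
... | inj₁ p = inj₁ (==-true p)
... | inj₂ p = inj₂ (==-true p)

inc-unique : (I : Instance) {e f : Fin (m I)} {u v : Fin (n I)} → u ≢ v →
             inc I e u ≡ true → inc I e v ≡ true → inc I f u ≡ true → inc I f v ≡ true → e ≡ f
inc-unique I {e} {f} u≢v eu ev fu fv
  with inc-cases I eu | inc-cases I ev | inc-cases I fu | inc-cases I fv
... | inj₁ a | inj₁ b | _ | _ = ⊥-elim (u≢v (trans (sym a) b))
... | inj₂ a | inj₂ b | _ | _ = ⊥-elim (u≢v (trans (sym a) b))
... | _ | _ | inj₁ a | inj₁ b = ⊥-elim (u≢v (trans (sym a) b))
... | _ | _ | inj₂ a | inj₂ b = ⊥-elim (u≢v (trans (sym a) b))
... | inj₁ a | inj₂ b | inj₁ c | inj₂ d = noParallel I e f (inj₁ (trans a (sym c) , trans b (sym d)))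
... | inj₁ a | inj₂ b | inj₂ c | inj₁ d = noParallel I e f (inj₂ (trans a (sym c) , trans b (sym d)))
... | inj₂ a | inj₁ b | inj₁ c | inj₂ d = noParallel I e f (inj₂ (trans b (sym d) , trans a (sym c)))
... | inj₂ a | inj₁ b | inj₂ c | inj₁ d = noParallel I e f (inj₁ (trans b (sym d) , trans a (sym c)))

∑-inc : (I : Instance) (e : Fin (m I)) (f : Fin (n I) → ℚ) →
        ∑ (λ u → ι (inc I e u) * f u) ≡ f (end₁ I e) + f (end₂ I e)
∑-inc I e f = trans (∑-cong (λ u → split u))
  (trans (∑-+ (λ u → ι (end₁ I e == u) * f u) (λ u → ι (end₂ I e == u) * f u))
         (cong₂ _+_ (∑-== (end₁ I e) f) (∑-== (end₂ I e) f)))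
  where
  split : ∀ u → ι (inc I e u) * f u ≡ ι (end₁ I e == u) * f u + ι (end₂ I e == u) * f u
  split u with decb (end₁ I e == u) | decb (end₂ I e == u)
  ... | inj₁ a | inj₁ b = ⊥-elim (loopless I e (trans (==-true a) (sym (==-true b))))
  ... | inj₁ a | inj₂ b rewrite a | b = lem (f u)
    where
    lem : ∀ x → 1ℚ * x ≡ 1ℚ * x + 0ℚ * x
    lem = solve 1 (λ x → con 1ℚ :* x := con 1ℚ :* x :+ con 0ℚ :* x) refl
  ... | inj₂ a | _ rewrite a = lem (ι (end₂ I e == u)) (f u)
    where
    lem : ∀ b x → b * x ≡ 0ℚ * x + b * x
    lem = solve 2 (λ b x → b :* x := con 0ℚ :* x :+ b :* x) refl

Sub : {k : ℕ} → Vec Bool k → Vec Bool k → Set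
Sub S T = ∀ e → lookup S e ≡ true → lookup T e ≡ true

IsMatching : (I : Instance) → EdgeSet (m I) → Set
IsMatching I M = ∀ e f u → lookup M e ≡ true → lookup M f ≡ true →
                 inc I e u ≡ true → inc I f u ≡ true → e ≡ f

weight-∑ : (I : Instance) (S : EdgeSet (m I)) → weight I S ≡ ∑ (λ e → ι (lookup S e) * w I e)
weight-∑ I S = trans (sum-allFin (λ e → if lookup S e then w I e else 0ℚ)) (∑-cong (λ e → eq e (lookup S e)))
  where
  eq : ∀ e b → (if b then w I e else 0ℚ) ≡ ι b * w I e
  eq e true  = sym (*-identityˡ (w I e))
  eq e false = sym (*-zeroˡ (w I e))

⊆ₑ⇒Sub : (S T : Vec Bool k) → (S ⊆ₑ T) ≡ true → Sub S T
⊆ₑ⇒Sub S T h e p with all-tabulate⁻ (λ e → not (e ∈ₑ S) ∨ e ∈ₑ T) h e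
... | q rewrite p = q

Sub⇒⊆ₑ : (S T : Vec Bool k) → Sub S T → (S ⊆ₑ T) ≡ true
Sub⇒⊆ₑ S T h = all-tabulate⁺ (λ e → not (e ∈ₑ S) ∨ e ∈ₑ T) go
  where
  go : ∀ e → not (lookup S e) ∨ lookup T e ≡ true
  go e with lookup S e in eq
  ... | false = refl
  ... | true  = h e eq

isMatching⇒ : (I : Instance) (M : EdgeSet (m I)) → isMatching I M ≡ true → IsMatching I M
isMatching⇒ I M h e f u eM fM eu fu with e ≟ f in eq
... | yes p = p
... | no ¬p = ⊥-elim (contra touching)
  where
  row : foldr _∧_ true (map (λ f → not (e ∈ₑ M ∧ f ∈ₑ M ∧ not (does (e ≟ f)) ∧ touches I e f)) (allFin (m I))) ≡ true
  row = all-tabulate⁻ (λ e → foldr _∧_ true (map (λ f → not (e ∈ₑ M ∧ f ∈ₑ M ∧ not (does (e ≟ f)) ∧ touches I e f)) (allFin (m I))))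
          (trans (sym (foldr-∧-concatMap (λ e → map (λ f → not (e ∈ₑ M ∧ f ∈ₑ M ∧ not (does (e ≟ f)) ∧ touches I e f)) (allFin (m I))) (allFin (m I)))) h) e
  cell : not (lookup M e ∧ lookup M f ∧ not (does (e ≟ f)) ∧ touches I e f) ≡ true
  cell = all-tabulate⁻ (λ f → not (e ∈ₑ M ∧ f ∈ₑ M ∧ not (does (e ≟ f)) ∧ touches I e f)) row f
  contra : touches I e f ≡ true → ⊥
  contra t with cell
  ... | c rewrite eM | fM | eq | t with c
  ...   | ()
  touching : touches I e f ≡ true
  touching with inc-cases I eu | inc-cases I fu
  ... | inj₁ a | inj₁ b rewrite trans a (sym b) | ==-refl (end₁ I f) = refl
  ... | inj₁ a | inj₂ b rewrite trans a (sym b) | ==-refl (end₂ I f) = ∨-zeroʳ _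
  ... | inj₂ a | inj₁ b rewrite trans a (sym b) | ==-refl (end₁ I f)
    = trans (cong ((end₁ I e == end₁ I f) ∨_) (∨-zeroʳ _)) (∨-zeroʳ _)
  ... | inj₂ a | inj₂ b rewrite trans a (sym b) | ==-refl (end₂ I f)
    = trans (cong ((end₁ I e == end₁ I f) ∨_) (trans (cong ((end₁ I e == end₂ I f) ∨_) (∨-zeroʳ _)) (∨-zeroʳ _))) (∨-zeroʳ _)

⇒isMatching : (I : Instance) (M : EdgeSet (m I)) → IsMatching I M → isMatching I M ≡ true
⇒isMatching I M h =
  trans (foldr-∧-concatMap (λ e → map (λ f → not (e ∈ₑ M ∧ f ∈ₑ M ∧ not (does (e ≟ f)) ∧ touches I e f)) (allFin (m I))) (allFin (m I)))
  (all-tabulate⁺ (λ e → foldr _∧_ true (map (λ f → not (e ∈ₑ M ∧ f ∈ₑ M ∧ not (does (e ≟ f)) ∧ touches I e f)) (allFin (m I))))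
    (λ e → all-tabulate⁺ (λ f → not (e ∈ₑ M ∧ f ∈ₑ M ∧ not (does (e ≟ f)) ∧ touches I e f)) (cell e)))
  where
  cell : ∀ e f → not (lookup M e ∧ lookup M f ∧ not (does (e ≟ f)) ∧ touches I e f) ≡ true
  cell e f with lookup M e in eM | lookup M f in fM | e ≟ f
  ... | false | _     | _      = refl
  ... | true  | false | _      = refl
  ... | true  | true  | yes _  = refl
  ... | true  | true  | no ¬p with touches I e f in t
  ...   | false = refl
  ...   | true with ∨-true t
  ...     | inj₁ a = ⊥-elim (¬p (h e f (end₁ I f) eM fM (subst (λ u → inc I e u ≡ true) (==-true a) (inc₁ I e)) (inc₁ I f)))
  ...     | inj₂ t₁ with ∨-true t₁
  ...       | inj₁ a = ⊥-elim (¬p (h e f (end₂ I f) eM fM (subst (λ u → inc I e u ≡ true) (==-true a) (inc₁ I e)) (inc₂ I f)))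
  ...       | inj₂ t₂ with ∨-true t₂
  ...         | inj₁ a = ⊥-elim (¬p (h e f (end₁ I f) eM fM (subst (λ u → inc I e u ≡ true) (==-true a) (inc₂ I e)) (inc₁ I f)))
  ...         | inj₂ a = ⊥-elim (¬p (h e f (end₂ I f) eM fM (subst (λ u → inc I e u ≡ true) (==-true a) (inc₂ I e)) (inc₂ I f)))

mwm-≥ : (I : Instance) (H M : EdgeSet (m I)) → Sub M H → IsMatching I M → weight I M ≤ mwm I H
mwm-≥ I H M s c = maxℚ-ub (subst (_∈ map cand (allEdgeSets (m I))) val (∈-map⁺ cand (allEdgeSets-complete M)))
  where
  cand : EdgeSet (m I) → ℚ
  cand M = if (M ⊆ₑ H) ∧ isMatching I M then weight I M else 0ℚ
  val : cand M ≡ weight I M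
  val rewrite Sub⇒⊆ₑ M H s | ⇒isMatching I M c = refl

-- The maximum may be the starting value 0, or the 0 assigned to an inadmissible candidate; in these
-- cases the empty matching attains it. The witness also serves as the deterministic choice of an
-- optimal matching.
mwm-attained : (I : Instance) (H : EdgeSet (m I)) →
               Σ (EdgeSet (m I)) λ M → Sub M H × IsMatching I M × (weight I M ≡ mwm I H)
mwm-attained I H = go (maxℚ-sel (map cand (allEdgeSets (m I))))
  where
  cand : EdgeSet (m I) → ℚ
  cand M = if (M ⊆ₑ H) ∧ isMatching I M then weight I M else 0ℚ
  empty : mwm I H ≡ 0ℚ → Σ (EdgeSet (m I)) λ M → Sub M H × IsMatching I M × (weight I M ≡ mwm I H)
  empty z = replicate (m I) false
    , (λ e p → ⊥-elim (true≢false p (lookup-replicate e false)))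
    , (λ e f u p → ⊥-elim (true≢false p (lookup-replicate e false)))
    , trans (trans (weight-∑ I (replicate (m I) false))
        (∑-zero (λ e → trans (cong (λ b → ι b * w I e) (lookup-replicate e false)) (*-zeroˡ (w I e))))) (sym z)
  go : (mwm I H ≡ 0ℚ) ⊎ (mwm I H ∈ map cand (allEdgeSets (m I))) → Σ (EdgeSet (m I)) λ M → Sub M H × IsMatching I M × (weight I M ≡ mwm I H)
  go (inj₁ z) = empty z
  go (inj₂ h) with ∈-map⁻ cand h
  ... | M , _ , eq with (M ⊆ₑ H) in a | isMatching I M in b
  ...   | true  | true  = M , ⊆ₑ⇒Sub M H a , isMatching⇒ I M b , sym eq
  ...   | true  | false = empty eq
  ...   | false | _     = empty eq

mwm-mono : (I : Instance) {H H' : EdgeSet (m I)} → Sub H H' → mwm I H ≤ mwm I H'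
mwm-mono I {H} {H'} s with mwm-attained I H
... | M , M⊆H , c , eq = ≤-resp eq refl (mwm-≥ I H' M (λ e p → s e (M⊆H e p)) c)

realization : (I : Instance) → D (EdgeSet (m I))
realization I = prod (λ e → bern (p I e) (<⇒≤ (p-pos I e)) (p-le1 I e))

𝔼-E : (I : Instance) (f : EdgeSet (m I) → ℚ) → 𝔼 I f ≡ E (realization I) f
𝔼-E I f = trans
  (sum-map-cong _ (λ R → ∏ (λ e → if lookup R e then p I e else 1ℚ - p I e) * f R) (allEdgeSets (m I))
    (λ R → cong (_* f R) (∏-allFin (λ e → if lookup R e then p I e else 1ℚ - p I e))))
  (sum-allEdgeSets (p I) (λ e → <⇒≤ (p-pos I e)) (p-le1 I) f)

-- Naturals inside ℚ

ℕtoℚ-+ : ∀ a b → ℕtoℚ (a ℕ.+ b) ≡ ℕtoℚ a + ℕtoℚ b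
ℕtoℚ-+ zero    b = sym (+-identityˡ (ℕtoℚ b))
ℕtoℚ-+ (suc a) b = trans (ℕtoℚ-suc (a ℕ.+ b)) (trans (cong (λ z → 1ℚ + z) (ℕtoℚ-+ a b))
  (trans (sym (+-assoc 1ℚ (ℕtoℚ a) (ℕtoℚ b))) (cong (λ z → z + ℕtoℚ b) (sym (ℕtoℚ-suc a)))))

ℕtoℚ-* : ∀ a b → ℕtoℚ (a ℕ.* b) ≡ ℕtoℚ a * ℕtoℚ b
ℕtoℚ-* zero    b = sym (*-zeroˡ (ℕtoℚ b))
ℕtoℚ-* (suc a) b = trans (ℕtoℚ-+ b (a ℕ.* b)) (trans (cong (λ z → ℕtoℚ b + z) (ℕtoℚ-* a b))
  (trans (lem (ℕtoℚ a) (ℕtoℚ b)) (cong (λ z → z * ℕtoℚ b) (sym (ℕtoℚ-suc a)))))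
  where
  lem : ∀ a b → b + a * b ≡ (1ℚ + a) * b
  lem = solve 2 (λ a b → b :+ a :* b := (con 1ℚ :+ a) :* b) refl

0≤ℕtoℚ : ∀ k → 0ℚ ≤ ℕtoℚ k
0≤ℕtoℚ zero    = ≤-refl
0≤ℕtoℚ (suc k) = ≤-resp refl (sym (ℕtoℚ-suc k)) (0≤1 ⊕ 0≤ℕtoℚ k)

ℕtoℚ-mono : ∀ {a b} → a ℕ.≤ b → ℕtoℚ a ≤ ℕtoℚ b
ℕtoℚ-mono {b = b} z≤n = 0≤ℕtoℚ b
ℕtoℚ-mono {suc a} {suc b} (s≤s h) =
  ≤-resp (sym (ℕtoℚ-suc a)) (sym (ℕtoℚ-suc b)) (+-monoʳ-≤ 1ℚ (ℕtoℚ-mono h))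

1≤ℕtoℚ-suc : ∀ k → 1ℚ ≤ ℕtoℚ (suc k)
1≤ℕtoℚ-suc k = ≤-resp (+-identityʳ 1ℚ) (sym (ℕtoℚ-suc k)) (+-monoʳ-≤ 1ℚ (0≤ℕtoℚ k))

0<1 : 0ℚ < 1ℚ
0<1 = positive⁻¹ 1ℚ

0<ℕtoℚ-suc : ∀ k → 0ℚ < ℕtoℚ (suc k)
0<ℕtoℚ-suc k = <-≤-trans 0<1 (1≤ℕtoℚ-suc k)

ℕtoℚ-reflect : ∀ a b → ℕtoℚ a ≤ ℕtoℚ b → a ℕ.≤ b
ℕtoℚ-reflect a b h with a ℕ.≤? b
... | yes p = p
... | no ¬p = ⊥-elim (<-irrefl refl (<-≤-trans lt h))
  where
  lt : ℕtoℚ b < ℕtoℚ a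
  lt = <-≤-trans (≤-<-trans (≡⇒≤ (sym (+-identityˡ (ℕtoℚ b)))) (+-monoˡ-< (ℕtoℚ b) 0<1))
         (≤-trans (≡⇒≤ (sym (ℕtoℚ-suc b))) (ℕtoℚ-mono (ℕP.≰⇒> ¬p)))

sumℕ : (Fin k → ℕ) → ℕ
sumℕ {zero}  f = 0
sumℕ {suc k} f = f fz ℕ.+ sumℕ (λ i → f (fs i))

sumℕ-mono : {f g : Fin k → ℕ} → (∀ i → f i ℕ.≤ g i) → sumℕ f ℕ.≤ sumℕ g
sumℕ-mono {zero}  h = z≤n
sumℕ-mono {suc k} h = ℕP.+-mono-≤ (h fz) (sumℕ-mono (λ i → h (fs i)))

sumℕ-mono-< : {f g : Fin k → ℕ} → (∀ i → f i ℕ.≤ g i) → ∀ i → f i ℕ.< g i → sumℕ f ℕ.< sumℕ g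
sumℕ-mono-< h fz     lt = ℕP.+-mono-<-≤ lt (sumℕ-mono (λ i → h (fs i)))
sumℕ-mono-< h (fs i) lt = ℕP.+-mono-≤-< (h fz) (sumℕ-mono-< (λ i → h (fs i)) i lt)

sumℕ-+ : (f g : Fin k → ℕ) → sumℕ (λ i → f i ℕ.+ g i) ≡ sumℕ f ℕ.+ sumℕ g
sumℕ-+ {zero}  f g = refl
sumℕ-+ {suc k} f g = trans (cong (f fz ℕ.+ g fz ℕ.+_) (sumℕ-+ (λ i → f (fs i)) (λ i → g (fs i))))
  (ℕ-lem (f fz) (g fz) _ _)
  where
  ℕ-lem : ∀ a b c d → a ℕ.+ b ℕ.+ (c ℕ.+ d) ≡ a ℕ.+ c ℕ.+ (b ℕ.+ d)
  ℕ-lem = NS.solve 4 (λ a b c d → a NS.:+ b NS.:+ (c NS.:+ d) NS.:= a NS.:+ c NS.:+ (b NS.:+ d)) refl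

sumℕ-cong : {f g : Fin k → ℕ} → (∀ i → f i ≡ g i) → sumℕ f ≡ sumℕ g
sumℕ-cong {zero}  h = refl
sumℕ-cong {suc k} h = cong₂ ℕ._+_ (h fz) (sumℕ-cong (λ i → h (fs i)))

ℕtoℚ-sum : (f : Fin k → ℕ) → ℕtoℚ (sumℕ f) ≡ ∑ (λ i → ℕtoℚ (f i))
ℕtoℚ-sum {zero}  f = refl
ℕtoℚ-sum {suc k} f = trans (ℕtoℚ-+ (f fz) (sumℕ (λ i → f (fs i)))) (cong (λ z → ℕtoℚ (f fz) + z) (ℕtoℚ-sum (λ i → f (fs i))))

β : Bool → ℕ
β true  = 1
β false = 0

ℕtoℚ-β : ∀ b → ℕtoℚ (β b) ≡ ι b
ℕtoℚ-β true  = refl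
ℕtoℚ-β false = refl

size : Vec Bool k → ℕ
size S = sumℕ (λ e → β (lookup S e))

wℕ : (Fin k → ℕ) → Vec Bool k → ℕ
wℕ W M = sumℕ (λ e → β (lookup M e) ℕ.* W e)

β-mono : ∀ {a b} → (a ≡ true → b ≡ true) → β a ℕ.≤ β b
β-mono {false} h = z≤n
β-mono {true}  h rewrite h refl = ℕP.≤-refl

fraction : ∀ q → 0ℚ ≤ q → Σ ℕ λ d → Σ ℕ λ a → q * ℕtoℚ (suc d) ≡ ℕtoℚ a
fraction q@(mkℚ (ℤ.+ a) d c) h = d , a ,
  toℚᵘ-injective (U.≃-trans (toℚᵘ-homo-* q (ℕtoℚ (suc d)))
  (U.≃-trans (U.*-congˡ {toℚᵘ q} (toℚᵘ-fromℚᵘ (UB.mkℚᵘ (ℤ.+ suc d) 0)))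
  (U.≃-trans (UB.*≡* eq) (U.≃-sym (toℚᵘ-fromℚᵘ (UB.mkℚᵘ (ℤ.+ a) 0))))))
  where
  eq : ℤ.+ a ℤ.* ℤ.+ suc d ℤ.* ℤ.+ 1 ≡ ℤ.+ a ℤ.* ℤ.+ suc (d ℕ.* 1)
  eq = trans (ℤP.*-identityʳ _) (cong (λ z → ℤ.+ a ℤ.* ℤ.+ suc z) (sym (ℕP.*-identityʳ d)))
fraction q@(mkℚ ℤ.-[1+ a ] d c) h with nonNegative h
... | ()

-- Integral weights are wanted because the rounding argument is an induction on their sum, in which
-- some of them are lowered by one.
common-denominator : (w : Fin k → ℚ) → (∀ e → 0ℚ ≤ w e) →
                     Σ ℕ λ d → Σ (Fin k → ℕ) λ W → ∀ e → ℕtoℚ (suc d) * w e ≡ ℕtoℚ (W e)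
common-denominator {zero}  w h = 0 , (λ ()) , λ ()
common-denominator {suc k} w h = d₁ ℕ.+ d₀ ℕ.* suc d₁ , W' , go
  where
  head : Σ ℕ λ d → Σ ℕ λ a → w fz * ℕtoℚ (suc d) ≡ ℕtoℚ a
  head = fraction (w fz) (h fz)
  tail : Σ ℕ λ d → Σ (Fin k → ℕ) λ W → ∀ e → ℕtoℚ (suc d) * w (fs e) ≡ ℕtoℚ (W e)
  tail = common-denominator (λ e → w (fs e)) (λ e → h (fs e))
  d₀ d₁ a : ℕ
  d₀ = proj₁ head
  d₁ = proj₁ tail
  a  = proj₁ (proj₂ head)
  W : Fin k → ℕ
  W = proj₁ (proj₂ tail)
  W' : Fin (suc k) → ℕ
  W' fz     = suc d₁ ℕ.* a
  W' (fs i) = suc d₀ ℕ.* W i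
  lem₀ : ∀ a b x → a * b * x ≡ b * (x * a)
  lem₀ = solve 3 (λ a b x → a :* b :* x := b :* (x :* a)) refl
  lem₁ : ∀ a b x → a * b * x ≡ a * (b * x)
  lem₁ = solve 3 (λ a b x → a :* b :* x := a :* (b :* x)) refl
  go : ∀ e → ℕtoℚ (suc d₀ ℕ.* suc d₁) * w e ≡ ℕtoℚ (W' e)
  go fz = trans (cong (λ z → z * w fz) (ℕtoℚ-* (suc d₀) (suc d₁)))
    (trans (lem₀ (ℕtoℚ (suc d₀)) (ℕtoℚ (suc d₁)) (w fz))
    (trans (cong (λ z → ℕtoℚ (suc d₁) * z) (proj₂ (proj₂ head))) (sym (ℕtoℚ-* (suc d₁) a))))
  go (fs i) = trans (cong (λ z → z * w (fs i)) (ℕtoℚ-* (suc d₀) (suc d₁)))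
    (trans (lem₁ (ℕtoℚ (suc d₀)) (ℕtoℚ (suc d₁)) (w (fs i)))
    (trans (cong (λ z → ℕtoℚ (suc d₀) * z) (proj₂ (proj₂ tail) i)) (sym (ℕtoℚ-* (suc d₀) (W i)))))

-- Exchanging two matchings of a bipartite graph

Misses : (I : Instance) → EdgeSet (m I) → Fin (n I) → Set
Misses I M u = ∀ e → lookup M e ≡ true → inc I e u ≡ true → ⊥

Crosses : (I : Instance) → (Fin (n I) → Bool) → Fin (m I) → Set
Crosses I lab e = lab (end₁ I e) ≢ lab (end₂ I e)

record Ends (I : Instance) (e : Fin (m I)) (u b : Fin (n I)) : Set where
  field
    at-u : inc I e u ≡ true
    at-b : inc I e b ≡ true
    only : ∀ z → inc I e z ≡ true → (z ≡ u) ⊎ (z ≡ b)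

open Ends

ends : (I : Instance) (lab : Fin (n I) → Bool) (e : Fin (m I)) (u : Fin (n I)) → Crosses I lab e →
       inc I e u ≡ true → Σ (Fin (n I)) λ b → Ends I e u b × (lab u ≢ lab b)
ends I lab e u c h with inc-cases I h
... | inj₁ refl = end₂ I e , record { at-u = h ; at-b = inc₂ I e ; only = only' } , c
  where
  only' : ∀ z → inc I e z ≡ true → (z ≡ end₁ I e) ⊎ (z ≡ end₂ I e)
  only' z q with inc-cases I q
  ... | inj₁ a = inj₁ (sym a)
  ... | inj₂ a = inj₂ (sym a)
... | inj₂ refl = end₁ I e , record { at-u = h ; at-b = inc₁ I e ; only = only' } , ≢-sym c
  where
  only' : ∀ z → inc I e z ≡ true → (z ≡ end₂ I e) ⊎ (z ≡ end₁ I e)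
  only' z q with inc-cases I q
  ... | inj₁ a = inj₂ (sym a)
  ... | inj₂ a = inj₁ (sym a)

∈-insert : (M : Vec Bool k) (e f : Fin k) → lookup (M [ e ]≔ true) f ≡ true → (f ≡ e) ⊎ (lookup M f ≡ true)
∈-insert M e f h with f ≟ e
... | yes p = inj₁ p
... | no ¬p = inj₂ (trans (sym (lookup∘update′ ¬p M true)) h)

∈-remove : (M : Vec Bool k) (e f : Fin k) → lookup (M [ e ]≔ false) f ≡ true → (f ≢ e) × (lookup M f ≡ true)
∈-remove M e f h with f ≟ e
... | yes refl = ⊥-elim (true≢false h (lookup∘update e M false))
... | no ¬p = ¬p , trans (sym (lookup∘update′ ¬p M false)) h

remove-Sub : (M : Vec Bool k) (e : Fin k) → Sub (M [ e ]≔ false) M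
remove-Sub M e f h = proj₂ (∈-remove M e f h)

sub-matching : (I : Instance) (M N : EdgeSet (m I)) → Sub N M → IsMatching I M → IsMatching I N
sub-matching I M N s h e f u eN fN = h e f u (s e eN) (s f fN)

insert-matching : (I : Instance) {M : EdgeSet (m I)} {e : Fin (m I)} {u b : Fin (n I)} → Ends I e u b →
                  Misses I M u → Misses I M b → IsMatching I M → IsMatching I (M [ e ]≔ true)
insert-matching I {M} {e} {u} {b} en mu mb h f g z fN gN fz' gz with ∈-insert M e f fN | ∈-insert M e g gN
... | inj₁ p | inj₁ q = trans p (sym q)
... | inj₂ p | inj₂ q = h f g z p q fz' gz
... | inj₁ refl | inj₂ q with only en z fz'
...   | inj₁ refl = ⊥-elim (mu g q gz)
...   | inj₂ refl = ⊥-elim (mb g q gz)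
insert-matching I {M} {e} {u} {b} en mu mb h f g z fN gN fz' gz | inj₂ p | inj₁ refl with only en z gz
...   | inj₁ refl = ⊥-elim (mu f p fz')
...   | inj₂ refl = ⊥-elim (mb f p fz')

¬true⇒false : ∀ {b} → (b ≡ true → ⊥) → b ≡ false
¬true⇒false {true}  h = ⊥-elim (h refl)
¬true⇒false {false} h = refl

size-remove : (M : Vec Bool k) (e : Fin k) → lookup M e ≡ true → size (M [ e ]≔ false) ℕ.< size M
size-remove M e h = sumℕ-mono-< (λ f → β-mono (remove-Sub M e f)) e
  (subst (λ b → β b ℕ.< β (lookup M e)) (sym (lookup∘update e M false)) (subst (λ b → 0 ℕ.< β b) (sym h) (s≤s z≤n)))

at? : (I : Instance) (M : EdgeSet (m I)) (u : Fin (n I)) →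
      (Σ (Fin (m I)) λ e → (lookup M e ≡ true) × (inc I e u ≡ true)) ⊎ Misses I M u
at? I M u with any? (λ e → (lookup M e ∧ inc I e u) Bool.≟ true)
... | yes (e , h) = inj₁ (e , ∧-true h)
... | no ¬h = inj₂ (λ e p q → ¬h (e , cong₂ _∧_ p q))

bool-third : ∀ {a b c : Bool} → a ≢ b → b ≢ c → a ≡ c
bool-third {true}  {true}  {c}     h _ = ⊥-elim (h refl)
bool-third {false} {false} {c}     h _ = ⊥-elim (h refl)
bool-third {true}  {false} {true}  _ _ = refl
bool-third {true}  {false} {false} _ h = ⊥-elim (h refl)
bool-third {false} {true}  {false} _ _ = refl
bool-third {false} {true}  {true}  _ h = ⊥-elim (h refl)

-- For `M` missing `u` and `M'` missing `v`: the same edges, counted with multiplicity, are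
-- redistributed into two matchings, the second of which misses both vertices. By `balance` the
-- total weight of the pair is preserved for every weight function.
record Exchanged (I : Instance) (M M' : EdgeSet (m I)) (u v : Fin (n I)) : Set where
  field
    N N'      : EdgeSet (m I)
    N-match   : IsMatching I N
    N'-match  : IsMatching I N'
    balance   : ∀ e → β (lookup N e) ℕ.+ β (lookup N' e) ≡ β (lookup M e) ℕ.+ β (lookup M' e)
    N'-misses-u : Misses I N' u
    N'-misses-v : Misses I N' v

  union : ∀ e → (lookup N e ≡ true) ⊎ (lookup N' e ≡ true) → (lookup M e ≡ true) ⊎ (lookup M' e ≡ true)
  union e h with lookup M e | lookup M' e | lookup N e | lookup N' e | balance e | h
  ... | true  | _    | _ | _ | _ | _ = inj₁ refl
  ... | false | true | _ | _ | _ | _ = inj₂ refl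
  ... | false | false | true  | _     | () | _
  ... | false | false | false | true  | () | _
  ... | false | false | false | false | _ | inj₁ ()
  ... | false | false | false | false | _ | inj₂ ()

-- The alternating path is the single edge `e₀`, which moves from `M'` to `M`.
exchange-end : (I : Instance) (M M' : EdgeSet (m I)) (u v b : Fin (n I)) (e₀ : Fin (m I)) →
               IsMatching I M → IsMatching I M' → Misses I M u → Misses I M' v →
               lookup M' e₀ ≡ true → Ends I e₀ u b → Misses I M b → Exchanged I M M' u v
exchange-end I M M' u v b e₀ hM hM' mu mv e₀M' en₀ mb = record
  { N = M [ e₀ ]≔ true ; N' = M' [ e₀ ]≔ false
  ; N-match = insert-matching I {M} en₀ mu mb hM
  ; N'-match = sub-matching I M' (M' [ e₀ ]≔ false) (remove-Sub M' e₀) hM'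
  ; balance = bal
  ; N'-misses-u = λ e p q → proj₁ (∈-remove M' e₀ e p) (hM' e e₀ u (remove-Sub M' e₀ e p) e₀M' q (at-u en₀))
  ; N'-misses-v = λ e p q → mv e (remove-Sub M' e₀ e p) q }
  where
  e₀∉M : lookup M e₀ ≡ false
  e₀∉M = ¬true⇒false (λ p → mu e₀ p (at-u en₀))
  bal : ∀ e → β (lookup (M [ e₀ ]≔ true) e) ℕ.+ β (lookup (M' [ e₀ ]≔ false) e) ≡ β (lookup M e) ℕ.+ β (lookup M' e)
  bal e with e ≟ e₀
  ... | yes refl rewrite lookup∘update e M true | lookup∘update e M' false | e₀∉M | e₀M' = refl
  ... | no ¬p rewrite lookup∘update′ ¬p M true | lookup∘update′ ¬p M' false = refl

-- The first two edges of the path are set aside, the rest is exchanged starting from `a`, and the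
-- two edges are put back with their roles swapped. Reinsertion is safe: the two matchings have no
-- other edge at `u` or `b`, and the recursive `N'` misses `a`.
exchange-step : (I : Instance) (M M' : EdgeSet (m I)) (u v b a : Fin (n I)) (e₀ e₁ : Fin (m I)) →
                IsMatching I M → IsMatching I M' → Misses I M u → Misses I M' v →
                lookup M' e₀ ≡ true → Ends I e₀ u b → lookup M e₁ ≡ true → Ends I e₁ b a → a ≢ v →
                Exchanged I (M [ e₁ ]≔ false) (M' [ e₀ ]≔ false) a v → Exchanged I M M' u v
exchange-step I M M' u v b a e₀ e₁ hM hM' mu mv e₀M' en₀ e₁M en₁ a≢v rec = record
  { N = X.N [ e₀ ]≔ true ; N' = X.N' [ e₁ ]≔ true
  ; N-match = insert-matching I {X.N} en₀ (away-u X.N inj₁) (away-b X.N inj₁) X.N-match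
  ; N'-match = insert-matching I {X.N'} en₁ (away-b X.N' inj₂) X.N'-misses-u X.N'-match
  ; balance = bal
  ; N'-misses-u = miss-u
  ; N'-misses-v = miss-v }
  where
  module X = Exchanged rec
  away-u : (S : EdgeSet (m I)) → (∀ {e} → lookup S e ≡ true → (lookup X.N e ≡ true) ⊎ (lookup X.N' e ≡ true)) → Misses I S u
  away-u S inS e p q with X.union e (inS p)
  ... | inj₁ r = mu e (remove-Sub M e₁ e r) q
  ... | inj₂ r = proj₁ (∈-remove M' e₀ e r) (hM' e e₀ u (remove-Sub M' e₀ e r) e₀M' q (at-u en₀))
  away-b : (S : EdgeSet (m I)) → (∀ {e} → lookup S e ≡ true → (lookup X.N e ≡ true) ⊎ (lookup X.N' e ≡ true)) → Misses I S b
  away-b S inS e p q with X.union e (inS p)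
  ... | inj₁ r = proj₁ (∈-remove M e₁ e r) (hM e e₁ b (remove-Sub M e₁ e r) e₁M q (at-u en₁))
  ... | inj₂ r = proj₁ (∈-remove M' e₀ e r) (hM' e e₀ b (remove-Sub M' e₀ e r) e₀M' q (at-b en₀))
  e₀∉M : lookup M e₀ ≡ false
  e₀∉M = ¬true⇒false (λ p → mu e₀ p (at-u en₀))
  e₀≢e₁ : e₀ ≢ e₁
  e₀≢e₁ refl = true≢false e₁M e₀∉M
  e₁∉M' : lookup M' e₁ ≡ false
  e₁∉M' = ¬true⇒false (λ p → e₀≢e₁ (hM' e₀ e₁ b e₀M' p (at-b en₀) (at-u en₁)))
  e₀∉N' : lookup X.N' e₀ ≡ false
  e₀∉N' = ¬true⇒false (λ p → away-u X.N' inj₂ e₀ p (at-u en₀))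
  e₁∉N : lookup X.N e₁ ≡ false
  e₁∉N = ¬true⇒false (λ p → away-b X.N inj₁ e₁ p (at-u en₁))
  bal : ∀ e → β (lookup (X.N [ e₀ ]≔ true) e) ℕ.+ β (lookup (X.N' [ e₁ ]≔ true) e) ≡ β (lookup M e) ℕ.+ β (lookup M' e)
  bal e with e ≟ e₀ | e ≟ e₁
  ... | yes refl | yes q = ⊥-elim (e₀≢e₁ q)
  ... | yes refl | no ¬q rewrite lookup∘update e X.N true | lookup∘update′ ¬q X.N' true | e₀∉N' | e₀∉M | e₀M' = refl
  ... | no ¬p | yes refl rewrite lookup∘update′ ¬p X.N true | lookup∘update e X.N' true | e₁∉N | e₁M | e₁∉M' = refl
  ... | no ¬p | no ¬q rewrite lookup∘update′ ¬p X.N true | lookup∘update′ ¬q X.N' true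
    = trans (X.balance e) (cong₂ (λ a b → β a ℕ.+ β b) (lookup∘update′ ¬q M false) (lookup∘update′ ¬p M' false))
  miss-u : Misses I (X.N' [ e₁ ]≔ true) u
  miss-u e p q with ∈-insert X.N' e₁ e p
  ... | inj₁ refl = mu e₁ e₁M q
  ... | inj₂ r = away-u X.N' inj₂ e r q
  miss-v : Misses I (X.N' [ e₁ ]≔ true) v
  miss-v e p q with ∈-insert X.N' e₁ e p
  ... | inj₂ r = X.N'-misses-v e r q
  ... | inj₁ refl with only en₁ v q
  ...   | inj₁ refl = mv e₀ e₀M' (at-b en₀)
  ...   | inj₂ refl = a≢v refl

-- Walk along the alternating path from u: in a bipartite graph it can never end at v.
exchange : (I : Instance) (lab : Fin (n I) → Bool) (fuel : ℕ) (M M' : EdgeSet (m I)) → size M' ℕ.≤ fuel →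
           IsMatching I M → IsMatching I M' →
           (∀ e → lookup M e ≡ true → Crosses I lab e) → (∀ e → lookup M' e ≡ true → Crosses I lab e) →
           ∀ u v → lab u ≢ lab v → Misses I M u → Misses I M' v → Exchanged I M M' u v
exchange I lab fuel M M' le hM hM' cM cM' u v u≢v mu mv with at? I M' u
... | inj₂ mu' = record { N = M ; N' = M' ; N-match = hM ; N'-match = hM' ; balance = λ e → refl
                        ; N'-misses-u = mu' ; N'-misses-v = mv }
... | inj₁ (e₀ , e₀M' , e₀u) with fuel
...   | zero = ⊥-elim (ℕP.<⇒≱ (size-remove M' e₀ e₀M') (ℕP.≤-trans le z≤n))
...   | suc fuel' with ends I lab e₀ u (cM' e₀ e₀M') e₀u
...     | b , en₀ , u≢b with at? I M b
...       | inj₂ mb = exchange-end I M M' u v b e₀ hM hM' mu mv e₀M' en₀ mb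
...       | inj₁ (e₁ , e₁M , e₁b) with ends I lab e₁ b (cM e₁ e₁M) e₁b
...         | a , en₁ , b≢a =
  exchange-step I M M' u v b a e₀ e₁ hM hM' mu mv e₀M' en₀ e₁M en₁ (λ p → a≢v (cong lab p))
    (exchange I lab fuel' (M [ e₁ ]≔ false) (M' [ e₀ ]≔ false) (ℕP.≤-pred (ℕP.≤-trans (size-remove M' e₀ e₀M') le))
    (sub-matching I M (M [ e₁ ]≔ false) (remove-Sub M e₁) hM) (sub-matching I M' (M' [ e₀ ]≔ false) (remove-Sub M' e₀) hM')
    (λ e p → cM e (remove-Sub M e₁ e p)) (λ e p → cM' e (remove-Sub M' e₀ e p))
    a v a≢v
    (λ e p q → proj₁ (∈-remove M e₁ e p) (hM e e₁ a (remove-Sub M e₁ e p) e₁M q (at-b en₁)))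
    (λ e p q → mv e (remove-Sub M' e₀ e p) q))
  where
  -- Two crossings return to the side of `u`, and `v` lies on the other side.
  a≢v : lab a ≢ lab v
  a≢v p = b≢a (sym (trans p (bool-third (≢-sym u≢v) u≢b)))

-- Rounding fractional matchings of bipartite graphs

∈-tabulate : (f : Fin k → Bool) (e : Fin k) → lookup (tabulate f) e ≡ true → f e ≡ true
∈-tabulate f e h = trans (sym (lookup∘tabulate f e)) h

tabulate-∈ : (f : Fin k → Bool) (e : Fin k) → f e ≡ true → lookup (tabulate f) e ≡ true
tabulate-∈ f e h = trans (lookup∘tabulate f e) h

reweight : (I : Instance) → (Fin (m I) → ℕ) → Instance
reweight I W = record
  { n = n I ; m = m I ; end₁ = end₁ I ; end₂ = end₂ I ; loopless = loopless I ; noParallel = noParallel I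
  ; w = λ e → ℕtoℚ (W e) ; w-nonneg = λ e → 0≤ℕtoℚ (W e) ; p = p I ; p-pos = p-pos I ; p-le1 = p-le1 I }

weight-reweight : (I : Instance) (W : Fin (m I) → ℕ) (M : EdgeSet (m I)) →
                  weight (reweight I W) M ≡ ℕtoℚ (wℕ W M)
weight-reweight I W M = trans (weight-∑ (reweight I W) M)
  (sym (trans (ℕtoℚ-sum (λ e → β (lookup M e) ℕ.* W e))
    (∑-cong (λ e → trans (ℕtoℚ-* (β (lookup M e)) (W e)) (cong (λ z → z * ℕtoℚ (W e)) (ℕtoℚ-β (lookup M e)))))))

record Maximum (I : Instance) (W : Fin (m I) → ℕ) (H : EdgeSet (m I)) : Set where
  field
    best    : EdgeSet (m I)
    inside  : Sub best H
    match   : IsMatching I best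
    maximal : ∀ M → Sub M H → IsMatching I M → wℕ W M ℕ.≤ wℕ W best

maximum : (I : Instance) (W : Fin (m I) → ℕ) (H : EdgeSet (m I)) → Maximum I W H
maximum I W H = from (mwm-attained (reweight I W) H)
  where
  from : (Σ (EdgeSet (m I)) λ M → Sub M H × IsMatching I M × (weight (reweight I W) M ≡ mwm (reweight I W) H)) → Maximum I W H
  from (M , s , c , eq) = record { best = M ; inside = s ; match = c
    ; maximal = λ M' s' c' → ℕtoℚ-reflect (wℕ W M') (wℕ W M)
        (≤-resp (weight-reweight I W M') (trans (sym eq) (weight-reweight I W M)) (mwm-≥ (reweight I W) H M' s' c')) }

isPos : ℕ → Bool
isPos zero    = false
isPos (suc _) = true

isPos-< : ∀ a → isPos a ≡ true → 0 ℕ.< a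
isPos-< (suc _) _ = s≤s z≤n

-- An inequality rather than an equation because `ℕ.pred` stops at zero: a weight 0 is not lowered,
-- and the extra term is then a surplus.
lowered-pay-at : ∀ b k {y} → 0ℚ ≤ y → y * ℕtoℚ k ≤ y * ℕtoℚ (if b then ℕ.pred k else k) + ι b * y
lowered-pay-at false k {y} 0≤y = ≡⇒≤ (lem (y * ℕtoℚ k) y)
  where
  lem : ∀ a b → a ≡ a + 0ℚ * b
  lem = solve 2 (λ a b → a := a :+ con 0ℚ :* b) refl
lowered-pay-at true zero {y} 0≤y = by-gap 0≤y (lem (y * ℕtoℚ zero) y)
  where
  lem : ∀ a b → b ≡ a + 1ℚ * b - a
  lem = solve 2 (λ a b → b := a :+ con 1ℚ :* b :- a) refl
lowered-pay-at true (suc k) {y} 0≤y = ≡⇒≤ (trans (cong (λ z → y * z) (ℕtoℚ-suc k)) (lem y (ℕtoℚ k)))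
  where
  lem : ∀ a b → a * (1ℚ + b) ≡ a * b + 1ℚ * a
  lem = solve 2 (λ a b → a :* (con 1ℚ :+ b) := a :* b :+ con 1ℚ :* a) refl

β-drop-zero : ∀ a x {y} → y ℕ.≤ x → β a ℕ.* y ℕ.≤ β (a ∧ isPos x) ℕ.* y
β-drop-zero false x       _   = z≤n
β-drop-zero true  zero    z≤n = z≤n
β-drop-zero true  (suc x) _   = ℕP.≤-refl

β-*-< : ∀ {a x y} → a ≡ true → x ℕ.< y → β a ℕ.* x ℕ.< β a ℕ.* y
β-*-< refl = ℕP.+-monoˡ-< 0

β-<-* : ∀ {a b x} → a ≡ false → b ≡ true → 0 ℕ.< x → β a ℕ.* x ℕ.< β b ℕ.* x
β-<-* refl refl = ℕP.+-monoˡ-< 0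

-- A maximum matching avoids u unless deleting u lowers the optimum; in that case the weights at u
-- can be lowered by one.  If neither end of a positive edge can be treated so, exchange two optimal
-- matchings avoiding the two ends and add the edge.
module Rounding (I : Instance) (lab : Fin (n I) → Bool) (H : EdgeSet (m I))
                (crosses : ∀ e → lookup H e ≡ true → Crosses I lab e)
                (y : Fin (m I) → ℚ) (0≤y : ∀ e → 0ℚ ≤ y e) (y-supp : ∀ e → lookup H e ≡ false → y e ≡ 0ℚ)
                (load : ∀ u → ∑ (λ e → ι (inc I e u) * y e) ≤ 1ℚ) where

  Rounded : (Fin (m I) → ℕ) → Set
  Rounded W = Σ (EdgeSet (m I)) λ M → Sub M H × IsMatching I M × (∑ (λ e → y e * ℕtoℚ (W e)) ≤ ℕtoℚ (wℕ W M))

  lowered : Fin (n I) → (Fin (m I) → ℕ) → Fin (m I) → ℕ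
  lowered z W e = if inc I e z then ℕ.pred (W e) else W e

  lowered≤ : ∀ z W e → lowered z W e ℕ.≤ W e
  lowered≤ z W e with inc I e z
  ... | true  = ℕP.pred[n]≤n
  ... | false = ℕP.≤-refl

  lowered< : ∀ z W e → inc I e z ≡ true → isPos (W e) ≡ true → suc (lowered z W e) ≡ W e
  lowered< z W e h q rewrite h with W e | q
  ... | suc _ | _ = refl
  ... | zero  | ()

  lowered-pay : ∀ z W e → y e * ℕtoℚ (W e) ≤ y e * ℕtoℚ (lowered z W e) + ι (inc I e z) * y e
  lowered-pay z W e = lowered-pay-at (inc I e z) (W e) (0≤y e)

  positive-part : (Fin (m I) → ℕ) → EdgeSet (m I)
  positive-part W = tabulate (λ e → lookup H e ∧ isPos (W e))

  avoiding : Fin (n I) → (Fin (m I) → ℕ) → EdgeSet (m I)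
  avoiding z W = tabulate (λ e → (lookup H e ∧ isPos (W e)) ∧ not (inc I e z))

  -- The load at `z` is at most 1, so lowering the weights there costs the fractional value at most
  -- 1. The optimum for `W` exceeds the lowered weight of `M'` by at least 1 as well: either a
  -- positive edge of `M'` covers `z` and regains its unit, or `M'` is bounded by the optimum
  -- avoiding `z`, which is strictly smaller.
  lower : (W : Fin (m I) → ℕ) (z : Fin (n I)) (M⁺ : Maximum I W (positive-part W)) (M⁻ : Maximum I W (avoiding z W)) →
          wℕ W (Maximum.best M⁻) ℕ.< wℕ W (Maximum.best M⁺) → Rounded (lowered z W) → Rounded W
  lower W z M⁺ M⁻ lt (M' , s , c , h) =
    M⁺.best , (λ e p → proj₁ (∧-true (∈-tabulate _ e (M⁺.inside e p)))) , M⁺.match ,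
    ≤-trans total (ℕtoℚ-mono gain)
    where
    module M⁺ = Maximum M⁺
    module M⁻ = Maximum M⁻
    -- Edges of weight 0 are dropped; on the remaining ones the lowering at `z` is by exactly one.
    M'' : EdgeSet (m I)
    M'' = tabulate (λ e → lookup M' e ∧ isPos (W e))
    M''⊆M' : Sub M'' M'
    M''⊆M' e p = proj₁ (∧-true (∈-tabulate _ e p))
    c'' : IsMatching I M''
    c'' = sub-matching I M' M'' M''⊆M' c
    M''⊆ : Sub M'' (positive-part W)
    M''⊆ e p = tabulate-∈ _ e (cong₂ _∧_ (s e (M''⊆M' e p)) (proj₂ (∧-true {lookup M' e} (∈-tabulate _ e p))))
    drop-zero : wℕ (lowered z W) M' ℕ.≤ wℕ (lowered z W) M''
    drop-zero = sumℕ-mono (λ e → subst (λ b → β (lookup M' e) ℕ.* lowered z W e ℕ.≤ β b ℕ.* lowered z W e)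
      (sym (lookup∘tabulate (λ e → lookup M' e ∧ isPos (W e)) e)) (β-drop-zero (lookup M' e) (W e) (lowered≤ z W e)))
    gain-at : (Σ (Fin (m I)) λ e → (lookup M'' e ≡ true) × (inc I e z ≡ true)) ⊎ Misses I M'' z →
              suc (wℕ (lowered z W) M') ℕ.≤ wℕ W M⁺.best
    gain-at (inj₂ miss) = ℕP.≤-<-trans (ℕP.≤-trans drop-zero
          (ℕP.≤-trans (sumℕ-mono (λ e → ℕP.*-monoʳ-≤ (β (lookup M'' e)) (lowered≤ z W e)))
          (M⁻.maximal M'' (λ e p → tabulate-∈ _ e (cong₂ _∧_ (∈-tabulate _ e (M''⊆ e p))
             (cong not (¬true⇒false (miss e p))))) c''))) lt
    gain-at (inj₁ (e₁ , e₁M , e₁z)) = ℕP.≤-trans (s≤s drop-zero)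
          (ℕP.≤-trans (sumℕ-mono-< (λ e → ℕP.*-monoʳ-≤ (β (lookup M'' e)) (lowered≤ z W e)) e₁
              (β-*-< e₁M (ℕP.≤-reflexive (lowered< z W e₁ e₁z (proj₂ (∧-true {lookup M' e₁} (∈-tabulate _ e₁ e₁M)))))))
            (M⁺.maximal M'' M''⊆ c''))
    gain : suc (wℕ (lowered z W) M') ℕ.≤ wℕ W M⁺.best
    gain = gain-at (at? I M'' z)
    total : ∑ (λ e → y e * ℕtoℚ (W e)) ≤ ℕtoℚ (suc (wℕ (lowered z W) M'))
    total = ≤-trans (∑-mono (lowered-pay z W))
      (≤-trans (≡⇒≤ (∑-+ (λ e → y e * ℕtoℚ (lowered z W e)) (λ e → ι (inc I e z) * y e)))
      (≤-trans (+-mono-≤ h (load z))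
        (≡⇒≤ (trans (+-comm (ℕtoℚ (wℕ (lowered z W) M')) 1ℚ) (sym (ℕtoℚ-suc (wℕ (lowered z W) M')))))))

  -- Exchange the optima avoiding the two ends. Together they weigh at least twice the maximum, and
  -- the first new matching weighs at most the maximum, so the second weighs at least the maximum.
  -- It misses both ends and can be extended by the positive edge `e₀`: a contradiction.
  blocked : (W : Fin (m I) → ℕ) (e₀ : Fin (m I)) → lookup H e₀ ≡ true → isPos (W e₀) ≡ true →
            (M⁺ : Maximum I W (positive-part W)) (Mu : Maximum I W (avoiding (end₁ I e₀) W))
            (Mv : Maximum I W (avoiding (end₂ I e₀) W)) →
            wℕ W (Maximum.best M⁺) ℕ.≤ wℕ W (Maximum.best Mu) →
            wℕ W (Maximum.best M⁺) ℕ.≤ wℕ W (Maximum.best Mv) → ⊥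
  blocked W e₀ e₀H e₀W M⁺ Mu Mv hu hv =
    ℕP.<⇒≱ heavier (M⁺.maximal (X.N' [ e₀ ]≔ true) ins (insert-matching I {X.N'} en X.N'-misses-u X.N'-misses-v X.N'-match))
    where
    module M⁺ = Maximum M⁺
    module Mu = Maximum Mu
    module Mv = Maximum Mv
    inH⁺ : ∀ {z} e → lookup (avoiding z W) e ≡ true → lookup (positive-part W) e ≡ true
    inH⁺ {z} e p = tabulate-∈ _ e (proj₁ (∧-true (∈-tabulate (λ e → (lookup H e ∧ isPos (W e)) ∧ not (inc I e z)) e p)))
    inH : ∀ e → lookup (positive-part W) e ≡ true → lookup H e ≡ true
    inH e p = proj₁ (∧-true (∈-tabulate _ e p))
    missing : ∀ z (M : Maximum I W (avoiding z W)) → Misses I (Maximum.best M) z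
    missing z M e p q with proj₂ (∧-true {lookup H e ∧ isPos (W e)} (∈-tabulate _ e (Maximum.inside M e p)))
    ... | r rewrite q with r
    ...   | ()
    ex : Exchanged I Mu.best Mv.best (end₁ I e₀) (end₂ I e₀)
    ex = exchange I lab (size Mv.best) Mu.best Mv.best ℕP.≤-refl Mu.match Mv.match
      (λ e p → crosses e (inH e (inH⁺ {end₁ I e₀} e (Mu.inside e p)))) (λ e p → crosses e (inH e (inH⁺ {end₂ I e₀} e (Mv.inside e p))))
      (end₁ I e₀) (end₂ I e₀) (crosses e₀ e₀H) (missing (end₁ I e₀) Mu) (missing (end₂ I e₀) Mv)
    module X = Exchanged ex
    from-union : ∀ e → (lookup X.N e ≡ true) ⊎ (lookup X.N' e ≡ true) → lookup (positive-part W) e ≡ true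
    from-union e h with X.union e h
    ... | inj₁ p = inH⁺ {end₁ I e₀} e (Mu.inside e p)
    ... | inj₂ p = inH⁺ {end₂ I e₀} e (Mv.inside e p)
    sums : wℕ W X.N ℕ.+ wℕ W X.N' ≡ wℕ W Mu.best ℕ.+ wℕ W Mv.best
    sums = trans (sym (sumℕ-+ (λ e → β (lookup X.N e) ℕ.* W e) (λ e → β (lookup X.N' e) ℕ.* W e)))
      (trans (sumℕ-cong (λ e → trans (sym (ℕP.*-distribʳ-+ (W e) (β (lookup X.N e)) (β (lookup X.N' e))))
         (trans (cong (ℕ._* W e) (X.balance e)) (ℕP.*-distribʳ-+ (W e) (β (lookup Mu.best e)) (β (lookup Mv.best e))))))
      (sumℕ-+ (λ e → β (lookup Mu.best e) ℕ.* W e) (λ e → β (lookup Mv.best e) ℕ.* W e)))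
    μ : ℕ
    μ = wℕ W M⁺.best
    N≤ : wℕ W X.N ℕ.≤ μ
    N≤ = M⁺.maximal X.N (λ e p → from-union e (inj₁ p)) X.N-match
    N'≥ : μ ℕ.≤ wℕ W X.N'
    N'≥ = ℕP.+-cancelˡ-≤ μ _ _ (ℕP.≤-trans (ℕP.+-mono-≤ hu hv) (ℕP.≤-trans (ℕP.≤-reflexive (sym sums)) (ℕP.+-monoˡ-≤ (wℕ W X.N') N≤)))
    en : Ends I e₀ (end₁ I e₀) (end₂ I e₀)
    en = record { at-u = inc₁ I e₀ ; at-b = inc₂ I e₀ ; only = only' }
      where
      only' : ∀ z → inc I e₀ z ≡ true → (z ≡ end₁ I e₀) ⊎ (z ≡ end₂ I e₀)
      only' z q with inc-cases I q
      ... | inj₁ a = inj₁ (sym a)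
      ... | inj₂ a = inj₂ (sym a)
    ins : Sub (X.N' [ e₀ ]≔ true) (positive-part W)
    ins e p with ∈-insert X.N' e₀ e p
    ... | inj₁ refl = tabulate-∈ _ e₀ (cong₂ _∧_ e₀H e₀W)
    ... | inj₂ q    = from-union e (inj₂ q)
    e₀∉N' : lookup X.N' e₀ ≡ false
    e₀∉N' = ¬true⇒false (λ p → X.N'-misses-u e₀ p (inc₁ I e₀))
    heavier : μ ℕ.< wℕ W (X.N' [ e₀ ]≔ true)
    heavier = ℕP.≤-<-trans N'≥ (sumℕ-mono-< (λ e → ℕP.*-monoˡ-≤ (W e) (β-mono (grow e))) e₀
      (β-<-* e₀∉N' (lookup∘update e₀ X.N' true) (isPos-< (W e₀) e₀W)))
      where
      grow : ∀ e → lookup X.N' e ≡ true → lookup (X.N' [ e₀ ]≔ true) e ≡ true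
      grow e p with e ≟ e₀
      ... | yes refl = lookup∘update e X.N' true
      ... | no ¬q = trans (lookup∘update′ ¬q X.N' true) p

  round : (s : ℕ) (W : Fin (m I) → ℕ) → sumℕ W ℕ.≤ s → Rounded W
  round-at : (s : ℕ) (W : Fin (m I) → ℕ) → sumℕ W ℕ.≤ s → Dec (Σ (Fin (m I)) λ e → lookup H e ∧ isPos (W e) ≡ true) → Rounded W
  round s W le = round-at s W le (any? (λ e → (lookup H e ∧ isPos (W e)) Bool.≟ true))

  round-at s W le (no ¬h) = Maximum.best M , Maximum.inside M , Maximum.match M ,
        ≤-trans (≡⇒≤ (∑-zero none)) (0≤ℕtoℚ (wℕ W (Maximum.best M)))
    where
    M : Maximum I W H
    M = maximum I W H
    none : ∀ e → y e * ℕtoℚ (W e) ≡ 0ℚ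
    none e = at (decb (lookup H e)) (W e) refl
      where
      at : (lookup H e ≡ true) ⊎ (lookup H e ≡ false) → ∀ k → W e ≡ k → y e * ℕtoℚ k ≡ 0ℚ
      at (inj₂ q) k       eq = trans (cong (λ z → z * ℕtoℚ k) (y-supp e q)) (*-zeroˡ (ℕtoℚ k))
      at (inj₁ q) zero    eq = *-zeroʳ (y e)
      at (inj₁ q) (suc _) eq = ⊥-elim (¬h (e , cong₂ _∧_ q (cong isPos eq)))
  round-at zero W le (yes (e₀ , h₀)) = ⊥-elim (ℕP.<⇒≱ (sumℕ-mono-< (λ e → lowered≤ (end₁ I e₀) W e) e₀
                  (ℕP.≤-reflexive (lowered< (end₁ I e₀) W e₀ (inc₁ I e₀) (proj₂ (∧-true {lookup H e₀} h₀))))) (ℕP.≤-trans le z≤n))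
  round-at (suc s') W le (yes (e₀ , h₀)) = go (wℕ W (Maximum.best Mu) ℕ.<? wℕ W (Maximum.best M⁺)) (wℕ W (Maximum.best Mv) ℕ.<? wℕ W (Maximum.best M⁺))
    where
    M⁺ : Maximum I W (positive-part W)
    M⁺ = maximum I W (positive-part W)
    Mu : Maximum I W (avoiding (end₁ I e₀) W)
    Mu = maximum I W (avoiding (end₁ I e₀) W)
    Mv : Maximum I W (avoiding (end₂ I e₀) W)
    Mv = maximum I W (avoiding (end₂ I e₀) W)
    smaller : ∀ z → inc I e₀ z ≡ true → sumℕ (lowered z W) ℕ.≤ s'
    smaller z q = ℕP.≤-pred (ℕP.≤-trans (sumℕ-mono-< (lowered≤ z W) e₀
      (ℕP.≤-reflexive (lowered< z W e₀ q (proj₂ (∧-true {lookup H e₀} h₀))))) le)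
    go : Dec (wℕ W (Maximum.best Mu) ℕ.< wℕ W (Maximum.best M⁺)) → Dec (wℕ W (Maximum.best Mv) ℕ.< wℕ W (Maximum.best M⁺)) → Rounded W
    go (yes lt) _ = lower W (end₁ I e₀) M⁺ Mu lt (round s' (lowered (end₁ I e₀) W) (smaller (end₁ I e₀) (inc₁ I e₀)))
    go (no _) (yes lt) = lower W (end₂ I e₀) M⁺ Mv lt (round s' (lowered (end₂ I e₀) W) (smaller (end₂ I e₀) (inc₂ I e₀)))
    go (no a) (no b) = ⊥-elim (blocked W e₀ (proj₁ (∧-true h₀)) (proj₂ (∧-true {lookup H e₀} h₀)) M⁺ Mu Mv (ℕP.≮⇒≥ a) (ℕP.≮⇒≥ b))

  -- Integrality of the bipartite matching polytope, stated for one weight vector. The result for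
  -- integral weights is scaled back by the common denominator.
  rounding : ∑ (λ e → y e * w I e) ≤ mwm I H
  rounding = from (common-denominator (w I) (w-nonneg I))
    where
    from : (Σ ℕ λ d → Σ (Fin (m I) → ℕ) λ W → ∀ e → ℕtoℚ (suc d) * w I e ≡ ℕtoℚ (W e)) →
           ∑ (λ e → y e * w I e) ≤ mwm I H
    from (d , W , eq) = by (round (sumℕ W) W ℕP.≤-refl)
      where
      swap : ∀ a b c → b * (a * c) ≡ a * (b * c)
      swap = solve 3 (λ a b c → b :* (a :* c) := a :* (b :* c)) refl
      scaled : ∑ (λ e → y e * ℕtoℚ (W e)) ≡ ℕtoℚ (suc d) * ∑ (λ e → y e * w I e)
      scaled = trans (∑-cong (λ e → trans (cong (λ z → y e * z) (sym (eq e))) (swap (ℕtoℚ (suc d)) (y e) (w I e))))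
                     (∑-*ˡ (ℕtoℚ (suc d)) (λ e → y e * w I e))
      weighed : ∀ M → ℕtoℚ (suc d) * weight I M ≡ ℕtoℚ (wℕ W M)
      weighed M = trans (cong (λ z → ℕtoℚ (suc d) * z) (weight-∑ I M))
        (trans (sym (∑-*ˡ (ℕtoℚ (suc d)) (λ e → ι (lookup M e) * w I e)))
        (trans (∑-cong (λ e → trans (swap (ι (lookup M e)) (ℕtoℚ (suc d)) (w I e)) (cong (λ z → ι (lookup M e) * z) (eq e))))
        (trans (sym (weight-∑ (reweight I W) M)) (weight-reweight I W M))))
      by : Rounded W → ∑ (λ e → y e * w I e) ≤ mwm I H
      by (M , s , c , h) = *-cancel (ℕtoℚ (suc d)) (0<ℕtoℚ-suc d)
        (≤-trans (≤-resp scaled (sym (weighed M)) h) (*-monoʳ-nn (ℕtoℚ (suc d)) (0≤ℕtoℚ (suc d)) (mwm-≥ I H M s c)))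

-- Linear statistics of a product distribution

lin-update : (c : Fin k → ℚ) (φ : Ω → ℚ) (v : Vec Ω k) (i : Fin k) (x : Ω) →
             ∑ (λ j → c j * φ (lookup (v [ i ]≔ x) j)) ≡ ∑ (λ j → c j * φ (lookup v j)) + c i * (φ x - φ (lookup v i))
lin-update {suc k} c φ (y ∷ v) fz x = lem (c fz) (φ x) (φ y) (∑ (λ j → c (fs j) * φ (lookup v j)))
  where
  lem : ∀ c x y s → c * x + s ≡ c * y + s + c * (x - y)
  lem = solve 4 (λ c x y s → c :* x :+ s := c :* y :+ s :+ c :* (x :- y)) refl
lin-update {suc k} c φ (y ∷ v) (fs i) x =
  trans (cong (λ z → c fz * φ y + z) (lin-update (λ j → c (fs j)) φ v i x))
        (sym (+-assoc (c fz * φ y) (∑ (λ j → c (fs j) * φ (lookup v j))) (c (fs i) * (φ x - φ (lookup v i)))))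

E-coord : (ds : Fin k → D Ω) (i : Fin k) (φ : Ω → ℚ) → E (prod ds) (λ v → φ (lookup v i)) ≡ E (ds i) φ
E-coord ds i φ = trans (resample ds i (λ v → φ (lookup v i)))
  (trans (E-cong (prod ds) (λ v → E-cong (ds i) (λ x → cong φ (lookup∘update i v x)))) (E-const (prod ds) (E (ds i) φ)))

E-bern-ι : ∀ π (p : 0ℚ ≤ π) (q : π ≤ 1ℚ) → E (bern π p q) ι ≡ π
E-bern-ι π p q = lem π
  where
  lem : ∀ π → π * 1ℚ + (1ℚ - π) * 0ℚ ≡ π
  lem = solve 1 (λ π → π :* con 1ℚ :+ (con 1ℚ :- π) :* con 0ℚ := π) refl

-- Discarding the edges at atypical vertices

module Filter (γ κ : ℚ) (0≤γ : 0ℚ ≤ γ) (0≤κ : 0ℚ ≤ κ) (κγ : κ * sq γ ≡ 1ℚ) where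

  -- Indicator of a deviation of absolute value at most `γ`. It is written with squares so that
  -- Chebyshev's bound `good-≥` is immediate, `κ` being the inverse square of `γ`.
  good : ℚ → ℚ
  good x = ι (does (sq x ≤? sq γ))

  good-nn : ∀ x → 0ℚ ≤ good x
  good-nn x = 0≤ι (does (sq x ≤? sq γ))

  good≤1 : ∀ x → good x ≤ 1ℚ
  good≤1 x = ι≤1 (does (sq x ≤? sq γ))

  good-≥ : ∀ x → 1ℚ - κ * sq x ≤ good x
  good-≥ x = go (sq x ≤? sq γ)
    where
    lem₁ : ∀ a → a ≡ 1ℚ - (1ℚ - a)
    lem₁ = solve 1 (λ a → a := con 1ℚ :- (con 1ℚ :- a)) refl
    lem₂ : ∀ a → a - 1ℚ ≡ 0ℚ - (1ℚ - a)
    lem₂ = solve 1 (λ a → a :- con 1ℚ := con 0ℚ :- (con 1ℚ :- a)) refl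
    go : (d : Dec (sq x ≤ sq γ)) → 1ℚ - κ * sq x ≤ ι (does d)
    go (yes _) = by-gap (0≤κ ⊗ 0≤sq x) (lem₁ (κ * sq x))
    go (no ¬p) = by-gap (gap (≤-trans (≡⇒≤ (sym κγ)) (*-monoʳ-nn κ 0≤κ (<⇒≤ (≰⇒> ¬p))))) (lem₂ (κ * sq x))

  good-bound : ∀ m x a → 0ℚ ≤ m → a ≤ m + x → good x * a ≤ m + γ
  good-bound m x a 0≤m h = go (sq x ≤? sq γ)
    where
    go : (d : Dec (sq x ≤ sq γ)) → ι (does d) * a ≤ m + γ
    go (no _) = ≤-trans (≡⇒≤ (*-zeroˡ a)) (0≤m ⊕ 0≤γ)
    go (yes p) = ≤-trans (≡⇒≤ (*-identityˡ a)) (≤-trans h (+-monoʳ-≤ m x≤γ))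
      where
      x≤γ : x ≤ γ
      x≤γ with x ≤? γ
      ... | yes q = q
      ... | no ¬q = ⊥-elim (<-irrefl refl (<-≤-trans γ²<x² p))
        where
        γ<x : γ < x
        γ<x = ≰⇒> ¬q
        γ²<x² : sq γ < sq x
        γ²<x² = ≤-<-trans (*-monoˡ-nn γ 0≤γ (<⇒≤ γ<x)) (*-monoʳ-<-pos x {{Data.Rational.positive (≤-<-trans 0≤γ γ<x)}} γ<x)

  module _ (I : Instance) where

    filtered : (Fin (m I) → ℚ) → (Fin (n I) → ℚ) → Fin (m I) → ℚ
    filtered Y dev e = Y e * (good (dev (end₁ I e)) * good (dev (end₂ I e)))

    filtered-nn : ∀ Y dev → (∀ e → 0ℚ ≤ Y e) → ∀ e → 0ℚ ≤ filtered Y dev e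
    filtered-nn Y dev h e = h e ⊗ good-nn (dev (end₁ I e)) ⊗ good-nn (dev (end₂ I e))

    -- Every edge at `u` carries the factor `good (dev u)`: at an atypical vertex the load vanishes,
    -- at a typical one it exceeds its target by at most `γ`. The bound thus holds for every
    -- outcome, not only with high probability.
    filtered-load : ∀ Y dev (μ : Fin (n I) → ℚ) → (∀ e → 0ℚ ≤ Y e) → (∀ u → 0ℚ ≤ μ u) →
                    (∀ u → ∑ (λ e → ι (inc I e u) * Y e) ≤ μ u + dev u) →
                    ∀ u → ∑ (λ e → ι (inc I e u) * filtered Y dev e) ≤ μ u + γ
    filtered-load Y dev μ 0≤Y 0≤μ h u =
      ≤-trans (∑-mono term) (≤-trans (≡⇒≤ (∑-*ˡ (good (dev u)) (λ e → ι (inc I e u) * Y e)))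
        (good-bound (μ u) (dev u) _ (0≤μ u) (h u)))
      where
      lem₁ : ∀ y a b → 1ℚ * (y * (a * b)) ≡ a * (y * b)
      lem₁ = solve 3 (λ y a b → con 1ℚ :* (y :* (a :* b)) := a :* (y :* b)) refl
      lem₂ : ∀ y a b → 1ℚ * (y * (a * b)) ≡ b * (y * a)
      lem₂ = solve 3 (λ y a b → con 1ℚ :* (y :* (a :* b)) := b :* (y :* a)) refl
      lem₄ : ∀ y z a → 0ℚ * y ≡ a * (0ℚ * z)
      lem₄ = solve 3 (λ y z a → con 0ℚ :* y := a :* (con 0ℚ :* z)) refl
      at : ∀ e → (end₁ I e ≡ u) ⊎ (end₂ I e ≡ u) → 1ℚ * filtered Y dev e ≤ good (dev u) * (1ℚ * Y e)
      at e (inj₁ refl) = ≤-trans (≡⇒≤ (lem₁ (Y e) (good (dev (end₁ I e))) (good (dev (end₂ I e)))))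
        (*-monoʳ-nn (good (dev u)) (good-nn (dev u)) (≤-trans (*≤1 (0≤Y e) (good≤1 (dev (end₂ I e)))) (≡⇒≤ (sym (*-identityˡ (Y e))))))
      at e (inj₂ refl) = ≤-trans (≡⇒≤ (lem₂ (Y e) (good (dev (end₁ I e))) (good (dev (end₂ I e)))))
        (*-monoʳ-nn (good (dev u)) (good-nn (dev u)) (≤-trans (*≤1 (0≤Y e) (good≤1 (dev (end₁ I e)))) (≡⇒≤ (sym (*-identityˡ (Y e))))))
      term : ∀ e → ι (inc I e u) * filtered Y dev e ≤ good (dev u) * (ι (inc I e u) * Y e)
      term e with inc I e u in eq
      ... | false = ≡⇒≤ (lem₄ (filtered Y dev e) (Y e) (good (dev u)))
      ... | true  = at e (inc-cases I eq)

    -- Union bound over the two ends, with Chebyshev at each, kept linear in the squared deviations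
    -- so that expectations can be taken.
    filtered-≥ : ∀ Y dev → (∀ e → 0ℚ ≤ Y e) → ∀ e →
                 Y e - κ * (Y e * sq (dev (end₁ I e)) + Y e * sq (dev (end₂ I e))) ≤ filtered Y dev e
    filtered-≥ Y dev 0≤Y e = ≤-trans (≡⇒≤ (lem (Y e) κ (sq (dev (end₁ I e))) (sq (dev (end₂ I e)))))
      (*-monoʳ-nn (Y e) (0≤Y e) (prod-≥ (κ * sq (dev (end₁ I e))) (κ * sq (dev (end₂ I e))) (good-≥ (dev (end₁ I e))) (good-≥ (dev (end₂ I e)))
          (good≤1 (dev (end₁ I e))) (good≤1 (dev (end₂ I e)))))
      where
      lem : ∀ y k a b → y - k * (y * a + y * b) ≡ y * (1ℚ - k * a - k * b)
      lem = solve 4 (λ y k a b → y :- k :* (y :* a :+ y :* b) := y :* (con 1ℚ :- k :* a :- k :* b)) refl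
      lem₂ : ∀ s t a b → (a - (1ℚ - s)) + (b - (1ℚ - t)) + (1ℚ - a) * (1ℚ - b) ≡ a * b - (1ℚ - s - t)
      lem₂ = solve 4 (λ s t a b → (a :- (con 1ℚ :- s)) :+ (b :- (con 1ℚ :- t)) :+ (con 1ℚ :- a) :* (con 1ℚ :- b) := a :* b :- (con 1ℚ :- s :- t)) refl
      prod-≥ : ∀ s t {a b} → 1ℚ - s ≤ a → 1ℚ - t ≤ b → a ≤ 1ℚ → b ≤ 1ℚ → 1ℚ - s - t ≤ a * b
      prod-≥ s t {a} {b} p q a≤1 b≤1 = by-gap ((gap p ⊕ gap q) ⊕ gap a≤1 ⊗ gap b≤1) (lem₂ s t a b)

    -- Chebyshev: the expected loss is small once Y e · dev² is small on average.
    E-filtered : {Ω : Set} (d : D Ω) (Y : Ω → Fin (m I) → ℚ) (dev : Ω → Fin (n I) → ℚ) →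
                 (∀ ω e → 0ℚ ≤ Y ω e) → ∀ e (a v : ℚ) → a ≤ E d (λ ω → Y ω e) →
                 (∀ u → inc I e u ≡ true → E d (λ ω → Y ω e * sq (dev ω u)) ≤ v) →
                 a - κ * (v + v) ≤ E d (λ ω → filtered (Y ω) (dev ω) e)
    E-filtered d Y dev 0≤Y e a v ha hv =
      ≤-trans (by-gap (gap ha ⊕ 0≤κ ⊗ (gap (hv (end₁ I e) (inc₁ I e)) ⊕ gap (hv (end₂ I e) (inc₂ I e))))
                 (lem a κ v (E d (λ ω → Y ω e)) (E d (λ ω → Y ω e * sq (dev ω (end₁ I e)))) (E d (λ ω → Y ω e * sq (dev ω (end₂ I e))))))
      (≤-trans (≡⇒≤ (sym expand)) (E-mono d (λ ω → filtered-≥ (Y ω) (dev ω) (0≤Y ω) e)))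
      where
      lem : ∀ a k v y s t → (y - a) + k * ((v - s) + (v - t)) ≡ y - k * (s + t) - (a - k * (v + v))
      lem = solve 6 (λ a k v y s t → (y :- a) :+ k :* ((v :- s) :+ (v :- t)) := y :- k :* (s :+ t) :- (a :- k :* (v :+ v))) refl
      expand : E d (λ ω → Y ω e - κ * (Y ω e * sq (dev ω (end₁ I e)) + Y ω e * sq (dev ω (end₂ I e)))) ≡
               E d (λ ω → Y ω e) - κ * (E d (λ ω → Y ω e * sq (dev ω (end₁ I e))) + E d (λ ω → Y ω e * sq (dev ω (end₂ I e))))
      expand = trans (E-- d (λ ω → Y ω e) (λ ω → κ * (Y ω e * sq (dev ω (end₁ I e)) + Y ω e * sq (dev ω (end₂ I e)))))
        (cong (λ z → E d (λ ω → Y ω e) - z)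
          (trans (E-*ˡ d κ (λ ω → Y ω e * sq (dev ω (end₁ I e)) + Y ω e * sq (dev ω (end₂ I e))))
            (cong (λ z → κ * z) (E-+ d (λ ω → Y ω e * sq (dev ω (end₁ I e))) (λ ω → Y ω e * sq (dev ω (end₂ I e)))))))

-- Independent sampling of edges

module Sampling (π : Fin k → ℚ) (π₀ : ∀ e → 0ℚ ≤ π e) (π₁ : ∀ e → π e ≤ 1ℚ) where

  sample : D (Vec Bool k)
  sample = prod (λ e → bern (π e) (π₀ e) (π₁ e))

  E-ι : ∀ e → E sample (λ B → ι (lookup B e)) ≡ π e
  E-ι e = trans (E-coord (λ e → bern (π e) (π₀ e) (π₁ e)) e ι) (E-bern-ι (π e) (π₀ e) (π₁ e))

  E-linear : (c : Fin k → ℚ) → E sample (λ B → ∑ (λ e → c e * ι (lookup B e))) ≡ ∑ (λ e → c e * π e)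
  E-linear c = trans (E-∑ sample (λ e B → c e * ι (lookup B e)))
    (∑-cong (λ e → trans (E-*ˡ sample (c e) (λ B → ι (lookup B e))) (cong (λ z → c e * z) (E-ι e))))

  -- Conditioning on a coin: restricting to the samples that contain `e` amounts to a factor `π e`
  -- and to forcing `e` into the sample.
  E-given : ∀ e (f : Vec Bool k → ℚ) → E sample (λ B → ι (lookup B e) * f B) ≡ π e * E sample (λ B → f (B [ e ]≔ true))
  E-given e f = trans (resample (λ e → bern (π e) (π₀ e) (π₁ e)) e (λ B → ι (lookup B e) * f B))
    (trans (E-cong sample (λ B → trans
        (cong₂ (λ a b → π e * (ι a * f (B [ e ]≔ true)) + (1ℚ - π e) * (ι b * f (B [ e ]≔ false)))
          (lookup∘update e B true) (lookup∘update e B false))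
        (lem (π e) (f (B [ e ]≔ true)) (f (B [ e ]≔ false)))))
    (E-*ˡ sample (π e) (λ B → f (B [ e ]≔ true))))
    where
    lem : ∀ p a b → p * (1ℚ * a) + (1ℚ - p) * (0ℚ * b) ≡ p * a
    lem = solve 3 (λ p a b → p :* (con 1ℚ :* a) :+ (con 1ℚ :- p) :* (con 0ℚ :* b) := p :* a) refl

  module _ (c : Fin k → ℚ) (δ : ℚ) (0≤c : ∀ e → 0ℚ ≤ c e) (c≤δ : ∀ e → c e ≤ δ) where

    stat : Vec Bool k → ℚ
    stat B = ∑ (λ e → c e * ι (lookup B e))

    mean : ℚ
    mean = ∑ (λ e → c e * π e)

    forced : Fin k → Vec Bool k → ℚ
    forced e B = stat (B [ e ]≔ true)

    forced-eq : ∀ e B → forced e B ≡ stat B + c e * (1ℚ - ι (lookup B e))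
    forced-eq e B = lin-update c ι B e true

    forced-≥ : ∀ e B → stat B ≤ forced e B
    forced-≥ e B = by-gap (0≤c e ⊗ gap (ι≤1 (lookup B e))) (trans (lem (stat B) (c e * (1ℚ - ι (lookup B e)))) (cong (λ z → z - stat B) (sym (forced-eq e B))))
      where
      lem : ∀ a b → b ≡ a + b - a
      lem = solve 2 (λ a b → b := a :+ b :- a) refl

    forced-≤ : ∀ e B → forced e B ≤ stat B + δ
    forced-≤ e B = ≤-trans (≡⇒≤ (forced-eq e B)) (+-monoʳ-≤ (stat B)
      (≤-trans (*≤1 (0≤c e) (by-gap (0≤ι (lookup B e)) (lem (ι (lookup B e))))) (c≤δ e)))
      where
      lem : ∀ a → a ≡ 1ℚ - (1ℚ - a)
      lem = solve 1 (λ a → a := con 1ℚ :- (con 1ℚ :- a)) refl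

    forced-change : ∀ e B i → sq (forced e B - forced e (B [ i ]≔ false)) ≤ δ * (c i * ι (lookup B i))
    forced-change e B i = ≤-trans (≡⇒≤ (cong sq diff)) (bound i (lookup B i))
      where
      0≤δ : 0ℚ ≤ δ
      0≤δ = ≤-trans (0≤c e) (c≤δ e)
      t : ℚ
      t = if does (i ≟ e) then 0ℚ else c i * ι (lookup B i)
      diff : forced e B - forced e (B [ i ]≔ false) ≡ t
      diff with i ≟ e
      ... | yes refl = trans (cong (λ z → stat (B [ i ]≔ true) - stat z) (update-twice B i)) (lem (stat (B [ i ]≔ true)))
        where
        lem : ∀ a → a - a ≡ 0ℚ
        lem = solve 1 (λ a → a :- a := con 0ℚ) refl
        update-twice : ∀ {k} (B : Vec Bool k) i → (B [ i ]≔ false) [ i ]≔ true ≡ B [ i ]≔ true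
        update-twice (x ∷ B) fz     = refl
        update-twice (x ∷ B) (fs i) = cong (x ∷_) (update-twice B i)
      ... | no ¬p = trans (cong₂ _-_ (forced-eq e B) (forced-eq e (B [ i ]≔ false)))
          (trans (cong₂ (λ a b → stat B + c e * (1ℚ - ι (lookup B e)) - (a + c e * (1ℚ - ι b)))
              (lin-update c ι B i false) (lookup∘update′ (≢-sym ¬p) B false))
            (lem (stat B) (c e) (ι (lookup B e)) (c i) (ι (lookup B i))))
        where
        lem : ∀ s c x d y → s + c * (1ℚ - x) - (s + d * (0ℚ - y) + c * (1ℚ - x)) ≡ d * y
        lem = solve 5 (λ s c x d y → s :+ c :* (con 1ℚ :- x) :- (s :+ d :* (con 0ℚ :- y) :+ c :* (con 1ℚ :- x)) := d :* y) refl
      bound : ∀ i b → sq (if does (i ≟ e) then 0ℚ else c i * ι b) ≤ δ * (c i * ι b)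
      bound i b with i ≟ e
      ... | yes _ = 0≤δ ⊗ 0≤c i ⊗ 0≤ι b
      ... | no _  = *-monoˡ-nn (c i * ι b) (0≤c i ⊗ 0≤ι b) (≤-trans (*≤1 (0≤c i) (ι≤1 b)) (c≤δ i))

    -- Given that `e` is sampled, the statistic is `forced e`. Its variance is at most `δ` times the
    -- mean, since by Efron-Stein an edge `i` is charged at most the square of `c i`, and only when
    -- present. Forcing `e` moves the mean by at most `δ`, which gives the second term.
    sampled-deviation : ∀ e → E sample (λ B → ι (lookup B e) * sq (stat B - mean)) ≤ π e * (δ * mean + δ * δ)
    sampled-deviation e = ≤-trans (≡⇒≤ (E-given e (λ B → sq (stat B - mean))))
      (*-monoʳ-nn (π e) (π₀ e) (≤-trans (≡⇒≤ (E-sq-shift sample (forced e) mean)) (+-mono-≤ variance bias)))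
      where
      variance : Var sample (forced e) ≤ δ * mean
      variance = ≤-trans (efron-stein (λ e → bern (π e) (π₀ e) (π₁ e)) (λ _ → false) (forced e))
        (≤-trans (∑-mono (λ i → E-mono sample (λ B → forced-change e B i)))
        (≡⇒≤ (trans (∑-cong (λ i → trans (E-*ˡ sample δ (λ B → c i * ι (lookup B i)))
            (cong (λ z → δ * z) (trans (E-*ˡ sample (c i) (λ B → ι (lookup B i))) (cong (λ z → c i * z) (E-ι i))))))
          (∑-*ˡ δ (λ i → c i * π i)))))
      lo : mean ≤ E sample (forced e)
      lo = ≤-resp (E-linear c) refl (E-mono sample (forced-≥ e))
      hi : E sample (forced e) ≤ mean + δ
      hi = ≤-resp refl (trans (E-+ sample stat (λ _ → δ)) (cong₂ _+_ (E-linear c) (E-const sample δ))) (E-mono sample (forced-≤ e))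
      bias : sq (E sample (forced e) - mean) ≤ δ * δ
      bias = *-mono-nn (gap lo) d≤ (gap lo) d≤
        where
        lem : ∀ x y d → x + d - y ≡ d - (y - x)
        lem = solve 3 (λ x y d → x :+ d :- y := d :- (y :- x)) refl
        d≤ : E sample (forced e) - mean ≤ δ
        d≤ = by-gap (gap hi) (lem mean (E sample (forced e)) δ)

    sampled-mean : ∀ e → E sample (λ B → ι (lookup B e) * stat B) ≤ π e * (mean + δ)
    sampled-mean e = ≤-trans (≡⇒≤ (E-given e stat)) (*-monoʳ-nn (π e) (π₀ e)
      (≤-resp refl (trans (E-+ sample stat (λ _ → δ)) (cong₂ _+_ (E-linear c) (E-const sample δ))) (E-mono sample (forced-≤ e))))

sq-≤ : ∀ {x s} → 0ℚ ≤ s - x → 0ℚ ≤ s + x → sq x ≤ sq s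
sq-≤ {x} {s} p q = by-gap (p ⊗ q) (lem x s)
  where
  lem : ∀ x s → (s - x) * (s + x) ≡ s * s - x * x
  lem = solve 2 (λ x s → (s :- x) :* (s :+ x) := s :* s :- x :* x) refl

ι-not : ∀ b → ι (not b) ≡ 1ℚ - ι b
ι-not true  = refl
ι-not false = refl

-- Statistics of vertex variables seen from a vertex u

module Neighbourhood (I : Instance) where

  -- The value of `f` at the other end of `e` as seen from `u`; it is 0 when `u` is not an end of
  -- `e`.
  across : Fin (m I) → Fin (n I) → (Fin (n I) → ℚ) → ℚ
  across e u f = ι (end₁ I e == u) * f (end₂ I e) + ι (end₂ I e == u) * f (end₁ I e)

  view : (Fin (m I) → ℚ) → (Fin (n I) → ℚ) → Fin (n I) → ℚ
  view a X u = ∑ (λ e → a e * across e u X)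

  coeff : (Fin (m I) → ℚ) → Fin (n I) → Fin (n I) → ℚ
  coeff a u z = ∑ (λ e → a e * across e u (λ t → ι (t == z)))

  across-1 : ∀ e u → across e u (λ _ → 1ℚ) ≡ ι (inc I e u)
  across-1 e u with decb (end₁ I e == u) | decb (end₂ I e == u)
  ... | inj₁ a | inj₁ b = ⊥-elim (loopless I e (trans (==-true a) (sym (==-true b))))
  ... | inj₁ a | inj₂ b rewrite a | b = refl
  ... | inj₂ a | inj₁ b rewrite a | b = refl
  ... | inj₂ a | inj₂ b rewrite a | b = refl

  across-nn : ∀ e u f → (∀ z → 0ℚ ≤ f z) → 0ℚ ≤ across e u f
  across-nn e u f h = 0≤ι (end₁ I e == u) ⊗ h (end₂ I e) ⊕ 0≤ι (end₂ I e == u) ⊗ h (end₁ I e)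

  across-∑ : ∀ e u f → ∑ (λ z → across e u (λ t → ι (t == z)) * f z) ≡ across e u f
  across-∑ e u f = trans (∑-cong (λ z → lem (ι (end₁ I e == u)) (ι (end₂ I e == z)) (ι (end₂ I e == u)) (ι (end₁ I e == z)) (f z)))
    (trans (∑-+ (λ z → ι (end₁ I e == u) * (ι (end₂ I e == z) * f z)) (λ z → ι (end₂ I e == u) * (ι (end₁ I e == z) * f z)))
    (cong₂ _+_
      (trans (∑-*ˡ (ι (end₁ I e == u)) (λ z → ι (end₂ I e == z) * f z)) (cong (λ z → ι (end₁ I e == u) * z) (∑-== (end₂ I e) f)))
      (trans (∑-*ˡ (ι (end₂ I e == u)) (λ z → ι (end₁ I e == z) * f z)) (cong (λ z → ι (end₂ I e == u) * z) (∑-== (end₁ I e) f)))))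
    where
    lem : ∀ a b c d f → (a * b + c * d) * f ≡ a * (b * f) + c * (d * f)
    lem = solve 5 (λ a b c d f → (a :* b :+ c :* d) :* f := a :* (b :* f) :+ c :* (d :* f)) refl

  view-coeff : ∀ a f u → view a f u ≡ ∑ (λ z → coeff a u z * f z)
  view-coeff a f u = sym (trans (∑-cong (λ z → sym (∑-*ʳ (f z) (λ e → a e * across e u (λ t → ι (t == z))))))
    (trans (∑-swap (λ z e → a e * across e u (λ t → ι (t == z)) * f z))
    (∑-cong (λ e → trans (∑-cong (λ z → *-assoc (a e) (across e u (λ t → ι (t == z))) (f z)))
      (trans (∑-*ˡ (a e) (λ z → across e u (λ t → ι (t == z)) * f z)) (cong (λ z → a e * z) (across-∑ e u f)))))))

  degree-of : (Fin (m I) → ℚ) → Fin (n I) → ℚ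
  degree-of a u = ∑ (λ e → ι (inc I e u) * a e)

  view-1 : ∀ a u → view a (λ _ → 1ℚ) u ≡ degree-of a u
  view-1 a u = ∑-cong (λ e → trans (cong (λ z → a e * z) (across-1 e u)) (*-comm (a e) (ι (inc I e u))))

  ∑-coeff : ∀ a u → ∑ (coeff a u) ≡ degree-of a u
  ∑-coeff a u = trans (∑-cong (λ z → sym (*-identityʳ (coeff a u z)))) (trans (sym (view-coeff a (λ _ → 1ℚ) u)) (view-1 a u))

  coeff-nn : ∀ a → (∀ e → 0ℚ ≤ a e) → ∀ u z → 0ℚ ≤ coeff a u z
  coeff-nn a h u z = ∑-nn (λ e → h e ⊗ across-nn e u _ (λ t → 0≤ι (t == z)))

  -- Two vertices are joined by at most one edge, so collecting the terms of `view` by the far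
  -- vertex yields coefficients no larger than a single edge value. This transfers variance bounds
  -- from vertex variables to edge sums.
  coeff≤ : ∀ a δ → 0ℚ ≤ δ → (∀ e → 0ℚ ≤ a e) → (∀ e → a e ≤ δ) → ∀ u z → coeff a u z ≤ δ
  coeff≤ a δ 0≤δ 0≤a a≤δ u z with u ≟ z
  ... | yes refl = ≤-trans (≡⇒≤ (∑-zero (λ e → trans (cong (λ x → a e * x) (none e)) (*-zeroʳ (a e))))) 0≤δ
    where
    none : ∀ e → across e u (λ t → ι (t == u)) ≡ 0ℚ
    none e with decb (end₁ I e == u) | decb (end₂ I e == u)
    ... | inj₁ p | inj₁ q = ⊥-elim (loopless I e (trans (==-true p) (sym (==-true q))))
    ... | inj₁ p | inj₂ q rewrite p | q = refl
    ... | inj₂ p | inj₁ q rewrite p | q = refl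
    ... | inj₂ p | inj₂ q rewrite p | q = refl
  ... | no u≢z = ≤-trans (∑-mono term)
      (∑-unique (λ e → inc I e u ∧ inc I e z) a δ 0≤δ (λ e _ → a≤δ e)
        (λ e f p q → inc-unique I u≢z (proj₁ (∧-true p)) (proj₂ (∧-true {inc I e u} p)) (proj₁ (∧-true q)) (proj₂ (∧-true {inc I f u} q))))
    where
    across≤ : ∀ e → across e u (λ t → ι (t == z)) ≤ ι (inc I e u ∧ inc I e z)
    across≤ e with decb (end₁ I e == u) | decb (end₂ I e == u)
    ... | inj₁ p | inj₁ q = ⊥-elim (loopless I e (trans (==-true p) (sym (==-true q))))
    ... | inj₁ p | inj₂ q rewrite p | q =
      ≤-trans (≡⇒≤ (lem (ι (end₂ I e == z)) (ι (end₁ I e == z)))) (ι-mono {end₂ I e == z} {(end₁ I e == z) ∨ (end₂ I e == z)} (λ r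
          → trans (cong ((end₁ I e == z) ∨_) r) (∨T (end₁ I e == z))))
      where
      lem : ∀ a b → 1ℚ * a + 0ℚ * b ≡ a
      lem = solve 2 (λ a b → con 1ℚ :* a :+ con 0ℚ :* b := a) refl
      ∨T : ∀ b → b ∨ true ≡ true
      ∨T true = refl
      ∨T false = refl
    ... | inj₂ p | inj₁ q rewrite p | q =
      ≤-trans (≡⇒≤ (lem (ι (end₂ I e == z)) (ι (end₁ I e == z)))) (ι-mono {end₁ I e == z} {(end₁ I e == z) ∨ (end₂ I e == z)} (λ r
          → cong (_∨ (end₂ I e == z)) r))
      where
      lem : ∀ a b → 0ℚ * a + 1ℚ * b ≡ b
      lem = solve 2 (λ a b → con 0ℚ :* a :+ con 1ℚ :* b := b) refl
    ... | inj₂ p | inj₂ q rewrite p | q = ≡⇒≤ (lem (ι (end₂ I e == z)) (ι (end₁ I e == z)))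
      where
      lem : ∀ a b → 0ℚ * a + 0ℚ * b ≡ 0ℚ
      lem = solve 2 (λ a b → con 0ℚ :* a :+ con 0ℚ :* b := con 0ℚ) refl
    term : ∀ e → a e * across e u (λ t → ι (t == z)) ≤ ι (inc I e u ∧ inc I e z) * a e
    term e = ≤-trans (*-monoʳ-nn (a e) (0≤a e) (across≤ e)) (≡⇒≤ (*-comm (a e) (ι (inc I e u ∧ inc I e z))))

  E-view : (d : D Ω) (a : Fin (m I) → ℚ) (X : Ω → Fin (n I) → ℚ) (u : Fin (n I)) →
           E d (λ ω → view a (X ω) u) ≡ view a (λ z → E d (λ ω → X ω z)) u
  E-view d a X u = trans (E-∑ d (λ e ω → a e * across e u (X ω))) (∑-cong (λ e → trans (E-*ˡ d (a e) (λ ω → across e u (X ω)))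
    (cong (λ z → a e * z) (trans (E-+ d (λ ω → ι (end₁ I e == u) * X ω (end₂ I e)) (λ ω → ι (end₂ I e == u) * X ω (end₁ I e)))
      (cong₂ _+_ (E-*ˡ d (ι (end₁ I e == u)) (λ ω → X ω (end₂ I e))) (E-*ˡ d (ι (end₂ I e == u)) (λ ω → X ω (end₁ I e))))))))

  -- What concentration asks of a family of random vertex variables: linear statistics with small
  -- coefficients vary, up to the factor `c`, as if the variables were independent. It is proved for
  -- the random sides and for the vertices left free by the proposals.
  Spread : D Ω → (Ω → Fin (n I) → ℚ) → ℚ → Set
  Spread d X c = ∀ b δ → 0ℚ ≤ δ → (∀ z → 0ℚ ≤ b z) → (∀ z → b z ≤ δ) → Var d (λ ω → ∑ (λ z → b z * X ω z)) ≤ c * (δ * ∑ b)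

  Var-cong : (d : D Ω) {f g : Ω → ℚ} → (∀ ω → f ω ≡ g ω) → Var d f ≡ Var d g
  Var-cong d h = cong₂ (λ a b → a - sq b) (E-cong d (λ ω → cong sq (h ω))) (E-cong d h)

  Var-view : (d : D Ω) (X : Ω → Fin (n I) → ℚ) (c : ℚ) → Spread d X c → ∀ a δ → 0ℚ ≤ δ → (∀ e → 0ℚ ≤ a e) → (∀ e → a e ≤ δ) →
             ∀ u → Var d (λ ω → view a (X ω) u) ≤ c * (δ * degree-of a u)
  Var-view d X c sp a δ 0≤δ 0≤a a≤δ u =
    ≤-resp (Var-cong d (λ ω → sym (view-coeff a (X ω) u))) (cong (λ z → c * (δ * z)) (∑-coeff a u))
      (sp (coeff a u) δ 0≤δ (coeff-nn a 0≤a u) (coeff≤ a δ 0≤δ 0≤a a≤δ u))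

-- Random bipartitions in which the edges of a given matching cross

module Bipartition (I : Instance) (K : EdgeSet (m I)) (K-match : IsMatching I K) where

  open Neighbourhood I

  Second : Fin (n I) → Fin (m I) → Set
  Second z f = (lookup K f ≡ true) × (end₂ I f ≡ z)

  second? : ∀ z → (Σ (Fin (m I)) (Second z)) ⊎ (∀ f → lookup K f ≡ true → end₂ I f ≢ z)
  second? z with any? (λ f → (lookup K f ∧ (end₂ I f == z)) Bool.≟ true)
  ... | yes (f , h) = inj₁ (f , proj₁ (∧-true h) , ==-true (proj₂ (∧-true {lookup K f} h)))
  ... | no ¬h = inj₂ (λ f p q → ¬h (f , cong₂ _∧_ p (trans (cong (_== z) q) (==-refl z))))

  -- The ends of an edge of `K` share one coin: the second end uses the coin of the first with the
  -- outcome reversed. A vertex that is not a second end uses its own.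
  rep : Fin (n I) → Fin (n I)
  rep z with second? z
  ... | inj₁ (f , _) = end₁ I f
  ... | inj₂ _       = z

  flipped : Fin (n I) → Bool
  flipped z with second? z
  ... | inj₁ _ = true
  ... | inj₂ _ = false

  flipped-rep : ∀ z → flipped z ≡ true → Σ (Fin (m I)) λ f → Second z f × (end₁ I f ≡ rep z)
  flipped-rep z h with second? z | h
  ... | inj₁ (f , s) | _ = f , s , refl
  ... | inj₂ _ | ()

  unflipped-rep : ∀ z → flipped z ≡ false → rep z ≡ z
  unflipped-rep z h with second? z | h
  ... | inj₁ _ | ()
  ... | inj₂ _ | _ = refl

  unflipped : ∀ z → flipped z ≡ false → ∀ f → lookup K f ≡ true → end₂ I f ≢ z
  unflipped z h with second? z | h
  ... | inj₁ _ | ()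
  ... | inj₂ s | _ = s

  side : Vec Bool (n I) → Fin (n I) → Bool
  side ω z = lookup ω (rep z) xor flipped z

  K-crosses : ∀ ω f → lookup K f ≡ true → side ω (end₁ I f) ≢ side ω (end₂ I f)
  K-crosses ω f fK eq with decb (flipped (end₁ I f)) | decb (flipped (end₂ I f))
  ... | inj₁ a | _ with flipped-rep (end₁ I f) a
  ...   | g , (gK , p) , _ with K-match f g (end₁ I f) fK gK (inc₁ I f) (subst (λ z → inc I g z ≡ true) p (inc₂ I g))
  ...     | refl = loopless I f (sym p)
  K-crosses ω f fK eq | inj₂ a | inj₂ b = unflipped (end₂ I f) b f fK refl
  K-crosses ω f fK eq | inj₂ a | inj₁ b with flipped-rep (end₂ I f) b
  ...   | g , (gK , p) , q with K-match f g (end₂ I f) fK gK (inc₂ I f) (subst (λ z → inc I g z ≡ true) p (inc₂ I g))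
  ...     | refl = contra (lookup ω (end₁ I f)) (trans (sym (cong₂ (λ r c → lookup ω r xor c) (unflipped-rep (end₁ I f) a) a))
                     (trans eq (cong₂ (λ r c → lookup ω r xor c) (sym q) b)))
    where
    contra : ∀ x → x xor false ≡ x xor true → ⊥
    contra true ()
    contra false ()

  -- Outside `K` the two ends depend on different coins, so such an edge crosses with probability
  -- exactly one half. Equal coins would make the edge a loop or parallel to an edge of `K`.
  rep-injective : ∀ {e} → lookup K e ≡ false → rep (end₁ I e) ≢ rep (end₂ I e)
  rep-injective {e} e∉K eq with decb (flipped (end₁ I e)) | decb (flipped (end₂ I e))
  ... | inj₂ a | inj₂ b = loopless I e (trans (sym (unflipped-rep (end₁ I e) a)) (trans eq (unflipped-rep (end₂ I e) b)))
  ... | inj₂ a | inj₁ b with flipped-rep (end₂ I e) b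
  ...   | f , (fK , p) , q = true≢false (subst (λ g → lookup K g ≡ true) f≡e fK) e∉K
    where
    f≡e : f ≡ e
    f≡e = noParallel I f e (inj₁ (trans q (trans (sym eq) (unflipped-rep (end₁ I e) a)) , p))
  rep-injective {e} e∉K eq | inj₁ a | inj₂ b with flipped-rep (end₁ I e) a
  ...   | f , (fK , p) , q = true≢false (subst (λ g → lookup K g ≡ true) f≡e fK) e∉K
    where
    f≡e : f ≡ e
    f≡e = noParallel I f e (inj₂ (trans q (trans eq (unflipped-rep (end₂ I e) b)) , p))
  rep-injective {e} e∉K eq | inj₁ a | inj₁ b with flipped-rep (end₁ I e) a | flipped-rep (end₂ I e) b
  ...   | f , (fK , p) , q | g , (gK , r) , s with K-match f g (rep (end₁ I e)) fK gK
            (subst (λ z → inc I f z ≡ true) q (inc₁ I f)) (subst (λ z → inc I g z ≡ true) (trans s (sym eq)) (inc₁ I g))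
  ...     | refl = loopless I e (trans (sym p) r)

  ½≤1 : ½ ≤ 1ℚ
  ½≤1 = by-gap 0≤½ refl

  open Sampling {n I} (λ _ → ½) (λ _ → 0≤½) (λ _ → ½≤1) public renaming (sample to sides)

  E-half : ∀ i (f : Vec Bool (n I) → ℚ) → (∀ ω → f (ω [ i ]≔ true) + f (ω [ i ]≔ false) ≡ 1ℚ) → E sides f ≡ ½
  E-half i f h = trans (resample (λ _ → bern ½ 0≤½ ½≤1) i f)
    (trans (E-cong sides (λ ω → trans (lem (f (ω [ i ]≔ true)) (f (ω [ i ]≔ false))) (cong (λ z → ½ * z) (h ω)))) (E-const sides ½))
    where
    lem : ∀ a b → ½ * a + (1ℚ - ½) * b ≡ ½ * (a + b)
    lem = solve 2 (λ a b → con ½ :* a :+ con ½ :* b := con ½ :* (a :+ b)) refl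

  X : Vec Bool (n I) → Fin (n I) → ℚ
  X ω z = ι (side ω z)

  side-at : ∀ ω z b → side (ω [ rep z ]≔ b) z ≡ b xor flipped z
  side-at ω z b = cong (_xor flipped z) (lookup∘update (rep z) ω b)

  side-off : ∀ ω z i b → rep z ≢ i → side (ω [ i ]≔ b) z ≡ side ω z
  side-off ω z i b h = cong (_xor flipped z) (lookup∘update′ h ω b)

  E-X : ∀ z → E sides (λ ω → X ω z) ≡ ½
  E-X z = E-half (rep z) (λ ω → X ω z) (λ ω → trans (cong₂ (λ a b → ι a + ι b) (side-at ω z true) (side-at ω z false)) (both (flipped z)))
    where
    both : ∀ b → ι (true xor b) + ι (false xor b) ≡ 1ℚ
    both true  = refl
    both false = refl

  cross : Vec Bool (n I) → Fin (m I) → ℚ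
  cross ω e = ι (side ω (end₁ I e) xor side ω (end₂ I e))

  E-cross : ∀ e → lookup K e ≡ false → E sides (λ ω → cross ω e) ≡ ½
  E-cross e e∉K = E-half (rep (end₁ I e)) (λ ω → cross ω e) (λ ω → trans
    (cong₂ _+_
      (cong₂ (λ a b → ι (a xor b)) (side-at ω (end₁ I e) true) (side-off ω (end₂ I e) (rep (end₁ I e)) true (≢-sym (rep-injective e∉K))))
      (cong₂ (λ a b → ι (a xor b)) (side-at ω (end₁ I e) false) (side-off ω (end₂ I e) (rep (end₁ I e)) false (≢-sym (rep-injective e∉K)))))
    (both (flipped (end₁ I e)) (side ω (end₂ I e))))
    where
    both : ∀ b c → ι ((true xor b) xor c) + ι ((false xor b) xor c) ≡ 1ℚ
    both true  true  = refl
    both true  false = refl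
    both false true  = refl
    both false false = refl

  -- A coin drives at most two vertices, its own and the one matched to it, so its influence `s i`
  -- is at most `2 δ`; the influences add up to the sum of `b`. Hence the constant 2.
  sides-spread : Spread sides X (ℤ.+ 2 / 1)
  sides-spread b δ 0≤δ 0≤b b≤δ = ≤-trans (efron-stein (λ _ → bern ½ 0≤½ ½≤1) (λ _ → false) f)
    (≤-trans (∑-mono (λ i → E-≤ sides (two * δ * s i) (λ ω → ≤-trans (change i ω) (*-monoˡ-nn (s i) (0≤s i) (s≤ i)))))
    (≡⇒≤ (trans (∑-*ˡ (two * δ) s) (trans (cong (λ z → two * δ * z) total) (*-assoc two δ (∑ b))))))
    where
    two : ℚ
    two = ℤ.+ 2 / 1
    f : Vec Bool (n I) → ℚ
    f ω = ∑ (λ z → b z * X ω z)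
    s : Fin (n I) → ℚ
    s i = ∑ (λ z → b z * ι (rep z == i))
    0≤s : ∀ i → 0ℚ ≤ s i
    0≤s i = ∑-nn (λ z → 0≤b z ⊗ 0≤ι (rep z == i))
    total : ∑ s ≡ ∑ b
    total = trans (∑-swap (λ i z → b z * ι (rep z == i))) (∑-cong (λ z → trans (∑-*ˡ (b z) (λ i → ι (rep z == i)))
      (trans (cong (λ x → b z * x) (trans (∑-cong (λ i → sym (*-identityʳ (ι (rep z == i))))) (∑-== (rep z) (λ _ → 1ℚ)))) (*-identityʳ (b z)))))
    s≤ : ∀ i → s i ≤ two * δ
    s≤ i = ≤-trans (∑-mono term) (≤-trans (≡⇒≤ (∑-+ (λ z → ι (z == i) * b z) (λ z → ι (flipped z ∧ (rep z == i)) * b z)))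
      (≤-trans (+-mono-≤
        (∑-unique (λ z → z == i) b δ 0≤δ (λ z _ → b≤δ z) (λ z z' p q → trans (==-true p) (sym (==-true q))))
        (∑-unique (λ z → flipped z ∧ (rep z == i)) b δ 0≤δ (λ z _ → b≤δ z) uniq))
      (≡⇒≤ (lem δ))))
      where
      lem : ∀ a → a + a ≡ two * a
      lem = solve 1 (λ a → a :+ a := con two :* a) refl
      uniq : ∀ z z' → flipped z ∧ (rep z == i) ≡ true → flipped z' ∧ (rep z' == i) ≡ true → z ≡ z'
      uniq z z' p q with ∧-true p | ∧-true q
      ... | p₁ , p₂ | q₁ , q₂ with flipped-rep z p₁ | flipped-rep z' q₁
      ...   | f , (fK , a) , c | g , (gK , a') , c' with K-match f g i fK gK
              (subst (λ t → inc I f t ≡ true) (trans c (==-true p₂)) (inc₁ I f))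
              (subst (λ t → inc I g t ≡ true) (trans c' (==-true q₂)) (inc₁ I g))
      ...     | refl = trans (sym a) a'
      split : ∀ z → ι (rep z == i) ≤ ι (z == i) + ι (flipped z ∧ (rep z == i))
      split z with decb (flipped z)
      ... | inj₁ h rewrite h = by-gap (0≤ι (z == i)) (lem' (ι (rep z == i)) (ι (z == i)))
        where
        lem' : ∀ a b → b ≡ b + a - a
        lem' = solve 2 (λ a b → b := b :+ a :- a) refl
      ... | inj₂ h rewrite h | unflipped-rep z h = ≡⇒≤ (sym (+-identityʳ (ι (z == i))))
      term : ∀ z → b z * ι (rep z == i) ≤ ι (z == i) * b z + ι (flipped z ∧ (rep z == i)) * b z
      term z = ≤-trans (*-monoʳ-nn (b z) (0≤b z) (split z)) (≡⇒≤ (lem' (b z) (ι (z == i)) (ι (flipped z ∧ (rep z == i)))))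
        where
        lem' : ∀ b x y → b * (x + y) ≡ x * b + y * b
        lem' = solve 3 (λ b x y → b :* (x :+ y) := x :* b :+ y :* b) refl
    change : ∀ i ω → sq (f ω - f (ω [ i ]≔ false)) ≤ s i * s i
    change i ω = sq-≤ {f ω - f (ω [ i ]≔ false)} {s i} (≤-resp refl (eq₁ (s i) (f ω) (f (ω [ i ]≔ false))) (gap up)) (≤-resp refl (eq₂ (s i) (f ω)
        (f (ω [ i ]≔ false))) (gap down))
      where
      eq₁ : ∀ s a b → (b + s) - a ≡ s - (a - b)
      eq₁ = solve 3 (λ s a b → (b :+ s) :- a := s :- (a :- b)) refl
      eq₂ : ∀ s a b → (a + s) - b ≡ s + (a - b)
      eq₂ = solve 3 (λ s a b → (a :+ s) :- b := s :+ (a :- b)) refl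
      near : ∀ z → (X ω z ≤ X (ω [ i ]≔ false) z + ι (rep z == i)) × (X (ω [ i ]≔ false) z ≤ X ω z + ι (rep z == i))
      near z with rep z ≟ i
      ... | yes refl = ≤-trans (ι≤1 (side ω z)) (by-gap (0≤ι (side (ω [ i ]≔ false) z)) (lem (ι (side (ω [ i ]≔ false) z))))
                     , ≤-trans (ι≤1 (side (ω [ i ]≔ false) z)) (by-gap (0≤ι (side ω z)) (lem (ι (side ω z))))
        where
        lem : ∀ a → a ≡ a + 1ℚ - 1ℚ
        lem = solve 1 (λ a → a := a :+ con 1ℚ :- con 1ℚ) refl
      ... | no ¬p rewrite side-off ω z i false ¬p = ≡⇒≤ (sym (+-identityʳ (ι (side ω z)))) , ≡⇒≤ (sym (+-identityʳ (ι (side ω z))))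
      up : f ω ≤ f (ω [ i ]≔ false) + s i
      up = ≤-resp refl (∑-+ (λ z → b z * X (ω [ i ]≔ false) z) (λ z → b z * ι (rep z == i)))
        (∑-mono (λ z → ≤-trans (*-monoʳ-nn (b z) (0≤b z) (proj₁ (near z))) (≡⇒≤ (*-distribˡ-+ (b z) (X (ω [ i ]≔ false) z) (ι (rep z == i))))))
      down : f (ω [ i ]≔ false) ≤ f ω + s i
      down = ≤-resp refl (∑-+ (λ z → b z * X ω z) (λ z → b z * ι (rep z == i)))
        (∑-mono (λ z → ≤-trans (*-monoʳ-nn (b z) (0≤b z) (proj₂ (near z))) (≡⇒≤ (*-distribˡ-+ (b z) (X ω z) (ι (rep z == i))))))

  module Split (γ κ : ℚ) (0≤γ : 0ℚ ≤ γ) (0≤κ : 0ℚ ≤ κ) (κγ : κ * sq γ ≡ 1ℚ)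
               (y : Fin (m I) → ℚ) (δ : ℚ) (0≤δ : 0ℚ ≤ δ) (0≤y : ∀ e → 0ℚ ≤ y e) (y≤δ : ∀ e → y e ≤ δ)
               (y-K : ∀ e → lookup K e ≡ true → y e ≡ 0ℚ)
               (bounded : ∀ u → degree-of y u ≤ ℤ.+ 2 / 1) where

    open Filter γ κ 0≤γ 0≤κ κγ

    two four : ℚ
    two  = ℤ.+ 2 / 1
    four = ℤ.+ 4 / 1

    0≤two : 0ℚ ≤ two
    0≤two = 0≤1 ⊕ 0≤1

    -- Doubling compensates for the probability one half of crossing.
    a : Fin (m I) → ℚ
    a e = two * y e

    Y : Vec Bool (n I) → Fin (m I) → ℚ
    Y ω e = a e * cross ω e

    dev₀ : Vec Bool (n I) → Fin (n I) → ℚ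
    dev₀ ω u = view a (X ω) u - degree-of y u

    -- The crossing load at `u` is `view a (X ω) u` when `u` is on the side `false`, and twice the
    -- degree minus this view when it is on the side `true`. Hence the change of sign.
    dev : Vec Bool (n I) → Fin (n I) → ℚ
    dev ω u = if side ω u then 0ℚ - dev₀ ω u else dev₀ ω u

    split : Vec Bool (n I) → Fin (m I) → ℚ
    split ω = filtered I (Y ω) (dev ω)

    0≤a : ∀ e → 0ℚ ≤ a e
    0≤a e = 0≤two ⊗ 0≤y e

    0≤Y : ∀ ω e → 0ℚ ≤ Y ω e
    0≤Y ω e = 0≤a e ⊗ 0≤ι (side ω (end₁ I e) xor side ω (end₂ I e))

    split-nn : ∀ ω e → 0ℚ ≤ split ω e
    split-nn ω = filtered-nn I (Y ω) (dev ω) (0≤Y ω)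

    goods : Vec Bool (n I) → Fin (m I) → ℚ
    goods ω e = good (dev ω (end₁ I e)) * good (dev ω (end₂ I e))

    factor : Vec Bool (n I) → Fin (m I) → ℚ
    factor ω e = two * (cross ω e * goods ω e)

    split-factor : ∀ ω e → split ω e ≡ factor ω e * y e
    split-factor ω e = lem two (y e) (cross ω e) (good (dev ω (end₁ I e)) * good (dev ω (end₂ I e)))
      where
      lem : ∀ t y c g → t * y * c * g ≡ t * (c * g) * y
      lem = solve 4 (λ t y c g → t :* y :* c :* g := t :* (c :* g) :* y) refl

    factor-nn : ∀ ω e → 0ℚ ≤ factor ω e
    factor-nn ω e = 0≤two ⊗ 0≤ι (side ω (end₁ I e) xor side ω (end₂ I e)) ⊗ good-nn (dev ω (end₁ I e)) ⊗ good-nn (dev ω (end₂ I e))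

    factor≤2 : ∀ ω e → factor ω e ≤ two
    factor≤2 ω e = *≤1 0≤two (≤-trans (*≤1 (0≤ι (side ω (end₁ I e) xor side ω (end₂ I e)))
      (≤-trans (*≤1 (good-nn (dev ω (end₁ I e))) (good≤1 (dev ω (end₂ I e)))) (good≤1 (dev ω (end₁ I e))))) (ι≤1 (side ω (end₁ I e) xor side ω (end₂ I e))))

    split-load : ∀ ω u → degree-of (split ω) u ≤ degree-of y u + γ
    split-load ω = filtered-load I (Y ω) (dev ω) (degree-of y) (0≤Y ω) (λ u → ∑-nn (λ e → 0≤ι (inc I e u) ⊗ 0≤y e)) load
      where
      half-a : ∀ u → degree-of a u ≡ two * degree-of y u
      half-a u = trans (∑-cong (λ e → lem (ι (inc I e u)) two (y e))) (∑-*ˡ two (λ e → ι (inc I e u) * y e))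
        where
        lem : ∀ i t y → i * (t * y) ≡ t * (i * y)
        lem = solve 3 (λ i t y → i :* (t :* y) := t :* (i :* y)) refl
      seen : ∀ u b → side ω u ≡ b → ∀ e → ι (inc I e u) * Y ω e ≡ a e * across e u (λ z → if b then 1ℚ - X ω z else X ω z)
      seen u b h e = go (decb (end₁ I e == u)) (decb (end₂ I e == u))
        where
        F : Fin (n I) → ℚ
        F z = if b then 1ℚ - X ω z else X ω z
        shape : ∀ {i j c x} → (end₁ I e == u) ≡ i → (end₂ I e == u) ≡ j → cross ω e ≡ c →
                ι (i ∨ j) * (a e * c) ≡ a e * (ι i * F (end₂ I e) + ι j * F (end₁ I e)) →
                x ≡ a e * across e u F → ι (inc I e u) * Y ω e ≡ x
        shape p q c h x = trans (trans (cong₂ (λ i c → ι i * (a e * c)) (cong₂ _∨_ p q) c)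
          (trans h (sym (cong₂ (λ i j → a e * (ι i * F (end₂ I e) + ι j * F (end₁ I e))) p q)))) (sym x)
        lem₀ : ∀ a c s t → 0ℚ * (a * c) ≡ a * (0ℚ * s + 0ℚ * t)
        lem₀ = solve 4 (λ a c s t → con 0ℚ :* (a :* c) := a :* (con 0ℚ :* s :+ con 0ℚ :* t)) refl
        lem₁ : ∀ a s t → 1ℚ * (a * s) ≡ a * (1ℚ * s + 0ℚ * t)
        lem₁ = solve 3 (λ a s t → con 1ℚ :* (a :* s) := a :* (con 1ℚ :* s :+ con 0ℚ :* t)) refl
        lem₂ : ∀ a s t → 1ℚ * (a * s) ≡ a * (0ℚ * t + 1ℚ * s)
        lem₂ = solve 3 (λ a s t → con 1ℚ :* (a :* s) := a :* (con 0ℚ :* t :+ con 1ℚ :* s)) refl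
        flˡ : ∀ b c → ι (b xor c) ≡ (if b then 1ℚ - ι c else ι c)
        flˡ true  c = ι-not c
        flˡ false c = refl
        flʳ : ∀ b c → ι (c xor b) ≡ (if b then 1ℚ - ι c else ι c)
        flʳ true  true  = refl
        flʳ true  false = refl
        flʳ false true  = refl
        flʳ false false = refl
        go : ((end₁ I e == u) ≡ true) ⊎ ((end₁ I e == u) ≡ false) → ((end₂ I e == u) ≡ true) ⊎ ((end₂ I e == u) ≡ false) →
             ι (inc I e u) * Y ω e ≡ a e * across e u F
        go (inj₁ p) (inj₁ q) = ⊥-elim (loopless I e (trans (==-true p) (sym (==-true q))))
        go (inj₂ p) (inj₂ q) = shape p q refl (lem₀ (a e) (cross ω e) (F (end₂ I e)) (F (end₁ I e))) refl
        go (inj₁ p) (inj₂ q) = shape p q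
          (trans (cong (λ s → ι (s xor side ω (end₂ I e))) (trans (cong (side ω) (==-true p)) h)) (flˡ b (side ω (end₂ I e))))
          (lem₁ (a e) (F (end₂ I e)) (F (end₁ I e))) refl
        go (inj₂ p) (inj₁ q) = shape p q
          (trans (cong (λ s → ι (side ω (end₁ I e) xor s)) (trans (cong (side ω) (==-true q)) h)) (flʳ b (side ω (end₁ I e))))
          (lem₂ (a e) (F (end₁ I e)) (F (end₂ I e))) refl
      complement : ∀ u → view a (λ z → 1ℚ - X ω z) u ≡ two * degree-of y u - view a (X ω) u
      complement u = trans (∑-cong (λ e → lem (a e) (ι (end₁ I e == u)) (X ω (end₂ I e)) (ι (end₂ I e == u)) (X ω (end₁ I e))))
        (trans (∑-- (λ e → a e * across e u (λ _ → 1ℚ)) (λ e → a e * across e u (X ω)))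
          (cong (λ z → z - view a (X ω) u) (trans (view-1 a u) (half-a u))))
        where
        lem : ∀ a i x j y → a * (i * (1ℚ - x) + j * (1ℚ - y)) ≡ a * (i * 1ℚ + j * 1ℚ) - a * (i * x + j * y)
        lem = solve 5 (λ a i x j y → a :* (i :* (con 1ℚ :- x) :+ j :* (con 1ℚ :- y)) := a :* (i :* con 1ℚ :+ j :* con 1ℚ) :- a :* (i :* x :+ j :* y)) refl
      load : ∀ u → ∑ (λ e → ι (inc I e u) * Y ω e) ≤ degree-of y u + dev ω u
      load u with side ω u in eq
      ... | true  = ≡⇒≤ (trans (∑-cong (seen u true eq)) (trans (complement u) (lem (degree-of y u) (view a (X ω) u))))
        where
        lem : ∀ m v → two * m - v ≡ m + (0ℚ - (v - m))
        lem = solve 2 (λ m v → con two :* m :- v := m :+ (con 0ℚ :- (v :- m))) refl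
      ... | false = ≡⇒≤ (trans (∑-cong (seen u false eq)) (lem (degree-of y u) (view a (X ω) u)))
        where
        lem : ∀ m v → v ≡ m + (v - m)
        lem = solve 2 (λ m v → v := m :+ (v :- m)) refl

    E-split : ∀ e → y e * (1ℚ - κ * (ℤ.+ 64 / 1 * δ)) ≤ E sides (λ ω → split ω e)
    -- The mean square deviation is at most `16 δ` at each end and is weighted by at most `2 (y e)`;
    -- the two ends together give 64.
    E-split e = ≤-trans (≡⇒≤ (lem (y e) κ δ)) (E-filtered I sides Y dev 0≤Y e (y e) (two * y e * (four * four * δ)) centred
        (λ u _ → ≤-trans (E-mono sides (λ ω → *-monoˡ-nn (sq (dev ω u)) (0≤sq (dev ω u)) (*≤1 (0≤a e) (ι≤1 (side ω (end₁ I e) xor side ω (end₂ I e))))))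
           (≤-trans (≡⇒≤ (E-*ˡ sides (a e) (λ ω → sq (dev ω u)))) (*-monoʳ-nn (a e) (0≤a e) (small u)))))
      where
      lem : ∀ y k d → y * (1ℚ - k * (ℤ.+ 64 / 1 * d)) ≡ y - k * (two * y * (four * four * d) + two * y * (four * four * d))
      lem = solve 3 (λ y k d → y :* (con 1ℚ :- k :* (con (ℤ.+ 64 / 1) :* d)) := y :- k :* (con two :* y :* (con four :* con four :* d)
          :+ con two :* y :* (con four :* con four :* d))) refl
      centred : y e ≤ E sides (λ ω → Y ω e)
      centred = go (decb (lookup K e))
        where
        halve : ∀ y → two * y * ½ ≡ y
        halve = solve 1 (λ y → con two :* y :* con ½ := y) refl
        go : (lookup K e ≡ true) ⊎ (lookup K e ≡ false) → y e ≤ E sides (λ ω → Y ω e)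
        go (inj₁ p) = ≤-trans (≡⇒≤ (y-K e p)) (E-nn sides (λ ω → 0≤Y ω e))
        go (inj₂ p) = ≡⇒≤ (sym (trans (E-*ˡ sides (a e) (λ ω → cross ω e)) (trans (cong (λ z → a e * z) (E-cross e p)) (halve (y e)))))
      a-deg : ∀ u → degree-of a u ≡ two * degree-of y u
      a-deg u = trans (∑-cong (λ e → lem' (ι (inc I e u)) two (y e))) (∑-*ˡ two (λ e → ι (inc I e u) * y e))
        where
        lem' : ∀ i t y → i * (t * y) ≡ t * (i * y)
        lem' = solve 3 (λ i t y → i :* (t :* y) := t :* (i :* y)) refl
      centre : ∀ u → E sides (λ ω → view a (X ω) u) ≡ degree-of y u
      centre u = trans (E-view sides a X u) (trans (∑-cong (λ e → trans (cong₂ (λ s t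
          → a e * (ι (end₁ I e == u) * s + ι (end₂ I e == u) * t)) (E-X (end₂ I e)) (E-X (end₁ I e)))
          (lem₁ (a e) (ι (end₁ I e == u)) (ι (end₂ I e == u)) ½)))
        (trans (∑-*ʳ ½ (λ e → a e * across e u (λ _ → 1ℚ))) (trans (cong (λ z → z * ½) (trans (view-1 a u) (a-deg u))) (halve (degree-of y u)))))
        where
        lem₁ : ∀ a i j h → a * (i * h + j * h) ≡ a * (i * 1ℚ + j * 1ℚ) * h
        lem₁ = solve 4 (λ a i j h → a :* (i :* h :+ j :* h) := a :* (i :* con 1ℚ :+ j :* con 1ℚ) :* h) refl
        halve : ∀ y → two * y * ½ ≡ y
        halve = solve 1 (λ y → con two :* y :* con ½ := y) refl
      dev-sq : ∀ ω u → sq (dev ω u) ≡ sq (dev₀ ω u)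
      dev-sq ω u with side ω u
      ... | true  = lem' (dev₀ ω u)
        where
        lem' : ∀ x → (0ℚ - x) * (0ℚ - x) ≡ x * x
        lem' = solve 1 (λ x → (con 0ℚ :- x) :* (con 0ℚ :- x) := x :* x) refl
      ... | false = refl
      small : ∀ u → E sides (λ ω → sq (dev ω u)) ≤ four * four * δ
      small u = ≤-trans (≡⇒≤ (trans (E-cong sides (λ ω → dev-sq ω u)) (trans (E-sq-shift sides (λ ω → view a (X ω) u) (degree-of y u))
          (trans (cong (λ z → Var sides (λ ω → view a (X ω) u) + sq (z - degree-of y u)) (centre u)) (flat (Var sides (λ ω
              → view a (X ω) u)) (degree-of y u))))))
        (≤-trans (Var-view sides X two sides-spread a (two * δ) (0≤two ⊗ 0≤δ) 0≤a (λ e → *-monoʳ-nn two 0≤two (y≤δ e)) u)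
        (≤-trans (≡⇒≤ (cong (λ z → two * (two * δ * z)) (a-deg u)))
        (≤-trans (*-monoʳ-nn two 0≤two (*-monoʳ-nn (two * δ) (0≤two ⊗ 0≤δ) (*-monoʳ-nn two 0≤two (bounded u)))) (≡⇒≤ (last δ)))))
        where
        flat : ∀ v m → v + sq (m - m) ≡ v
        flat = solve 2 (λ v m → v :+ (m :- m) :* (m :- m) := v) refl
        last : ∀ d → two * (two * d * (two * two)) ≡ four * four * d
        last = solve 1 (λ d → con two :* (con two :* d :* (con two :* con two)) := con four :* con four :* d) refl

-- One sampling step: a fractional solution β·π is replaced by β on the sampled edges

module EdgeStep (γ κ : ℚ) (0≤γ : 0ℚ ≤ γ) (0≤κ : 0ℚ ≤ κ) (κγ : κ * sq γ ≡ 1ℚ) (I : Instance)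
                (π : Fin (m I) → ℚ) (π₀ : ∀ e → 0ℚ ≤ π e) (π₁ : ∀ e → π e ≤ 1ℚ)
                (β : Fin (m I) → ℚ) (δ : ℚ) (0≤δ : 0ℚ ≤ δ) (δ≤1 : δ ≤ 1ℚ) (0≤β : ∀ e → 0ℚ ≤ β e) (β≤δ : ∀ e → β e ≤ δ) where

  open Neighbourhood I
  open Filter γ κ 0≤γ 0≤κ κγ
  open Sampling π π₀ π₁

  base : Fin (m I) → ℚ
  base e = β e * π e

  c : Fin (n I) → Fin (m I) → ℚ
  c u e = ι (inc I e u) * β e

  0≤c : ∀ u e → 0ℚ ≤ c u e
  0≤c u e = 0≤ι (inc I e u) ⊗ 0≤β e

  c≤δ : ∀ u e → c u e ≤ δ
  c≤δ u e = ≤-trans (≤-resp refl (*-identityˡ (β e)) (*-monoˡ-nn (β e) (0≤β e) (ι≤1 (inc I e u)))) (β≤δ e)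

  Y : Vec Bool (m I) → Fin (m I) → ℚ
  Y B e = ι (lookup B e) * β e

  dev : Vec Bool (m I) → Fin (n I) → ℚ
  dev B u = stat (c u) δ (0≤c u) (c≤δ u) B - mean (c u) δ (0≤c u) (c≤δ u)

  0≤Y : ∀ B e → 0ℚ ≤ Y B e
  0≤Y B e = 0≤ι (lookup B e) ⊗ 0≤β e

  step : Vec Bool (m I) → Fin (m I) → ℚ
  step B = filtered I (Y B) (dev B)

  goods : Vec Bool (m I) → Fin (m I) → ℚ
  goods B e = good (dev B (end₁ I e)) * good (dev B (end₂ I e))

  keep : Vec Bool (m I) → Fin (m I) → ℚ
  keep B e = ι (lookup B e) * goods B e

  keep-nn : ∀ B e → 0ℚ ≤ keep B e
  keep-nn B e = 0≤ι (lookup B e) ⊗ good-nn (dev B (end₁ I e)) ⊗ good-nn (dev B (end₂ I e))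

  keep≤ι : ∀ B e → keep B e ≤ ι (lookup B e)
  keep≤ι B e = *≤1 (0≤ι (lookup B e)) (≤-trans (*≤1 (good-nn (dev B (end₁ I e))) (good≤1 (dev B (end₂ I e)))) (good≤1 (dev B (end₁ I e))))

  step-keep : ∀ B e → step B e ≡ keep B e * β e
  step-keep B e = lem (ι (lookup B e)) (β e) (good (dev B (end₁ I e)) * good (dev B (end₂ I e)))
    where
    lem : ∀ i b g → i * b * g ≡ i * g * b
    lem = solve 3 (λ i b g → i :* b :* g := i :* g :* b) refl

  step-nn : ∀ B e → 0ℚ ≤ step B e
  step-nn B = filtered-nn I (Y B) (dev B) (0≤Y B)

  mean-base : ∀ u → mean (c u) δ (0≤c u) (c≤δ u) ≡ degree-of base u
  mean-base u = ∑-cong (λ e → *-assoc (ι (inc I e u)) (β e) (π e))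

  base-nn : ∀ e → 0ℚ ≤ base e
  base-nn e = 0≤β e ⊗ π₀ e

  step-load : ∀ B u → degree-of (step B) u ≤ degree-of base u + γ
  step-load B = filtered-load I (Y B) (dev B) (degree-of base) (0≤Y B) (λ u → ∑-nn (λ e → 0≤ι (inc I e u) ⊗ base-nn e))
    (λ u → ≡⇒≤ (trans (∑-cong (λ e → lem (ι (inc I e u)) (ι (lookup B e)) (β e)))
      (trans (lem₂ (stat (c u) δ (0≤c u) (c≤δ u) B) (mean (c u) δ (0≤c u) (c≤δ u)))
        (cong (λ z → z + dev B u) (mean-base u)))))
    where
    lem : ∀ i b y → i * (b * y) ≡ i * y * b
    lem = solve 3 (λ i b y → i :* (b :* y) := i :* y :* b) refl
    lem₂ : ∀ s m → s ≡ m + (s - m)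
    lem₂ = solve 2 (λ s m → s := m :+ (s :- m)) refl

  six : ℚ
  six = ℤ.+ 6 / 1

  E-step : (∀ u → degree-of base u ≤ ℤ.+ 2 / 1) → ∀ e → base e * (1ℚ - κ * (six * δ)) ≤ E sample (λ B → step B e)
  E-step bounded e = ≤-trans (≡⇒≤ (lem (base e) κ δ))
    (E-filtered I sample Y dev 0≤Y e (base e) (base e * (ℤ.+ 3 / 1 * δ))
      (≡⇒≤ (sym (trans (E-*ʳ sample (β e) (λ B → ι (lookup B e))) (trans (cong (λ z → z * β e) (E-ι e)) (*-comm (π e) (β e))))))
      (λ u _ → ≤-trans (≡⇒≤ (trans (E-cong sample (λ B → lem₂ (ι (lookup B e)) (β e) (sq (dev B u)))) (E-*ˡ sample (β e) (λ B
          → ι (lookup B e) * sq (dev B u)))))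
        (≤-trans (*-monoʳ-nn (β e) (0≤β e) (≤-trans (sampled-deviation (c u) δ (0≤c u) (c≤δ u) e) (*-monoʳ-nn (π e) (π₀ e) (small u))))
          (≡⇒≤ (sym (*-assoc (β e) (π e) (ℤ.+ 3 / 1 * δ)))))))
    where
    lem : ∀ y k d → y * (1ℚ - k * (six * d)) ≡ y - k * (y * (ℤ.+ 3 / 1 * d) + y * (ℤ.+ 3 / 1 * d))
    lem = solve 3 (λ y k d → y :* (con 1ℚ :- k :* (con six :* d)) := y :- k :* (y :* (con (ℤ.+ 3 / 1) :* d) :+ y :* (con (ℤ.+ 3 / 1) :* d))) refl
    lem₂ : ∀ i b s → i * b * s ≡ b * (i * s)
    lem₂ = solve 3 (λ i b s → i :* b :* s := b :* (i :* s)) refl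
    -- The mean load is at most 2 and `δ` is at most 1, hence the 3; two ends make the 6 of the
    -- conclusion.
    small : ∀ u → δ * mean (c u) δ (0≤c u) (c≤δ u) + δ * δ ≤ ℤ.+ 3 / 1 * δ
    small u = ≤-trans (+-mono-≤ (*-monoʳ-nn δ 0≤δ (≤-trans (≡⇒≤ (mean-base u)) (bounded u))) (*-monoʳ-nn δ 0≤δ δ≤1)) (≡⇒≤ (lem₃ δ))
      where
      lem₃ : ∀ d → d * (ℤ.+ 2 / 1) + d * 1ℚ ≡ ℤ.+ 3 / 1 * d
      lem₃ = solve 1 (λ d → d :* con (ℤ.+ 2 / 1) :+ d :* con 1ℚ := con (ℤ.+ 3 / 1) :* d) refl

-- The random subgraph

-- `γ` is the deviation of a load tolerated in one sampling step and `ε` the tolerated relative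
-- loss; `τ` separates crucial from minor edges; `S` bounds the factor by which a scheme may scale
-- `xN`; `L` is the pruning threshold. `κ` and `Λ` are the reciprocals of the square of `γ` and of
-- `L`, tied to them by equations so that no division occurs.
record Parameters : Set where
  field
    γ κ τ S L Λ ε : ℚ
    0≤γ : 0ℚ ≤ γ
    γ≤  : ℤ.+ 4 / 1 * γ ≤ 1ℚ
    0≤κ : 0ℚ ≤ κ
    κγ  : κ * sq γ ≡ 1ℚ
    0<τ : 0ℚ < τ
    0≤S : 0ℚ ≤ S
    Sτ≤ : ℤ.+ 2 / 1 * S * τ ≤ 1ℚ
    0≤Λ : 0ℚ ≤ Λ
    ΛL  : Λ * L ≡ 1ℚ
    ε≤1 : ε ≤ 1ℚ
    0≤L : 0ℚ ≤ L
    τ≤1 : τ ≤ 1ℚ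
    small : κ * (ℤ.+ 64 / 1 * (ℤ.+ 2 / 1 * S * τ)) + ℤ.+ 4 / 1 * Λ ≤ ε

module Sparse (params : Parameters) (I : Instance) where

  open Parameters params
  open Neighbourhood I

  0≤τ : 0ℚ ≤ τ
  0≤τ = <⇒≤ 0<τ

  0≤p : ∀ e → 0ℚ ≤ p I e
  0≤p e = <⇒≤ (p-pos I e)

  opt : EdgeSet (m I) → EdgeSet (m I)
  opt R = proj₁ (mwm-attained I R)

  opt-Sub : ∀ R → Sub (opt R) R
  opt-Sub R = proj₁ (proj₂ (mwm-attained I R))

  opt-match : ∀ R → IsMatching I (opt R)
  opt-match R = proj₁ (proj₂ (proj₂ (mwm-attained I R)))

  real : D (EdgeSet (m I))
  real = realization I

  module Real = Sampling (p I) 0≤p (p-le1 I)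

  x : Fin (m I) → ℚ
  x e = E real (λ R → ι (lookup (opt R) e))

  0≤x : ∀ e → 0ℚ ≤ x e
  0≤x e = E-nn real (λ R → 0≤ι (lookup (opt R) e))

  matching-load : ∀ (M : EdgeSet (m I)) → IsMatching I M → ∀ u → ∑ (λ e → ι (inc I e u) * ι (lookup M e)) ≤ 1ℚ
  matching-load M h u = ≤-trans (≡⇒≤ (∑-cong (λ e → trans (sym (ι-∧ (inc I e u) (lookup M e))) (sym (*-identityʳ _)))))
    (∑-unique (λ e → inc I e u ∧ lookup M e) (λ _ → 1ℚ) 1ℚ 0≤1 (λ _ _ → ≤-refl)
      (λ e f p q → h e f u (proj₂ (∧-true {inc I e u} p)) (proj₂ (∧-true {inc I f u} q)) (proj₁ (∧-true p)) (proj₁ (∧-true q))))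

  x-load : ∀ u → degree-of x u ≤ 1ℚ
  x-load u = ≤-trans (≡⇒≤ (sym (trans (E-∑ real (λ e R → ι (inc I e u) * ι (lookup (opt R) e)))
      (∑-cong (λ e → E-*ˡ real (ι (inc I e u)) (λ R → ι (lookup (opt R) e)))))))
    (E-≤ real 1ℚ (λ R → matching-load (opt R) (opt-match R) u))

  OPT : E real (mwm I) ≡ ∑ (λ e → x e * w I e)
  OPT = trans (E-cong real (λ R → trans (sym (proj₂ (proj₂ (proj₂ (mwm-attained I R))))) (weight-∑ I (opt R))))
    (trans (E-∑ real (λ e R → ι (lookup (opt R) e) * w I e)) (∑-cong (λ e → E-*ʳ real (w I e) (λ R → ι (lookup (opt R) e)))))

  crucial : Fin (m I) → Bool
  crucial e = does (τ * p I e ≤? x e)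

  crucial⇒ : ∀ e → crucial e ≡ true → τ * p I e ≤ x e
  crucial⇒ e = go (τ * p I e ≤? x e)
    where
    go : (d : Dec (τ * p I e ≤ x e)) → does d ≡ true → τ * p I e ≤ x e
    go (yes h) _ = h
    go (no _) ()

  minor⇒ : ∀ e → crucial e ≡ false → x e ≤ τ * p I e
  minor⇒ e = go (τ * p I e ≤? x e)
    where
    go : (d : Dec (τ * p I e ≤ x e)) → does d ≡ false → x e ≤ τ * p I e
    go (yes h) ()
    go (no h) _ = <⇒≤ (≰⇒> h)

  xC xN : Fin (m I) → ℚ
  xC e = ι (crucial e) * x e
  xN e = ι (not (crucial e)) * x e

  0≤xC : ∀ e → 0ℚ ≤ xC e
  0≤xC e = 0≤ι (crucial e) ⊗ 0≤x e

  0≤xN : ∀ e → 0ℚ ≤ xN e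
  0≤xN e = 0≤ι (not (crucial e)) ⊗ 0≤x e

  x-split : ∀ e → xC e + xN e ≡ x e
  x-split e = go (crucial e)
    where
    lem₁ : ∀ a → 1ℚ * a + 0ℚ * a ≡ a
    lem₁ = solve 1 (λ a → con 1ℚ :* a :+ con 0ℚ :* a := a) refl
    lem₂ : ∀ a → 0ℚ * a + 1ℚ * a ≡ a
    lem₂ = solve 1 (λ a → con 0ℚ :* a :+ con 1ℚ :* a := a) refl
    go : ∀ b → ι b * x e + ι (not b) * x e ≡ x e
    go true  = lem₁ (x e)
    go false = lem₂ (x e)

  xN≤τ : ∀ e → xN e ≤ τ
  xN≤τ e = go (crucial e) refl
    where
    go : ∀ b → crucial e ≡ b → ι (not b) * x e ≤ τ
    go true  _ = ≤-trans (≡⇒≤ (*-zeroˡ (x e))) 0≤τ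
    go false h = ≤-trans (≡⇒≤ (*-identityˡ (x e))) (≤-trans (minor⇒ e h) (*≤1 0≤τ (p-le1 I e)))

  load-split : ∀ u → degree-of xC u + degree-of xN u ≤ 1ℚ
  load-split u = ≤-trans (≡⇒≤ (trans (sym (∑-+ (λ e → ι (inc I e u) * xC e) (λ e → ι (inc I e u) * xN e)))
    (∑-cong (λ e → trans (sym (*-distribˡ-+ (ι (inc I e u)) (xC e) (xN e))) (cong (λ z → ι (inc I e u) * z) (x-split e)))))) (x-load u)

  0<τp : ∀ e → 0ℚ < τ * p I e
  0<τp e = ≤-<-trans (≡⇒≤ (sym (*-zeroʳ τ))) (*-monoʳ-<-pos τ {{Data.Rational.positive 0<τ}} (p-pos I e))

  σ : Fin (m I) → ℚ
  σ e = if crucial e then 1ℚ else x e * proj₁ (recip (τ * p I e) (0<τp e))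

  σ-facts : ∀ e → (0ℚ ≤ σ e) × (σ e ≤ 1ℚ) × (ι (not (crucial e)) * (τ * p I e) * σ e ≡ xN e)
  σ-facts e = go (crucial e) refl
    where
    r : ℚ
    r = proj₁ (recip (τ * p I e) (0<τp e))
    0<r : 0ℚ < r
    0<r = proj₁ (proj₂ (recip (τ * p I e) (0<τp e)))
    one : τ * p I e * r ≡ 1ℚ
    one = proj₂ (proj₂ (recip (τ * p I e) (0<τp e)))
    lem₁ : ∀ t x → 0ℚ * t * 1ℚ ≡ 0ℚ * x
    lem₁ = solve 2 (λ t x → con 0ℚ :* t :* con 1ℚ := con 0ℚ :* x) refl
    lem₂ : ∀ t x r → 1ℚ * t * (x * r) ≡ t * r * (1ℚ * x)
    lem₂ = solve 3 (λ t x r → con 1ℚ :* t :* (x :* r) := t :* r :* (con 1ℚ :* x)) refl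
    go : ∀ b → crucial e ≡ b → (0ℚ ≤ (if b then 1ℚ else x e * r)) × ((if b then 1ℚ else x e * r) ≤ 1ℚ) ×
         (ι (not b) * (τ * p I e) * (if b then 1ℚ else x e * r) ≡ ι (not b) * x e)
    go true  _ = 0≤1 , ≤-refl , lem₁ (τ * p I e) (x e)
    go false h = 0≤x e ⊗ <⇒≤ 0<r , ≤-trans (*-monoˡ-nn r (<⇒≤ 0<r) (minor⇒ e h)) (≡⇒≤ one)
      , trans (lem₂ (τ * p I e) (x e) r) (trans (cong (λ z → z * (1ℚ * x e)) one) (*-identityˡ (1ℚ * x e)))

  0≤σ : ∀ e → 0ℚ ≤ σ e
  0≤σ e = proj₁ (σ-facts e)
  σ≤1 : ∀ e → σ e ≤ 1ℚ
  σ≤1 e = proj₁ (proj₂ (σ-facts e))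

  module Query = Sampling σ 0≤σ σ≤1

  queries : D (EdgeSet (m I))
  queries = Query.sample

  scale : ℚ
  scale = τ * pmin I

  minor-degree : EdgeSet (m I) → Fin (n I) → ℚ
  minor-degree B u = ∑ (λ e → ι (inc I e u ∧ not (crucial e)) * ι (lookup B e))

  sparse-at : EdgeSet (m I) → Fin (n I) → Bool
  sparse-at B u = does (scale * minor-degree B u ≤? L)

  Q : EdgeSet (m I) → EdgeSet (m I)
  Q B = tabulate (λ e → crucial e ∨ (lookup B e ∧ (sparse-at B (end₁ I e) ∧ sparse-at B (end₂ I e))))

  pmin-facts : (0ℚ ≤ pmin I) × (pmin I ≤ 1ℚ) × (∀ e → pmin I ≤ p I e)
  pmin-facts = subst (λ z → (0ℚ ≤ z) × (z ≤ 1ℚ) × (∀ e → z ≤ p I e)) (sym (cong (List.foldr _⊓_ 1ℚ) (map-tabulate id (p I)))) (go (p I) 0≤p)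
    where
    go : ∀ {k} (q : Fin k → ℚ) → (∀ e → 0ℚ ≤ q e) → let z = List.foldr _⊓_ 1ℚ (List.tabulate q) in (0ℚ ≤ z) × (z ≤ 1ℚ) × (∀ e → z ≤ q e)
    go {zero} q h = 0≤1 , ≤-refl , λ ()
    go {suc k} q h with go (λ i → q (fs i)) (λ i → h (fs i))
    ... | a , b , c = ⊓-glb (h fz) a , ≤-trans (p⊓q≤q (q fz) _) b , λ { fz → p⊓q≤p (q fz) _ ; (fs i) → ≤-trans (p⊓q≤q (q fz) _) (c i) }

  0≤scale : 0ℚ ≤ scale
  0≤scale = 0≤τ ⊗ proj₁ pmin-facts

  degree-∑ : ∀ H u → ℕtoℚ (degree I H u) ≡ ∑ (λ e → ι (inc I e u) * ι (lookup H e))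
  degree-∑ H u = trans (cong ℕtoℚ (cong (List.foldr ℕ._+_ 0) (map-tabulate id ind))) (trans (go ind) (∑-cong (λ e → eq (lookup H e) (inc I e u))))
    where
    go : ∀ {k} (f : Fin k → ℕ) → ℕtoℚ (List.foldr ℕ._+_ 0 (List.tabulate f)) ≡ ∑ (λ e → ℕtoℚ (f e))
    go {zero} f = refl
    go {suc k} f = trans (ℕtoℚ-+ (f fz) (List.foldr ℕ._+_ 0 (List.tabulate (λ i → f (fs i))))) (cong (λ z → ℕtoℚ (f fz) + z) (go (λ i → f (fs i))))
    ind : Fin (m I) → ℕ
    ind e = if lookup H e ∧ inc I e u then 1 else 0
    eq : ∀ a b → ℕtoℚ (if a ∧ b then 1 else 0) ≡ ι b * ι a
    eq true  true  = refl
    eq true  false = refl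
    eq false true  = refl
    eq false false = refl

  -- A crucial edge takes at least `scale` of the load of `x` at a vertex, which is at most 1; the
  -- minor edges at a vertex are kept only if they amount to at most `L` in the same unit. The sum
  -- `1ℚ + L` is the origin of the constant of the theorem.
  Q-degree : ∀ B u → ℕtoℚ (degree I (Q B) u) * pmin I * τ ≤ 1ℚ + L
  Q-degree B u = ≤-trans (≡⇒≤ (trans (lem (ℕtoℚ (degree I (Q B) u)) (pmin I) τ) (cong (λ z → scale * z) (degree-∑ (Q B) u))))
    (≤-trans (*-monoʳ-nn scale 0≤scale (≤-trans (∑-mono term) (≡⇒≤ (∑-+ (λ e → ι (inc I e u) * ι (crucial e)) minors))))
    (≤-trans (≡⇒≤ (*-distribˡ-+ scale (∑ (λ e → ι (inc I e u) * ι (crucial e))) (∑ minors)))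
      (+-mono-≤ cruc minor)))
    where
    lem : ∀ d p t → d * p * t ≡ t * p * d
    lem = solve 3 (λ d p t → d :* p :* t := t :* p :* d) refl
    minors : Fin (m I) → ℚ
    minors e = ι (sparse-at B u) * (ι (inc I e u ∧ not (crucial e)) * ι (lookup B e))
    cruc : scale * ∑ (λ e → ι (inc I e u) * ι (crucial e)) ≤ 1ℚ
    cruc = ≤-trans (≡⇒≤ (sym (∑-*ˡ scale (λ e → ι (inc I e u) * ι (crucial e))))) (≤-trans (∑-mono bound) (x-load u))
      where
      lem₁ : ∀ s i → s * (i * 1ℚ) ≡ i * s
      lem₁ = solve 2 (λ s i → s :* (i :* con 1ℚ) := i :* s) refl
      lem₀ : ∀ s i → s * (i * 0ℚ) ≡ 0ℚ
      lem₀ = solve 2 (λ s i → s :* (i :* con 0ℚ) := con 0ℚ) refl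
      bound : ∀ e → scale * (ι (inc I e u) * ι (crucial e)) ≤ ι (inc I e u) * x e
      bound e = go (crucial e) refl
        where
        go : ∀ b → crucial e ≡ b → scale * (ι (inc I e u) * ι b) ≤ ι (inc I e u) * x e
        go true  h = ≤-trans (≡⇒≤ (lem₁ scale (ι (inc I e u)))) (*-monoʳ-nn (ι (inc I e u)) (0≤ι (inc I e u))
          (≤-trans (*-monoʳ-nn τ 0≤τ (proj₂ (proj₂ pmin-facts) e)) (crucial⇒ e h)))
        go false h = ≤-trans (≡⇒≤ (lem₀ scale (ι (inc I e u)))) (0≤ι (inc I e u) ⊗ 0≤x e)
    minor : scale * ∑ minors ≤ L
    minor = ≤-trans (≡⇒≤ (trans (cong (λ z → scale * z) (∑-*ˡ (ι (sparse-at B u)) (λ e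
        → ι (inc I e u ∧ not (crucial e)) * ι (lookup B e)))) (lem₁ scale (ι (sparse-at B u)) (minor-degree B u))))
      (go (scale * minor-degree B u ≤? L))
      where
      lem₁ : ∀ s i d → s * (i * d) ≡ i * (s * d)
      lem₁ = solve 3 (λ s i d → s :* (i :* d) := i :* (s :* d)) refl
      go : (d : Dec (scale * minor-degree B u ≤ L)) → ι (does d) * (scale * minor-degree B u) ≤ L
      go (yes h) = ≤-trans (≡⇒≤ (*-identityˡ (scale * minor-degree B u))) h
      go (no _)  = ≤-trans (≡⇒≤ (*-zeroˡ (scale * minor-degree B u))) 0≤L
    term : ∀ e → ι (inc I e u) * ι (lookup (Q B) e) ≤ ι (inc I e u) * ι (crucial e) + minors e
    term e = ≤-trans (≡⇒≤ (cong (λ b → ι (inc I e u) * ι b) (lookup∘tabulate _ e)))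
      (go (inc I e u) refl (crucial e) (lookup B e))
      where
      go : ∀ i → inc I e u ≡ i → ∀ c b → ι i * ι (c ∨ (b ∧ (sparse-at B (end₁ I e) ∧ sparse-at B (end₂ I e)))) ≤
           ι i * ι c + ι (sparse-at B u) * (ι (i ∧ not c) * ι b)
      go false _ c b = ≤-trans (≡⇒≤ (*-zeroˡ (ι (c ∨ (b ∧ (sparse-at B (end₁ I e) ∧ sparse-at B (end₂ I e)))))))
                         ((≤-refl ⊗ 0≤ι c) ⊕ 0≤ι (sparse-at B u) ⊗ ≤-refl ⊗ 0≤ι b)
      go true _ true b = by-gap (0≤ι (sparse-at B u) ⊗ ≤-refl ⊗ 0≤ι b) (l₁ (ι (sparse-at B u) * (0ℚ * ι b)))
        where
        l₁ : ∀ a → a ≡ 1ℚ * 1ℚ + a - 1ℚ * 1ℚ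
        l₁ = solve 1 (λ a → a := con 1ℚ :* con 1ℚ :+ a :- con 1ℚ :* con 1ℚ) refl
      go true h false b = at b (inc-cases I h)
        where
        l₂ : ∀ s a → 1ℚ * 0ℚ + s * (1ℚ * a) ≡ s * a
        l₂ = solve 2 (λ s a → con 1ℚ :* con 0ℚ :+ s :* (con 1ℚ :* a) := s :* a) refl
        at : ∀ b → (end₁ I e ≡ u) ⊎ (end₂ I e ≡ u) → 1ℚ * ι (b ∧ (sparse-at B (end₁ I e) ∧ sparse-at B (end₂ I e))) ≤ 1ℚ * 0ℚ + ι (sparse-at B u) * (1ℚ * ι b)
        at false _ = ≡⇒≤ (trans (*-zeroʳ 1ℚ) (sym (trans (l₂ (ι (sparse-at B u)) 0ℚ) (*-zeroʳ (ι (sparse-at B u))))))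
        at true (inj₁ refl) = ≤-resp (sym (*-identityˡ _)) (sym (trans (l₂ (ι (sparse-at B u)) 1ℚ) (*-identityʳ _)))
          (ι-mono {sparse-at B (end₁ I e) ∧ sparse-at B (end₂ I e)} {sparse-at B (end₁ I e)} (λ q → proj₁ (∧-true q)))
        at true (inj₂ refl) = ≤-resp (sym (*-identityˡ _)) (sym (trans (l₂ (ι (sparse-at B u)) 1ℚ) (*-identityʳ _)))
          (ι-mono {sparse-at B (end₁ I e) ∧ sparse-at B (end₂ I e)} {sparse-at B (end₂ I e)} (λ q → proj₂ (∧-true {sparse-at B (end₁ I e)} q)))

-- From a fractional solution on the minor edges to an actual matching

module Pipeline (params : Parameters) (I : Instance) where

  open Parameters params
  open Neighbourhood I
  open Sparse params I

  two : ℚ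
  two = ℤ.+ 2 / 1

  0≤two : 0ℚ ≤ two
  0≤two = 0≤1 ⊕ 0≤1

  minor : Fin (m I) → ℚ
  minor e = ι (not (crucial e))

  P : EdgeSet (m I) → Fin (n I) → ℚ
  P B u = ι (sparse-at B u)

  -- Markov's inequality in pointwise form, so that it can be averaged together with the correlated
  -- event that an edge is sampled.
  P-≥ : ∀ B u → 1ℚ - Λ * (scale * minor-degree B u) ≤ P B u
  P-≥ B u = go (scale * minor-degree B u ≤? L)
    where
    0≤s : 0ℚ ≤ scale * minor-degree B u
    0≤s = 0≤scale ⊗ ∑-nn (λ e → 0≤ι (inc I e u ∧ not (crucial e)) ⊗ 0≤ι (lookup B e))
    lem₁ : ∀ a → a ≡ 1ℚ - (1ℚ - a)
    lem₁ = solve 1 (λ a → a := con 1ℚ :- (con 1ℚ :- a)) refl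
    lem₂ : ∀ a → a - 1ℚ ≡ 0ℚ - (1ℚ - a)
    lem₂ = solve 1 (λ a → a :- con 1ℚ := con 0ℚ :- (con 1ℚ :- a)) refl
    go : (d : Dec (scale * minor-degree B u ≤ L)) → 1ℚ - Λ * (scale * minor-degree B u) ≤ ι (does d)
    go (yes _) = by-gap (0≤Λ ⊗ 0≤s) (lem₁ (Λ * (scale * minor-degree B u)))
    go (no ¬p) = by-gap (gap (≤-trans (≡⇒≤ (sym ΛL)) (*-monoʳ-nn Λ 0≤Λ (<⇒≤ (≰⇒> ¬p))))) (lem₂ (Λ * (scale * minor-degree B u)))

  module At (K : EdgeSet (m I)) (K-match : IsMatching I K) (K-crucial : ∀ e → lookup K e ≡ true → crucial e ≡ true)
            (ζ : Fin (m I) → ℚ) (0≤ζ : ∀ e → 0ℚ ≤ ζ e) (ζ≤S : ∀ e → ζ e ≤ S)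
            (bounded : ∀ u → degree-of (λ e → ζ e * xN e) u ≤ 1ℚ + γ) where

    y : Fin (m I) → ℚ
    y e = ζ e * xN e

    0≤y : ∀ e → 0ℚ ≤ y e
    0≤y e = 0≤ζ e ⊗ 0≤xN e

    -- Bound for the value of a single edge in the two edge sampling steps; the factor 2 is the
    -- doubling on the random sides.
    δ : ℚ
    δ = two * S * τ

    0≤δ : 0ℚ ≤ δ
    0≤δ = (0≤two ⊗ 0≤S) ⊗ 0≤τ

    y≤ : ∀ e → y e ≤ S * τ
    y≤ e = *-mono-nn (0≤ζ e) (ζ≤S e) (0≤xN e) (xN≤τ e)

    -- The initial excess `γ` and one more `γ` for each of the three experiments keep all loads
    -- below 2; this is where `4 γ ≤ 1` enters.
    bounded₂ : ∀ {x} → x ≤ 1ℚ + γ → x + (γ + γ + γ) ≤ two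
    bounded₂ {x} h = by-gap (gap h ⊕ gap γ≤) (lem x γ)
      where
      lem : ∀ x g → (1ℚ + g - x) + (1ℚ - ℤ.+ 4 / 1 * g) ≡ two - (x + (g + g + g))
      lem = solve 2 (λ x g → (con 1ℚ :+ g :- x) :+ (con 1ℚ :- con (ℤ.+ 4 / 1) :* g) := con two :- (x :+ (g :+ g :+ g))) refl

    bounded₀ : ∀ u → degree-of y u ≤ two
    bounded₀ u = ≤-trans (by-gap ((0≤γ ⊕ 0≤γ) ⊕ 0≤γ) (lem (degree-of y u) (γ + γ + γ))) (bounded₂ (bounded u))
      where
      lem : ∀ x g → g ≡ x + g - x
      lem = solve 2 (λ x g → g := x :+ g :- x) refl

    open Bipartition I K K-match using (side; sides; module Split)
    module S₁ = Split γ κ 0≤γ 0≤κ κγ y (S * τ) (0≤S ⊗ 0≤τ) 0≤y y≤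
      (λ e h → trans (cong (λ b → ζ e * (ι (not b) * x e)) (K-crucial e h)) (trans (cong (λ z → ζ e * z) (*-zeroˡ (x e))) (*-zeroʳ (ζ e)))) bounded₀

    module Sided (ω : Vec Bool (n I)) where

      ζ₁ : Fin (m I) → ℚ
      ζ₁ e = S₁.factor ω e * ζ e

      0≤ζ₁ : ∀ e → 0ℚ ≤ ζ₁ e
      0≤ζ₁ e = S₁.factor-nn ω e ⊗ 0≤ζ e

      ζ₁≤ : ∀ e → ζ₁ e ≤ two * S
      ζ₁≤ e = *-mono-nn (S₁.factor-nn ω e) (S₁.factor≤2 ω e) (0≤ζ e) (ζ≤S e)

      y₁ : Fin (m I) → ℚ
      y₁ e = S₁.split ω e

      y₁-eq : ∀ e → y₁ e ≡ ζ₁ e * xN e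
      y₁-eq e = trans (S₁.split-factor ω e) (sym (*-assoc (S₁.factor ω e) (ζ e) (xN e)))

      load₁ : ∀ u → degree-of y₁ u ≤ degree-of y u + γ
      load₁ = S₁.split-load ω

      -- Value given to a queried edge: multiplied by the query probability `σ e` it returns `y₁ e`.
      β₁ : Fin (m I) → ℚ
      β₁ e = ζ₁ e * (minor e * (τ * p I e))

      0≤β₁ : ∀ e → 0ℚ ≤ β₁ e
      0≤β₁ e = 0≤ζ₁ e ⊗ 0≤ι (not (crucial e)) ⊗ 0≤τ ⊗ 0≤p e

      β₁≤ : ∀ e → β₁ e ≤ δ
      β₁≤ e = *-mono-nn (0≤ζ₁ e) (ζ₁≤ e) (0≤ι (not (crucial e)) ⊗ 0≤τ ⊗ 0≤p e)
        (≤-trans (≤-resp refl (*-identityˡ (τ * p I e)) (*-monoˡ-nn (τ * p I e) (0≤τ ⊗ 0≤p e) (ι≤1 (not (crucial e))))) (*≤1 0≤τ (p-le1 I e)))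

      module S₂ = EdgeStep γ κ 0≤γ 0≤κ κγ I σ 0≤σ σ≤1 β₁ δ 0≤δ Sτ≤ 0≤β₁ β₁≤

      base₂ : ∀ e → S₂.base e ≡ y₁ e
      base₂ e = trans (*-assoc (ζ₁ e) (minor e * (τ * p I e)) (σ e)) (trans (cong (λ z → ζ₁ e * z) (proj₂ (proj₂ (σ-facts e)))) (sym (y₁-eq e)))

      deg₂ : ∀ u → degree-of S₂.base u ≡ degree-of y₁ u
      deg₂ u = ∑-cong (λ e → cong (λ z → ι (inc I e u) * z) (base₂ e))

      y₂ : EdgeSet (m I) → Fin (m I) → ℚ
      y₂ B e = S₂.step B e * (P B (end₁ I e) * P B (end₂ I e))

      PP≤1 : ∀ B e → P B (end₁ I e) * P B (end₂ I e) ≤ 1ℚ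
      PP≤1 B e = ≤-trans (*≤1 (0≤ι (sparse-at B (end₁ I e))) (ι≤1 (sparse-at B (end₂ I e)))) (ι≤1 (sparse-at B (end₁ I e)))

      0≤PP : ∀ B e → 0ℚ ≤ P B (end₁ I e) * P B (end₂ I e)
      0≤PP B e = 0≤ι (sparse-at B (end₁ I e)) ⊗ 0≤ι (sparse-at B (end₂ I e))

      load₂ : ∀ B u → degree-of (y₂ B) u ≤ degree-of y u + (γ + γ)
      load₂ B u = ≤-trans (∑-mono (λ e → *-monoʳ-nn (ι (inc I e u)) (0≤ι (inc I e u)) (*≤1 (S₂.step-nn B e) (PP≤1 B e))))
        (≤-trans (S₂.step-load B u) (≤-trans (+-monoˡ-≤ γ (≤-trans (≡⇒≤ (deg₂ u)) (load₁ u))) (≡⇒≤ (+-assoc (degree-of y u) γ γ))))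

      -- Two losses add up: that of the filter, by Chebyshev, and that of the pruning, by Markov.
      -- The latter depends on how many edges are sampled at the ends of `e`, given that `e` itself
      -- is sampled.
      E-y₂ : ∀ e → (1ℚ - ε) * y₁ e ≤ E queries (λ B → y₂ B e)
      E-y₂ e = ≤-trans budget (≤-trans (+-mono-≤ (≤-trans (≡⇒≤ (cong (λ z → z * (1ℚ - κ * (six * δ))) (sym (base₂ e)))) (S₂.E-step bound e)) (neg-mono loss))
          (≤-trans (≡⇒≤ (sym expand)) (E-mono queries pointwise)))
        where
        six : ℚ
        six = ℤ.+ 6 / 1
        bound : ∀ u → degree-of S₂.base u ≤ two
        bound u = ≤-trans (≡⇒≤ (deg₂ u)) (≤-trans (load₁ u) (≤-trans (by-gap (0≤γ ⊕ 0≤γ) (lem (degree-of y u) γ)) (bounded₂ (bounded u))))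
          where
          lem : ∀ x g → g + g ≡ x + (g + g + g) - (x + g)
          lem = solve 2 (λ x g → g :+ g := x :+ (g :+ g :+ g) :- (x :+ g)) refl
        neg-mono : ∀ {a b} → a ≤ b → - b ≤ - a
        neg-mono {a} {b} h = by-gap (gap h) (lem a b)
          where
          lem : ∀ a b → b - a ≡ - a - (- b)
          lem = solve 2 (λ a b → b :- a := :- a :- (:- b)) refl
        -- the edges at u that were sampled, in units of 1 / (τ pmin)
        crowd : EdgeSet (m I) → Fin (n I) → ℚ
        crowd B u = ι (lookup B e) * minor-degree B u
        -- Given that `e` is sampled, the expected number of sampled minor edges at `u` is at most
        -- the unconditional one plus 1. In the unit `scale` each of these two parts is at most 1.
        E-crowd : ∀ u → scale * E queries (λ B → crowd B u) ≤ two * σ e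
        E-crowd u = ≤-trans (*-monoʳ-nn scale 0≤scale (Query.sampled-mean (λ f → ι (inc I f u ∧ not (crucial f))) 1ℚ (λ f
            → 0≤ι (inc I f u ∧ not (crucial f))) (λ f → ι≤1 (inc I f u ∧ not (crucial f))) e))
          (≤-trans (≡⇒≤ (lem scale (σ e) mean))
          (≤-trans (*-monoʳ-nn (σ e) (0≤σ e) (+-mono-≤ few (≤-trans (*≤1 0≤τ (proj₁ (proj₂ pmin-facts))) τ≤1))) (≡⇒≤ (*-comm (σ e) two))))
          where
          mean : ℚ
          mean = ∑ (λ f → ι (inc I f u ∧ not (crucial f)) * σ f)
          lem : ∀ s t m → s * (t * (m + 1ℚ)) ≡ t * (s * m + s)
          lem = solve 3 (λ s t m → s :* (t :* (m :+ con 1ℚ)) := t :* (s :* m :+ s)) refl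
          lem₁ : ∀ t q i c s → t * q * (i * c * s) ≡ i * (q * (c * t * s))
          lem₁ = solve 5 (λ t q i c s → t :* q :* (i :* c :* s) := i :* (q :* (c :* t :* s))) refl
          few : scale * mean ≤ 1ℚ
          few = ≤-trans (≡⇒≤ (sym (∑-*ˡ scale (λ f → ι (inc I f u ∧ not (crucial f)) * σ f))))
            (≤-trans (∑-mono term) (x-load u))
            where
            term : ∀ f → scale * (ι (inc I f u ∧ not (crucial f)) * σ f) ≤ ι (inc I f u) * x f
            term f = ≤-trans (≡⇒≤ (trans (cong (λ z → scale * (z * σ f)) (ι-∧ (inc I f u) (not (crucial f)))) (lem₁ τ (pmin I) (ι (inc I f u))
                (minor f) (σ f))))
              (*-monoʳ-nn (ι (inc I f u)) (0≤ι (inc I f u)) (≤-trans (*-monoˡ-nn (minor f * τ * σ f) ((0≤ι (not (crucial f)) ⊗ 0≤τ) ⊗ 0≤σ f) (proj₂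
                  (proj₂ pmin-facts) f))
                (≤-trans (≡⇒≤ (trans (lem₄ (p I f) (minor f) τ (σ f)) (proj₂ (proj₂ (σ-facts f)))))
                  (≤-resp refl (*-identityˡ (x f)) (*-monoˡ-nn (x f) (0≤x f) (ι≤1 (not (crucial f))))))))
              where
              lem₄ : ∀ p c t s → p * (c * t * s) ≡ c * (t * p) * s
              lem₄ = solve 4 (λ p c t s → p :* (c :* t :* s) := c :* (t :* p) :* s) refl
        -- The value before pruning is at most `ι (lookup B e) * β₁ e`, so the pruning loss is
        -- dominated by this product, whose expectation `E-crowd` controls.
        excess : EdgeSet (m I) → ℚ
        excess B = β₁ e * (Λ * (scale * (crowd B (end₁ I e) + crowd B (end₂ I e))))
        E-excess : E queries excess ≡ β₁ e * (Λ * (scale * E queries (λ B → crowd B (end₁ I e)) + scale * E queries (λ B → crowd B (end₂ I e))))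
        E-excess = trans (E-*ˡ queries (β₁ e) (λ B → Λ * (scale * (crowd B (end₁ I e) + crowd B (end₂ I e)))))
          (cong (λ z → β₁ e * z) (trans (E-*ˡ queries Λ (λ B → scale * (crowd B (end₁ I e) + crowd B (end₂ I e))))
            (cong (λ z → Λ * z) (trans (E-*ˡ queries scale (λ B → crowd B (end₁ I e) + crowd B (end₂ I e)))
              (trans (cong (λ z → scale * z) (E-+ queries (λ B → crowd B (end₁ I e)) (λ B → crowd B (end₂ I e)))) (*-distribˡ-+ scale _ _))))))
        loss : E queries excess ≤ ℤ.+ 4 / 1 * Λ * y₁ e
        loss = ≤-trans (≡⇒≤ E-excess) (≤-trans (*-monoʳ-nn (β₁ e) (0≤β₁ e) (*-monoʳ-nn Λ 0≤Λ (+-mono-≤ (E-crowd (end₁ I e)) (E-crowd (end₂ I e)))))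
          (≡⇒≤ (trans (lem (β₁ e) Λ (σ e)) (cong (λ z → ℤ.+ 4 / 1 * Λ * z) (base₂ e)))))
          where
          lem : ∀ b l s → b * (l * (two * s + two * s)) ≡ ℤ.+ 4 / 1 * l * (b * s)
          lem = solve 3 (λ b l s → b :* (l :* (con two :* s :+ con two :* s)) := con (ℤ.+ 4 / 1) :* l :* (b :* s)) refl
        expand : E queries (λ B → S₂.step B e - excess B) ≡ E queries (λ B → S₂.step B e) + - E queries excess
        expand = E-- queries (λ B → S₂.step B e) excess
        pointwise : ∀ B → S₂.step B e - excess B ≤ y₂ B e
        pointwise B = by-gap ((S₂.step-nn B e ⊗ 0≤prod) ⊕ gap capped ⊗ 0≤Λ ⊗ 0≤scale ⊗ (0≤d₁ ⊕ 0≤d₂))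
            (lem (S₂.step B e) (P₁ * P₂) Λ scale d₁ d₂ (ι (lookup B e)) (β₁ e))
          where
          P₁ P₂ d₁ d₂ : ℚ
          P₁ = P B (end₁ I e)
          P₂ = P B (end₂ I e)
          d₁ = minor-degree B (end₁ I e)
          d₂ = minor-degree B (end₂ I e)
          0≤d₁ : 0ℚ ≤ d₁
          0≤d₁ = ∑-nn (λ f → 0≤ι (inc I f (end₁ I e) ∧ not (crucial f)) ⊗ 0≤ι (lookup B f))
          0≤d₂ : 0ℚ ≤ d₂
          0≤d₂ = ∑-nn (λ f → 0≤ι (inc I f (end₂ I e) ∧ not (crucial f)) ⊗ 0≤ι (lookup B f))
          lem₀ : ∀ a b s t → (a - (1ℚ - s)) + (b - (1ℚ - t)) + (1ℚ - a) * (1ℚ - b) ≡ a * b - (1ℚ - (s + t))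
          lem₀ = solve 4 (λ a b s t → (a :- (con 1ℚ :- s)) :+ (b :- (con 1ℚ :- t)) :+ (con 1ℚ :- a) :* (con 1ℚ :- b) := a :* b :- (con 1ℚ :- (s :+ t))) refl
          lem₀' : ∀ a b s t l c → a * b - (1ℚ - (l * (c * s) + l * (c * t))) ≡ a * b - (1ℚ - l * (c * (s + t)))
          lem₀' = solve 6 (λ a b s t l c → a :* b :- (con 1ℚ :- (l :* (c :* s) :+ l :* (c :* t))) := a :* b :- (con 1ℚ :- l :* (c :* (s :+ t)))) refl
          0≤prod : 0ℚ ≤ P₁ * P₂ - (1ℚ - Λ * (scale * (d₁ + d₂)))
          0≤prod = ≤-resp refl (trans (lem₀ P₁ P₂ (Λ * (scale * d₁)) (Λ * (scale * d₂))) (lem₀' P₁ P₂ d₁ d₂ Λ scale))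
            ((gap (P-≥ B (end₁ I e)) ⊕ gap (P-≥ B (end₂ I e))) ⊕ gap (ι≤1 (sparse-at B (end₁ I e))) ⊗ gap (ι≤1 (sparse-at B (end₂ I e))))
          capped : S₂.step B e ≤ ι (lookup B e) * β₁ e
          capped = ≤-trans (≡⇒≤ (S₂.step-keep B e)) (*-monoˡ-nn (β₁ e) (0≤β₁ e) (S₂.keep≤ι B e))
          lem : ∀ s q l c a b i z → s * (q - (1ℚ - l * (c * (a + b)))) + (i * z - s) * (l * (c * (a + b))) ≡ s * q - (s - z * (l * (c * (i * a + i * b))))
          lem = solve 8 (λ s q l c a b i z → s :* (q :- (con 1ℚ :- l :* (c :* (a :+ b)))) :+ (i :* z :- s) :* (l :* (c :* (a :+ b)))
              := s :* q :- (s :- z :* (l :* (c :* (i :* a :+ i :* b))))) refl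
        -- The parameters leave room for the constant 64 of the random sides; this step spends 6,
        -- and 58 is the surplus.
        budget : (1ℚ - ε) * y₁ e ≤ y₁ e * (1ℚ - κ * (six * δ)) + - (ℤ.+ 4 / 1 * Λ * y₁ e)
        budget = by-gap ((gap small ⊕ 0≤κ ⊗ (ν ⊗ 0≤δ)) ⊗ S₁.split-nn ω e) (lem ε κ δ Λ (y₁ e))
          where
          ν : 0ℚ ≤ ℤ.+ 58 / 1
          ν = nonNegative⁻¹ (ℤ.+ 58 / 1)
          lem : ∀ ε k d l y → (ε - (k * (ℤ.+ 64 / 1 * d) + ℤ.+ 4 / 1 * l) + k * (ℤ.+ 58 / 1 * d)) * y
              ≡ y * (1ℚ - k * (six * d)) + - (ℤ.+ 4 / 1 * l * y) - (1ℚ - ε) * y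
          lem = solve 5 (λ ε k d l y → (ε :- (k :* (con (ℤ.+ 64 / 1) :* d) :+ con (ℤ.+ 4 / 1) :* l) :+ k :* (con (ℤ.+ 58 / 1) :* d)) :* y
            := y :* (con 1ℚ :- k :* (con six :* d)) :+ :- (con (ℤ.+ 4 / 1) :* l :* y) :- (con 1ℚ :- ε) :* y) refl

      module Queried (B : EdgeSet (m I)) where

        -- Value on an edge that is queried and realized. Up to the filters this happens to a minor
        -- edge with probability `x e / τ`, so the value is `ζ₁ e * τ`, in which `p I e` has
        -- cancelled: the query probabilities have their form in order to keep single edges small.
        β₂ : Fin (m I) → ℚ
        β₂ e = S₂.keep B e * (P B (end₁ I e) * P B (end₂ I e)) * (ζ₁ e * (minor e * τ))

        0≤kP : ∀ e → 0ℚ ≤ S₂.keep B e * (P B (end₁ I e) * P B (end₂ I e))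
        0≤kP e = S₂.keep-nn B e ⊗ 0≤PP B e

        0≤β₂ : ∀ e → 0ℚ ≤ β₂ e
        0≤β₂ e = 0≤kP e ⊗ 0≤ζ₁ e ⊗ 0≤ι (not (crucial e)) ⊗ 0≤τ

        β₂≤ : ∀ e → β₂ e ≤ δ
        β₂≤ e = ≤-trans (≤-resp refl (*-identityˡ (ζ₁ e * (minor e * τ))) (*-monoˡ-nn (ζ₁ e * (minor e * τ)) (0≤ζ₁ e ⊗ 0≤ι (not (crucial e)) ⊗ 0≤τ)
            (≤-trans (*≤1 (S₂.keep-nn B e) (PP≤1 B e)) (≤-trans (S₂.keep≤ι B e) (ι≤1 (lookup B e))))))
          (*-mono-nn (0≤ζ₁ e) (ζ₁≤ e) (0≤ι (not (crucial e)) ⊗ 0≤τ) (≤-resp refl (*-identityˡ τ) (*-monoˡ-nn τ 0≤τ (ι≤1 (not (crucial e))))))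

        module S₃ = EdgeStep γ κ 0≤γ 0≤κ κγ I (p I) 0≤p (p-le1 I) β₂ δ 0≤δ Sτ≤ 0≤β₂ β₂≤

        base₃ : ∀ e → S₃.base e ≡ y₂ B e
        base₃ e = trans (lem (S₂.keep B e) (P B (end₁ I e) * P B (end₂ I e)) (ζ₁ e) (minor e) τ (p I e))
          (cong (λ z → z * (P B (end₁ I e) * P B (end₂ I e))) (sym (S₂.step-keep B e)))
          where
          lem : ∀ k q z c t p → k * q * (z * (c * t)) * p ≡ k * (z * (c * (t * p))) * q
          lem = solve 6 (λ k q z c t p → k :* q :* (z :* (c :* t)) :* p := k :* (z :* (c :* (t :* p))) :* q) refl

        deg₃ : ∀ u → degree-of S₃.base u ≡ degree-of (y₂ B) u
        deg₃ u = ∑-cong (λ e → cong (λ z → ι (inc I e u) * z) (base₃ e))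

        z : EdgeSet (m I) → Fin (m I) → ℚ
        z R e = S₃.step R e

        0≤z : ∀ R e → 0ℚ ≤ z R e
        0≤z R e = S₃.step-nn R e

        load₃ : ∀ R u → degree-of (z R) u ≤ degree-of y u + (γ + γ + γ)
        load₃ R u = ≤-trans (S₃.step-load R u) (≤-trans (+-monoˡ-≤ γ (≤-trans (≡⇒≤ (deg₃ u)) (load₂ B u))) (≡⇒≤ (+-assoc (degree-of y u) (γ + γ) γ)))

        E-z : ∀ e → (1ℚ - ε) * y₂ B e ≤ E real (λ R → z R e)
        E-z e = ≤-trans budget (≤-trans (≡⇒≤ (cong (λ z → z * (1ℚ - κ * (S₃.six * δ))) (sym (base₃ e)))) (S₃.E-step bound e))
          where
          bound : ∀ u → degree-of S₃.base u ≤ two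
          bound u = ≤-trans (≡⇒≤ (deg₃ u)) (≤-trans (load₂ B u) (≤-trans (by-gap 0≤γ (lem (degree-of y u) γ)) (bounded₂ (bounded u))))
            where
            lem : ∀ x g → g ≡ x + (g + g + g) - (x + (g + g))
            lem = solve 2 (λ x g → g := x :+ (g :+ g :+ g) :- (x :+ (g :+ g))) refl
          0≤y₂ : 0ℚ ≤ y₂ B e
          0≤y₂ = S₂.step-nn B e ⊗ 0≤PP B e
          budget : (1ℚ - ε) * y₂ B e ≤ y₂ B e * (1ℚ - κ * (S₃.six * δ))
          budget = by-gap (((gap small ⊕ 0≤κ ⊗ (nonNegative⁻¹ (ℤ.+ 58 / 1) ⊗ 0≤δ)) ⊕ nonNegative⁻¹ (ℤ.+ 4 / 1) ⊗ 0≤Λ) ⊗ 0≤y₂) (lem ε κ δ Λ (y₂ B e))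
            where
            lem : ∀ ε k d l y → (ε - (k * (ℤ.+ 64 / 1 * d) + ℤ.+ 4 / 1 * l) + k * (ℤ.+ 58 / 1 * d) + ℤ.+ 4 / 1 * l) * y
                ≡ y * (1ℚ - k * (ℤ.+ 6 / 1 * d)) - (1ℚ - ε) * y
            lem = solve 5 (λ ε k d l y → (ε :- (k :* (con (ℤ.+ 64 / 1) :* d) :+ con (ℤ.+ 4 / 1) :* l) :+ k :* (con (ℤ.+ 58 / 1) :* d)
                :+ con (ℤ.+ 4 / 1) :* l) :* y
              := y :* (con 1ℚ :- k :* (con (ℤ.+ 6 / 1) :* d)) :- (con 1ℚ :- ε) :* y) refl

        -- z lives on crossing, queried, realized minor edges where y is positive
        z-zero : ∀ R e → (ζ₁ e ≡ 0ℚ) ⊎ (crucial e ≡ true) ⊎ (lookup (Q B) e ≡ false) ⊎ (lookup R e ≡ false) → z R e ≡ 0ℚ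
        z-zero R e h = trans (S₃.step-keep R e) (go h)
          where
          l₁ : ∀ k a b → k * (a * (0ℚ * b)) ≡ 0ℚ
          l₁ = solve 3 (λ k a b → k :* (a :* (con 0ℚ :* b)) := con 0ℚ) refl
          l₂ : ∀ k a b c → k * (a * (b * (0ℚ * c))) ≡ 0ℚ
          l₂ = solve 4 (λ k a b c → k :* (a :* (b :* (con 0ℚ :* c))) := con 0ℚ) refl
          l₃ : ∀ k a → k * (0ℚ * a) ≡ 0ℚ
          l₃ = solve 2 (λ k a → k :* (con 0ℚ :* a) := con 0ℚ) refl
          β₂-zero : S₂.keep B e * (P B (end₁ I e) * P B (end₂ I e)) ≡ 0ℚ → S₃.keep R e * β₂ e ≡ 0ℚ
          β₂-zero q = trans (cong (λ z → S₃.keep R e * (z * (ζ₁ e * (minor e * τ)))) q) (l₃ (S₃.keep R e) (ζ₁ e * (minor e * τ)))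
          unqueried : ∀ b s t → lookup B e ≡ b → sparse-at B (end₁ I e) ≡ s → sparse-at B (end₂ I e) ≡ t → crucial e ∨ (b ∧ (s ∧ t)) ≡ false →
                      S₂.keep B e * (P B (end₁ I e) * P B (end₂ I e)) ≡ 0ℚ
          unqueried false s t eb es et _ = trans (cong (λ b → ι b * g * (P B (end₁ I e) * P B (end₂ I e))) eb) (l₄ g (P B (end₁ I e) * P B (end₂ I e)))
            where
            g : ℚ
            g = S₂.goods B e
            l₄ : ∀ a b → 0ℚ * a * b ≡ 0ℚ
            l₄ = solve 2 (λ a b → con 0ℚ :* a :* b := con 0ℚ) refl
          unqueried true false t eb es et _ = trans (cong (λ s → S₂.keep B e * (ι s * P B (end₂ I e))) es) (l₅ (S₂.keep B e) (P B (end₂ I e)))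
            where
            l₅ : ∀ k a → k * (0ℚ * a) ≡ 0ℚ
            l₅ = solve 2 (λ k a → k :* (con 0ℚ :* a) := con 0ℚ) refl
          unqueried true true false eb es et _ = trans (cong (λ t → S₂.keep B e * (P B (end₁ I e) * ι t)) et) (l₆ (S₂.keep B e) (P B (end₁ I e)))
            where
            l₆ : ∀ k a → k * (a * 0ℚ) ≡ 0ℚ
            l₆ = solve 2 (λ k a → k :* (a :* con 0ℚ) := con 0ℚ) refl
          unqueried true true true eb es et q = ⊥-elim (true≢false (∨-zeroʳ (crucial e)) q)
          go : (ζ₁ e ≡ 0ℚ) ⊎ (crucial e ≡ true) ⊎ (lookup (Q B) e ≡ false) ⊎ (lookup R e ≡ false) → S₃.keep R e * β₂ e ≡ 0ℚ
          go (inj₁ q) = trans (cong (λ z → S₃.keep R e * (kP * (z * (minor e * τ)))) q) (l₁ (S₃.keep R e) kP (minor e * τ))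
            where
            kP : ℚ
            kP = S₂.keep B e * (P B (end₁ I e) * P B (end₂ I e))
          go (inj₂ (inj₁ q)) = trans (cong (λ b → S₃.keep R e * (kP * (ζ₁ e * (ι (not b) * τ)))) q) (l₂ (S₃.keep R e) kP (ζ₁ e) τ)
            where
            kP : ℚ
            kP = S₂.keep B e * (P B (end₁ I e) * P B (end₂ I e))
          go (inj₂ (inj₂ (inj₁ q))) = β₂-zero (unqueried (lookup B e) (sparse-at B (end₁ I e)) (sparse-at B (end₂ I e)) refl refl refl
            (trans (sym (lookup∘tabulate _ e)) q))
          go (inj₂ (inj₂ (inj₂ q))) = trans (cong (λ b → ι b * S₃.goods R e * β₂ e) q) (l₇ (S₃.goods R e) (β₂ e))
            where
            l₇ : ∀ a b → 0ℚ * a * b ≡ 0ℚ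
            l₇ = solve 2 (λ a b → con 0ℚ :* a :* b := con 0ℚ) refl

-- Matchings that combine a fixed crucial matching with sampled minor edges

module Assembly (params : Parameters) (I : Instance) where

  open Parameters params
  open Neighbourhood I
  open Sparse params I

  -- `S'` supplies the crucial edges and contains `K`, while the minor edges are realized afresh. In
  -- `feasible` a scheme declares how its weights `θ` on `K` and `ψ` on the minor edges fit
  -- together: they must cope with every `z` that can survive the three experiments, whose loads
  -- exceed those of `ζ e * xN e` by up to `3 γ`.
  module _ (K : EdgeSet (m I)) (K-match : IsMatching I K) (K-crucial : ∀ e → lookup K e ≡ true → crucial e ≡ true)
           (ζ : Fin (m I) → ℚ) (0≤ζ : ∀ e → 0ℚ ≤ ζ e) (ζ≤S : ∀ e → ζ e ≤ S)
           (bounded : ∀ u → degree-of (λ e → ζ e * xN e) u ≤ 1ℚ + γ)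
           (θ ψ : Fin (m I) → ℚ) (0≤θ : ∀ e → 0ℚ ≤ θ e) (0≤ψ : ∀ e → 0ℚ ≤ ψ e)
           (feasible : ∀ z → (∀ e → 0ℚ ≤ z e) → (∀ e → ζ e ≡ 0ℚ → z e ≡ 0ℚ) →
                       (∀ u → degree-of z u ≤ degree-of (λ e → ζ e * xN e) u + (γ + γ + γ)) →
                       ∀ u → ∑ (λ e → ι (inc I e u) * (ι (lookup K e) * θ e + ψ e * z e)) ≤ 1ℚ)
           (S' : EdgeSet (m I)) (K⊆S' : Sub K S') where

    open Pipeline.At params I K K-match K-crucial ζ 0≤ζ ζ≤S bounded
    open Bipartition I K K-match using (side; sides; K-crosses)

    module One (ω : Vec Bool (n I)) (B R : EdgeSet (m I)) where

      open Sided ω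
      open Queried B

      -- Keeping only the crossing edges makes the graph bipartite, and `K` survives by the choice
      -- of the sides.
      H H' : EdgeSet (m I)
      H  = Q B ∩ₑ mix crucial S' R
      H' = tabulate (λ e → lookup H e ∧ (side ω (end₁ I e) xor side ω (end₂ I e)))

      f : Fin (m I) → ℚ
      f e = ι (lookup K e) * θ e + ψ e * z R e

      lookup-H : ∀ e → lookup H e ≡ lookup (Q B) e ∧ (if crucial e then lookup S' e else lookup R e)
      lookup-H e = trans (lookup-zipWith _∧_ e (Q B) (mix crucial S' R)) (cong (lookup (Q B) e ∧_) (lookup-mix crucial S' R e))

      xor-≢ : ∀ a b → a xor b ≡ true → a ≢ b
      xor-≢ true  true  () refl
      xor-≢ false false () refl

      ≢-xor : ∀ a b → a ≢ b → a xor b ≡ true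
      ≢-xor true  true  h = ⊥-elim (h refl)
      ≢-xor true  false h = refl
      ≢-xor false true  h = refl
      ≢-xor false false h = ⊥-elim (h refl)

      crosses : ∀ e → lookup H' e ≡ true → Crosses I (side ω) e
      crosses e h = xor-≢ _ _ (proj₂ (∧-true {lookup H e} (∈-tabulate _ e h)))

      K⊆H' : ∀ e → lookup K e ≡ true → lookup H' e ≡ true
      K⊆H' e h = tabulate-∈ _ e (cong₂ _∧_
        (trans (lookup-H e) (cong₂ _∧_ (tabulate-∈ _ e (cong (_∨ (lookup B e ∧ (sparse-at B (end₁ I e) ∧ sparse-at B (end₂ I e)))) (K-crucial e h)))
          (trans (cong (λ c → if c then lookup S' e else lookup R e) (K-crucial e h)) (K⊆S' e h))))
        (≢-xor _ _ (K-crosses ω e h)))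

      0≤f : ∀ e → 0ℚ ≤ f e
      0≤f e = 0≤ι (lookup K e) ⊗ 0≤θ e ⊕ 0≤ψ e ⊗ 0≤z R e

      z-out : ∀ e → lookup H' e ≡ false → z R e ≡ 0ℚ
      z-out e h = go (crucial e) (lookup (Q B) e) (lookup R e) (side ω (end₁ I e) xor side ω (end₂ I e)) refl refl refl refl
        where
        go : ∀ c q r s → crucial e ≡ c → lookup (Q B) e ≡ q → lookup R e ≡ r → (side ω (end₁ I e) xor side ω (end₂ I e)) ≡ s → z R e ≡ 0ℚ
        go true q r s ec eq er es = z-zero R e (inj₂ (inj₁ ec))
        go false false r s ec eq er es = z-zero R e (inj₂ (inj₂ (inj₁ eq)))
        go false true false s ec eq er es = z-zero R e (inj₂ (inj₂ (inj₂ er)))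
        go false true true false ec eq er es = z-zero R e (inj₁ (trans (cong (λ b → S₁.two * (ι b * g) * ζ e) es) (lem S₁.two g (ζ e))))
          where
          g : ℚ
          g = S₁.goods ω e
          lem : ∀ t g z → t * (0ℚ * g) * z ≡ 0ℚ
          lem = solve 3 (λ t g z → t :* (con 0ℚ :* g) :* z := con 0ℚ) refl
        go false true true true ec eq er es = ⊥-elim (true≢false (tabulate-∈ _ e (cong₂ _∧_
          (trans (lookup-H e) (cong₂ _∧_ eq (trans (cong (λ c → if c then lookup S' e else lookup R e) ec) er))) es)) h)

      f-supp : ∀ e → lookup H' e ≡ false → f e ≡ 0ℚ
      f-supp e h = trans (cong₂ (λ a b → ι a * θ e + ψ e * b) K∌e (z-out e h)) (lem (θ e) (ψ e))
        where
        K∌e : lookup K e ≡ false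
        K∌e = ¬true⇒false (λ p → true≢false (K⊆H' e p) h)
        lem : ∀ a b → 0ℚ * a + b * 0ℚ ≡ 0ℚ
        lem = solve 2 (λ a b → con 0ℚ :* a :+ b :* con 0ℚ := con 0ℚ) refl

      load : ∀ u → ∑ (λ e → ι (inc I e u) * f e) ≤ 1ℚ
      load = feasible (z R) (0≤z R)
        (λ e h → z-zero R e (inj₁ (trans (cong (λ x → S₁.factor ω e * x) h) (*-zeroʳ (S₁.factor ω e)))))
        (load₃ R)

      bound : ∑ (λ e → f e * w I e) ≤ mwm I H
      bound = ≤-trans (Rounding.rounding I (side ω) H' crosses f 0≤f f-supp load)
        (mwm-mono I {H'} {H} (λ e h → proj₁ (∧-true {lookup H e} (∈-tabulate (λ e → lookup H e ∧ (side ω (end₁ I e) xor side ω (end₂ I e))) e h))))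

    value : ℚ
    value = E queries (λ B → E real (λ R → mwm I (Q B ∩ₑ mix crucial S' R)))

    part : ℚ
    part = ∑ (λ e → ι (lookup K e) * θ e * w I e)

    gain : Fin (m I) → ℚ
    gain e = ψ e * w I e

    0≤gain : ∀ e → 0ℚ ≤ gain e
    0≤gain e = 0≤ψ e ⊗ w-nonneg I e

    E³ : (Vec Bool (n I) → EdgeSet (m I) → EdgeSet (m I) → ℚ) → ℚ
    E³ f = E sides (λ ω → E queries (λ B → E real (λ R → f ω B R)))

    E³-mono : ∀ {f g} → (∀ ω B R → f ω B R ≤ g ω B R) → E³ f ≤ E³ g
    E³-mono h = E-mono sides (λ ω → E-mono queries (λ B → E-mono real (λ R → h ω B R)))

    E³-z : ∀ e → (1ℚ - ε) * ((1ℚ - ε) * ((1ℚ - ε) * y e)) ≤ E³ (λ ω B R → Sided.Queried.z ω B R e)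
    E³-z e = ≤-trans (*-monoʳ-nn (1ℚ - ε) r (*-monoʳ-nn (1ℚ - ε) r E-y₁))
      (≤-trans (≡⇒≤ (sym (trans (E-*ˡ sides (1ℚ - ε) (λ ω → (1ℚ - ε) * Sided.y₁ ω e)) (cong (λ z → (1ℚ - ε) * z) (E-*ˡ sides (1ℚ - ε) (λ ω → Sided.y₁ ω e))))))
      (E-mono sides (λ ω → ≤-trans (*-monoʳ-nn (1ℚ - ε) r (Sided.E-y₂ ω e))
        (≤-trans (≡⇒≤ (sym (E-*ˡ queries (1ℚ - ε) (λ B → Sided.y₂ ω B e))))
          (E-mono queries (λ B → Sided.Queried.E-z ω B e))))))
      where
      r : 0ℚ ≤ 1ℚ - ε
      r = gap ε≤1
      E-y₁ : (1ℚ - ε) * y e ≤ E sides (λ ω → Sided.y₁ ω e)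
      E-y₁ = ≤-trans (by-gap (0≤y e ⊗ ((gap small ⊕ 0≤κ ⊗ nonNegative⁻¹ (ℤ.+ 64 / 1) ⊗ 0≤S ⊗ 0≤τ)
          ⊕ nonNegative⁻¹ (ℤ.+ 4 / 1) ⊗ 0≤Λ)) (lem ε κ S τ Λ (y e))) (S₁.E-split e)
        where
        lem : ∀ ε k s t l y → y * (ε - (k * (ℤ.+ 64 / 1 * (ℤ.+ 2 / 1 * s * t)) + ℤ.+ 4 / 1 * l) + k * (ℤ.+ 64 / 1 * (s * t)) + ℤ.+ 4 / 1 * l)
            ≡ y * (1ℚ - k * (ℤ.+ 64 / 1 * (s * t))) - (1ℚ - ε) * y
        lem = solve 6 (λ ε k s t l y → y :* (ε :- (k :* (con (ℤ.+ 64 / 1) :* (con (ℤ.+ 2 / 1) :* s :* t)) :+ con (ℤ.+ 4 / 1) :* l)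
            :+ k :* (con (ℤ.+ 64 / 1) :* (s :* t)) :+ con (ℤ.+ 4 / 1) :* l)
          := y :* (con 1ℚ :- k :* (con (ℤ.+ 64 / 1) :* (s :* t))) :- (con 1ℚ :- ε) :* y) refl

    E³-sum : ∀ (g : Fin (m I) → ℚ) (f : Fin (m I) → Vec Bool (n I) → EdgeSet (m I) → EdgeSet (m I) → ℚ) →
             E³ (λ ω B R → ∑ (λ e → g e * f e ω B R)) ≡ ∑ (λ e → g e * E³ (f e))
    E³-sum g f = trans (E-cong sides (λ ω → trans (E-cong queries (λ B → pull real (λ e R → f e ω B R))) (pull queries (λ e B → E real (λ R → f e ω B R)))))
        (pull sides (λ e ω → E queries (λ B → E real (λ R → f e ω B R))))
      where
      pull : ∀ {Ω : Set} (d : D Ω) (h : Fin (m I) → Ω → ℚ) → E d (λ o → ∑ (λ e → g e * h e o)) ≡ ∑ (λ e → g e * E d (h e))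
      pull d h = trans (E-∑ d (λ e o → g e * h e o)) (∑-cong (λ e → E-*ˡ d (g e) (h e)))

    -- For every outcome the fractional solution is rounded inside the realized part of `Q B`.
    -- Averaging costs the minor edges one factor `1ℚ - ε` for each of the three experiments; the
    -- part on `K` is deterministic and loses nothing.
    assembled : part + ∑ (λ e → gain e * ((1ℚ - ε) * ((1ℚ - ε) * ((1ℚ - ε) * y e)))) ≤ value
    assembled = ≤-trans (+-monoʳ-≤ part (∑-mono (λ e → *-monoʳ-nn (gain e) (0≤gain e) (E³-z e))))
      (≤-trans (≡⇒≤ (sym both)) (≤-trans (E³-mono (λ ω B R → ≤-trans (≡⇒≤ (sym (rearrange ω B R))) (One.bound ω B R)))
        (≡⇒≤ (E-const sides value))))
      where
      zz : Fin (m I) → Vec Bool (n I) → EdgeSet (m I) → EdgeSet (m I) → ℚ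
      zz e ω B R = Sided.Queried.z ω B R e
      lem : ∀ k t p z w → (k * t + p * z) * w ≡ k * t * w + p * w * z
      lem = solve 5 (λ k t p z w → (k :* t :+ p :* z) :* w := k :* t :* w :+ p :* w :* z) refl
      rearrange : ∀ ω B R → ∑ (λ e → One.f ω B R e * w I e) ≡ part + ∑ (λ e → gain e * zz e ω B R)
      rearrange ω B R = trans (∑-cong (λ e → lem (ι (lookup K e)) (θ e) (ψ e) (zz e ω B R) (w I e)))
        (∑-+ (λ e → ι (lookup K e) * θ e * w I e) (λ e → gain e * zz e ω B R))
      split₁ : ∀ {Ω : Set} (d : D Ω) (h : Ω → ℚ) → E d (λ o → part + h o) ≡ part + E d h
      split₁ d h = trans (E-+ d (λ _ → part) h) (cong (λ z → z + E d h) (E-const d part))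
      both : E³ (λ ω B R → part + ∑ (λ e → gain e * zz e ω B R)) ≡ part + ∑ (λ e → gain e * E³ (zz e))
      both = trans (E-cong sides (λ ω → trans (E-cong queries (λ B → split₁ real (λ R → ∑ (λ e → gain e * zz e ω B R))))
          (split₁ queries (λ B → E real (λ R → ∑ (λ e → gain e * zz e ω B R))))))
        (trans (split₁ sides (λ ω → E queries (λ B → E real (λ R → ∑ (λ e → gain e * zz e ω B R)))))
          (cong (λ z → part + z) (E³-sum gain zz)))

-- The first scheme: the crucial part of an optimum, completed fractionally

module Crucial-first (params : Parameters) (0<γ : 0ℚ < Parameters.γ params) (1≤S : 1ℚ ≤ Parameters.S params) (I : Instance) where

  open Parameters params
  open Neighbourhood I
  open Sparse params I

  Γ : ℚ
  Γ = γ + γ + γ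

  0<Γ : 0ℚ < Γ
  0<Γ = <-≤-trans 0<γ (by-gap (0≤γ ⊕ 0≤γ) (lem γ))
    where
    lem : ∀ g → g + g ≡ g + g + g - g
    lem = solve 1 (λ g → g :+ g := g :+ g :+ g :- g) refl

  c : Fin (n I) → ℚ
  c u = degree-of xC u

  0≤c : ∀ u → 0ℚ ≤ c u
  0≤c u = ∑-nn (λ e → 0≤ι (inc I e u) ⊗ 0≤xC e)

  0≤deg-xN : ∀ u → 0ℚ ≤ degree-of xN u
  0≤deg-xN u = ∑-nn (λ e → 0≤ι (inc I e u) ⊗ 0≤xN e)

  c≤1 : ∀ u → c u ≤ 1ℚ
  c≤1 u = ≤-trans (by-gap (0≤deg-xN u) (lem (c u) (degree-of xN u))) (load-split u)
    where
    lem : ∀ a b → b ≡ a + b - a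
    lem = solve 2 (λ a b → b := a :+ b :- a) refl

  -- Room for the minor load at `u`, enlarged by the total deviation `Γ` of the three experiments.
  -- Positivity of `Γ` keeps it invertible even at crucial load 1.
  g : Fin (n I) → ℚ
  g u = 1ℚ + Γ - c u

  0<g : ∀ u → 0ℚ < g u
  0<g u = <-≤-trans 0<Γ (by-gap (gap (c≤1 u)) (lem (c u) Γ))
    where
    lem : ∀ c t → 1ℚ - c ≡ 1ℚ + t - c - t
    lem = solve 2 (λ c t → con 1ℚ :- c := con 1ℚ :+ t :- c :- t) refl

  i : Fin (n I) → ℚ
  i u = proj₁ (recip (g u) (0<g u))

  0≤i : ∀ u → 0ℚ ≤ i u
  0≤i u = <⇒≤ (proj₁ (proj₂ (recip (g u) (0<g u))))

  gi : ∀ u → g u * i u ≡ 1ℚ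
  gi u = proj₂ (proj₂ (recip (g u) (0<g u)))

  room : ∀ u → degree-of xN u + Γ ≤ g u
  room u = by-gap (gap (load-split u)) (lem (c u) (degree-of xN u) Γ)
    where
    lem : ∀ c n t → 1ℚ - (c + n) ≡ 1ℚ + t - c - (n + t)
    lem = solve 3 (λ c n t → con 1ℚ :- (c :+ n) := con 1ℚ :+ t :- c :- (n :+ t)) refl

  -- Fraction of its capacity that a covered vertex reserves for minor edges. With this dependence
  -- on the load, `θ e` equals `1 - d u - (1 - c v) / 32` for either naming `u`, `v` of the two
  -- ends, so it respects the reserve at both.
  d : Fin (n I) → ℚ
  d u = ℤ.+ 6 / 32 - (ℤ.+ 1 / 32) * c u

  0≤d : ∀ u → 0ℚ ≤ d u
  0≤d u = by-gap' (nonNegative⁻¹ (ℤ.+ 1 / 32) ⊗ gap (c≤1 u)) (nonNegative⁻¹ (ℤ.+ 5 / 32)) (lem (c u))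
    where
    by-gap' : ∀ {a b x} → 0ℚ ≤ a → 0ℚ ≤ b → a + b ≡ x → 0ℚ ≤ x
    by-gap' p q refl = p ⊕ q
    lem : ∀ c → (ℤ.+ 1 / 32) * (1ℚ - c) + (ℤ.+ 5 / 32) ≡ (ℤ.+ 6 / 32) - (ℤ.+ 1 / 32) * c
    lem = solve 1 (λ c → con (ℤ.+ 1 / 32) :* (con 1ℚ :- c) :+ con (ℤ.+ 5 / 32) := con (ℤ.+ 6 / 32) :- con (ℤ.+ 1 / 32) :* c) refl

  d≤1 : ∀ u → d u ≤ 1ℚ
  d≤1 u = by-gap (nonNegative⁻¹ (ℤ.+ 1 / 32) ⊗ 0≤c u ⊕ nonNegative⁻¹ (ℤ.+ 26 / 32)) (lem (c u))
    where
    lem : ∀ c → (ℤ.+ 1 / 32) * c + (ℤ.+ 26 / 32) ≡ 1ℚ - ((ℤ.+ 6 / 32) - (ℤ.+ 1 / 32) * c)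
    lem = solve 1 (λ c → con (ℤ.+ 1 / 32) :* c :+ con (ℤ.+ 26 / 32) := con 1ℚ :- (con (ℤ.+ 6 / 32) :- con (ℤ.+ 1 / 32) :* c)) refl

  -- The slope 1/32 is matched to the mixture: two thirds of it cancel one third of the conflict
  -- loss 1/16 of the proposals.
  θ : Fin (m I) → ℚ
  θ e = ℤ.+ 25 / 32 + (ℤ.+ 1 / 32) * (c (end₁ I e) + c (end₂ I e))

  0≤θ : ∀ e → 0ℚ ≤ θ e
  0≤θ e = nonNegative⁻¹ (ℤ.+ 25 / 32) ⊕ nonNegative⁻¹ (ℤ.+ 1 / 32) ⊗ (0≤c (end₁ I e) ⊕ 0≤c (end₂ I e))

  θ≤ : ∀ e u → inc I e u ≡ true → θ e ≤ 1ℚ - d u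
  θ≤ e u h = go (inc-cases I h)
    where
    lem₁ : ∀ a b → (ℤ.+ 1 / 32) * (1ℚ - b) ≡ 1ℚ - ((ℤ.+ 6 / 32) - (ℤ.+ 1 / 32) * a) - ((ℤ.+ 25 / 32) + (ℤ.+ 1 / 32) * (a + b))
    lem₁ = solve 2 (λ a b → con (ℤ.+ 1 / 32) :* (con 1ℚ :- b) := con 1ℚ :- (con (ℤ.+ 6 / 32) :- con (ℤ.+ 1 / 32) :* a) :- (con (ℤ.+ 25 / 32)
        :+ con (ℤ.+ 1 / 32) :* (a :+ b))) refl
    lem₂ : ∀ a b → (ℤ.+ 1 / 32) * (1ℚ - a) ≡ 1ℚ - ((ℤ.+ 6 / 32) - (ℤ.+ 1 / 32) * b) - ((ℤ.+ 25 / 32) + (ℤ.+ 1 / 32) * (a + b))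
    lem₂ = solve 2 (λ a b → con (ℤ.+ 1 / 32) :* (con 1ℚ :- a) := con 1ℚ :- (con (ℤ.+ 6 / 32) :- con (ℤ.+ 1 / 32) :* b) :- (con (ℤ.+ 25 / 32)
        :+ con (ℤ.+ 1 / 32) :* (a :+ b))) refl
    go : (end₁ I e ≡ u) ⊎ (end₂ I e ≡ u) → θ e ≤ 1ℚ - d u
    go (inj₁ q) = subst (λ t → θ e ≤ 1ℚ - d t) q (by-gap (nonNegative⁻¹ (ℤ.+ 1 / 32) ⊗ gap (c≤1 (end₂ I e))) (lem₁ (c (end₁ I e)) (c (end₂ I e))))
    go (inj₂ q) = subst (λ t → θ e ≤ 1ℚ - d t) q (by-gap (nonNegative⁻¹ (ℤ.+ 1 / 32) ⊗ gap (c≤1 (end₁ I e))) (lem₂ (c (end₁ I e)) (c (end₂ I e))))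

  K : EdgeSet (m I) → EdgeSet (m I)
  K S' = tabulate (λ e → lookup (opt S') e ∧ crucial e)

  K-eq : ∀ S' e → lookup (K S') e ≡ lookup (opt S') e ∧ crucial e
  K-eq S' e = lookup∘tabulate _ e

  K⊆opt : ∀ S' → Sub (K S') (opt S')
  K⊆opt S' e h = proj₁ (∧-true (trans (sym (K-eq S' e)) h))

  K-crucial : ∀ S' e → lookup (K S') e ≡ true → crucial e ≡ true
  K-crucial S' e h = proj₂ (∧-true {lookup (opt S') e} (trans (sym (K-eq S' e)) h))

  K-match : ∀ S' → IsMatching I (K S')
  K-match S' e f u p q = opt-match S' e f u (K⊆opt S' e p) (K⊆opt S' f q)

  cov : EdgeSet (m I) → Fin (n I) → ℚ
  cov S' u = ∑ (λ e → ι (inc I e u) * ι (lookup (K S') e))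

  0≤cov : ∀ S' u → 0ℚ ≤ cov S' u
  0≤cov S' u = ∑-nn (λ e → 0≤ι (inc I e u) ⊗ 0≤ι (lookup (K S') e))

  cov≤1 : ∀ S' u → cov S' u ≤ 1ℚ
  cov≤1 S' = matching-load (K S') (K-match S')

  E-K : ∀ e → E real (λ S' → ι (lookup (K S') e)) ≡ xC e
  E-K e = trans (E-cong real (λ S' → trans (cong ι (K-eq S' e)) (trans (ι-∧ (lookup (opt S') e) (crucial e)) (*-comm (ι (lookup (opt S') e)) (ι (crucial e))))))
    (E-*ˡ real (ι (crucial e)) (λ S' → ι (lookup (opt S') e)))

  E-cov : ∀ u → E real (λ S' → cov S' u) ≡ c u
  E-cov u = trans (E-∑ real (λ e S' → ι (inc I e u) * ι (lookup (K S') e)))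
    (∑-cong (λ e → trans (E-*ˡ real (ι (inc I e u)) (λ S' → ι (lookup (K S') e))) (cong (λ z → ι (inc I e u) * z) (E-K e))))

  -- Residual capacity per unit of minor load: `i u` at an uncovered vertex, `d u * i u` at a
  -- covered one.
  r : EdgeSet (m I) → Fin (n I) → ℚ
  r S' u = i u * (1ℚ - (1ℚ - d u) * cov S' u)

  0≤left : ∀ S' u → 0ℚ ≤ 1ℚ - (1ℚ - d u) * cov S' u
  0≤left S' u = ≤-resp refl (lem (d u) (cov S' u)) (gap (cov≤1 S' u) ⊕ 0≤d u ⊗ 0≤cov S' u)
    where
    lem : ∀ d v → 1ℚ - v + d * v ≡ 1ℚ - (1ℚ - d) * v
    lem = solve 2 (λ d v → con 1ℚ :- v :+ d :* v := con 1ℚ :- (con 1ℚ :- d) :* v) refl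

  0≤r : ∀ S' u → 0ℚ ≤ r S' u
  0≤r S' u = 0≤i u ⊗ 0≤left S' u

  ψ : EdgeSet (m I) → Fin (m I) → ℚ
  ψ S' e = r S' (end₁ I e) ⊓ r S' (end₂ I e)

  0≤ψ : ∀ S' e → 0ℚ ≤ ψ S' e
  0≤ψ S' e = ⊓-glb (0≤r S' (end₁ I e)) (0≤r S' (end₂ I e))

  ψ≤ : ∀ S' e u → inc I e u ≡ true → ψ S' e ≤ r S' u
  ψ≤ S' e u h = go (inc-cases I h)
    where
    go : (end₁ I e ≡ u) ⊎ (end₂ I e ≡ u) → ψ S' e ≤ r S' u
    go (inj₁ q) = subst (λ t → ψ S' e ≤ r S' t) q (p⊓q≤p (r S' (end₁ I e)) (r S' (end₂ I e)))
    go (inj₂ q) = subst (λ t → ψ S' e ≤ r S' t) q (p⊓q≤q (r S' (end₁ I e)) (r S' (end₂ I e)))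

  ζ : Fin (m I) → ℚ
  ζ _ = 1ℚ

  ζ-deg : ∀ u → degree-of (λ e → ζ e * xN e) u ≡ degree-of xN u
  ζ-deg u = ∑-cong (λ e → cong (λ z → ι (inc I e u) * z) (*-identityˡ (xN e)))

  at-endpoint : ∀ {a b} e u → (inc I e u ≡ true → a ≤ b) → ι (inc I e u) * a ≤ ι (inc I e u) * b
  at-endpoint {a} {b} e u h = go (inc I e u) refl
    where
    go : ∀ t → inc I e u ≡ t → ι t * a ≤ ι t * b
    go true  p = *-monoʳ-nn 1ℚ 0≤1 (h p)
    go false p = ≡⇒≤ (trans (*-zeroˡ a) (sym (*-zeroˡ b)))

  -- At `u` the matching takes at most `(1ℚ - d u) * cov S' u`; the minor load is at most `g u`, so
  -- multiplying it by at most `r S' u` fits into what is left.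
  feasible : ∀ S' z → (∀ e → 0ℚ ≤ z e) → (∀ e → ζ e ≡ 0ℚ → z e ≡ 0ℚ) →
             (∀ u → degree-of z u ≤ degree-of (λ e → ζ e * xN e) u + Γ) →
             ∀ u → ∑ (λ e → ι (inc I e u) * (ι (lookup (K S') e) * θ e + ψ S' e * z e)) ≤ 1ℚ
  feasible S' z 0≤z _ h u =
    ≤-trans (∑-mono (λ e → ≤-trans (at-endpoint e u (λ q → +-mono-≤ (*-monoʳ-nn (ι (lookup (K S') e)) (0≤ι (lookup (K S') e)) (θ≤ e u q))
        (*-monoˡ-nn (z e) (0≤z e) (ψ≤ S' e u q))))
        (≡⇒≤ (lem (ι (inc I e u)) (ι (lookup (K S') e)) (1ℚ - d u) (r S' u) (z e)))))
    (≤-trans (≡⇒≤ (trans (∑-+ (λ e → (1ℚ - d u) * (ι (inc I e u) * ι (lookup (K S') e))) (λ e → r S' u * (ι (inc I e u) * z e)))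
        (cong₂ _+_ (∑-*ˡ (1ℚ - d u) (λ e → ι (inc I e u) * ι (lookup (K S') e))) (∑-*ˡ (r S' u) (λ e → ι (inc I e u) * z e)))))
    (≤-trans (+-monoʳ-≤ ((1ℚ - d u) * cov S' u) (*-monoʳ-nn (r S' u) (0≤r S' u) (≤-trans (h u) (≤-trans (≡⇒≤ (cong (λ z → z + Γ) (ζ-deg u))) (room u)))))
      (≡⇒≤ (trans (lem₂ ((1ℚ - d u) * cov S' u) (i u) (g u)) (trans (cong (λ q → (1ℚ - d u) * cov S' u
          + q * (1ℚ - (1ℚ - d u) * cov S' u)) (gi u)) (lem₃ ((1ℚ - d u) * cov S' u)))))))
    where
    lem : ∀ i k a b z → i * (k * a + b * z) ≡ a * (i * k) + b * (i * z)
    lem = solve 5 (λ i k a b z → i :* (k :* a :+ b :* z) := a :* (i :* k) :+ b :* (i :* z)) refl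
    lem₂ : ∀ a i g → a + i * (1ℚ - a) * g ≡ a + g * i * (1ℚ - a)
    lem₂ = solve 3 (λ a i g → a :+ i :* (con 1ℚ :- a) :* g := a :+ g :* i :* (con 1ℚ :- a)) refl
    lem₃ : ∀ a → a + 1ℚ * (1ℚ - a) ≡ 1ℚ
    lem₃ = solve 1 (λ a → a :+ con 1ℚ :* (con 1ℚ :- a) := con 1ℚ) refl

  bounded : ∀ u → degree-of (λ e → ζ e * xN e) u ≤ 1ℚ + γ
  bounded u = ≤-trans (≡⇒≤ (ζ-deg u)) (≤-trans (by-gap (0≤c u) (lem (c u) (degree-of xN u))) (≤-trans (load-split u) (by-gap 0≤γ (lem₂ γ))))
    where
    lem : ∀ a b → a ≡ a + b - b
    lem = solve 2 (λ a b → a := a :+ b :- b) refl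
    lem₂ : ∀ a → a ≡ 1ℚ + a - 1ℚ
    lem₂ = solve 1 (λ a → a := con 1ℚ :+ a :- con 1ℚ) refl

  V : ℚ
  V = E queries (λ B → E real (λ R → mwm I (Q B ∩ₑ R)))

  -- Resampling the minor edges does not change the distribution of the realization.
  V-resampled : V ≡ E real (λ S' → E queries (λ B → E real (λ R → mwm I (Q B ∩ₑ mix crucial S' R))))
  V-resampled = trans (E-cong queries (λ B → E-mix (λ e → bern (p I e) (<⇒≤ (p-pos I e)) (p-le1 I e)) crucial (λ R → mwm I (Q B ∩ₑ R))))
    (E-comm queries real (λ B S' → E real (λ R → mwm I (Q B ∩ₑ mix crucial S' R))))

  Ψ : Fin (m I) → ℚ
  Ψ e = E real (λ S' → ψ S' e)

  shrunk : ℚ → ℚ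
  shrunk a = (1ℚ - ε) * ((1ℚ - ε) * ((1ℚ - ε) * a))

  module As = Assembly params I

  share : EdgeSet (m I) → ℚ
  share S' = ∑ (λ e → ι (lookup (K S') e) * θ e * w I e) + ∑ (λ e → ψ S' e * w I e * shrunk (xN e))

  redrawn : EdgeSet (m I) → ℚ
  redrawn S' = E queries (λ B → E real (λ R → mwm I (Q B ∩ₑ mix crucial S' R)))

  share≤ : ∀ S' → share S' ≤ redrawn S'
  share≤ S' = ≤-trans (≡⇒≤ same) (As.assembled (K S') (K-match S') (K-crucial S') ζ (λ _ → 0≤1) (λ _ → 1≤S) bounded θ (ψ S') 0≤θ (0≤ψ S') (feasible S') S'
      (λ e h → opt-Sub S' e (K⊆opt S' e h)))
    where
    same : share S' ≡ ∑ (λ e → ι (lookup (K S') e) * θ e * w I e) + ∑ (λ e → ψ S' e * w I e * shrunk (1ℚ * xN e))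
    same = cong (λ z → ∑ (λ e → ι (lookup (K S') e) * θ e * w I e) + z) (∑-cong (λ e → cong (λ q → ψ S' e * w I e * shrunk q) (sym (*-identityˡ (xN e)))))

  E-share : E real share ≡ ∑ (λ e → xC e * θ e * w I e) + ∑ (λ e → Ψ e * w I e * shrunk (xN e))
  E-share = trans (E-+ real (λ S' → ∑ (λ e → ι (lookup (K S') e) * θ e * w I e)) (λ S' → ∑ (λ e → ψ S' e * w I e * shrunk (xN e))))
      (cong₂ _+_ first second)
    where
    first : E real (λ S' → ∑ (λ e → ι (lookup (K S') e) * θ e * w I e)) ≡ ∑ (λ e → xC e * θ e * w I e)
    first = trans (E-∑ real (λ e S' → ι (lookup (K S') e) * θ e * w I e)) (∑-cong (λ e → trans (E-*ʳ real (w I e) (λ S' → ι (lookup (K S') e) * θ e))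
          (cong (λ z → z * w I e) (trans (E-*ʳ real (θ e) (λ S' → ι (lookup (K S') e))) (cong (λ z → z * θ e) (E-K e))))))
    second : E real (λ S' → ∑ (λ e → ψ S' e * w I e * shrunk (xN e))) ≡ ∑ (λ e → Ψ e * w I e * shrunk (xN e))
    second = trans (E-∑ real (λ e S' → ψ S' e * w I e * shrunk (xN e))) (∑-cong (λ e → trans (E-*ʳ real (shrunk (xN e)) (λ S' → ψ S' e * w I e))
          (cong (λ z → z * shrunk (xN e)) (E-*ʳ real (w I e) (λ S' → ψ S' e)))))

  crucial-first : ∑ (λ e → xC e * θ e * w I e) + ∑ (λ e → Ψ e * w I e * shrunk (xN e)) ≤ V
  crucial-first = ≤-resp E-share (sym V-resampled) (E-mono real {share} {redrawn} share≤)

  -- Linear minorants of ψ in the coverage variables bound Ψ from below.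
  Ψ-≥ : ∀ e u v A₀ A₁ A₂ → (∀ S' → A₀ - A₁ * cov S' u - A₂ * cov S' v ≤ ψ S' e) → A₀ - A₁ * c u - A₂ * c v ≤ Ψ e
  Ψ-≥ e u v A₀ A₁ A₂ h = ≤-trans (≡⇒≤ (sym eq)) (E-mono real h)
    where
    eq : E real (λ S' → A₀ - A₁ * cov S' u - A₂ * cov S' v) ≡ A₀ - A₁ * c u - A₂ * c v
    eq = trans (E-- real (λ S' → A₀ - A₁ * cov S' u) (λ S' → A₂ * cov S' v))
      (cong₂ _-_ (trans (E-- real (λ _ → A₀) (λ S' → A₁ * cov S' u)) (cong₂ _-_ (E-const real A₀) (trans (E-*ˡ real A₁ (λ S'
          → cov S' u)) (cong (λ z → A₁ * z) (E-cov u)))))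
        (trans (E-*ˡ real A₂ (λ S' → cov S' v)) (cong (λ z → A₂ * z) (E-cov v))))

-- The second scheme: every vertex is a sender or a receiver; senders propose to receivers

module Proposals (params : Parameters) (I : Instance) where

  open Parameters params
  open Neighbourhood I
  open Sparse params I

  ½≤1 : ½ ≤ 1ℚ
  ½≤1 = by-gap 0≤½ refl

  module Labels = Sampling {n I} (λ _ → ½) (λ _ → 0≤½) (λ _ → ½≤1)

  labels : D (Vec Bool (n I))
  labels = Labels.sample

  samples : D (Vec (EdgeSet (m I)) (n I))
  samples = prod (λ _ → real)

  -- A sample is attached to every vertex before the labels are consulted, so labels and samples
  -- form a product space to which Efron-Stein applies.
  World : Set
  World = Vec Bool (n I) × Vec (EdgeSet (m I)) (n I)

  world : D World
  world = bind labels λ s → bind samples λ P → ret (s , P)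

  E-world : ∀ f → E world f ≡ E labels (λ s → E samples (λ P → f (s , P)))
  E-world f = trans (E-bind labels _ f) (E-cong labels (λ s → E-bind samples _ f))

  picked : EdgeSet (m I) → Fin (n I) → Fin (m I) → Bool
  picked R v e = lookup (opt R) e ∧ (inc I e v ∧ crucial e)

  pick : Vec (EdgeSet (m I)) (n I) → Fin (n I) → Fin (m I) → Bool
  pick P v e = picked (lookup P v) v e

  picked-unique : ∀ R v e f → picked R v e ≡ true → picked R v f ≡ true → e ≡ f
  picked-unique R v e f p q = opt-match R e f v (proj₁ (∧-true p)) (proj₁ (∧-true q))
    (proj₁ (∧-true (proj₂ (∧-true {lookup (opt R) e} p)))) (proj₁ (∧-true (proj₂ (∧-true {lookup (opt R) f} q))))

  opt-none : ∀ e → lookup (opt (replicate (m I) false)) e ≡ false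
  opt-none e = go (lookup (opt (replicate (m I) false)) e) refl
    where
    go : ∀ b → lookup (opt (replicate (m I) false)) e ≡ b → b ≡ false
    go false _ = refl
    go true  h = ⊥-elim (true≢false (opt-Sub (replicate (m I) false) e h) (lookup-replicate e false))

  E-picked : ∀ v e → inc I e v ≡ true → E real (λ R → ι (picked R v e)) ≡ xC e
  E-picked v e h = trans (E-cong real (λ R → trans (ι-∧ (lookup (opt R) e) (inc I e v ∧ crucial e)) (trans (cong (λ b
      → ι (lookup (opt R) e) * ι (b ∧ crucial e)) h)
      (*-comm (ι (lookup (opt R) e)) (ι (crucial e))))))
    (E-*ˡ real (ι (crucial e)) (λ R → ι (lookup (opt R) e)))

  E-pick : ∀ v e → inc I e v ≡ true → E samples (λ P → ι (pick P v e)) ≡ xC e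
  E-pick v e h = trans (E-coord (λ _ → real) v (λ R → ι (picked R v e))) (E-picked v e h)

  active : Vec Bool (n I) → Fin (m I) → Bool
  active s e = lookup s (end₁ I e) xor lookup s (end₂ I e)

  -- On an edge that is not active this is merely some end; the definition stays total so that every
  -- edge is owned by exactly one vertex.
  sender : Vec Bool (n I) → Fin (m I) → Fin (n I)
  sender s e = if lookup s (end₁ I e) then end₁ I e else end₂ I e

  sender-inc : ∀ s e → inc I e (sender s e) ≡ true
  sender-inc s e = go (lookup s (end₁ I e))
    where
    go : ∀ b → inc I e (if b then end₁ I e else end₂ I e) ≡ true
    go true  = inc₁ I e
    go false = inc₂ I e

  A : World → Fin (m I) → Bool
  A (s , P) e = active s e ∧ pick P (sender s e) e

  A-crucial : ∀ ω e → A ω e ≡ true → crucial e ≡ true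
  A-crucial (s , P) e h = proj₂ (∧-true {inc I e (sender s e)} (proj₂ (∧-true {lookup (opt (lookup P (sender s e))) e} (proj₂ (∧-true {active s e} h)))))

  hit? : ∀ ω v → Dec (Σ (Fin (m I)) λ e → inc I e v ∧ A ω e ≡ true)
  hit? ω v = any? (λ e → (inc I e v ∧ A ω e) Bool.≟ true)

  -- Free means touched by no proposal at all, not even by one that goes on to lose a conflict.
  X : World → Fin (n I) → ℚ
  X ω v = ι (not (does (hit? ω v)))

  0≤X : ∀ ω v → 0ℚ ≤ X ω v
  0≤X ω v = 0≤ι (not (does (hit? ω v)))

  X≤1 : ∀ ω v → X ω v ≤ 1ℚ
  X≤1 ω v = ι≤1 (not (does (hit? ω v)))

  X-hit : ∀ ω v e → inc I e v ≡ true → A ω e ≡ true → X ω v ≡ 0ℚ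
  X-hit ω v e p q = go (hit? ω v)
    where
    go : (d : Dec (Σ (Fin (m I)) λ e → inc I e v ∧ A ω e ≡ true)) → ι (not (does d)) ≡ 0ℚ
    go (yes _) = refl
    go (no ¬h) = ⊥-elim (¬h (e , cong₂ _∧_ p q))

  -- A vertex free under `ω'` but not under `ω` has a proposal that is present only under `ω`, and
  -- this one is paid for by `Δ`.
  X-compare : ∀ ω ω' v (Δ : Fin (m I) → ℚ) → (∀ e → 0ℚ ≤ Δ e) → (∀ e → ι (A ω e) ≤ ι (A ω' e) + Δ e) →
              X ω' v ≤ X ω v + ∑ (λ e → ι (inc I e v) * Δ e)
  X-compare ω ω' v Δ 0≤Δ h = go (hit? ω v)
    where
    0≤sum : 0ℚ ≤ ∑ (λ e → ι (inc I e v) * Δ e)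
    0≤sum = ∑-nn (λ e → 0≤ι (inc I e v) ⊗ 0≤Δ e)
    lem : ∀ s → s ≡ 1ℚ + s - 1ℚ
    lem = solve 1 (λ s → s := con 1ℚ :+ s :- con 1ℚ) refl
    go : (d : Dec (Σ (Fin (m I)) λ e → inc I e v ∧ A ω e ≡ true)) → X ω' v ≤ ι (not (does d)) + ∑ (λ e → ι (inc I e v) * Δ e)
    go (no _) = ≤-trans (X≤1 ω' v) (by-gap 0≤sum (lem (∑ (λ e → ι (inc I e v) * Δ e))))
    go (yes (e , p)) = ≤-trans (at (A ω' e) refl) (≡⇒≤ (sym (+-identityˡ _)))
      where
      at : ∀ b → A ω' e ≡ b → X ω' v ≤ ∑ (λ e → ι (inc I e v) * Δ e)
      at true  q = ≤-trans (≡⇒≤ (X-hit ω' v e (proj₁ (∧-true {inc I e v} p)) q)) 0≤sum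
      at false q = ≤-trans (X≤1 ω' v) (≤-trans (≤-trans (≡⇒≤ (cong ι (sym (proj₂ (∧-true {inc I e v} p)))))
          (≤-trans (h e) (≡⇒≤ (trans (cong (λ b → ι b + Δ e) q) (trans (+-identityˡ (Δ e)) (trans (sym (*-identityˡ (Δ e))) (cong (λ b
              → ι b * Δ e) (sym (proj₁ (∧-true {inc I e v} p))))))))))
        (∑-term (λ e → 0≤ι (inc I e v) ⊗ 0≤Δ e) e))

  X-≥ : ∀ ω v → 1ℚ - ∑ (λ e → ι (inc I e v) * ι (A ω e)) ≤ X ω v
  X-≥ ω v = go (hit? ω v)
    where
    0≤sum : ∀ e → 0ℚ ≤ ι (inc I e v) * ι (A ω e)
    0≤sum e = 0≤ι (inc I e v) ⊗ 0≤ι (A ω e)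
    lem₁ : ∀ a → a ≡ 1ℚ - (1ℚ - a)
    lem₁ = solve 1 (λ a → a := con 1ℚ :- (con 1ℚ :- a)) refl
    lem₂ : ∀ a → a - 1ℚ ≡ 0ℚ - (1ℚ - a)
    lem₂ = solve 1 (λ a → a :- con 1ℚ := con 0ℚ :- (con 1ℚ :- a)) refl
    go : (d : Dec (Σ (Fin (m I)) λ e → inc I e v ∧ A ω e ≡ true)) → 1ℚ - ∑ (λ e → ι (inc I e v) * ι (A ω e)) ≤ ι (not (does d))
    go (no _) = by-gap (∑-nn 0≤sum) (lem₁ (∑ (λ e → ι (inc I e v) * ι (A ω e))))
    go (yes (e , p)) = by-gap (gap (≤-trans (≡⇒≤ (sym (cong₂ (λ a b → ι a * ι b) (proj₁ (∧-true {inc I e v} p)) (proj₂ (∧-true {inc I e v} p)))))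
        (∑-term 0≤sum e)))
      (lem₂ (∑ (λ e → ι (inc I e v) * ι (A ω e))))

  E-active : ∀ e → E labels (λ s → ι (active s e)) ≡ ½
  E-active e = trans (resample (λ _ → bern ½ 0≤½ ½≤1) (end₁ I e) (λ s → ι (active s e)))
    (trans (E-cong labels (λ s → trans (cong₂ (λ a b → ½ * ι a + (1ℚ - ½) * ι b) (val s true) (val s false)) (both (lookup s (end₂ I e))))) (E-const labels ½))
    where
    val : ∀ s b → active (s [ end₁ I e ]≔ b) e ≡ b xor lookup s (end₂ I e)
    val s b = cong₂ _xor_ (lookup∘update (end₁ I e) s b) (lookup∘update′ (≢-sym (loopless I e)) s b)
    both : ∀ b → ½ * ι (true xor b) + (1ℚ - ½) * ι (false xor b) ≡ ½
    both true  = refl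
    both false = refl

  E-A : ∀ e → E world (λ ω → ι (A ω e)) ≡ ½ * xC e
  E-A e = trans (E-world (λ ω → ι (A ω e)))
    (trans (E-cong labels (λ s → trans (E-cong samples (λ P → ι-∧ (active s e) (pick P (sender s e) e)))
        (trans (E-*ˡ samples (ι (active s e)) (λ P → ι (pick P (sender s e) e))) (cong (λ z → ι (active s e) * z) (E-pick (sender s e) e (sender-inc s e))))))
    (trans (E-*ʳ labels (xC e) (λ s → ι (active s e))) (cong (λ z → z * xC e) (E-active e))))

  E-free : ∀ v → 1ℚ - ½ * degree-of xC v ≤ E world (λ ω → X ω v)
  E-free v = ≤-trans (≡⇒≤ (sym eq)) (E-mono world (λ ω → X-≥ ω v))
    where
    lem : ∀ i h x → i * (h * x) ≡ h * (i * x)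
    lem = solve 3 (λ i h x → i :* (h :* x) := h :* (i :* x)) refl
    eq : E world (λ ω → 1ℚ - ∑ (λ e → ι (inc I e v) * ι (A ω e))) ≡ 1ℚ - ½ * degree-of xC v
    eq = trans (E-- world (λ _ → 1ℚ) (λ ω → ∑ (λ e → ι (inc I e v) * ι (A ω e)))) (cong₂ _-_ (E-const world 1ℚ)
      (trans (E-∑ world (λ e ω → ι (inc I e v) * ι (A ω e))) (trans (∑-cong (λ e → trans (E-*ˡ world (ι (inc I e v)) (λ ω → ι (A ω e)))
        (trans (cong (λ z → ι (inc I e v) * z) (E-A e)) (lem (ι (inc I e v)) ½ (xC e))))) (∑-*ˡ ½ (λ e → ι (inc I e v) * xC e)))))

  E-independent : ∀ u v → u ≢ v → (φ χ : EdgeSet (m I) → ℚ) →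
                  E samples (λ P → φ (lookup P u) * χ (lookup P v)) ≡ E real φ * E real χ
  E-independent u v u≢v φ χ = trans (resample (λ _ → real) u (λ P → φ (lookup P u) * χ (lookup P v)))
    (trans (E-cong samples (λ P → trans (E-cong real (λ R → cong₂ _*_ (cong φ (lookup∘update u P R)) (cong χ (lookup∘update′ (≢-sym u≢v) P R))))
        (E-*ʳ real (χ (lookup P v)) φ)))
    (trans (E-*ˡ samples (E real φ) (λ P → χ (lookup P v))) (cong (λ z → E real φ * z) (E-coord (λ _ → real) v χ))))

  apart : Vec Bool (n I) → Fin (m I) → Fin (m I) → Bool
  apart s e f = active s e ∧ (active s f ∧ not (sender s e == sender s f))

  -- A sender proposes along at most one edge, so the product vanishes if the senders coincide;
  -- different senders have independent samples.
  E-AA-given : ∀ s e f → e ≢ f → E samples (λ P → ι (A (s , P) e) * ι (A (s , P) f)) ≤ ι (apart s e f) * (xC e * xC f)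
  E-AA-given s e f e≢f = go (active s e) (active s f) (sender s e ≟ sender s f)
    where
    pe pf : Vec (EdgeSet (m I)) (n I) → Bool
    pe P = pick P (sender s e) e
    pf P = pick P (sender s f) f
    zero-E : ∀ {g : Vec (EdgeSet (m I)) (n I) → ℚ} {c} → (∀ P → g P ≡ 0ℚ) → 0ℚ ≤ c → E samples g ≤ 0ℚ * c
    zero-E {g} {c} h _ = ≡⇒≤ (trans (trans (E-cong samples h) (E-const samples 0ℚ)) (sym (*-zeroˡ c)))
    0≤xx : 0ℚ ≤ xC e * xC f
    0≤xx = 0≤xC e ⊗ 0≤xC f
    both : ∀ P → sender s e ≡ sender s f → pe P ≡ true → pf P ≡ true → ⊥
    both P q a b = e≢f (picked-unique (lookup P (sender s e)) (sender s e) e f a (subst (λ v → picked (lookup P v) v f ≡ true) (sym q) b))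
    go : ∀ a b (d : Dec (sender s e ≡ sender s f)) →
         E samples (λ P → ι (a ∧ pe P) * ι (b ∧ pf P)) ≤ ι (a ∧ (b ∧ not (does d))) * (xC e * xC f)
    go false b     d = zero-E (λ P → *-zeroˡ (ι (b ∧ pf P))) 0≤xx
    go true  false d = zero-E (λ P → *-zeroʳ (ι (pe P))) 0≤xx
    go true  true (yes q) = zero-E (λ P → excl (pe P) (pf P) (both P q)) 0≤xx
      where
      excl : ∀ a b → (a ≡ true → b ≡ true → ⊥) → ι a * ι b ≡ 0ℚ
      excl true  true  h = ⊥-elim (h refl refl)
      excl true  false h = refl
      excl false b     h = *-zeroˡ (ι b)
    go true  true (no q) = ≡⇒≤ (trans (E-independent (sender s e) (sender s f) q (λ R → ι (picked R (sender s e) e)) (λ R → ι (picked R (sender s f) f)))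
      (trans (cong₂ _*_ (E-picked (sender s e) e (sender-inc s e)) (E-picked (sender s f) f (sender-inc s f))) (sym (*-identityˡ (xC e * xC f)))))

  -- Two proposals sharing the vertex u come from different senders only if u is a receiver.
  roles : Fin (n I) → Fin (n I) → Fin (n I) → Vec Bool (n I) → ℚ
  roles u v z s = ι (lookup s v) * (ι (lookup s z) * (1ℚ - ι (lookup s u)))

  E-roles : ∀ u v z → u ≢ v → u ≢ z → v ≢ z → E labels (roles u v z) ≡ ℤ.+ 1 / 8
  E-roles u v z u≢v u≢z v≢z =
    trans (Labels.E-given v (λ s → ι (lookup s z) * (1ℚ - ι (lookup s u))))
    (trans (cong (λ q → ½ * q) (trans (E-cong labels (λ s → cong₂ (λ a b → ι a * (1ℚ - ι b)) (lookup∘update′ (≢-sym v≢z) s true) (lookup∘update′ u≢v s true)))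
      (trans (Labels.E-given z (λ s → 1ℚ - ι (lookup s u)))
      (cong (λ q → ½ * q) (trans (E-cong labels (λ s → cong (λ b → 1ℚ - ι b) (lookup∘update′ u≢z s true)))
        (trans (E-- labels (λ _ → 1ℚ) (λ s → ι (lookup s u))) (cong₂ _-_ (E-const labels 1ℚ) (Labels.E-ι u))))))))
    refl)

  far : ∀ e u → inc I e u ≡ true → Σ (Fin (n I)) λ v → (inc I e v ≡ true) × (u ≢ v) ×
        (∀ s → active s e ≡ true → (lookup s u ≡ true → sender s e ≡ u) × (lookup s u ≡ false → lookup s v ≡ true))
  far e u h = go (inc-cases I h)
    where
    go : (end₁ I e ≡ u) ⊎ (end₂ I e ≡ u) → Σ (Fin (n I)) λ v → (inc I e v ≡ true) × (u ≢ v) ×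
        (∀ s → active s e ≡ true → (lookup s u ≡ true → sender s e ≡ u) × (lookup s u ≡ false → lookup s v ≡ true))
    go (inj₁ refl) = end₂ I e , inc₂ I e , loopless I e , λ s a → (λ p → cong (λ b → if b then end₁ I e else end₂ I e) p)
      , λ p → trans (cong (_xor lookup s (end₂ I e)) (sym p)) a
    go (inj₂ refl) = end₁ I e , inc₁ I e , ≢-sym (loopless I e) , λ s a → (λ p → cong (λ b → if b then end₁ I e else end₂ I e) (away s a p))
      , λ p → near (lookup s (end₁ I e)) (trans (cong (lookup s (end₁ I e) xor_) (sym p)) a)
      where
      near : ∀ b → b xor false ≡ true → b ≡ true
      near true _ = refl
      away : ∀ s → active s e ≡ true → lookup s (end₂ I e) ≡ true → lookup s (end₁ I e) ≡ false
      away s a p = go' (lookup s (end₁ I e)) (trans (cong (lookup s (end₁ I e) xor_) (sym p)) a)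
        where
        go' : ∀ b → b xor true ≡ true → b ≡ false
        go' false _ = refl
        go' true ()

  -- The common vertex must receive and both far ends must send. These are three independent labels
  -- at distinct vertices, hence 1/8.
  E-AA : ∀ e f u → e ≢ f → inc I e u ≡ true → inc I f u ≡ true →
         E world (λ ω → ι (A ω e) * ι (A ω f)) ≤ (ℤ.+ 1 / 8) * (xC e * xC f)
  E-AA e f u e≢f eu fu =
    ≤-trans (≡⇒≤ (E-world (λ ω → ι (A ω e) * ι (A ω f))))
    (≤-trans (E-mono labels (λ s → E-AA-given s e f e≢f))
    (≤-trans (≡⇒≤ (E-*ʳ labels (xC e * xC f) (λ s → ι (apart s e f))))
    (*-monoˡ-nn (xC e * xC f) (0≤xC e ⊗ 0≤xC f) (≤-trans (E-mono labels split) (≡⇒≤ (E-roles u v z u≢v u≢z v≢z))))))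
    where
    v z : Fin (n I)
    v = proj₁ (far e u eu)
    z = proj₁ (far f u fu)
    u≢v : u ≢ v
    u≢v = proj₁ (proj₂ (proj₂ (far e u eu)))
    u≢z : u ≢ z
    u≢z = proj₁ (proj₂ (proj₂ (far f u fu)))
    rv : ∀ s → active s e ≡ true → (lookup s u ≡ true → sender s e ≡ u) × (lookup s u ≡ false → lookup s v ≡ true)
    rv = proj₂ (proj₂ (proj₂ (far e u eu)))
    rz : ∀ s → active s f ≡ true → (lookup s u ≡ true → sender s f ≡ u) × (lookup s u ≡ false → lookup s z ≡ true)
    rz = proj₂ (proj₂ (proj₂ (far f u fu)))
    v≢z : v ≢ z
    v≢z q = e≢f (inc-unique I u≢v eu (proj₁ (proj₂ (far e u eu))) fu
      (subst (λ t → inc I f t ≡ true) (sym q) (proj₁ (proj₂ (far f u fu)))))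
    split : ∀ s → ι (apart s e f) ≤ roles u v z s
    split s = go (active s e) (active s f) (sender s e ≟ sender s f) refl refl
      where
      0≤roles : 0ℚ ≤ roles u v z s
      0≤roles = 0≤ι (lookup s v) ⊗ 0≤ι (lookup s z) ⊗ gap (ι≤1 (lookup s u))
      go : ∀ a b (d : Dec (sender s e ≡ sender s f)) → active s e ≡ a → active s f ≡ b → ι (a ∧ (b ∧ not (does d))) ≤ roles u v z s
      go false b     d ea eb = 0≤roles
      go true  false d ea eb = 0≤roles
      go true  true (yes q) ea eb = 0≤roles
      go true  true (no q) ea eb = at (lookup s u) refl
        where
        at : ∀ b → lookup s u ≡ b → 1ℚ ≤ roles u v z s
        at true  h = ⊥-elim (q (trans (proj₁ (rv s ea) h) (sym (proj₁ (rz s eb) h))))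
        at false h = ≡⇒≤ (sym (trans (cong₂ (λ a b → ι a * (ι b * (1ℚ - ι (lookup s u)))) (proj₂ (rv s ea) h) (proj₂ (rz s eb) h))
          (cong (λ b → 1ℚ * (1ℚ * (1ℚ - ι b))) h)))

-- Concentration of linear statistics of the free vertices

module Proposal-spread (params : Parameters) (I : Instance) where

  open Parameters params
  open Neighbourhood I
  open Sparse params I
  open Proposals params I

  module _ (b : Fin (n I) → ℚ) (δ : ℚ) (0≤δ : 0ℚ ≤ δ) (0≤b : ∀ z → 0ℚ ≤ b z) (b≤δ : ∀ z → b z ≤ δ) where

    two four : ℚ
    two  = ℤ.+ 2 / 1
    four = ℤ.+ 4 / 1

    0≤two : 0ℚ ≤ two
    0≤two = nonNegative⁻¹ two

    0≤four : 0ℚ ≤ four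
    0≤four = nonNegative⁻¹ four

    free : World → ℚ
    free ω = ∑ (λ z → b z * X ω z)

    cost : Fin (m I) → ℚ
    cost e = b (end₁ I e) + b (end₂ I e)

    0≤cost : ∀ e → 0ℚ ≤ cost e
    0≤cost e = 0≤b (end₁ I e) ⊕ 0≤b (end₂ I e)

    cost≤ : ∀ e → cost e ≤ two * δ
    cost≤ e = ≤-trans (+-mono-≤ (b≤δ (end₁ I e)) (b≤δ (end₂ I e))) (≡⇒≤ (lem δ))
      where
      lem : ∀ d → d + d ≡ two * d
      lem = solve 1 (λ d → d :+ d := con two :* d) refl

    ∑-cost : ∀ (Δ : Fin (m I) → ℚ) → ∑ (λ z → b z * ∑ (λ e → ι (inc I e z) * Δ e)) ≡ ∑ (λ e → Δ e * cost e)
    ∑-cost Δ = trans (∑-cong (λ z → sym (∑-*ˡ (b z) (λ e → ι (inc I e z) * Δ e))))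
      (trans (∑-swap (λ z e → b z * (ι (inc I e z) * Δ e)))
      (∑-cong (λ e → trans (∑-cong (λ z → lem (b z) (ι (inc I e z)) (Δ e))) (trans (∑-*ˡ (Δ e) (λ z → ι (inc I e z) * b z)) (cong (λ t
          → Δ e * t) (∑-inc I e b))))))
      where
      lem : ∀ b i d → b * (i * d) ≡ d * (i * b)
      lem = solve 3 (λ b i d → b :* (i :* d) := d :* (i :* b)) refl

    -- Exchanging the sums gives the sum of `b z` times the crucial load at `z`, which is at most 1.
    total-cost : ∑ (λ e → xC e * cost e) ≤ ∑ b
    total-cost = ≤-trans (≡⇒≤ (sym (∑-cost xC))) (∑-mono (λ z → *≤1 (0≤b z) (c≤1 z)))
      where
      c≤1 : ∀ z → ∑ (λ e → ι (inc I e z) * xC e) ≤ 1ℚ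
      c≤1 z = ≤-trans (by-gap (∑-nn (λ e → 0≤ι (inc I e z) ⊗ 0≤xN e)) (lem (degree-of xC z) (degree-of xN z))) (load-split z)
        where
        lem : ∀ a b → b ≡ a + b - a
        lem = solve 2 (λ a b → b := a :+ b :- a) refl

    free-compare : ∀ ω ω' (Δ : Fin (m I) → ℚ) → (∀ e → 0ℚ ≤ Δ e) → (∀ e → ι (A ω e) ≤ ι (A ω' e) + Δ e) →
                   free ω' ≤ free ω + ∑ (λ e → Δ e * cost e)
    free-compare ω ω' Δ 0≤Δ h = ≤-trans (∑-mono (λ z → ≤-trans (*-monoʳ-nn (b z) (0≤b z) (X-compare ω ω' z Δ 0≤Δ h)) (≡⇒≤ (*-distribˡ-+ (b z)
        (X ω z) (∑ (λ e → ι (inc I e z) * Δ e))))))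
      (≡⇒≤ (trans (∑-+ (λ z → b z * X ω z) (λ z → b z * ∑ (λ e → ι (inc I e z) * Δ e))) (cong (λ t → free ω + t) (∑-cost Δ))))

    sq-close : ∀ {x y} g → x ≤ y + g → y ≤ x + g → sq (x - y) ≤ sq g
    sq-close {x} {y} g p q = sq-≤ {x - y} {g} (≤-resp refl (l₁ x y g) (gap p)) (≤-resp refl (l₂ x y g) (gap q))
      where
      l₁ : ∀ x y g → y + g - x ≡ g - (x - y)
      l₁ = solve 3 (λ x y g → y :+ g :- x := g :- (x :- y)) refl
      l₂ : ∀ x y g → x + g - y ≡ g + (x - y)
      l₂ = solve 3 (λ x y g → x :+ g :- y := g :+ (x :- y)) refl

    none : EdgeSet (m I)
    none = replicate (m I) false

    module _ (s : Vec Bool (n I)) where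

      G : Fin (n I) → EdgeSet (m I) → ℚ
      G v R = ∑ (λ e → ι (picked R v e) * cost e)

      0≤G : ∀ v R → 0ℚ ≤ G v R
      0≤G v R = ∑-nn (λ e → 0≤ι (picked R v e) ⊗ 0≤cost e)

      G≤ : ∀ v R → G v R ≤ two * δ
      G≤ v R = ∑-unique (picked R v) cost (two * δ) (0≤two ⊗ 0≤δ) (λ e _ → cost≤ e) (picked-unique R v)

      A-redrawn : ∀ P v e → (ι (A (s , P) e) ≤ ι (A (s , P [ v ]≔ none) e) + ι (pick P v e)) ×
                            (ι (A (s , P [ v ]≔ none) e) ≤ ι (A (s , P) e) + ι (pick P v e))
      A-redrawn P v e = go (active s e) (sender s e ≟ v)
        where
        go : ∀ a → Dec (sender s e ≡ v) →
             (ι (a ∧ pick P (sender s e) e) ≤ ι (a ∧ pick (P [ v ]≔ none) (sender s e) e) + ι (pick P v e)) ×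
             (ι (a ∧ pick (P [ v ]≔ none) (sender s e) e) ≤ ι (a ∧ pick P (sender s e) e) + ι (pick P v e))
        go false _ = ≤-refl ⊕ 0≤ι (pick P v e) , ≤-refl ⊕ 0≤ι (pick P v e)
        go true (yes q) = by-gap (0≤ι new) (trans (l₁ (ι new) (ι (pick P v e))) (cong (λ t → ι new + ι (pick P v e) - ι t) (cong (λ t → pick P t e) (sym q))))
          , ≤-trans (≡⇒≤ gone) (0≤ι (pick P (sender s e) e) ⊕ 0≤ι (pick P v e))
          where
          new : Bool
          new = pick (P [ v ]≔ none) (sender s e) e
          l₁ : ∀ a b → a ≡ a + b - b
          l₁ = solve 2 (λ a b → a := a :+ b :- b) refl
          gone : ι new ≡ 0ℚ
          gone = cong ι (trans (cong (λ t → pick (P [ v ]≔ none) t e) q) (trans (cong (λ R → picked R v e) (lookup∘update v P none))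
            (cong (_∧ (inc I e v ∧ crucial e)) (opt-none e))))
        go true (no ¬q) = by-gap (0≤ι (pick P v e)) (trans (l₂ (ι (pick P (sender s e) e)) (ι (pick P v e))) (cong (λ t
            → ι t + ι (pick P v e) - ι (pick P (sender s e) e)) (sym same)))
          , by-gap (0≤ι (pick P v e)) (trans (l₂ (ι (pick P (sender s e) e)) (ι (pick P v e))) (cong (λ t
              → ι (pick P (sender s e) e) + ι (pick P v e) - ι t) (sym same)))
          where
          l₂ : ∀ a b → b ≡ a + b - a
          l₂ = solve 2 (λ a b → b := a :+ b :- a) refl
          same : pick (P [ v ]≔ none) (sender s e) e ≡ pick P (sender s e) e
          same = cong (λ R → picked R (sender s e) e) (lookup∘update′ ¬q P none)

      -- Replacing the sample of `v` by the empty graph removes its only possible proposal and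
      -- affects only the two ends of that edge. Hence the cost `G` is at most `2 δ`, and its square
      -- is linear in `G`.
      change : ∀ P v → sq (free (s , P) - free (s , P [ v ]≔ none)) ≤ two * δ * G v (lookup P v)
      change P v = ≤-trans (sq-close (G v (lookup P v))
          (free-compare (s , P [ v ]≔ none) (s , P) (λ e → ι (pick P v e)) (λ e → 0≤ι (pick P v e)) (λ e → proj₂ (A-redrawn P v e)))
          (free-compare (s , P) (s , P [ v ]≔ none) (λ e → ι (pick P v e)) (λ e → 0≤ι (pick P v e)) (λ e → proj₁ (A-redrawn P v e))))
        (*-monoˡ-nn (G v (lookup P v)) (0≤G v (lookup P v)) (G≤ v (lookup P v)))

      E-G : ∀ v → E samples (λ P → G v (lookup P v)) ≡ ∑ (λ e → ι (inc I e v) * (xC e * cost e))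
      E-G v = trans (E-coord (λ _ → real) v (G v)) (trans (E-∑ real (λ e R → ι (picked R v e) * cost e))
        (∑-cong (λ e → trans (E-*ʳ real (cost e) (λ R → ι (picked R v e))) (term e (inc I e v) refl))))
        where
        term : ∀ e i → inc I e v ≡ i → E real (λ R → ι (picked R v e)) * cost e ≡ ι i * (xC e * cost e)
        term e true  h = trans (cong (λ t → t * cost e) (E-picked v e h)) (sym (*-identityˡ (xC e * cost e)))
        term e false h = trans (cong (λ t → t * cost e) (trans (E-cong real (λ R → cong ι (off R (lookup (opt R) e)))) (E-const real 0ℚ))) (trans
            (*-zeroˡ (cost e)) (sym (*-zeroˡ (xC e * cost e))))
          where
          off : ∀ R o → o ∧ (inc I e v ∧ crucial e) ≡ false
          off R true  = cong (_∧ crucial e) h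
          off R false = refl

      ends-twice : ∀ (a : Fin (m I) → ℚ) → ∑ (λ v → ∑ (λ e → ι (inc I e v) * a e)) ≡ two * ∑ a
      ends-twice a = trans (∑-swap (λ v e → ι (inc I e v) * a e)) (trans (∑-cong (λ e → trans (∑-inc I e (λ _ → a e)) (lem (a e)))) (∑-*ˡ two a))
        where
        lem : ∀ d → d + d ≡ two * d
        lem = solve 1 (λ d → d :+ d := con two :* d) refl

      Var-picks : Var samples (λ P → free (s , P)) ≤ four * (δ * ∑ b)
      Var-picks = ≤-trans (efron-stein (λ _ → real) (λ _ → none) (λ P → free (s , P)))
        (≤-trans (∑-mono (λ v → E-mono samples (λ P → change P v)))
        (≤-trans (≡⇒≤ (trans (∑-cong (λ v → trans (E-*ˡ samples (two * δ) (λ P → G v (lookup P v))) (cong (λ t → two * δ * t) (E-G v))))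
            (trans (∑-*ˡ (two * δ) (λ v → ∑ (λ e → ι (inc I e v) * (xC e * cost e)))) (cong (λ t → two * δ * t) (ends-twice (λ e → xC e * cost e))))))
        (≤-trans (*-monoʳ-nn (two * δ) (0≤two ⊗ 0≤δ) (*-monoʳ-nn two 0≤two total-cost)) (≡⇒≤ (lem δ (∑ b))))))
        where
        lem : ∀ d s → two * d * (two * s) ≡ four * (d * s)
        lem = solve 2 (λ d s → con two :* d :* (con two :* s) := con four :* (d :* s)) refl

    -- Labels are compared only after averaging over the samples. For fixed samples one label may
    -- switch many proposals at once; on average those at `z` are controlled by its crucial load,
    -- which gives `H z ≤ 4 δ`.
    average : Vec Bool (n I) → ℚ
    average s = E samples (λ P → free (s , P))

    -- Relabelling `z` affects only edges at `z` that are picked by one of their ends; counting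
    -- picks from both ends makes the bound independent of the labels.
    Δs : Fin (n I) → Vec (EdgeSet (m I)) (n I) → Fin (m I) → ℚ
    Δs z P e = ι (inc I e z) * (ι (pick P (end₁ I e) e) + ι (pick P (end₂ I e) e))

    0≤Δs : ∀ z P e → 0ℚ ≤ Δs z P e
    0≤Δs z P e = 0≤ι (inc I e z) ⊗ (0≤ι (pick P (end₁ I e) e) ⊕ 0≤ι (pick P (end₂ I e) e))

    A≤picks : ∀ s P e → ι (A (s , P) e) ≤ ι (pick P (end₁ I e) e) + ι (pick P (end₂ I e) e)
    A≤picks s P e = go (active s e) (lookup s (end₁ I e))
      where
      p₁ p₂ : Bool
      p₁ = pick P (end₁ I e) e
      p₂ = pick P (end₂ I e) e
      l₁ : ∀ a b → b ≡ a + b - a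
      l₁ = solve 2 (λ a b → b := a :+ b :- a) refl
      l₂ : ∀ a b → a ≡ a + b - b
      l₂ = solve 2 (λ a b → a := a :+ b :- b) refl
      go : ∀ a b → ι (a ∧ pick P (if b then end₁ I e else end₂ I e) e) ≤ ι p₁ + ι p₂
      go false b    = 0≤ι p₁ ⊕ 0≤ι p₂
      go true true  = by-gap (0≤ι p₂) (l₁ (ι p₁) (ι p₂))
      go true false = by-gap (0≤ι p₁) (l₂ (ι p₁) (ι p₂))

    A-relabelled : ∀ s z c P e → ι (A (s , P) e) ≤ ι (A (s [ z ]≔ c , P) e) + Δs z P e
    A-relabelled s z c P e = go (end₁ I e ≟ z) (end₂ I e ≟ z)
      where
      s' : Vec Bool (n I)
      s' = s [ z ]≔ c
      near : inc I e z ≡ true → ι (A (s , P) e) ≤ ι (A (s' , P) e) + Δs z P e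
      near h = ≤-trans (A≤picks s P e) (≤-trans (≡⇒≤ (sym (trans (cong (λ i → ι i * q) h) (*-identityˡ q)))) (by-gap (0≤ι (A (s' , P) e)) (l₁ (ι (A
          (s' , P) e)) (Δs z P e))))
        where
        q : ℚ
        q = ι (pick P (end₁ I e) e) + ι (pick P (end₂ I e) e)
        l₁ : ∀ a b → a ≡ a + b - b
        l₁ = solve 2 (λ a b → a := a :+ b :- b) refl
      go : Dec (end₁ I e ≡ z) → Dec (end₂ I e ≡ z) → ι (A (s , P) e) ≤ ι (A (s' , P) e) + Δs z P e
      go (yes q) _ = near (subst (λ t → inc I e t ≡ true) q (inc₁ I e))
      go (no _) (yes q) = near (subst (λ t → inc I e t ≡ true) q (inc₂ I e))
      go (no p) (no q) = ≤-trans (≡⇒≤ (cong ι same)) (by-gap (0≤Δs z P e) (l₂ (ι (A (s' , P) e)) (Δs z P e)))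
        where
        l₂ : ∀ a b → b ≡ a + b - a
        l₂ = solve 2 (λ a b → b := a :+ b :- a) refl
        same : A (s , P) e ≡ A (s' , P) e
        same = cong₂ (λ a b → (a xor b) ∧ pick P (if a then end₁ I e else end₂ I e) e) (sym (lookup∘update′ p s c)) (sym (lookup∘update′ q s c))

    update-back : ∀ {k} (s : Vec Bool k) z → (s [ z ]≔ false) [ z ]≔ lookup s z ≡ s
    update-back (x ∷ s) fz     = refl
    update-back (x ∷ s) (fs z) = cong (x ∷_) (update-back s z)

    H : Fin (n I) → ℚ
    H z = ∑ (λ e → ι (inc I e z) * (two * (xC e * cost e)))

    E-Δs : ∀ z → E samples (λ P → ∑ (λ e → Δs z P e * cost e)) ≡ H z
    E-Δs z = trans (E-∑ samples (λ e P → Δs z P e * cost e)) (∑-cong (λ e →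
      trans (E-*ʳ samples (cost e) (λ P → Δs z P e)) (trans (cong (λ t → t * cost e)
        (trans (E-*ˡ samples (ι (inc I e z)) (λ P → ι (pick P (end₁ I e) e) + ι (pick P (end₂ I e) e)))
          (cong (λ t → ι (inc I e z) * t) (trans (E-+ samples (λ P → ι (pick P (end₁ I e) e)) (λ P → ι (pick P (end₂ I e) e)))
            (cong₂ _+_ (E-pick (end₁ I e) e (inc₁ I e)) (E-pick (end₂ I e) e (inc₂ I e)))))))
        (lem (ι (inc I e z)) (xC e) (cost e)))))
      where
      lem : ∀ i x c → i * (x + x) * c ≡ i * (two * (x * c))
      lem = solve 3 (λ i x c → i :* (x :+ x) :* c := i :* (con two :* (x :* c))) refl

    relabel : ∀ s s' z → (∀ P e → ι (A (s , P) e) ≤ ι (A (s' , P) e) + Δs z P e) → average s' ≤ average s + H z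
    relabel s s' z h = ≤-trans (E-mono samples (λ P → free-compare (s , P) (s' , P) (Δs z P) (0≤Δs z P) (h P)))
      (≡⇒≤ (trans (E-+ samples (λ P → free (s , P)) (λ P → ∑ (λ e → Δs z P e * cost e))) (cong (λ t → average s + t) (E-Δs z))))

    0≤H : ∀ z → 0ℚ ≤ H z
    0≤H z = ∑-nn (λ e → 0≤ι (inc I e z) ⊗ 0≤two ⊗ 0≤xC e ⊗ 0≤cost e)

    H≤ : ∀ z → H z ≤ four * δ
    H≤ z = ≤-trans (∑-mono (λ e → *-monoʳ-nn (ι (inc I e z)) (0≤ι (inc I e z)) (*-monoʳ-nn two 0≤two (*-monoʳ-nn (xC e) (0≤xC e) (cost≤ e)))))
      (≤-trans (≡⇒≤ (trans (∑-cong (λ e → lem (ι (inc I e z)) (xC e) δ)) (∑-*ˡ (four * δ) (λ e → ι (inc I e z) * xC e)))) (*≤1 (0≤four ⊗ 0≤δ) c≤1))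
      where
      lem : ∀ i x d → i * (two * (x * (two * d))) ≡ four * d * (i * x)
      lem = solve 3 (λ i x d → i :* (con two :* (x :* (con two :* d))) := con four :* d :* (i :* x)) refl
      c≤1 : degree-of xC z ≤ 1ℚ
      c≤1 = ≤-trans (by-gap (∑-nn (λ e → 0≤ι (inc I e z) ⊗ 0≤xN e)) (lem' (degree-of xC z) (degree-of xN z))) (load-split z)
        where
        lem' : ∀ a b → b ≡ a + b - a
        lem' = solve 2 (λ a b → b := a :+ b :- a) refl

    Var-labels : Var labels average ≤ ℤ.+ 16 / 1 * (δ * ∑ b)
    Var-labels = ≤-trans (efron-stein (λ _ → bern ½ 0≤½ ½≤1) (λ _ → false) average)
      (≤-trans (∑-mono (λ z → E-≤ labels (four * δ * H z) (λ s → ≤-trans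
          (sq-close (H z) (relabel (s [ z ]≔ false) s z (back s z)) (relabel s (s [ z ]≔ false) z (A-relabelled s z false)))
          (*-monoˡ-nn (H z) (0≤H z) (H≤ z)))))
      (≤-trans (≡⇒≤ (trans (∑-*ˡ (four * δ) H) (cong (λ t → four * δ * t) (trans (∑-swap (λ z e → ι (inc I e z) * (two * (xC e * cost e))))
          (trans (∑-cong (λ e → trans (∑-inc I e (λ _ → two * (xC e * cost e))) (lem₁ (xC e * cost e)))) (∑-*ˡ four (λ e → xC e * cost e)))))))
      (≤-trans (*-monoʳ-nn (four * δ) (0≤four ⊗ 0≤δ) (*-monoʳ-nn four 0≤four total-cost)) (≡⇒≤ (lem₂ δ (∑ b))))))
      where
      lem₁ : ∀ x → two * x + two * x ≡ four * x
      lem₁ = solve 1 (λ x → con two :* x :+ con two :* x := con four :* x) refl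
      lem₂ : ∀ d s → four * d * (four * s) ≡ ℤ.+ 16 / 1 * (d * s)
      lem₂ = solve 2 (λ d s → con four :* d :* (con four :* s) := con (ℤ.+ 16 / 1) :* (d :* s)) refl
      back : ∀ s z P e → ι (A (s [ z ]≔ false , P) e) ≤ ι (A (s , P) e) + Δs z P e
      back s z P e = subst (λ t → ι (A (s [ z ]≔ false , P) e) ≤ ι (A (t , P) e) + Δs z P e) (update-back s z) (A-relabelled (s [ z ]≔ false) z
          (lookup s z) P e)

    -- Total variance: 4 from the samples for fixed labels and 16 from the labels.
    Var-free : Var world free ≤ ℤ.+ 20 / 1 * (δ * ∑ b)
    Var-free = ≤-trans (≡⇒≤ (trans (cong₂ (λ p q → p - sq q) (E-world (λ ω → sq (free ω))) (E-world free)) (Var-nest labels samples (λ s P → free (s , P)))))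
      (≤-trans (+-mono-≤ (E-≤ labels (four * (δ * ∑ b)) Var-picks) Var-labels) (≡⇒≤ (lem (δ * ∑ b))))
      where
      lem : ∀ d → four * d + ℤ.+ 16 / 1 * d ≡ ℤ.+ 20 / 1 * d
      lem = solve 1 (λ d → con four :* d :+ con (ℤ.+ 16 / 1) :* d := con (ℤ.+ 20 / 1) :* d) refl

  world-spread : Spread world X (ℤ.+ 20 / 1)
  world-spread = Var-free

-- Resolution of conflicts between proposals

module Selection (params : Parameters) (I : Instance) where

  open Parameters params
  open Neighbourhood I
  open Sparse params I
  open Proposals params I

  before-if : (a b : ℚ) (i j : ℕ) → Dec (a ≤ b) → Dec (b ≤ a) → Dec (i ℕ.< j) → Bool
  before-if a b i j (no _)  _       _ = false
  before-if a b i j (yes _) (no _)  _ = true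
  before-if a b i j (yes _) (yes _) d = does d

  before : Fin (m I) → Fin (m I) → Bool
  before e f = before-if (w I e) (w I f) (toℕ e) (toℕ f) (w I e ≤? w I f) (w I f ≤? w I e) (toℕ e ℕ.<? toℕ f)

  before-≤ : ∀ e f → before e f ≡ true → w I e ≤ w I f
  before-≤ e f = go (w I e ≤? w I f) (w I f ≤? w I e) (toℕ e ℕ.<? toℕ f)
    where
    go : ∀ p q r → before-if (w I e) (w I f) (toℕ e) (toℕ f) p q r ≡ true → w I e ≤ w I f
    go (yes p) _ _ _ = p
    go (no _) _ _ ()

  before-total : ∀ e f → e ≢ f → (before e f ≡ true) ⊎ (before f e ≡ true)
  before-total e f e≢f = go (w I e ≤? w I f) (w I f ≤? w I e) (toℕ e ℕ.<? toℕ f) (toℕ f ℕ.<? toℕ e)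
    where
    go : ∀ p q r s → (before-if (w I e) (w I f) (toℕ e) (toℕ f) p q r ≡ true) ⊎ (before-if (w I f) (w I e) (toℕ f) (toℕ e) q p s ≡ true)
    go (no p)  (no q)  r s = ⊥-elim (p (<⇒≤ (≰⇒> q)))
    go (no _)  (yes _) r s = inj₂ refl
    go (yes _) (no _)  r s = inj₁ refl
    go (yes _) (yes _) (yes _) s = inj₁ refl
    go (yes _) (yes _) (no _) (yes _) = inj₂ refl
    go (yes _) (yes _) (no r) (no s) = ⊥-elim (e≢f (toℕ-injective (ℕP.≤-antisym (ℕP.≮⇒≥ s) (ℕP.≮⇒≥ r))))

  before-asym : ∀ e f → before e f ≡ true → before f e ≡ true → ⊥
  before-asym e f = go (w I e ≤? w I f) (w I f ≤? w I e) (toℕ e ℕ.<? toℕ f) (toℕ f ℕ.<? toℕ e)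
    where
    go : ∀ p q r s → before-if (w I e) (w I f) (toℕ e) (toℕ f) p q r ≡ true → before-if (w I f) (w I e) (toℕ f) (toℕ e) q p s ≡ true → ⊥
    go (no _) q r s ()
    go (yes _) (no _) r s _ ()
    go (yes _) (yes _) (no _) s ()
    go (yes _) (yes _) (yes _) (no _) _ ()
    go (yes _) (yes _) (yes r) (yes s) _ _ = ℕP.<-asym r s

  share : Fin (m I) → Fin (m I) → Bool
  share e f = inc I e (end₁ I f) ∨ inc I e (end₂ I f)

  share⇒ : ∀ e f → share e f ≡ true → Σ (Fin (n I)) λ u → (inc I e u ≡ true) × (inc I f u ≡ true)
  share⇒ e f h = go (∨-true h)
    where
    go : (inc I e (end₁ I f) ≡ true) ⊎ (inc I e (end₂ I f) ≡ true) → Σ (Fin (n I)) λ u → (inc I e u ≡ true) × (inc I f u ≡ true)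
    go (inj₁ p) = end₁ I f , p , inc₁ I f
    go (inj₂ p) = end₂ I f , p , inc₂ I f

  ⇒share : ∀ e f u → inc I e u ≡ true → inc I f u ≡ true → share e f ≡ true
  ⇒share e f u p q = go (inc-cases I q)
    where
    go : (end₁ I f ≡ u) ⊎ (end₂ I f ≡ u) → share e f ≡ true
    go (inj₁ r) = cong (_∨ inc I e (end₂ I f)) (trans (cong (inc I e) r) p)
    go (inj₂ r) = trans (cong (inc I e (end₁ I f) ∨_) (trans (cong (inc I e) r) p)) (∨-zeroʳ _)

  adj : Fin (m I) → Fin (m I) → Bool
  adj e f = not (e == f) ∧ share e f

  adj⇒≢ : ∀ e f → adj e f ≡ true → e ≢ f
  adj⇒≢ e f h refl = true≢false (proj₁ (∧-true h)) (cong not (==-refl e))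

  ⇒adj : ∀ e f u → e ≢ f → inc I e u ≡ true → inc I f u ≡ true → adj e f ≡ true
  ⇒adj e f u e≢f p q = cong₂ _∧_ (cong not (==-≢ e≢f)) (⇒share e f u p q)

  adj-share : ∀ e f → adj e f ≡ true → Σ (Fin (n I)) λ u → (inc I e u ≡ true) × (inc I f u ≡ true)
  adj-share e f h = share⇒ e f (proj₂ (∧-true {not (e == f)} h))

  adj-sym : ∀ e f → adj e f ≡ true → adj f e ≡ true
  adj-sym e f h = ⇒adj f e (proj₁ (adj-share e f h)) (≢-sym (adj⇒≢ e f h)) (proj₂ (proj₂ (adj-share e f h))) (proj₁ (proj₂ (adj-share e f h)))

  -- Of two conflicting proposals the lighter one loses (ties are broken by index).
  loses : Fin (m I) → Fin (m I) → Bool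
  loses e f = adj e f ∧ before e f

  lost? : ∀ ω e → Dec (Σ (Fin (m I)) λ f → A ω f ∧ loses e f ≡ true)
  lost? ω e = any? (λ f → (A ω f ∧ loses e f) Bool.≟ true)

  K : World → EdgeSet (m I)
  K ω = tabulate (λ e → A ω e ∧ not (does (lost? ω e)))

  K-eq : ∀ ω e → lookup (K ω) e ≡ A ω e ∧ not (does (lost? ω e))
  K-eq ω e = lookup∘tabulate _ e

  K⊆A : ∀ ω e → lookup (K ω) e ≡ true → A ω e ≡ true
  K⊆A ω e h = proj₁ (∧-true (trans (sym (K-eq ω e)) h))

  K-wins : ∀ ω e f → lookup (K ω) e ≡ true → A ω f ≡ true → loses e f ≡ true → ⊥
  K-wins ω e f h p q = go (lost? ω e) (proj₂ (∧-true {A ω e} (trans (sym (K-eq ω e)) h)))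
    where
    go : (d : Dec (Σ (Fin (m I)) λ f → A ω f ∧ loses e f ≡ true)) → not (does d) ≡ true → ⊥
    go (no ¬d) _ = ¬d (f , cong₂ _∧_ p q)
    go (yes _) ()

  K-match : ∀ ω → IsMatching I (K ω)
  K-match ω e f u p q eu fu = go (e ≟ f)
    where
    go : Dec (e ≡ f) → e ≡ f
    go (yes r) = r
    go (no e≢f) = ⊥-elim (clash (before-total e f e≢f))
      where
      clash : (before e f ≡ true) ⊎ (before f e ≡ true) → ⊥
      clash (inj₁ b) = K-wins ω e f p (K⊆A ω f q) (cong₂ _∧_ (⇒adj e f u e≢f eu fu) b)
      clash (inj₂ b) = K-wins ω f e q (K⊆A ω e p) (cong₂ _∧_ (⇒adj f e u (≢-sym e≢f) fu eu) b)

  conflict : World → Fin (m I) → Fin (m I) → ℚ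
  conflict ω e f = ι (loses e f) * (ι (A ω e) * ι (A ω f))

  ιK-≥ : ∀ ω e → ι (A ω e) - ∑ (λ f → conflict ω e f) ≤ ι (lookup (K ω) e)
  ιK-≥ ω e = ≤-trans (go (A ω e) refl (lost? ω e)) (≡⇒≤ (cong ι (sym (K-eq ω e))))
    where
    0≤conflict : ∀ f → 0ℚ ≤ conflict ω e f
    0≤conflict f = 0≤ι (loses e f) ⊗ 0≤ι (A ω e) ⊗ 0≤ι (A ω f)
    total : ℚ
    total = ∑ (λ f → conflict ω e f)
    l₁ : ∀ t → t ≡ 0ℚ - (0ℚ - t)
    l₁ = solve 1 (λ t → t := con 0ℚ :- (con 0ℚ :- t)) refl
    l₂ : ∀ t → t ≡ 1ℚ - (1ℚ - t)
    l₂ = solve 1 (λ t → t := con 1ℚ :- (con 1ℚ :- t)) refl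
    l₃ : ∀ t → t - 1ℚ ≡ 0ℚ - (1ℚ - t)
    l₃ = solve 1 (λ t → t :- con 1ℚ := con 0ℚ :- (con 1ℚ :- t)) refl
    go : ∀ a → A ω e ≡ a → (d : Dec (Σ (Fin (m I)) λ f → A ω f ∧ loses e f ≡ true)) → ι a - total ≤ ι (a ∧ not (does d))
    go false _ _ = by-gap (∑-nn 0≤conflict) (l₁ total)
    go true  _ (no _) = by-gap (∑-nn 0≤conflict) (l₂ total)
    go true  h (yes (f , p)) = by-gap (gap (≤-trans (≡⇒≤ one) (∑-term 0≤conflict f))) (l₃ total)
      where
      one : 1ℚ ≡ conflict ω e f
      one = sym (trans (cong (λ b → ι b * (ι (A ω e) * ι (A ω f))) (proj₂ (∧-true {A ω f} p)))
        (cong₂ (λ a b → 1ℚ * (ι a * ι b)) h (proj₁ (∧-true {A ω f} p))))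

  c : Fin (n I) → ℚ
  c u = degree-of xC u

  pair : Fin (m I) → Fin (m I) → ℚ
  pair e f = xC e * xC f

  0≤pair : ∀ e f → 0ℚ ≤ pair e f
  0≤pair e f = 0≤xC e ⊗ 0≤xC f

  lost : ℚ
  lost = ∑ (λ e → ∑ (λ f → w I e * (ι (loses e f) * pair e f)))

  -- A conflict costs the smaller of two weights, hence at most their average. Each edge of the pair
  -- is charged half of its own weight, and summing over the neighbours at both ends produces the
  -- crucial loads.
  lost≤ : lost + lost ≤ ∑ (λ e → w I e * (xC e * (c (end₁ I e) + c (end₂ I e))))
  lost≤ = ≤-trans (≡⇒≤ (trans (cong (λ z → lost + z) (∑-swap (λ e f → w I e * (ι (loses e f) * pair e f))))
      (trans (sym (∑-+ (λ e → ∑ (λ f → w I e * (ι (loses e f) * pair e f))) (λ e → ∑ (λ f → w I f * (ι (loses f e) * pair f e)))))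
        (∑-cong (λ e → sym (∑-+ (λ f → w I e * (ι (loses e f) * pair e f)) (λ f → w I f * (ι (loses f e) * pair f e))))))))
    (≤-trans (∑-mono (λ e → ∑-mono (λ f → exclusive e f)))
    (≤-trans (≡⇒≤ balance) (∑-mono neighbours)))
    where
    half : Fin (m I) → Fin (m I) → ℚ
    half e f = ½ * (w I e * (ι (adj e f) * pair e f))
    exclusive : ∀ e f → w I e * (ι (loses e f) * pair e f) + w I f * (ι (loses f e) * pair f e) ≤ half e f + half f e
    exclusive e f = go (adj e f) (adj f e) (before e f) (before f e) refl refl refl refl
      where
      h = pair e f
      flipped : pair f e ≡ h
      flipped = *-comm (xC f) (xC e)
      0≤wx : ∀ g → 0ℚ ≤ w I g * h
      0≤wx g = w-nonneg I g ⊗ 0≤pair e f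
      neither : ∀ a b → w I e * (ι (false ∧ a) * h) + w I f * (ι (false ∧ b) * pair f e) ≡ ½ * (w I e * (0ℚ * h)) + ½ * (w I f * (0ℚ * pair f e))
      neither a b = eq₀ (w I e) (w I f) h (pair f e) ½
        where
        eq₀ : ∀ a b x y h → a * (0ℚ * x) + b * (0ℚ * y) ≡ h * (a * (0ℚ * x)) + h * (b * (0ℚ * y))
        eq₀ = solve 5 (λ a b x y h → a :* (con 0ℚ :* x) :+ b :* (con 0ℚ :* y) := h :* (a :* (con 0ℚ :* x)) :+ h :* (b :* (con 0ℚ :* y))) refl
      go : ∀ a a' b b' → adj e f ≡ a → adj f e ≡ a' → before e f ≡ b → before f e ≡ b' →
           w I e * (ι (a ∧ b) * h) + w I f * (ι (a' ∧ b') * pair f e) ≤ ½ * (w I e * (ι a * h)) + ½ * (w I f * (ι a' * pair f e))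
      go true  false b b' p q _ _ = ⊥-elim (true≢false (adj-sym e f p) q)
      go false true  b b' p q _ _ = ⊥-elim (true≢false (adj-sym f e q) p)
      go false false b b' _ _ _ _ = ≡⇒≤ (neither b b')
      go true  true true true _ _ p q = ⊥-elim (before-asym e f p q)
      go true  true false false _ _ _ _ = by-gap (0≤½ ⊗ (0≤wx e ⊕ w-nonneg I f ⊗ 0≤pair f e)) (eq₀ (w I e) (w I f) h (pair f e) ½)
        where
        eq₀ : ∀ a b x y h → h * (a * x + b * y) ≡ h * (a * (1ℚ * x)) + h * (b * (1ℚ * y)) - (a * (0ℚ * x) + b * (0ℚ * y))
        eq₀ = solve 5 (λ a b x y h → h :* (a :* x :+ b :* y) := h :* (a :* (con 1ℚ :* x)) :+ h :* (b :* (con 1ℚ :* y)) :- (a :* (con 0ℚ :* x)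
            :+ b :* (con 0ℚ :* y))) refl
      go true  true true false _ _ p _ = ≤-resp (sym lhs) (sym rhs) (by-gap (0≤½ ⊗ gap (before-≤ e f p) ⊗ 0≤pair e f) (eq₀ (w I e) (w I f) h))
        where
        eq₀ : ∀ a b x → ½ * ((b - a) * x) ≡ ½ * ((a + b) * x) - a * x
        eq₀ = solve 3 (λ a b x → con ½ :* ((b :- a) :* x) := con ½ :* ((a :+ b) :* x) :- a :* x) refl
        l₁ : ∀ a b x y → a * (1ℚ * x) + b * (0ℚ * y) ≡ a * x
        l₁ = solve 4 (λ a b x y → a :* (con 1ℚ :* x) :+ b :* (con 0ℚ :* y) := a :* x) refl
        l₂ : ∀ a b x h → h * (a * (1ℚ * x)) + h * (b * (1ℚ * x)) ≡ h * ((a + b) * x)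
        l₂ = solve 4 (λ a b x h → h :* (a :* (con 1ℚ :* x)) :+ h :* (b :* (con 1ℚ :* x)) := h :* ((a :+ b) :* x)) refl
        lhs : w I e * (1ℚ * h) + w I f * (0ℚ * pair f e) ≡ w I e * h
        lhs = l₁ (w I e) (w I f) h (pair f e)
        rhs : ½ * (w I e * (1ℚ * h)) + ½ * (w I f * (1ℚ * pair f e)) ≡ ½ * ((w I e + w I f) * h)
        rhs = trans (cong (λ y → ½ * (w I e * (1ℚ * h)) + ½ * (w I f * (1ℚ * y))) flipped) (l₂ (w I e) (w I f) h ½)
      go true  true false true _ _ _ q = ≤-resp (sym lhs) (sym rhs) (by-gap (0≤½ ⊗ gap (before-≤ f e q) ⊗ 0≤pair e f) (eq₀ (w I e) (w I f) h))
        where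
        eq₀ : ∀ a b x → ½ * ((a - b) * x) ≡ ½ * ((a + b) * x) - b * x
        eq₀ = solve 3 (λ a b x → con ½ :* ((a :- b) :* x) := con ½ :* ((a :+ b) :* x) :- b :* x) refl
        l₁ : ∀ a b x → a * (0ℚ * x) + b * (1ℚ * x) ≡ b * x
        l₁ = solve 3 (λ a b x → a :* (con 0ℚ :* x) :+ b :* (con 1ℚ :* x) := b :* x) refl
        l₂ : ∀ a b x h → h * (a * (1ℚ * x)) + h * (b * (1ℚ * x)) ≡ h * ((a + b) * x)
        l₂ = solve 4 (λ a b x h → h :* (a :* (con 1ℚ :* x)) :+ h :* (b :* (con 1ℚ :* x)) := h :* ((a :+ b) :* x)) refl
        lhs : w I e * (0ℚ * h) + w I f * (1ℚ * pair f e) ≡ w I f * h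
        lhs = trans (cong (λ y → w I e * (0ℚ * h) + w I f * (1ℚ * y)) flipped) (l₁ (w I e) (w I f) h)
        rhs : ½ * (w I e * (1ℚ * h)) + ½ * (w I f * (1ℚ * pair f e)) ≡ ½ * ((w I e + w I f) * h)
        rhs = trans (cong (λ y → ½ * (w I e * (1ℚ * h)) + ½ * (w I f * (1ℚ * y))) flipped) (l₂ (w I e) (w I f) h ½)
    full : Fin (m I) → ℚ
    full e = ∑ (λ f → w I e * (ι (adj e f) * pair e f))
    balance : ∑ (λ e → ∑ (λ f → half e f + half f e)) ≡ ∑ full
    balance = trans (∑-cong (λ e → ∑-+ (half e) (λ f → half f e))) (trans (∑-+ (λ e → ∑ (half e)) (λ e → ∑ (λ f → half f e)))
      (trans (cong (λ z → ∑ (λ e → ∑ (half e)) + z) (∑-swap (λ e f → half f e)))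
      (trans (cong (λ z → z + z) (trans (∑-cong (λ e → ∑-*ˡ ½ (λ f → w I e * (ι (adj e f) * pair e f)))) (∑-*ˡ ½ full))) (eq₀ (∑ full)))))
      where
      eq₀ : ∀ s → ½ * s + ½ * s ≡ s
      eq₀ = solve 1 (λ s → con ½ :* s :+ con ½ :* s := s) refl
    neighbours : ∀ e → full e ≤ w I e * (xC e * (c (end₁ I e) + c (end₂ I e)))
    neighbours e = ≤-trans (≡⇒≤ (trans (∑-cong (λ f → l₁ (w I e) (ι (adj e f)) (xC e) (xC f))) (∑-*ˡ (w I e * xC e) (λ f → ι (adj e f) * xC f))))
      (≤-trans (*-monoʳ-nn (w I e * xC e) (w-nonneg I e ⊗ 0≤xC e) (≤-trans (∑-mono near) (≡⇒≤ (∑-+ (λ f → ι (inc I f (end₁ I e)) * xC f) (λ f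
          → ι (inc I f (end₂ I e)) * xC f)))))
        (≡⇒≤ (*-assoc (w I e) (xC e) (c (end₁ I e) + c (end₂ I e)))))
      where
      l₁ : ∀ w a x y → w * (a * (x * y)) ≡ w * x * (a * y)
      l₁ = solve 4 (λ w a x y → w :* (a :* (x :* y)) := w :* x :* (a :* y)) refl
      near : ∀ f → ι (adj e f) * xC f ≤ ι (inc I f (end₁ I e)) * xC f + ι (inc I f (end₂ I e)) * xC f
      near f = ≤-trans (*-monoˡ-nn (xC f) (0≤xC f) (go (adj e f) refl)) (≡⇒≤ (*-distribʳ-+ (xC f) (ι (inc I f (end₁ I e))) (ι (inc I f (end₂ I e)))))
        where
        i₁ i₂ : ℚ
        i₁ = ι (inc I f (end₁ I e))
        i₂ = ι (inc I f (end₂ I e))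
        l₂ : ∀ a b → b ≡ a + b - a
        l₂ = solve 2 (λ a b → b := a :+ b :- a) refl
        l₃ : ∀ a b → a ≡ a + b - b
        l₃ = solve 2 (λ a b → a := a :+ b :- b) refl
        go : ∀ a → adj e f ≡ a → ι a ≤ i₁ + i₂
        go false _ = 0≤ι (inc I f (end₁ I e)) ⊕ 0≤ι (inc I f (end₂ I e))
        go true h = at (inc-cases I (proj₁ (proj₂ (adj-share e f h))))
          where
          u : Fin (n I)
          u = proj₁ (adj-share e f h)
          fu : inc I f u ≡ true
          fu = proj₂ (proj₂ (adj-share e f h))
          at : (end₁ I e ≡ u) ⊎ (end₂ I e ≡ u) → 1ℚ ≤ i₁ + i₂
          at (inj₁ q) = ≤-trans (≡⇒≤ (sym (cong ι (trans (cong (inc I f) q) fu)))) (by-gap (0≤ι (inc I f (end₂ I e))) (l₂ i₁ i₂))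
          at (inj₂ q) = ≤-trans (≡⇒≤ (sym (cong ι (trans (cong (inc I f) q) fu)))) (by-gap (0≤ι (inc I f (end₁ I e))) (l₃ i₁ i₂))

  -- One half is the probability that the ends get different labels; 1/16 is half of the factor 1/8
  -- in `E-AA`, the halving being that of `lost≤`.
  share-of : Fin (m I) → ℚ
  share-of e = xC e * (½ - (ℤ.+ 1 / 16) * (c (end₁ I e) + c (end₂ I e)))

  selected : ∑ (λ e → share-of e * w I e) ≤ E world (λ ω → ∑ (λ e → ι (lookup (K ω) e) * 1ℚ * w I e))
  selected = ≤-trans budget (≤-trans (≡⇒≤ (sym expand)) (E-mono world (λ ω → ∑-mono (λ e → pointwise ω e))))
    where
    net : World → Fin (m I) → ℚ
    net ω e = w I e * (ι (A ω e) - ∑ (λ f → conflict ω e f))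
    pointwise : ∀ ω e → net ω e ≤ ι (lookup (K ω) e) * 1ℚ * w I e
    pointwise ω e = ≤-trans (*-monoʳ-nn (w I e) (w-nonneg I e) (ιK-≥ ω e)) (≡⇒≤ (eq₀ (w I e) (ι (lookup (K ω) e))))
      where
      eq₀ : ∀ w k → w * k ≡ k * 1ℚ * w
      eq₀ = solve 2 (λ w k → w :* k := k :* con 1ℚ :* w) refl
    clashes : Fin (m I) → ℚ
    clashes e = ∑ (λ f → ι (loses e f) * E world (λ ω → ι (A ω e) * ι (A ω f)))
    E-net : ∀ e → E world (λ ω → net ω e) ≡ w I e * (½ * xC e - clashes e)
    E-net e = trans (E-*ˡ world (w I e) (λ ω → ι (A ω e) - ∑ (λ f → conflict ω e f))) (cong (λ z → w I e * z)
      (trans (E-- world (λ ω → ι (A ω e)) (λ ω → ∑ (λ f → conflict ω e f))) (cong₂ _-_ (E-A e)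
        (trans (E-∑ world (λ f ω → conflict ω e f)) (∑-cong (λ f → E-*ˡ world (ι (loses e f)) (λ ω → ι (A ω e) * ι (A ω f))))))))
    expand : E world (λ ω → ∑ (λ e → net ω e)) ≡ ∑ (λ e → w I e * (½ * xC e - clashes e))
    expand = trans (E-∑ world (λ e ω → net ω e)) (∑-cong E-net)
    clash≤ : ∀ e f → ι (loses e f) * E world (λ ω → ι (A ω e) * ι (A ω f)) ≤ ι (loses e f) * ((ℤ.+ 1 / 8) * pair e f)
    clash≤ e f = go (loses e f) refl
      where
      go : ∀ b → loses e f ≡ b → ι b * E world (λ ω → ι (A ω e) * ι (A ω f)) ≤ ι b * ((ℤ.+ 1 / 8) * pair e f)
      go false _ = ≡⇒≤ (trans (*-zeroˡ (E world (λ ω → ι (A ω e) * ι (A ω f)))) (sym (*-zeroˡ ((ℤ.+ 1 / 8) * pair e f))))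
      go true h = *-monoʳ-nn 1ℚ 0≤1 (E-AA e f (proj₁ s) (adj⇒≢ e f a) (proj₁ (proj₂ s)) (proj₂ (proj₂ s)))
        where
        a : adj e f ≡ true
        a = proj₁ (∧-true h)
        s : Σ (Fin (n I)) λ u → (inc I e u ≡ true) × (inc I f u ≡ true)
        s = adj-share e f a
    W₁ W₂ : ℚ
    W₁ = ∑ (λ e → w I e * (½ * xC e))
    W₂ = ∑ (λ e → w I e * (xC e * (c (end₁ I e) + c (end₂ I e))))
    lower : W₁ - (ℤ.+ 1 / 8) * lost ≤ ∑ (λ e → w I e * (½ * xC e - clashes e))
    lower = ≤-trans (≡⇒≤ (sym (trans (∑-cong (λ e → l₁ (w I e) (½ * xC e) (∑ (λ f → ι (loses e f) * ((ℤ.+ 1 / 8) * pair e f)))))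
        (trans (∑-- (λ e → w I e * (½ * xC e)) (λ e → w I e * ∑ (λ f → ι (loses e f) * ((ℤ.+ 1 / 8) * pair e f))))
          (cong (λ z → W₁ - z) (trans (∑-cong (λ e → trans (sym (∑-*ˡ (w I e) (λ f → ι (loses e f) * ((ℤ.+ 1 / 8) * pair e f))))
            (trans (∑-cong (λ f → l₂ (w I e) (ι (loses e f)) (ℤ.+ 1 / 8) (pair e f))) (∑-*ˡ (ℤ.+ 1 / 8) (λ f
                → w I e * (ι (loses e f) * pair e f)))))) (∑-*ˡ (ℤ.+ 1 / 8) (λ e → ∑ (λ f → w I e * (ι (loses e f) * pair e f))))))))))
      (∑-mono (λ e → *-monoʳ-nn (w I e) (w-nonneg I e) (by-gap (gap (∑-mono (clash≤ e))) (l₃ (½ * xC e) (clashes e) (∑ (λ f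
          → ι (loses e f) * ((ℤ.+ 1 / 8) * pair e f)))))))
      where
      l₁ : ∀ w a b → w * (a - b) ≡ w * a - w * b
      l₁ = solve 3 (λ w a b → w :* (a :- b) := w :* a :- w :* b) refl
      l₂ : ∀ w i k p → w * (i * (k * p)) ≡ k * (w * (i * p))
      l₂ = solve 4 (λ w i k p → w :* (i :* (k :* p)) := k :* (w :* (i :* p))) refl
      l₃ : ∀ a b d → d - b ≡ a - b - (a - d)
      l₃ = solve 3 (λ a b d → d :- b := a :- b :- (a :- d)) refl
    budget : ∑ (λ e → share-of e * w I e) ≤ ∑ (λ e → w I e * (½ * xC e - clashes e))
    budget = ≤-trans (≡⇒≤ (trans (∑-cong (λ e → l₁ (xC e) (c (end₁ I e) + c (end₂ I e)) (w I e)))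
        (trans (∑-- (λ e → w I e * (½ * xC e)) (λ e → (ℤ.+ 1 / 16) * (w I e * (xC e * (c (end₁ I e) + c (end₂ I e))))))
          (cong (λ z → W₁ - z) (∑-*ˡ (ℤ.+ 1 / 16) (λ e → w I e * (xC e * (c (end₁ I e) + c (end₂ I e)))))))))
      (≤-trans (by-gap (nonNegative⁻¹ (ℤ.+ 1 / 16) ⊗ gap lost≤) (l₂ W₁ W₂ lost)) lower)
      where
      l₁ : ∀ x s w → x * (½ - (ℤ.+ 1 / 16) * s) * w ≡ w * (½ * x) - (ℤ.+ 1 / 16) * (w * (x * s))
      l₁ = solve 3 (λ x s w → x :* (con ½ :- con (ℤ.+ 1 / 16) :* s) :* w := w :* (con ½ :* x) :- con (ℤ.+ 1 / 16) :* (w :* (x :* s))) refl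
      l₂ : ∀ a b s → (ℤ.+ 1 / 16) * (b - (s + s)) ≡ a - (ℤ.+ 1 / 8) * s - (a - (ℤ.+ 1 / 16) * b)
      l₂ = solve 3 (λ a b s → con (ℤ.+ 1 / 16) :* (b :- (s :+ s)) := a :- con (ℤ.+ 1 / 8) :* s :- (a :- con (ℤ.+ 1 / 16) :* b)) refl

-- Scaled minor edges between vertices without proposals

module Proposals-first (params : Parameters) (0<γ : 0ℚ < Parameters.γ params) (1≤S : 1ℚ ≤ Parameters.S params)
  (wide : ℤ.+ 20 / 1 ≤ Parameters.S params * (Parameters.γ params + Parameters.γ params + Parameters.γ params))
  (tiny : Parameters.κ params * (ℤ.+ 64000 / 1 * (Parameters.S params * Parameters.τ params)) ≤ Parameters.ε params)
  (I : Instance) where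

  open Parameters params
  open Neighbourhood I
  open Sparse params I
  open Proposals params I
  open Proposal-spread params I using (world-spread)
  open Selection params I using (K; K-eq; K⊆A; K-match; share-of; selected)
  module CF = Crucial-first params 0<γ 1≤S I
  open CF using (c; 0≤c; c≤1; g; i; 0≤i; gi; room; V; shrunk; redrawn; Γ)

  twenty : ℚ
  twenty = ℤ.+ 20 / 1

  0≤twenty : 0ℚ ≤ twenty
  0≤twenty = nonNegative⁻¹ twenty

  20i≤S : ∀ u → twenty * i u ≤ S
  20i≤S u = ≤-trans (*-monoˡ-nn (i u) (0≤i u) wide) (≤-trans (≡⇒≤ (*-assoc S Γ (i u)))
    (*≤1 0≤S (≤-trans (*-monoˡ-nn (i u) (0≤i u) Γ≤g) (≡⇒≤ (gi u)))))
    where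
    Γ≤g : Γ ≤ g u
    Γ≤g = ≤-trans (by-gap (CF.0≤deg-xN u) (lem Γ (degree-of xN u))) (room u)
      where
      lem : ∀ a b → b ≡ b + a - a
      lem = solve 2 (λ a b → b := b :+ a :- a) refl

  -- Proportion of the minor edges aimed at from the viewpoint of `u`: the lower bound for the
  -- probability that `u` is free, divided by the room `g u`.
  t₀ : Fin (n I) → ℚ
  t₀ u = (1ℚ - ½ * c u) * i u

  0≤half : ∀ u → 0ℚ ≤ 1ℚ - ½ * c u
  0≤half u = gap (≤-trans (*-mono-nn 0≤½ ½≤1 (0≤c u) (c≤1 u)) (≡⇒≤ (*-identityˡ 1ℚ)))

  half≤1 : ∀ u → 1ℚ - ½ * c u ≤ 1ℚ
  half≤1 u = by-gap (0≤½ ⊗ 0≤c u) (lem (½ * c u))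
    where
    lem : ∀ a → a ≡ 1ℚ - (1ℚ - a)
    lem = solve 1 (λ a → a := con 1ℚ :- (con 1ℚ :- a)) refl

  0≤t₀ : ∀ u → 0ℚ ≤ t₀ u
  0≤t₀ u = 0≤half u ⊗ 0≤i u

  t₀≤i : ∀ u → t₀ u ≤ i u
  t₀≤i u = ≤-resp refl (*-identityˡ (i u)) (*-monoˡ-nn (i u) (0≤i u) (half≤1 u))

  t : Fin (m I) → ℚ
  t e = t₀ (end₁ I e) ⊓ t₀ (end₂ I e)

  0≤t : ∀ e → 0ℚ ≤ t e
  0≤t e = ⊓-glb (0≤t₀ (end₁ I e)) (0≤t₀ (end₂ I e))

  t≤ : ∀ e u → inc I e u ≡ true → t e ≤ t₀ u
  t≤ e u h = go (inc-cases I h)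
    where
    go : (end₁ I e ≡ u) ⊎ (end₂ I e ≡ u) → t e ≤ t₀ u
    go (inj₁ q) = subst (λ v → t e ≤ t₀ v) q (p⊓q≤p (t₀ (end₁ I e)) (t₀ (end₂ I e)))
    go (inj₂ q) = subst (λ v → t e ≤ t₀ v) q (p⊓q≤q (t₀ (end₁ I e)) (t₀ (end₂ I e)))

  joint : World → Fin (m I) → ℚ
  joint ω e = X ω (end₁ I e) * X ω (end₂ I e)

  0≤joint : ∀ ω e → 0ℚ ≤ joint ω e
  0≤joint ω e = 0≤X ω (end₁ I e) ⊗ 0≤X ω (end₂ I e)

  joint≤1 : ∀ ω e → joint ω e ≤ 1ℚ
  joint≤1 ω e = ≤-trans (*≤1 (0≤X ω (end₁ I e)) (X≤1 ω (end₂ I e))) (X≤1 ω (end₁ I e))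

  F : Fin (m I) → ℚ
  F e = E world (λ ω → joint ω e)

  -- Union bound, in the form that the product of the two complements `1ℚ - X ω u` is nonnegative.
  F-≥ : ∀ e → 1ℚ - ½ * (c (end₁ I e) + c (end₂ I e)) ≤ F e
  F-≥ e = ≤-trans (by-gap (gap (E-free (end₁ I e)) ⊕ gap (E-free (end₂ I e))) (lem ½ (c (end₁ I e)) (c (end₂ I e)) (E world (λ ω
      → X ω (end₁ I e))) (E world (λ ω → X ω (end₂ I e)))))
    (≤-trans (≡⇒≤ (sym expand)) (E-mono world (λ ω → by-gap (gap (X≤1 ω (end₁ I e)) ⊗ gap (X≤1 ω (end₂ I e))) (lem₂ (X ω (end₁ I e)) (X ω (end₂ I e))))))
    where
    lem : ∀ h a b x y → (x - (1ℚ - h * a)) + (y - (1ℚ - h * b)) ≡ x + y - 1ℚ - (1ℚ - h * (a + b))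
    lem = solve 5 (λ h a b x y → (x :- (con 1ℚ :- h :* a)) :+ (y :- (con 1ℚ :- h :* b)) := x :+ y :- con 1ℚ :- (con 1ℚ :- h :* (a :+ b))) refl
    lem₂ : ∀ x y → (1ℚ - x) * (1ℚ - y) ≡ x * y - (x + y - 1ℚ)
    lem₂ = solve 2 (λ x y → (con 1ℚ :- x) :* (con 1ℚ :- y) := x :* y :- (x :+ y :- con 1ℚ)) refl
    expand : E world (λ ω → X ω (end₁ I e) + X ω (end₂ I e) - 1ℚ) ≡ E world (λ ω → X ω (end₁ I e)) + E world (λ ω → X ω (end₂ I e)) - 1ℚ
    expand = trans (E-- world (λ ω → X ω (end₁ I e) + X ω (end₂ I e)) (λ _ → 1ℚ)) (cong₂ _-_ (E-+ world (λ ω → X ω (end₁ I e)) (λ ω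
        → X ω (end₂ I e))) (E-const world 1ℚ))

  -- Reciprocal of the probability that both ends are free, replaced by 0 below 1/20 so that the
  -- scaling stays bounded. The edges given up in this way have end loads summing to more than
  -- 19/10, and for them the first scheme alone is good enough.
  record Inverse (f : ℚ) (large : Bool) : Set where
    field
      Φ     : ℚ
      0≤Φ   : 0ℚ ≤ Φ
      Φ≤20  : Φ ≤ twenty
      Φf    : Φ * f ≡ ι large

  0<1/20 : 0ℚ < ℤ.+ 1 / 20
  0<1/20 = positive⁻¹ (ℤ.+ 1 / 20)

  inverse : ∀ f (d : Dec (ℤ.+ 1 / 20 ≤ f)) → Inverse f (does d)
  inverse f (no _)  = record { Φ = 0ℚ ; 0≤Φ = ≤-refl ; Φ≤20 = 0≤twenty ; Φf = *-zeroˡ f }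
  inverse f (yes h) = record { Φ = ρ ; 0≤Φ = 0≤ρ ; Φ≤20 = ≤-trans (≡⇒≤ (sym (one ρ))) (≤-trans (*-monoʳ-nn twenty 0≤twenty (≤-trans (*-monoˡ-nn ρ 0≤ρ h) (≡⇒≤ inv))) (≡⇒≤ (*-identityʳ twenty)))
                             ; Φf = trans (*-comm ρ f) inv }
    where
    0<f : 0ℚ < f
    0<f = <-≤-trans 0<1/20 h
    ρ : ℚ
    ρ = proj₁ (recip f 0<f)
    0≤ρ : 0ℚ ≤ ρ
    0≤ρ = <⇒≤ (proj₁ (proj₂ (recip f 0<f)))
    inv : f * ρ ≡ 1ℚ
    inv = proj₂ (proj₂ (recip f 0<f))
    one : ∀ r → twenty * ((ℤ.+ 1 / 20) * r) ≡ r
    one = solve 1 (λ r → con twenty :* (con (ℤ.+ 1 / 20) :* r) := r) refl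

  large : Fin (m I) → Bool
  large e = does (ℤ.+ 1 / 20 ≤? F e)

  module Inv (e : Fin (m I)) = Inverse (inverse (F e) (ℤ.+ 1 / 20 ≤? F e))

  a : Fin (m I) → ℚ
  a e = xN e * (t e * Inv.Φ e)

  0≤a : ∀ e → 0ℚ ≤ a e
  0≤a e = 0≤xN e ⊗ 0≤t e ⊗ Inv.0≤Φ e

  tΦ≤S : ∀ e → t e * Inv.Φ e ≤ S
  tΦ≤S e = ≤-trans (*-mono-nn (0≤t e) (≤-trans (t≤ e (end₁ I e) (inc₁ I e)) (t₀≤i (end₁ I e))) (Inv.0≤Φ e) (Inv.Φ≤20 e))
    (≤-trans (≡⇒≤ (*-comm (i (end₁ I e)) twenty)) (20i≤S (end₁ I e)))

  a≤ : ∀ e → a e ≤ S * τ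
  a≤ e = ≤-trans (*-mono-nn (0≤xN e) (xN≤τ e) (0≤t e ⊗ Inv.0≤Φ e) (tΦ≤S e)) (≡⇒≤ (*-comm τ S))

  -- All minor load at `u` is received while `u` is free, so its expectation is kept below the bound
  -- for the probability of that event and not merely below 1.
  used : ∀ u → degree-of (λ e → xN e * t e) u ≤ 1ℚ - ½ * c u
  used u = ≤-trans (∑-mono (λ e → ≤-trans (CF.at-endpoint e u (λ h → *-monoʳ-nn (xN e) (0≤xN e) (t≤ e u h))) (≡⇒≤ (sym (*-assoc (ι (inc I e u))
      (xN e) (t₀ u))))))
    (≤-trans (≡⇒≤ (∑-*ʳ (t₀ u) (λ e → ι (inc I e u) * xN e)))
    (≤-trans (*-monoˡ-nn (t₀ u) (0≤t₀ u) (≤-trans (by-gap (0≤γ ⊕ 0≤γ ⊕ 0≤γ) (lem₀ (degree-of xN u) γ)) (room u)))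
      (≡⇒≤ (trans (lem (g u) (1ℚ - ½ * c u) (i u)) (trans (cong (λ z → (1ℚ - ½ * c u) * z) (gi u)) (*-identityʳ (1ℚ - ½ * c u)))))))
    where
    lem₀ : ∀ a g → g + (g + g) ≡ a + (g + g + g) - a
    lem₀ = solve 2 (λ a g → g :+ (g :+ g) := a :+ (g :+ g :+ g) :- a) refl
    lem : ∀ g h i → g * (h * i) ≡ h * (g * i)
    lem = solve 3 (λ g h i → g :* (h :* i) := h :* (g :* i)) refl

  degree-a : ∀ u → degree-of a u ≤ twenty
  degree-a u = ≤-trans (∑-mono (λ e → ≤-trans (*-monoʳ-nn (ι (inc I e u)) (0≤ι (inc I e u)) (*-monoʳ-nn (xN e) (0≤xN e) (*-monoʳ-nn (t e) (0≤t e)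
      (Inv.Φ≤20 e))))
      (≡⇒≤ (lem (ι (inc I e u)) (xN e) (t e) twenty))))
    (≤-trans (≡⇒≤ (∑-*ˡ twenty (λ e → ι (inc I e u) * (xN e * t e)))) (*≤1 0≤twenty (≤-trans (used u) (half≤1 u))))
    where
    lem : ∀ i x t c → i * (x * (t * c)) ≡ c * (i * (x * t))
    lem = solve 4 (λ i x t c → i :* (x :* (t :* c)) := c :* (i :* (x :* t))) refl

  -- The load that `u` receives if it is free; its own state `X ω u` is not consulted.
  seen : World → Fin (n I) → ℚ
  seen ω u = view a (X ω) u

  V₀ : ℚ
  V₀ = ℤ.+ 400 / 1 * (S * τ)

  0≤Sτ : 0ℚ ≤ S * τ
  0≤Sτ = 0≤S ⊗ 0≤τ

  Var-seen : ∀ u → Var world (λ ω → seen ω u) ≤ V₀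
  Var-seen u = ≤-trans (Var-view world X twenty world-spread a (S * τ) 0≤Sτ 0≤a a≤ u)
    (≤-trans (*-monoʳ-nn twenty 0≤twenty (*-monoʳ-nn (S * τ) 0≤Sτ (degree-a u))) (≡⇒≤ (lem (S * τ))))
    where
    lem : ∀ s → twenty * (s * twenty) ≡ ℤ.+ 400 / 1 * s
    lem = solve 1 (λ s → con twenty :* (s :* con twenty) := con (ℤ.+ 400 / 1) :* s) refl

  centre : Fin (n I) → ℚ
  centre u = E world (λ ω → seen ω u)

  joint-across : ∀ ω e u → X ω u * across e u (X ω) ≡ ι (inc I e u) * joint ω e
  joint-across ω e u = go (end₁ I e == u) (end₂ I e == u) refl refl
    where
    x₁ x₂ xᵤ : ℚ
    x₁ = X ω (end₁ I e)
    x₂ = X ω (end₂ I e)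
    xᵤ = X ω u
    l₁ : ∀ x y z → x * (1ℚ * y + 0ℚ * z) ≡ 1ℚ * (x * y)
    l₁ = solve 3 (λ x y z → x :* (con 1ℚ :* y :+ con 0ℚ :* z) := con 1ℚ :* (x :* y)) refl
    l₂ : ∀ x y z → y * (0ℚ * z + 1ℚ * x) ≡ 1ℚ * (x * y)
    l₂ = solve 3 (λ x y z → y :* (con 0ℚ :* z :+ con 1ℚ :* x) := con 1ℚ :* (x :* y)) refl
    l₃ : ∀ x y z → x * (0ℚ * y + 0ℚ * z) ≡ 0ℚ * (z * y)
    l₃ = solve 3 (λ x y z → x :* (con 0ℚ :* y :+ con 0ℚ :* z) := con 0ℚ :* (z :* y)) refl
    go : ∀ b b' → (end₁ I e == u) ≡ b → (end₂ I e == u) ≡ b' → xᵤ * (ι (end₁ I e == u) * x₂ + ι (end₂ I e == u) * x₁) ≡ ι (inc I e u) * (x₁ * x₂)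
    go b b' p q = trans (cong₂ (λ r s → xᵤ * (ι r * x₂ + ι s * x₁)) p q) (trans (at b b' p q) (sym (cong₂ (λ r s → ι (r ∨ s) * (x₁ * x₂)) p q)))
      where
      at : ∀ b b' → (end₁ I e == u) ≡ b → (end₂ I e == u) ≡ b' → xᵤ * (ι b * x₂ + ι b' * x₁) ≡ ι (b ∨ b') * (x₁ * x₂)
      at true  true  p q = ⊥-elim (loopless I e (trans (==-true p) (sym (==-true q))))
      at true  false p q = trans (cong (λ z → X ω z * (1ℚ * x₂ + 0ℚ * x₁)) (sym (==-true p))) (l₁ x₁ x₂ x₁)
      at false true  p q = trans (cong (λ z → X ω z * (0ℚ * x₂ + 1ℚ * x₁)) (sym (==-true q))) (l₂ x₁ x₂ x₂)
      at false false p q = l₃ xᵤ x₂ x₁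

  joint-load : ∀ u → E world (λ ω → X ω u * seen ω u) ≤ 1ℚ - ½ * c u
  joint-load u = ≤-trans (≡⇒≤ eq) (≤-trans (∑-mono (λ e → *-monoʳ-nn (ι (inc I e u)) (0≤ι (inc I e u)) (≤-trans (≡⇒≤ (trans (lem (xN e) (t e)
      (Inv.Φ e) (F e)) (cong (λ z → xN e * t e * z) (Inv.Φf e))))
      (*≤1 (0≤xN e ⊗ 0≤t e) (ι≤1 (large e)))))) (used u))
    where
    lem : ∀ x t p f → x * (t * p) * f ≡ x * t * (p * f)
    lem = solve 4 (λ x t p f → x :* (t :* p) :* f := x :* t :* (p :* f)) refl
    l₁ : ∀ x a s → x * (a * s) ≡ a * (x * s)
    l₁ = solve 3 (λ x a s → x :* (a :* s) := a :* (x :* s)) refl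
    l₂ : ∀ a i j → a * (i * j) ≡ i * (a * j)
    l₂ = solve 3 (λ a i j → a :* (i :* j) := i :* (a :* j)) refl
    eq : E world (λ ω → X ω u * seen ω u) ≡ ∑ (λ e → ι (inc I e u) * (a e * F e))
    eq = trans (E-cong world (λ ω → trans (sym (∑-*ˡ (X ω u) (λ e → a e * across e u (X ω)))) (∑-cong (λ e → trans (l₁ (X ω u) (a e) (across e u (X ω)))
        (trans (cong (λ z → a e * z) (joint-across ω e u)) (l₂ (a e) (ι (inc I e u)) (joint ω e)))))))
      (trans (E-∑ world (λ e ω → ι (inc I e u) * (a e * joint ω e))) (∑-cong (λ e → trans (E-*ˡ world (ι (inc I e u)) (λ ω → a e * joint ω e))
        (cong (λ z → ι (inc I e u) * z) (E-*ˡ world (a e) (λ ω → joint ω e))))))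

  -- The covariance of X u and the load is at most the standard deviation of the load, which is tiny.
  centre≤ : ∀ u → centre u ≤ 1ℚ + ½ * γ
  centre≤ u = go (centre u ≤? 1ℚ)
    where
    f M η : ℚ
    f = E world (λ ω → X ω u)
    M = centre u
    -- The excess `f * (M - 1ℚ)` will be at most `η` and `f` is at least one half, so `M` exceeds 1
    -- by at most `2 η`, which is half of `γ`.
    η = (ℤ.+ 1 / 4) * γ
    0<η : 0ℚ < η
    0<η = ≤-<-trans (≡⇒≤ (sym (*-zeroʳ (ℤ.+ 1 / 4)))) (*-monoʳ-<-pos (ℤ.+ 1 / 4) 0<γ)
    half≤f : 1ℚ - ½ * c u ≤ f
    half≤f = E-free u
    ½≤f : ½ ≤ f
    ½≤f = ≤-trans (by-gap (0≤½ ⊗ gap (c≤1 u)) (lem (c u))) half≤f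
      where
      lem : ∀ c → ½ * (1ℚ - c) ≡ 1ℚ - ½ * c - ½
      lem = solve 1 (λ c → con ½ :* (con 1ℚ :- c) := con 1ℚ :- con ½ :* c :- con ½) refl
    f≤1 : f ≤ 1ℚ
    f≤1 = E-≤ world 1ℚ (λ ω → X≤1 ω u)
    EXX : E world (λ ω → sq (X ω u)) ≤ f
    EXX = E-mono world (λ ω → *≤1 (0≤X ω u) (X≤1 ω u))
    V₀≤ : V₀ ≤ η * η
    V₀≤ = by-gap ((nonNegative⁻¹ (ℤ.+ 1 / 16) ⊗ gap scaled) ⊕ nonNegative⁻¹ (ℤ.+ 3600 / 1) ⊗ 0≤Sτ) (lem γ (S * τ))
      where
      scaled : ℤ.+ 64000 / 1 * (S * τ) ≤ sq γ
      scaled = ≤-trans (≡⇒≤ (trans (sym (*-identityˡ _)) (trans (cong (λ z → z * (ℤ.+ 64000 / 1 * (S * τ))) (sym κγ)) (eq₀ κ (sq γ) (ℤ.+ 64000 / 1 *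
          (S * τ))))))
        (≤-trans (*-monoʳ-nn (sq γ) (0≤sq γ) (≤-trans tiny ε≤1)) (≡⇒≤ (*-identityʳ (sq γ))))
        where
        eq₀ : ∀ k g s → k * g * s ≡ g * (k * s)
        eq₀ = solve 3 (λ k g s → k :* g :* s := g :* (k :* s)) refl
      lem : ∀ g s → (ℤ.+ 1 / 16) * (g * g - ℤ.+ 64000 / 1 * s) + ℤ.+ 3600 / 1 * s ≡ (ℤ.+ 1 / 4) * g * ((ℤ.+ 1 / 4) * g) - ℤ.+ 400 / 1 * s
      lem = solve 2 (λ g s → con (ℤ.+ 1 / 16) :* (g :* g :- con (ℤ.+ 64000 / 1) :* s) :+ con (ℤ.+ 3600 / 1) :* s
          := con (ℤ.+ 1 / 4) :* g :* (con (ℤ.+ 1 / 4) :* g) :- con (ℤ.+ 400 / 1) :* s) refl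
    XX XL LL : ℚ
    XX = E world (λ ω → sq (X ω u))
    XL = E world (λ ω → X ω u * seen ω u)
    LL = E world (λ ω → sq (seen ω u))
    square : World → ℚ
    square ω = sq (η * (X ω u - f) + (seen ω u - M))
    E-square : E world square ≡ η * η * (XX - f * f) + (η + η) * (XL - f * M) + (LL - M * M)
    E-square = trans (E-cong world (λ ω → lem (X ω u) (seen ω u) η f M))
      (trans (E-+ world (λ ω → η * η * sq (X ω u) + (η + η) * (X ω u * seen ω u) + sq (seen ω u)) (λ ω → α₁ * X ω u + β₁ * seen ω u + δ₁))
      (trans (cong₂ _+_
        (trans (E-+ world (λ ω → η * η * sq (X ω u) + (η + η) * (X ω u * seen ω u)) (λ ω → sq (seen ω u)))
          (cong (λ z → z + LL) (trans (E-+ world (λ ω → η * η * sq (X ω u)) (λ ω → (η + η) * (X ω u * seen ω u)))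
            (cong₂ _+_ (E-*ˡ world (η * η) (λ ω → sq (X ω u))) (E-*ˡ world (η + η) (λ ω → X ω u * seen ω u))))))
        (trans (E-+ world (λ ω → α₁ * X ω u + β₁ * seen ω u) (λ _ → δ₁)) (cong₂ _+_ (trans (E-+ world (λ ω → α₁ * X ω u) (λ ω → β₁ * seen ω u))
          (cong₂ _+_ (E-*ˡ world α₁ (λ ω → X ω u)) (E-*ˡ world β₁ (λ ω → seen ω u)))) (E-const world δ₁))))
      (lem₂ η f M XX XL LL)))
      where
      α₁ β₁ δ₁ : ℚ
      α₁ = 0ℚ - ((η * η + η * η) * f + (η + η) * M)
      β₁ = 0ℚ - ((η + η) * f + (M + M))
      δ₁ = η * η * (f * f) + (η + η) * (f * M) + M * M
      lem : ∀ x m h f M → (h * (x - f) + (m - M)) * (h * (x - f) + (m - M)) ≡ h * h * (x * x) + (h + h) * (x * m) + m * m + ((0ℚ - ((h * h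
          + h * h) * f + (h + h) * M)) * x + (0ℚ - ((h + h) * f + (M + M))) * m + (h * h * (f * f) + (h + h) * (f * M) + M * M))
      lem = solve 5 (λ x m h f M → (h :* (x :- f) :+ (m :- M)) :* (h :* (x :- f) :+ (m :- M))
          := h :* h :* (x :* x) :+ (h :+ h) :* (x :* m) :+ m :* m :+ ((con 0ℚ :- ((h :* h :+ h :* h) :* f :+ (h :+ h) :* M)) :* x
          :+ (con 0ℚ :- ((h :+ h) :* f :+ (M :+ M))) :* m :+ (h :* h :* (f :* f) :+ (h :+ h) :* (f :* M) :+ M :* M))) refl
      lem₂ : ∀ h f M X L Q → h * h * X + (h + h) * L + Q + ((0ℚ - ((h * h + h * h) * f + (h + h) * M)) * f + (0ℚ - ((h + h) * f + (M + M))) * M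
          + (h * h * (f * f) + (h + h) * (f * M) + M * M)) ≡ h * h * (X - f * f) + (h + h) * (L - f * M) + (Q - M * M)
      lem₂ = solve 6 (λ h f M X L Q → h :* h :* X :+ (h :+ h) :* L :+ Q :+ ((con 0ℚ :- ((h :* h :+ h :* h) :* f :+ (h :+ h) :* M)) :* f
          :+ (con 0ℚ :- ((h :+ h) :* f :+ (M :+ M))) :* M :+ (h :* h :* (f :* f) :+ (h :+ h) :* (f :* M) :+ M :* M))
          := h :* h :* (X :- f :* f) :+ (h :+ h) :* (L :- f :* M) :+ (Q :- M :* M)) refl
    -- Nonnegativity of the mean of `square` bounds `2 η (f M - XL)` by `η²` times the variance of
    -- `X` plus that of the load, each at most `η²`; moreover `XL` is at most `f`.
    excess : f * (M - 1ℚ) ≤ η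
    excess = *-cancel (η + η) (<-≤-trans 0<η (by-gap (<⇒≤ 0<η) (l₀ η)))
      (by-gap ((((≤-resp refl E-square (E-nn world (λ ω → 0≤sq (η * (X ω u - f) + (seen ω u - M))))
          ⊕ ((<⇒≤ 0<η ⊗ <⇒≤ 0<η) ⊗ (gap (≤-trans EXX f≤1) ⊕ 0≤sq f)))
          ⊕ gap (Var-seen u)) ⊕ gap V₀≤) ⊕ (<⇒≤ 0<η ⊕ <⇒≤ 0<η) ⊗ gap (≤-trans (joint-load u) half≤f))
        (lem η f M XX XL LL V₀))
      where
      l₀ : ∀ h → h ≡ h + h - h
      l₀ = solve 1 (λ h → h := h :+ h :- h) refl
      lem : ∀ h f M X L Q v → h * h * (X - f * f) + (h + h) * (L - f * M) + (Q - M * M) + h * h * ((1ℚ - X) + f * f) + (v - (Q - M * M))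
          + (h * h - v) + (h + h) * (f - L)
            ≡ (h + h) * h - (h + h) * (f * (M - 1ℚ))
      lem = solve 7 (λ h f M X L Q v → h :* h :* (X :- f :* f) :+ (h :+ h) :* (L :- f :* M) :+ (Q :- M :* M) :+ h :* h :* ((con 1ℚ :- X)
          :+ f :* f) :+ (v :- (Q :- M :* M)) :+ (h :* h :- v) :+ (h :+ h) :* (f :- L)
            := (h :+ h) :* h :- (h :+ h) :* (f :* (M :- con 1ℚ))) refl
    go : Dec (M ≤ 1ℚ) → M ≤ 1ℚ + ½ * γ
    go (yes h) = ≤-trans h (by-gap (0≤½ ⊗ 0≤γ) (eq₀ (½ * γ)))
      where
      eq₀ : ∀ a → a ≡ 1ℚ + a - 1ℚ
      eq₀ = solve 1 (λ a → a := con 1ℚ :+ a :- con 1ℚ) refl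
    go (no h) = by-gap ((gap excess ⊕ gap ½≤f ⊗ gap (<⇒≤ (≰⇒> h))) ⊕ (gap excess ⊕ gap ½≤f ⊗ gap (<⇒≤ (≰⇒> h)))) (eq₀ f M γ)
      where
      eq₀ : ∀ f M g → ((ℤ.+ 1 / 4) * g - f * (M - 1ℚ)) + (f - ½) * (M - 1ℚ) + ((ℤ.+ 1 / 4) * g - f * (M - 1ℚ) + (f - ½) * (M - 1ℚ)) ≡ 1ℚ + ½ * g - M
      eq₀ = solve 3 (λ f M g → (con (ℤ.+ 1 / 4) :* g :- f :* (M :- con 1ℚ)) :+ (f :- con ½) :* (M :- con 1ℚ)
          :+ (con (ℤ.+ 1 / 4) :* g :- f :* (M :- con 1ℚ) :+ (f :- con ½) :* (M :- con 1ℚ)) := con 1ℚ :+ con ½ :* g :- M) refl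

  four : ℚ
  four = ℤ.+ 4 / 1

  -- The tolerance `γ` is shared: half covers the deviation from the centre and half the excess of
  -- the centre over 1. Halving the tolerance multiplies the Chebyshev constant by 4.
  κγ₀ : four * κ * sq (½ * γ) ≡ 1ℚ
  κγ₀ = trans (lem κ γ) κγ
    where
    lem : ∀ k g → four * k * ((½ * g) * (½ * g)) ≡ k * (g * g)
    lem = solve 2 (λ k g → con four :* k :* ((con ½ :* g) :* (con ½ :* g)) := k :* (g :* g)) refl

  open Filter (½ * γ) (four * κ) (0≤½ ⊗ 0≤γ) (nonNegative⁻¹ four ⊗ 0≤κ) κγ₀

  Y : World → Fin (m I) → ℚ
  Y ω e = a e * joint ω e

  0≤Y : ∀ ω e → 0ℚ ≤ Y ω e
  0≤Y ω e = 0≤a e ⊗ 0≤joint ω e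

  dev : World → Fin (n I) → ℚ
  dev ω u = seen ω u - centre u

  yA : World → Fin (m I) → ℚ
  yA ω = filtered I (Y ω) (dev ω)

  goods : World → Fin (m I) → ℚ
  goods ω e = good (dev ω (end₁ I e)) * good (dev ω (end₂ I e))

  0≤goods : ∀ ω e → 0ℚ ≤ goods ω e
  0≤goods ω e = good-nn (dev ω (end₁ I e)) ⊗ good-nn (dev ω (end₂ I e))

  goods≤1 : ∀ ω e → goods ω e ≤ 1ℚ
  goods≤1 ω e = ≤-trans (*≤1 (good-nn (dev ω (end₁ I e))) (good≤1 (dev ω (end₂ I e)))) (good≤1 (dev ω (end₁ I e)))

  ζ : World → Fin (m I) → ℚ
  ζ ω e = t e * Inv.Φ e * (joint ω e * goods ω e)

  0≤ζ : ∀ ω e → 0ℚ ≤ ζ ω e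
  0≤ζ ω e = (0≤t e ⊗ Inv.0≤Φ e) ⊗ 0≤joint ω e ⊗ 0≤goods ω e

  ζ≤S : ∀ ω e → ζ ω e ≤ S
  ζ≤S ω e = ≤-trans (*≤1 (0≤t e ⊗ Inv.0≤Φ e) (≤-trans (*≤1 (0≤joint ω e) (goods≤1 ω e)) (joint≤1 ω e))) (tΦ≤S e)

  ζ-yA : ∀ ω e → ζ ω e * xN e ≡ yA ω e
  ζ-yA ω e = lem (t e * Inv.Φ e) (joint ω e) (goods ω e) (xN e)
    where
    lem : ∀ t j g x → t * (j * g) * x ≡ x * t * j * g
    lem = solve 4 (λ t j g x → t :* (j :* g) :* x := x :* t :* j :* g) refl

  0≤across : ∀ ω e u → 0ℚ ≤ across e u (X ω)
  0≤across ω e u = across-nn e u (X ω) (0≤X ω)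

  0≤centre : ∀ u → 0ℚ ≤ centre u
  0≤centre u = E-nn world (λ ω → ∑-nn (λ e → 0≤a e ⊗ 0≤across ω e u))

  load : ∀ ω u → degree-of (λ e → ζ ω e * xN e) u ≤ 1ℚ + γ
  load ω u = ≤-trans (≡⇒≤ (∑-cong (λ e → cong (λ z → ι (inc I e u) * z) (ζ-yA ω e))))
    (≤-trans (filtered-load I (Y ω) (dev ω) centre (0≤Y ω) 0≤centre inner u)
    (≤-trans (+-monoˡ-≤ (½ * γ) (centre≤ u)) (≡⇒≤ (lem γ))))
    where
    lem : ∀ g → 1ℚ + ½ * g + ½ * g ≡ 1ℚ + g
    lem = solve 1 (λ g → con 1ℚ :+ con ½ :* g :+ con ½ :* g := con 1ℚ :+ g) refl
    l₁ : ∀ i a j → i * (a * j) ≡ a * (i * j)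
    l₁ = solve 3 (λ i a j → i :* (a :* j) := a :* (i :* j)) refl
    l₂ : ∀ s c → s ≡ c + (s - c)
    l₂ = solve 2 (λ s c → s := c :+ (s :- c)) refl
    inner : ∀ u → ∑ (λ e → ι (inc I e u) * Y ω e) ≤ centre u + dev ω u
    inner u = ≤-trans (∑-mono (λ e → ≤-trans (≡⇒≤ (trans (l₁ (ι (inc I e u)) (a e) (joint ω e)) (cong (λ z → a e * z) (sym (joint-across ω e u)))))
        (*-monoʳ-nn (a e) (0≤a e) (≤-trans (≡⇒≤ (*-comm (X ω u) (across e u (X ω)))) (*≤1 (0≤across ω e u) (X≤1 ω u))))))
      (≡⇒≤ (l₂ (seen ω u) (centre u)))

  E-yA : ∀ e → (1ℚ - ε) * (xN e * (t e * ι (large e))) ≤ E world (λ ω → yA ω e)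
  E-yA e = go (large e) (Inv.Φf e)
    where
    dev-Var : ∀ u → E world (λ ω → sq (dev ω u)) ≤ V₀
    dev-Var u = ≤-trans (≡⇒≤ (trans (E-sq-shift world (λ ω → seen ω u) (centre u)) (flat (Var world (λ ω → seen ω u)) (centre u)))) (Var-seen u)
      where
      flat : ∀ v m → v + sq (m - m) ≡ v
      flat = solve 2 (λ v m → v :+ (m :- m) :* (m :- m) := v) refl
    go : ∀ b → Inv.Φ e * F e ≡ ι b → (1ℚ - ε) * (xN e * (t e * ι b)) ≤ E world (λ ω → yA ω e)
    go false _ = ≤-trans (≡⇒≤ (lem (1ℚ - ε) (xN e) (t e))) (E-nn world (λ ω → filtered-nn I (Y ω) (dev ω) (0≤Y ω) e))
      where
      lem : ∀ r x t → r * (x * (t * 0ℚ)) ≡ 0ℚ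
      lem = solve 3 (λ r x t → r :* (x :* (t :* con 0ℚ)) := con 0ℚ) refl
    -- The two ends, the factor 4, the bound 20 for `Inv.Φ` and the 400 in `V₀` multiply to 64000.
    go true h = ≤-trans (by-gap ((0≤xN e ⊗ 0≤t e) ⊗ gap tiny) (lem ε (xN e) (t e) κ (S * τ)))
      (E-filtered I world Y dev 0≤Y e (xN e * t e) (twenty * (xN e * t e) * V₀)
        (≡⇒≤ (sym (trans (E-*ˡ world (a e) (λ ω → joint ω e)) (trans (lem₂ (xN e) (t e) (Inv.Φ e) (F e)) (trans (cong (λ z
            → xN e * t e * z) h) (*-identityʳ (xN e * t e)))))))
        (λ u _ → ≤-trans (E-mono world (λ ω → *-monoˡ-nn (sq (dev ω u)) (0≤sq (dev ω u)) (*≤1 (0≤a e) (joint≤1 ω e))))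
          (≤-trans (≡⇒≤ (E-*ˡ world (a e) (λ ω → sq (dev ω u)))) (*-mono-nn (0≤a e)
            (≤-trans (*-monoʳ-nn (xN e) (0≤xN e) (*-monoʳ-nn (t e) (0≤t e) (Inv.Φ≤20 e))) (≡⇒≤ (lem₃ (xN e) (t e) twenty)))
            (E-nn world (λ ω → 0≤sq (dev ω u))) (dev-Var u)))))
      where
      lem₂ : ∀ x t p f → x * (t * p) * f ≡ x * t * (p * f)
      lem₂ = solve 4 (λ x t p f → x :* (t :* p) :* f := x :* t :* (p :* f)) refl
      lem₃ : ∀ x t c → x * (t * c) ≡ c * (x * t)
      lem₃ = solve 3 (λ x t c → x :* (t :* c) := c :* (x :* t)) refl
      lem : ∀ ε x t k s → x * t * (ε - k * (ℤ.+ 64000 / 1 * s)) ≡ x * t - four * k * (twenty * (x * t) * (ℤ.+ 400 / 1 * s)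
          + twenty * (x * t) * (ℤ.+ 400 / 1 * s)) - (1ℚ - ε) * (x * (t * 1ℚ))
      lem = solve 5 (λ ε x t k s → x :* t :* (ε :- k :* (con (ℤ.+ 64000 / 1) :* s))
          := x :* t :- con four :* k :* (con twenty :* (x :* t) :* (con (ℤ.+ 400 / 1) :* s)
          :+ con twenty :* (x :* t) :* (con (ℤ.+ 400 / 1) :* s)) :- (con 1ℚ :- ε) :* (x :* (t :* con 1ℚ))) refl

-- Expected value of the proposal scheme

module Proposals-second (params : Parameters) (0<γ : 0ℚ < Parameters.γ params) (1≤S : 1ℚ ≤ Parameters.S params)
  (wide : ℤ.+ 20 / 1 ≤ Parameters.S params * (Parameters.γ params + Parameters.γ params + Parameters.γ params))
  (tiny : Parameters.κ params * (ℤ.+ 64000 / 1 * (Parameters.S params * Parameters.τ params)) ≤ Parameters.ε params)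
  (I : Instance) where

  open Parameters params
  open Neighbourhood I
  open Sparse params I
  open Proposals params I
  open Selection params I using (K; K-eq; K⊆A; K-match; share-of; selected)
  open Proposals-first params 0<γ 1≤S wide tiny I using (t; large; ζ; 0≤ζ; ζ≤S; load; ζ-yA; yA; E-yA; joint; goods; 0≤t; module Inv)
  module CF' = Crucial-first params 0<γ 1≤S I
  open CF' using (V; shrunk; redrawn)
  module As' = Assembly params I

  -- Brings a load of at most `1 + 4 γ`, of which `3 γ` stem from the three experiments, back below
  -- 1.
  damp : ℚ
  damp = 1ℚ - ℤ.+ 4 / 1 * γ

  0≤damp : 0ℚ ≤ damp
  0≤damp = gap γ≤

  -- In the composed realization every edge follows the sample of its sender, so all proposals are
  -- present together although they come from different samples.
  A-in : ∀ s P R e → A (s , P) e ≡ true → lookup (combine (λ v e → sender s e == v) P R) e ≡ true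
  A-in s P R e h = trans (lookup-combine (λ v e → sender s e == v) P R (sender s e) e (==-refl (sender s e)) (λ u q → sym (==-true q)))
    (opt-Sub (lookup P (sender s e)) e (proj₁ (∧-true (proj₂ (∧-true {active s e} h)))))

  K-crucial : ∀ ω e → lookup (K ω) e ≡ true → crucial e ≡ true
  K-crucial ω e h = A-crucial ω e (K⊆A ω e h)

  ζ-hit : ∀ ω e u → inc I e u ≡ true → X ω u ≡ 0ℚ → ζ ω e ≡ 0ℚ
  ζ-hit ω e u h q = go (inc-cases I h)
    where
    r : ℚ
    r = t e * Inv.Φ e
    l₁ : ∀ r x g → r * (0ℚ * x * g) ≡ 0ℚ
    l₁ = solve 3 (λ r x g → r :* (con 0ℚ :* x :* g) := con 0ℚ) refl
    l₂ : ∀ r x g → r * (x * 0ℚ * g) ≡ 0ℚ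
    l₂ = solve 3 (λ r x g → r :* (x :* con 0ℚ :* g) := con 0ℚ) refl
    go : (end₁ I e ≡ u) ⊎ (end₂ I e ≡ u) → ζ ω e ≡ 0ℚ
    go (inj₁ p) = trans (cong (λ z → r * (z * X ω (end₂ I e) * goods ω e)) (trans (cong (X ω) p) q)) (l₁ r (X ω (end₂ I e)) (goods ω e))
    go (inj₂ p) = trans (cong (λ z → r * (X ω (end₁ I e) * z * goods ω e)) (trans (cong (X ω) p) q)) (l₂ r (X ω (end₁ I e)) (goods ω e))

  -- At a vertex covered by `K` the minor edges vanish, since it is not free; elsewhere only the
  -- damped minor load remains. The matching can therefore keep its full weight 1.
  feasible : ∀ ω z → (∀ e → 0ℚ ≤ z e) → (∀ e → ζ ω e ≡ 0ℚ → z e ≡ 0ℚ) →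
             (∀ u → degree-of z u ≤ degree-of (λ e → ζ ω e * xN e) u + (γ + γ + γ)) →
             ∀ u → ∑ (λ e → ι (inc I e u) * (ι (lookup (K ω) e) * 1ℚ + damp * z e)) ≤ 1ℚ
  feasible ω z 0≤z zero-z h u = go (at? I (K ω) u)
    where
    go : (Σ (Fin (m I)) λ e → (lookup (K ω) e ≡ true) × (inc I e u ≡ true)) ⊎ Misses I (K ω) u →
         ∑ (λ e → ι (inc I e u) * (ι (lookup (K ω) e) * 1ℚ + damp * z e)) ≤ 1ℚ
    go (inj₁ (f , fK , fu)) = ≤-trans (≡⇒≤ (∑-cong term)) (matching-load (K ω) (K-match ω) u)
      where
      hit : X ω u ≡ 0ℚ
      hit = X-hit ω u f fu (K⊆A ω f fK)
      term : ∀ e → ι (inc I e u) * (ι (lookup (K ω) e) * 1ℚ + damp * z e) ≡ ι (inc I e u) * ι (lookup (K ω) e)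
      term e = at (inc I e u) refl
        where
        l₀ : ∀ a b → 0ℚ * a ≡ 0ℚ * b
        l₀ = solve 2 (λ a b → con 0ℚ :* a := con 0ℚ :* b) refl
        l₁ : ∀ k d → 1ℚ * (k * 1ℚ + d * 0ℚ) ≡ 1ℚ * k
        l₁ = solve 2 (λ k d → con 1ℚ :* (k :* con 1ℚ :+ d :* con 0ℚ) := con 1ℚ :* k) refl
        at : ∀ i → inc I e u ≡ i → ι i * (ι (lookup (K ω) e) * 1ℚ + damp * z e) ≡ ι i * ι (lookup (K ω) e)
        at false _ = l₀ (ι (lookup (K ω) e) * 1ℚ + damp * z e) (ι (lookup (K ω) e))
        at true  q = trans (cong (λ y → 1ℚ * (ι (lookup (K ω) e) * 1ℚ + damp * y)) (zero-z e (ζ-hit ω e u q hit))) (l₁ (ι (lookup (K ω) e)) damp)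
    go (inj₂ miss) = ≤-trans (≡⇒≤ (trans (∑-cong term) (∑-*ˡ damp (λ e → ι (inc I e u) * z e))))
        (≤-trans (*-monoʳ-nn damp 0≤damp (≤-trans (h u) (+-monoˡ-≤ (γ + γ + γ) (load ω u))))
          (by-gap (nonNegative⁻¹ (ℤ.+ 16 / 1) ⊗ 0≤γ ⊗ 0≤γ) (eq₀ γ)))
      where
      eq₀ : ∀ g → ℤ.+ 16 / 1 * (g * g) ≡ 1ℚ - (1ℚ - ℤ.+ 4 / 1 * g) * (1ℚ + g + (g + g + g))
      eq₀ = solve 1 (λ g → con (ℤ.+ 16 / 1) :* (g :* g) := con 1ℚ :- (con 1ℚ :- con (ℤ.+ 4 / 1) :* g) :* (con 1ℚ :+ g :+ (g :+ g :+ g))) refl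
      term : ∀ e → ι (inc I e u) * (ι (lookup (K ω) e) * 1ℚ + damp * z e) ≡ damp * (ι (inc I e u) * z e)
      term e = at (inc I e u) refl (lookup (K ω) e) refl
        where
        l₀ : ∀ k d z → 0ℚ * (k * 1ℚ + d * z) ≡ d * (0ℚ * z)
        l₀ = solve 3 (λ k d z → con 0ℚ :* (k :* con 1ℚ :+ d :* z) := d :* (con 0ℚ :* z)) refl
        l₁ : ∀ d z → 1ℚ * (0ℚ * 1ℚ + d * z) ≡ d * (1ℚ * z)
        l₁ = solve 2 (λ d z → con 1ℚ :* (con 0ℚ :* con 1ℚ :+ d :* z) := d :* (con 1ℚ :* z)) refl
        at : ∀ i → inc I e u ≡ i → ∀ k → lookup (K ω) e ≡ k → ι i * (ι k * 1ℚ + damp * z e) ≡ damp * (ι i * z e)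
        at false _ k     _ = l₀ (ι k) damp (z e)
        at true  p true  q = ⊥-elim (miss e q p)
        at true  p false q = l₁ damp (z e)

  gains : World → ℚ
  gains ω = ∑ (λ e → ι (lookup (K ω) e) * 1ℚ * w I e) + ∑ (λ e → damp * w I e * shrunk (yA ω e))

  one : ∀ s P R → gains (s , P) ≤ redrawn (combine (λ v e → sender s e == v) P R)
  one s P R = ≤-trans (≡⇒≤ same) (As'.assembled (K ω) (K-match ω) (K-crucial ω) (ζ ω) (0≤ζ ω) (ζ≤S ω) (load ω) (λ _ → 1ℚ) (λ _ → damp) (λ _
      → 0≤1) (λ _ → 0≤damp)
      (feasible ω) (combine (λ v e → sender s e == v) P R) (λ e h → A-in s P R e (K⊆A ω e h)))
    where
    ω : World
    ω = s , P
    same : gains ω ≡ ∑ (λ e → ι (lookup (K ω) e) * 1ℚ * w I e) + ∑ (λ e → damp * w I e * shrunk (ζ ω e * xN e))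
    same = cong (λ z → ∑ (λ e → ι (lookup (K ω) e) * 1ℚ * w I e) + z) (∑-cong (λ e → cong (λ q → damp * w I e * shrunk q) (sym (ζ-yA ω e))))

  -- For fixed labels the ownership of edges by senders is fixed, so the composition of independent
  -- samples is again distributed as a realization, on top of which the minor edges are redrawn.
  V-given : ∀ s → V ≡ E samples (λ P → E real (λ R → redrawn (combine (λ v e → sender s e == v) P R)))
  V-given s = trans CF'.V-resampled (E-combine (λ e → bern (p I e) (<⇒≤ (p-pos I e)) (p-le1 I e)) (λ v e → sender s e == v) redrawn)

  gains≤V : E world gains ≤ V
  gains≤V = ≤-trans (≡⇒≤ (E-world gains)) (E-≤ labels V (λ s → ≤-trans (E-mono samples (λ P → E-≥ real (gains (s , P)) (one s P))) (≡⇒≤ (sym (V-given s)))))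

  proposals-first : ∑ (λ e → share-of e * w I e) + ∑ (λ e → damp * w I e * shrunk ((1ℚ - ε) * (xN e * (t e * ι (large e))))) ≤ V
  proposals-first = ≤-trans (+-mono-≤ selected rest) (≤-trans (≡⇒≤ (sym E-gains)) gains≤V)
    where
    0≤r : 0ℚ ≤ 1ℚ - ε
    0≤r = gap ε≤1
    shrunk-mono : ∀ {a b} → a ≤ b → shrunk a ≤ shrunk b
    shrunk-mono h = *-monoʳ-nn (1ℚ - ε) 0≤r (*-monoʳ-nn (1ℚ - ε) 0≤r (*-monoʳ-nn (1ℚ - ε) 0≤r h))
    E-shrunk : ∀ e → E world (λ ω → shrunk (yA ω e)) ≡ shrunk (E world (λ ω → yA ω e))
    E-shrunk e = trans (E-*ˡ world (1ℚ - ε) (λ ω → (1ℚ - ε) * ((1ℚ - ε) * yA ω e))) (cong (λ z → (1ℚ - ε) * z)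
      (trans (E-*ˡ world (1ℚ - ε) (λ ω → (1ℚ - ε) * yA ω e)) (cong (λ z → (1ℚ - ε) * z) (E-*ˡ world (1ℚ - ε) (λ ω → yA ω e)))))
    rest : ∑ (λ e → damp * w I e * shrunk ((1ℚ - ε) * (xN e * (t e * ι (large e))))) ≤ E world (λ ω → ∑ (λ e → damp * w I e * shrunk (yA ω e)))
    rest = ≤-trans (∑-mono (λ e → *-monoʳ-nn (damp * w I e) (0≤damp ⊗ w-nonneg I e) (shrunk-mono (E-yA e))))
      (≡⇒≤ (sym (trans (E-∑ world (λ e ω → damp * w I e * shrunk (yA ω e))) (∑-cong (λ e → trans (E-*ˡ world (damp * w I e) (λ ω
          → shrunk (yA ω e))) (cong (λ z → damp * w I e * z) (E-shrunk e)))))))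
    E-gains : E world gains ≡ E world (λ ω → ∑ (λ e → ι (lookup (K ω) e) * 1ℚ * w I e)) + E world (λ ω → ∑ (λ e → damp * w I e * shrunk (yA ω e)))
    E-gains = E-+ world (λ ω → ∑ (λ e → ι (lookup (K ω) e) * 1ℚ * w I e)) (λ ω → ∑ (λ e → damp * w I e * shrunk (yA ω e)))

-- The worst case over the crucial loads b ≤ a of the two ends of a minor edge

-- The certificates below write the gap as a positive combination of products of the nonnegative forms
-- l₀, l₁', l₂' (the barycentric coordinates of the triangle of loads in question) and of squares.

Γ₀ T₀ damp₀ : ℚ
Γ₀    = ℤ.+ 3 / 1000
T₀    = ℤ.+ 683 / 1000
damp₀ = ℤ.+ 249 / 250

d₀ : ℚ → ℚ
d₀ c = ℤ.+ 6 / 32 - (ℤ.+ 1 / 32) * c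

mix₀ : ℚ → ℚ → ℚ
mix₀ Ψ t = (ℤ.+ 2 / 3) * Ψ + (ℤ.+ 1 / 3) * (damp₀ * t)

mix₀-mono : ∀ {Ψ Ψ' t t'} → Ψ ≤ Ψ' → t ≤ t' → mix₀ Ψ t ≤ mix₀ Ψ' t'
mix₀-mono p q = +-mono-≤ (*-monoʳ-nn (ℤ.+ 2 / 3) (nonNegative⁻¹ (ℤ.+ 2 / 3)) p)
  (*-monoʳ-nn (ℤ.+ 1 / 3) (nonNegative⁻¹ (ℤ.+ 1 / 3)) (*-monoʳ-nn damp₀ (nonNegative⁻¹ damp₀) q))

module Worst (a b ia ib : ℚ) (0≤b : 0ℚ ≤ b) (b≤a : b ≤ a) (a≤1 : a ≤ 1ℚ)
             (0≤ia : 0ℚ ≤ ia) (0≤ib : 0ℚ ≤ ib) (gia : (1ℚ + Γ₀ - a) * ia ≡ 1ℚ) (gib : (1ℚ + Γ₀ - b) * ib ≡ 1ℚ) where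

  ga gb : ℚ
  ga = 1ℚ + Γ₀ - a
  gb = 1ℚ + Γ₀ - b

  b≤1 : b ≤ 1ℚ
  b≤1 = ≤-trans b≤a a≤1

  0<g : ∀ x → x ≤ 1ℚ → 0ℚ < 1ℚ + Γ₀ - x
  0<g x h = <-≤-trans (positive⁻¹ Γ₀) (by-gap (gap h) (eq₀ x))
    where
    eq₀ : ∀ x → 1ℚ - x ≡ 1ℚ + Γ₀ - x - Γ₀
    eq₀ = solve 1 (λ x → con 1ℚ :- x := con 1ℚ :+ con Γ₀ :- x :- con Γ₀) refl

  0≤ga : 0ℚ ≤ ga
  0≤ga = <⇒≤ (0<g a a≤1)

  -- multiplication by ga gb clears the reciprocals
  clear : ∀ {p y z} → ga * gb * y ≡ (gb * ib) * p + (ga * ia) * z → ga * gb * T₀ ≤ p + z → T₀ ≤ y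
  clear {p} {y} {z} e h = *-cancel (ga * gb) 0<gg (≤-trans h (≡⇒≤ (sym (trans e (cong₂ _+_
      (trans (cong (λ r → r * p) (trans (*-comm gb ib) (trans (*-comm ib gb) gib))) (*-identityˡ p)) (trans (cong (λ r → r * z) gia) (*-identityˡ z)))))))
    where
    0<gg : 0ℚ < ga * gb
    0<gg = ≤-<-trans (≡⇒≤ (sym (*-zeroʳ ga))) (*-monoʳ-<-pos ga {{positive (0<g a a≤1)}} (0<g b b≤1))

  T-half : ℚ
  T-half = (1ℚ - ½ * b) * ib

  -- Expected value of the minimum of the residual capacities in the extremal couplings of the two
  -- coverage events. `Ψ₁`: the ends are never covered together, for `a + b ≤ 1`. `Ψ₂`: at least one
  -- is always covered, for `a + b ≥ 1`. `Ψ₃`: the end of smaller load alone decides, namely when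
  -- its full capacity `ib` is at most the reduced capacity `d₀ a * ia` of the other.
  Ψ₁ Ψ₂ Ψ₃ : ℚ
  Ψ₁ = ib - ib * (1ℚ - d₀ b) * b - (ib - d₀ a * ia) * a
  Ψ₂ = d₀ a * ia - (d₀ a * ia - d₀ b * ib) * b
  Ψ₃ = ib - ib * (1ℚ - d₀ b) * b

  case₁ : a + b ≤ 1ℚ → T₀ ≤ mix₀ Ψ₁ T-half
  case₁ h = clear (l₁ a b ga gb ia ib (d₀ a) (d₀ b)) (by-gap cert≥0 (l₂ a b))
    where
    l₀ l₁' l₂' : ℚ
    l₀  = 1ℚ - (a + b)
    l₁' = a - b
    l₂' = b + b
    0≤l₀ : 0ℚ ≤ l₀
    0≤l₀ = gap h
    0≤l₁ : 0ℚ ≤ l₁'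
    0≤l₁ = gap b≤a
    0≤l₂ : 0ℚ ≤ l₂'
    0≤l₂ = 0≤b ⊕ 0≤b
    l₁ : ∀ a b ga gb ia ib da db → ga * gb * ((ℤ.+ 2 / 3) * (ib - ib * (1ℚ - db) * b - (ib - da * ia) * a) + (ℤ.+ 1 / 3) * (damp₀ * ((1ℚ - ½ * b) * ib)))
         ≡ (gb * ib) * (ga * ((ℤ.+ 2 / 3) * (1ℚ - (1ℚ - db) * b - a) + (ℤ.+ 1 / 3) * (damp₀ * (1ℚ - ½ * b)))) + (ga * ia) * (gb * ((ℤ.+ 2 / 3) * (da * a)))
    l₁ = solve 8 (λ a b ga gb ia ib da db → ga :* gb :* (con (ℤ.+ 2 / 3) :* (ib :- ib :* (con 1ℚ :- db) :* b :- (ib :- da :* ia) :* a)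
        :+ con (ℤ.+ 1 / 3) :* (con damp₀ :* ((con 1ℚ :- con ½ :* b) :* ib)))
         := (gb :* ib) :* (ga :* (con (ℤ.+ 2 / 3) :* (con 1ℚ :- (con 1ℚ :- db) :* b :- a)
             :+ con (ℤ.+ 1 / 3) :* (con damp₀ :* (con 1ℚ :- con ½ :* b)))) :+ (ga :* ia) :* (gb :* (con (ℤ.+ 2 / 3) :* (da :* a)))) refl
    cert≥0 : 0ℚ ≤ (ℤ.+ 2377812952331 / 930000000000000) * (l₁' * (l₂' * (l₂'))) + ((ℤ.+ 11768947519 / 144150000000000) * (l₁' * (l₁' * (l₂')))
        + ((ℤ.+ 4389889550497 / 30000000000000) * (l₀ * (l₂' * (l₂'))) + ((ℤ.+ 13054564171369789 / 28830000000000000) * (l₀ * (l₀ * (l₂')))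
        + ((ℤ.+ 3609041603 / 100000000000) * (l₀ * (l₀ * (l₁'))) + ((ℤ.+ 943675559 / 3000000000) * (l₀ * (l₀ * (l₀)))
        + ((ℤ.+ 51039383 / 2500000000) * (sq (l₁' - (ℤ.+ 31 / 100) * l₂') * (l₀))
        + ((ℤ.+ 993364010251 / 96100000000000) * (sq (l₁' - (ℤ.+ 31 / 100) * l₂' - (ℤ.+ 3 / 5) * l₀) * (l₂'))
        + ((ℤ.+ 310260059 / 3000000000) * (sq (l₁' - (ℤ.+ 31 / 100) * l₂' - (ℤ.+ 7 / 10) * l₀) * (l₁'))
        + ((ℤ.+ 27251716969247 / 288300000000000) * (sq (l₁' - (ℤ.+ 31 / 100) * l₂' - (ℤ.+ 7 / 10) * l₀) * (l₂')))))))))))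
    cert≥0 = (nonNegative⁻¹ (ℤ.+ 2377812952331 / 930000000000000) ⊗ 0≤l₁ ⊗ 0≤l₂ ⊗ 0≤l₂)
        ⊕ ((nonNegative⁻¹ (ℤ.+ 11768947519 / 144150000000000) ⊗ 0≤l₁ ⊗ 0≤l₁ ⊗ 0≤l₂)
        ⊕ ((nonNegative⁻¹ (ℤ.+ 4389889550497 / 30000000000000) ⊗ 0≤l₀ ⊗ 0≤l₂ ⊗ 0≤l₂)
        ⊕ ((nonNegative⁻¹ (ℤ.+ 13054564171369789 / 28830000000000000) ⊗ 0≤l₀ ⊗ 0≤l₀ ⊗ 0≤l₂)
        ⊕ ((nonNegative⁻¹ (ℤ.+ 3609041603 / 100000000000) ⊗ 0≤l₀ ⊗ 0≤l₀ ⊗ 0≤l₁) ⊕ ((nonNegative⁻¹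
        (ℤ.+ 943675559 / 3000000000) ⊗ 0≤l₀ ⊗ 0≤l₀ ⊗ 0≤l₀) ⊕ ((nonNegative⁻¹ (ℤ.+ 51039383 / 2500000000) ⊗ 0≤sq (l₁' -
        (ℤ.+ 31 / 100) * l₂') ⊗ 0≤l₀) ⊕ ((nonNegative⁻¹ (ℤ.+ 993364010251 / 96100000000000) ⊗ 0≤sq (l₁' - (ℤ.+ 31 / 100) * l₂' -
        (ℤ.+ 3 / 5) * l₀) ⊗ 0≤l₂) ⊕ ((nonNegative⁻¹ (ℤ.+ 310260059 / 3000000000) ⊗ 0≤sq (l₁' - (ℤ.+ 31 / 100) * l₂' - (ℤ.+ 7 / 10) * l₀) ⊗ 0≤l₁)
        ⊕ (nonNegative⁻¹ (ℤ.+ 27251716969247 / 288300000000000) ⊗ 0≤sq (l₁' - (ℤ.+ 31 / 100) * l₂' - (ℤ.+ 7 / 10) * l₀) ⊗ 0≤l₂)))))))))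
    l₂ : ∀ a b → (ℤ.+ 2377812952331 / 930000000000000) * ((a - b) * ((b + b) * ((b + b))))
        + ((ℤ.+ 11768947519 / 144150000000000) * ((a - b) * ((a - b) * ((b + b)))) + ((ℤ.+ 4389889550497 / 30000000000000) * ((1ℚ - (a + b)) * ((b
        + b) * ((b + b)))) + ((ℤ.+ 13054564171369789 / 28830000000000000) * ((1ℚ - (a + b)) * ((1ℚ - (a + b)) * ((b + b))))
        + ((ℤ.+ 3609041603 / 100000000000) * ((1ℚ - (a + b)) * ((1ℚ - (a + b)) * ((a - b)))) + ((ℤ.+ 943675559 / 3000000000) * ((1ℚ - (a
        + b)) * ((1ℚ - (a + b)) * ((1ℚ - (a + b))))) + ((ℤ.+ 51039383 / 2500000000) * (sq ((a - b) - (ℤ.+ 31 / 100) * (b + b)) * ((1ℚ - (a + b))))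
        + ((ℤ.+ 993364010251 / 96100000000000) * (sq ((a - b) - (ℤ.+ 31 / 100) * (b + b) - (ℤ.+ 3 / 5) * (1ℚ - (a + b))) * ((b + b)))
        + ((ℤ.+ 310260059 / 3000000000) * (sq ((a - b) - (ℤ.+ 31 / 100) * (b + b) - (ℤ.+ 7 / 10) * (1ℚ - (a + b))) * ((a - b)))
        + ((ℤ.+ 27251716969247 / 288300000000000) * (sq ((a - b) - (ℤ.+ 31 / 100) * (b + b) - (ℤ.+ 7 / 10) * (1ℚ - (a + b))) * ((b + b))))))))))))
         ≡ ((1ℚ + Γ₀ - a) * ((ℤ.+ 2 / 3) * (1ℚ - (1ℚ - ((ℤ.+ 6 / 32) - (ℤ.+ 1 / 32) * b)) * b - a) + (ℤ.+ 1 / 3) * (damp₀ * (1ℚ - ½ * b))) + (1ℚ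
             + Γ₀ - b) * ((ℤ.+ 2 / 3) * (((ℤ.+ 6 / 32) - (ℤ.+ 1 / 32) * a) * a))) - (1ℚ + Γ₀ - a) * (1ℚ + Γ₀ - b) * T₀
    l₂ = solve 2 (λ a b → con (ℤ.+ 2377812952331 / 930000000000000) :* ((a :- b) :* ((b :+ b) :* ((b :+ b))))
        :+ (con (ℤ.+ 11768947519 / 144150000000000) :* ((a :- b) :* ((a :- b) :* ((b :+ b))))
        :+ (con (ℤ.+ 4389889550497 / 30000000000000) :* ((con 1ℚ :- (a :+ b)) :* ((b :+ b) :* ((b :+ b))))
        :+ (con (ℤ.+ 13054564171369789 / 28830000000000000) :* ((con 1ℚ :- (a :+ b)) :* ((con 1ℚ :- (a :+ b)) :* ((b :+ b))))
        :+ (con (ℤ.+ 3609041603 / 100000000000) :* ((con 1ℚ :- (a :+ b)) :* ((con 1ℚ :- (a :+ b)) :* ((a :- b))))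
        :+ (con (ℤ.+ 943675559 / 3000000000) :* ((con 1ℚ :- (a :+ b)) :* ((con 1ℚ :- (a :+ b)) :* ((con 1ℚ :- (a :+ b)))))
        :+ (con (ℤ.+ 51039383 / 2500000000) :* ((((a :- b) :- con (ℤ.+ 31 / 100) :* (b :+ b)) :* ((a :- b) :- con (ℤ.+ 31 / 100) :* (b
        :+ b))) :* ((con 1ℚ :- (a :+ b)))) :+ (con (ℤ.+ 993364010251 / 96100000000000) :* ((((a :- b) :- con (ℤ.+ 31 / 100) :* (b
        :+ b) :- con (ℤ.+ 3 / 5) :* (con 1ℚ :- (a :+ b))) :* ((a :- b) :- con (ℤ.+ 31 / 100) :* (b :+ b) :- con (ℤ.+ 3 / 5) :* (con 1ℚ :- (a
        :+ b)))) :* ((b :+ b))) :+ (con (ℤ.+ 310260059 / 3000000000) :* ((((a :- b) :- con (ℤ.+ 31 / 100) :* (b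
        :+ b) :- con (ℤ.+ 7 / 10) :* (con 1ℚ :- (a :+ b))) :* ((a :- b) :- con (ℤ.+ 31 / 100) :* (b :+ b) :- con (ℤ.+ 7 / 10) :* (con 1ℚ :- (a
        :+ b)))) :* ((a :- b))) :+ (con (ℤ.+ 27251716969247 / 288300000000000) :* ((((a :- b) :- con (ℤ.+ 31 / 100) :* (b
        :+ b) :- con (ℤ.+ 7 / 10) :* (con 1ℚ :- (a :+ b))) :* ((a :- b) :- con (ℤ.+ 31 / 100) :* (b :+ b) :- con (ℤ.+ 7 / 10) :* (con 1ℚ :- (a
        :+ b)))) :* ((b :+ b))))))))))))
         := ((con 1ℚ :+ con Γ₀ :- a) :* (con (ℤ.+ 2 / 3) :* (con 1ℚ :- (con 1ℚ :- (con (ℤ.+ 6 / 32) :- con (ℤ.+ 1 / 32) :* b)) :* b :- a)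
             :+ con (ℤ.+ 1 / 3) :* (con damp₀ :* (con 1ℚ :- con ½ :* b))) :+ (con 1ℚ
             :+ con Γ₀ :- b) :* (con (ℤ.+ 2 / 3) :* ((con (ℤ.+ 6 / 32) :- con (ℤ.+ 1 / 32) :* a) :* a))) :- (con 1ℚ :+ con Γ₀ :- a) :* (con 1ℚ
             :+ con Γ₀ :- b) :* con T₀) refl

  case₂ : 1ℚ ≤ a + b → T₀ ≤ mix₀ Ψ₂ T-half
  case₂ h = clear (l₁ a b ga gb ia ib (d₀ a) (d₀ b)) (by-gap cert≥0 (l₂ a b))
    where
    l₀ l₁' l₂' : ℚ
    l₀  = a + b - 1ℚ
    l₁' = a - b
    l₂' = (1ℚ - a) + (1ℚ - a)
    0≤l₀ : 0ℚ ≤ l₀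
    0≤l₀ = gap h
    0≤l₁ : 0ℚ ≤ l₁'
    0≤l₁ = gap b≤a
    0≤l₂ : 0ℚ ≤ l₂'
    0≤l₂ = gap a≤1 ⊕ gap a≤1
    l₁ : ∀ a b ga gb ia ib da db → ga * gb * ((ℤ.+ 2 / 3) * (da * ia - (da * ia - db * ib) * b) + (ℤ.+ 1 / 3) * (damp₀ * ((1ℚ - ½ * b) * ib)))
         ≡ (gb * ib) * (ga * ((ℤ.+ 2 / 3) * (db * b) + (ℤ.+ 1 / 3) * (damp₀ * (1ℚ - ½ * b)))) + (ga * ia) * (gb * ((ℤ.+ 2 / 3) * (da * (1ℚ - b))))
    l₁ = solve 8 (λ a b ga gb ia ib da db → ga :* gb :* (con (ℤ.+ 2 / 3) :* (da :* ia :- (da :* ia :- db :* ib) :* b)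
        :+ con (ℤ.+ 1 / 3) :* (con damp₀ :* ((con 1ℚ :- con ½ :* b) :* ib)))
         := (gb :* ib) :* (ga :* (con (ℤ.+ 2 / 3) :* (db :* b) :+ con (ℤ.+ 1 / 3) :* (con damp₀ :* (con 1ℚ :- con ½ :* b))))
             :+ (ga :* ia) :* (gb :* (con (ℤ.+ 2 / 3) :* (da :* (con 1ℚ :- b))))) refl
    -- The square vanishes, for `l₀ = 0`, near `a = 0.62` and `b = 0.38`, about where the gap is
    -- smallest along the line `a + b = 1`. The squares of the case `a + b ≤ 1` vanish at the same
    -- point.
    cert≥0 : 0ℚ ≤ (ℤ.+ 112445479 / 300000000000) * (l₂' * (l₂')) + ((ℤ.+ 7373959 / 3000000000) * (l₁' * (l₁'))
        + ((ℤ.+ 101192467 / 750000000) * (l₀ * (l₂')) + ((ℤ.+ 60103 / 500000000) * (l₀ * (l₁')) + ((ℤ.+ 804353 / 1000000000) * (l₀ * (l₀))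
        + ((ℤ.+ 3028861 / 30000000) * (sq (l₁' - (ℤ.+ 31 / 100) * l₂')))))))
    cert≥0 = (nonNegative⁻¹ (ℤ.+ 112445479 / 300000000000) ⊗ 0≤l₂ ⊗ 0≤l₂) ⊕ ((nonNegative⁻¹ (ℤ.+ 7373959 / 3000000000) ⊗ 0≤l₁ ⊗ 0≤l₁)
        ⊕ ((nonNegative⁻¹ (ℤ.+ 101192467 / 750000000) ⊗ 0≤l₀ ⊗ 0≤l₂) ⊕ ((nonNegative⁻¹ (ℤ.+ 60103 / 500000000) ⊗ 0≤l₀ ⊗ 0≤l₁)
        ⊕ ((nonNegative⁻¹ (ℤ.+ 804353 / 1000000000) ⊗ 0≤l₀ ⊗ 0≤l₀) ⊕ (nonNegative⁻¹ (ℤ.+ 3028861 / 30000000) ⊗ 0≤sq (l₁' - (ℤ.+ 31 / 100) * l₂'))))))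
    l₂ : ∀ a b → (ℤ.+ 112445479 / 300000000000) * (((1ℚ - a) + (1ℚ - a)) * (((1ℚ - a) + (1ℚ - a))))
        + ((ℤ.+ 7373959 / 3000000000) * ((a - b) * ((a - b))) + ((ℤ.+ 101192467 / 750000000) * ((a + b - 1ℚ) * (((1ℚ - a) + (1ℚ - a))))
        + ((ℤ.+ 60103 / 500000000) * ((a + b - 1ℚ) * ((a - b))) + ((ℤ.+ 804353 / 1000000000) * ((a + b - 1ℚ) * ((a + b - 1ℚ)))
        + ((ℤ.+ 3028861 / 30000000) * (sq ((a - b) - (ℤ.+ 31 / 100) * ((1ℚ - a) + (1ℚ - a)))))))))
         ≡ ((1ℚ + Γ₀ - a) * ((ℤ.+ 2 / 3) * (((ℤ.+ 6 / 32) - (ℤ.+ 1 / 32) * b) * b) + (ℤ.+ 1 / 3) * (damp₀ * (1ℚ - ½ * b))) + (1ℚ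
             + Γ₀ - b) * ((ℤ.+ 2 / 3) * (((ℤ.+ 6 / 32) - (ℤ.+ 1 / 32) * a) * (1ℚ - b)))) - (1ℚ + Γ₀ - a) * (1ℚ + Γ₀ - b) * T₀
    l₂ = solve 2 (λ a b → con (ℤ.+ 112445479 / 300000000000) :* (((con 1ℚ :- a) :+ (con 1ℚ :- a)) :* (((con 1ℚ :- a) :+ (con 1ℚ :- a))))
        :+ (con (ℤ.+ 7373959 / 3000000000) :* ((a :- b) :* ((a :- b))) :+ (con (ℤ.+ 101192467 / 750000000) :* ((a
        :+ b :- con 1ℚ) :* (((con 1ℚ :- a) :+ (con 1ℚ :- a)))) :+ (con (ℤ.+ 60103 / 500000000) :* ((a :+ b :- con 1ℚ) :* ((a :- b)))
        :+ (con (ℤ.+ 804353 / 1000000000) :* ((a :+ b :- con 1ℚ) :* ((a :+ b :- con 1ℚ)))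
        :+ (con (ℤ.+ 3028861 / 30000000) :* ((((a :- b) :- con (ℤ.+ 31 / 100) :* ((con 1ℚ :- a)
        :+ (con 1ℚ :- a))) :* ((a :- b) :- con (ℤ.+ 31 / 100) :* ((con 1ℚ :- a) :+ (con 1ℚ :- a))))))))))
         := ((con 1ℚ :+ con Γ₀ :- a) :* (con (ℤ.+ 2 / 3) :* ((con (ℤ.+ 6 / 32) :- con (ℤ.+ 1 / 32) :* b) :* b)
             :+ con (ℤ.+ 1 / 3) :* (con damp₀ :* (con 1ℚ :- con ½ :* b))) :+ (con 1ℚ
             :+ con Γ₀ :- b) :* (con (ℤ.+ 2 / 3) :* ((con (ℤ.+ 6 / 32) :- con (ℤ.+ 1 / 32) :* a) :* (con 1ℚ :- b)))) :- (con 1ℚ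
             :+ con Γ₀ :- a) :* (con 1ℚ :+ con Γ₀ :- b) :* con T₀) refl

  -- The larger load drops out: `ga` is a common factor, and what remains is quadratic in `b`.
  case₃ : T₀ ≤ mix₀ Ψ₃ T-half
  case₃ = clear (l₁ b ga gb ia ib (d₀ b)) (≤-trans (≡⇒≤ (*-assoc ga gb T₀)) (≤-trans (*-monoʳ-nn ga 0≤ga cert≥0) (≡⇒≤ (l₃ ga ((ℤ.+ 2 / 3) * (1ℚ -
      (1ℚ - d₀ b) * b) + (ℤ.+ 1 / 3) * (damp₀ * (1ℚ - ½ * b)))))))
    where
    l₁ : ∀ b ga gb ia ib db → ga * gb * ((ℤ.+ 2 / 3) * (ib - ib * (1ℚ - db) * b) + (ℤ.+ 1 / 3) * (damp₀ * ((1ℚ - ½ * b) * ib)))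
         ≡ (gb * ib) * (ga * ((ℤ.+ 2 / 3) * (1ℚ - (1ℚ - db) * b) + (ℤ.+ 1 / 3) * (damp₀ * (1ℚ - ½ * b)))) + (ga * ia) * 0ℚ
    l₁ = solve 6 (λ b ga gb ia ib db → ga :* gb :* (con (ℤ.+ 2 / 3) :* (ib :- ib :* (con 1ℚ :- db) :* b)
        :+ con (ℤ.+ 1 / 3) :* (con damp₀ :* ((con 1ℚ :- con ½ :* b) :* ib)))
         := (gb :* ib) :* (ga :* (con (ℤ.+ 2 / 3) :* (con 1ℚ :- (con 1ℚ :- db) :* b) :+ con (ℤ.+ 1 / 3) :* (con damp₀ :* (con 1ℚ :- con ½ :* b))))
             :+ (ga :* ia) :* con 0ℚ) refl
    l₃ : ∀ g x → g * x ≡ g * x + 0ℚ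
    l₃ = solve 2 (λ g x → g :* x := g :* x :+ con 0ℚ) refl
    cert≥0 : gb * T₀ ≤ (ℤ.+ 2 / 3) * (1ℚ - (1ℚ - d₀ b) * b) + (ℤ.+ 1 / 3) * (damp₀ * (1ℚ - ½ * b))
    cert≥0 = by-gap ((nonNegative⁻¹ (ℤ.+ 940853 / 3000000) ⊗ gap b≤1) ⊕ ((nonNegative⁻¹ (ℤ.+ 804353 / 3000000) ⊗ 0≤b)
        ⊕ (nonNegative⁻¹ (ℤ.+ 1 / 48) ⊗ 0≤b ⊗ gap b≤1))) (l₂ b)
      where
      l₂ : ∀ b → (ℤ.+ 940853 / 3000000) * (1ℚ - b) + ((ℤ.+ 804353 / 3000000) * b + (ℤ.+ 1 / 48) * (b * (1ℚ - b)))
           ≡ ((ℤ.+ 2 / 3) * (1ℚ - (1ℚ - ((ℤ.+ 6 / 32) - (ℤ.+ 1 / 32) * b)) * b) + (ℤ.+ 1 / 3) * (damp₀ * (1ℚ - ½ * b))) - (1ℚ + Γ₀ - b) * T₀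
      l₂ = solve 1 (λ b → con (ℤ.+ 940853 / 3000000) :* (con 1ℚ :- b) :+ (con (ℤ.+ 804353 / 3000000) :* b :+ con (ℤ.+ 1 / 48) :* (b :* (con 1ℚ :- b)))
           := (con (ℤ.+ 2 / 3) :* (con 1ℚ :- (con 1ℚ :- (con (ℤ.+ 6 / 32) :- con (ℤ.+ 1 / 32) :* b)) :* b)
               :+ con (ℤ.+ 1 / 3) :* (con damp₀ :* (con 1ℚ :- con ½ :* b))) :- (con 1ℚ :+ con Γ₀ :- b) :* con T₀) refl
  -- Here the second scheme may have given up the edge. But then `b` is at least 0.9, so `ib` is so
  -- large that even the reduced capacity at the end of smaller load, a lower bound for `Ψ`,
  -- suffices.
  case₄ : ℤ.+ 19 / 10 ≤ a + b → ∀ Ψ → d₀ b * ib ≤ Ψ → T₀ ≤ mix₀ Ψ 0ℚ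
  case₄ h Ψ k = ≤-trans (≤-trans big (≡⇒≤ (l₀ (d₀ b * ib)))) (mix₀-mono {d₀ b * ib} {Ψ} {0ℚ} {0ℚ} k ≤-refl)
    where
    l₀ : ∀ x → (ℤ.+ 2 / 3) * x ≡ mix₀ x 0ℚ
    l₀ = solve 1 (λ x → con (ℤ.+ 2 / 3) :* x := con (ℤ.+ 2 / 3) :* x :+ con (ℤ.+ 1 / 3) :* (con damp₀ :* con 0ℚ)) refl
    gb≤ : T₀ * gb ≤ (ℤ.+ 2 / 3) * d₀ b
    gb≤ = by-gap ((nonNegative⁻¹ (ℤ.+ 1 / 48) ⊗ gap b≤1 ⊕ nonNegative⁻¹ T₀ ⊗ (gap h ⊕ gap a≤1)) ⊕ nonNegative⁻¹ (ℤ.+ 101453 / 3000000)) (eq₀ a b)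
      where
      eq₀ : ∀ a b → (ℤ.+ 1 / 48) * (1ℚ - b) + T₀ * ((a + b - ℤ.+ 19 / 10) + (1ℚ - a)) + ℤ.+ 101453 / 3000000
          ≡ (ℤ.+ 2 / 3) * (ℤ.+ 6 / 32 - (ℤ.+ 1 / 32) * b) - T₀ * (1ℚ + Γ₀ - b)
      eq₀ = solve 2 (λ a b → con (ℤ.+ 1 / 48) :* (con 1ℚ :- b) :+ con T₀ :* ((a :+ b :- con (ℤ.+ 19 / 10)) :+ (con 1ℚ :- a))
          :+ con (ℤ.+ 101453 / 3000000) := con (ℤ.+ 2 / 3) :* (con (ℤ.+ 6 / 32) :- con (ℤ.+ 1 / 32) :* b) :- con T₀ :* (con 1ℚ :+ con Γ₀ :- b)) refl
    big : T₀ ≤ (ℤ.+ 2 / 3) * (d₀ b * ib)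
    big = ≤-trans (≡⇒≤ (sym (trans (*-assoc T₀ gb ib) (trans (cong (λ z → T₀ * z) gib) (*-identityʳ T₀))))) (≤-trans (*-monoˡ-nn ib 0≤ib gb≤) (≡⇒≤
        (*-assoc (ℤ.+ 2 / 3) (d₀ b) ib)))

-- The approximation ratio, edge by edge

module Bound (params : Parameters) (0<γ : 0ℚ < Parameters.γ params) (1≤S : 1ℚ ≤ Parameters.S params)
  (wide : ℤ.+ 20 / 1 ≤ Parameters.S params * (Parameters.γ params + Parameters.γ params + Parameters.γ params))
  (tiny : Parameters.κ params * (ℤ.+ 64000 / 1 * (Parameters.S params * Parameters.τ params)) ≤ Parameters.ε params)
  (γ≡ : Parameters.γ params ≡ ℤ.+ 1 / 1000) (ε≡ : Parameters.ε params ≡ ℤ.+ 1 / 2000)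
  (I : Instance) where

  open Parameters params

  open Neighbourhood I
  open Sparse params I
  open Crucial-first params 0<γ 1≤S I
  open Selection params I using (share-of)
  open Proposals-first params 0<γ 1≤S wide tiny I using (t; t₀; 0≤t₀; 0≤t; large; F; F-≥)
  open Proposals-second params 0<γ 1≤S wide tiny I using (damp; 0≤damp; proposals-first)

  G : Fin (n I) → ℚ
  G u = 1ℚ + Γ₀ - c u

  Gi : ∀ u → G u * i u ≡ 1ℚ
  Gi u = trans (cong (λ z → (1ℚ + z - c u) * i u) (sym (cong (λ z → z + z + z) γ≡))) (gi u)

  -- Written for ends ordered by load, with the properties of the minima passed as hypotheses, so
  -- that one argument serves both orientations of the edge.
  module Pair (e : Fin (m I)) (lo hi : Fin (n I)) (c≤ : c lo ≤ c hi)
              (ψ-glb : ∀ S' y → y ≤ r S' lo → y ≤ r S' hi → y ≤ ψ S' e)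
              (t-glb : ∀ y → y ≤ t₀ lo → y ≤ t₀ hi → y ≤ t e)
              (F≥ : 1ℚ - ½ * (c lo + c hi) ≤ F e) where

    module W = Worst (c hi) (c lo) (i hi) (i lo) (0≤c lo) c≤ (c≤1 hi) (0≤i hi) (0≤i lo) (Gi hi) (Gi lo)

    i≤ : i lo ≤ i hi
    i≤ = ≤-trans (≡⇒≤ (sym (trans (cong (λ z → z * i lo) (Gi hi)) (*-identityˡ (i lo)))))
      (≤-trans (by-gap ((0≤i hi ⊗ 0≤i lo) ⊗ gap c≤) (lem (c lo) (c hi) (i lo) (i hi) (1ℚ + Γ₀)))
        (≡⇒≤ (trans (cong (λ z → z * i hi) (Gi lo)) (*-identityˡ (i hi)))))
      where
      lem : ∀ a b i j g → j * i * (b - a) ≡ (g - a) * i * j - (g - b) * j * i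
      lem = solve 5 (λ a b i j g → j :* i :* (b :- a) := (g :- a) :* i :* j :- (g :- b) :* j :* i) refl

    -- After cross-multiplication the difference is `c hi - c lo` times `6/32 - (1 + Γ₀)/32`, which
    -- is 4997/32000: the room shrinks faster with the load than the reserve does.
    di≤ : d lo * i lo ≤ d hi * i hi
    di≤ = ≤-trans (≡⇒≤ (sym (trans (l₁ (d lo) (i lo) (G hi * i hi)) (trans (cong (λ z → z * (d lo * i lo)) (Gi hi)) (*-identityˡ (d lo * i lo))))))
      (≤-trans (by-gap ((0≤i hi ⊗ 0≤i lo) ⊗ (nonNegative⁻¹ (ℤ.+ 4997 / 32000) ⊗ gap c≤)) (lem (c lo) (c hi) (i lo) (i hi)))
        (≡⇒≤ (trans (l₁ (d hi) (i hi) (G lo * i lo)) (trans (cong (λ z → z * (d hi * i hi)) (Gi lo)) (*-identityˡ (d hi * i hi))))))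
      where
      l₁ : ∀ d i x → d * i * x ≡ x * (d * i)
      l₁ = solve 3 (λ d i x → d :* i :* x := x :* (d :* i)) refl
      lem : ∀ a b i j → j * i * (ℤ.+ 4997 / 32000 * (b - a)) ≡ (ℤ.+ 6 / 32 - (ℤ.+ 1 / 32) * b) * j * ((1ℚ
          + Γ₀ - a) * i) - (ℤ.+ 6 / 32 - (ℤ.+ 1 / 32) * a) * i * ((1ℚ + Γ₀ - b) * j)
      lem = solve 4 (λ a b i j → j :* i :* (con (ℤ.+ 4997 / 32000) :* (b :- a)) := (con (ℤ.+ 6 / 32) :- con (ℤ.+ 1 / 32) :* b) :* j :* ((con 1ℚ
          :+ con Γ₀ :- a) :* i) :- (con (ℤ.+ 6 / 32) :- con (ℤ.+ 1 / 32) :* a) :* i :* ((con 1ℚ :+ con Γ₀ :- b) :* j)) refl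

    -- The minimum in `t e` is attained at the end of smaller load; the constant 997/2000 is
    -- `1 - (1 + Γ₀)/2`.
    t-half : W.T-half ≤ t e
    t-half = t-glb W.T-half ≤-refl (≤-trans (≡⇒≤ (sym (trans (l₁ (1ℚ - ½ * c lo) (i lo) (G hi * i hi)) (trans (cong (λ z
        → z * t₀ lo) (Gi hi)) (*-identityˡ (t₀ lo))))))
      (≤-trans (by-gap ((0≤i hi ⊗ 0≤i lo) ⊗ (nonNegative⁻¹ (ℤ.+ 997 / 2000) ⊗ gap c≤)) (lem (c lo) (c hi) (i lo) (i hi)))
        (≡⇒≤ (trans (l₁ (1ℚ - ½ * c hi) (i hi) (G lo * i lo)) (trans (cong (λ z → z * t₀ hi) (Gi lo)) (*-identityˡ (t₀ hi)))))))
      where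
      l₁ : ∀ d i x → d * i * x ≡ x * (d * i)
      l₁ = solve 3 (λ d i x → d :* i :* x := x :* (d :* i)) refl
      lem : ∀ a b i j → j * i * (ℤ.+ 997 / 2000 * (b - a)) ≡ (1ℚ - ½ * b) * j * ((1ℚ + Γ₀ - a) * i) - (1ℚ - ½ * a) * i * ((1ℚ + Γ₀ - b) * j)
      lem = solve 4 (λ a b i j → j :* i :* (con (ℤ.+ 997 / 2000) :* (b :- a)) := (con 1ℚ :- con ½ :* b) :* j :* ((con 1ℚ
          :+ con Γ₀ :- a) :* i) :- (con 1ℚ :- con ½ :* a) :* i :* ((con 1ℚ :+ con Γ₀ :- b) :* j)) refl

    Ψ₃≤ : i lo ≤ d hi * i hi → W.Ψ₃ ≤ Ψ e
    Ψ₃≤ h = ≤-trans (≡⇒≤ (l₀ (i lo) (d lo) (c lo) (c hi))) (Ψ-≥ e lo hi (i lo) (i lo * (1ℚ - d lo)) 0ℚ (λ S' → ψ-glb S' _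
        (≡⇒≤ (l₁ (i lo) (d lo) (cov S' lo) (cov S' hi)))
        (≤-trans (by-gap ((0≤i lo ⊗ gap (d≤1 lo)) ⊗ 0≤cov S' lo ⊕ gap h ⊕ 0≤i hi ⊗ gap (d≤1 hi) ⊗ gap (cov≤1 S' hi)) (l₂ (i lo) (d lo) (cov S' lo)
            (i hi) (d hi) (cov S' hi))) ≤-refl)))
      where
      l₀ : ∀ i d c e → i - i * (1ℚ - d) * c ≡ i - i * (1ℚ - d) * c - 0ℚ * e
      l₀ = solve 4 (λ i d c e → i :- i :* (con 1ℚ :- d) :* c := i :- i :* (con 1ℚ :- d) :* c :- con 0ℚ :* e) refl
      l₁ : ∀ i d c e → i - i * (1ℚ - d) * c - 0ℚ * e ≡ i * (1ℚ - (1ℚ - d) * c)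
      l₁ = solve 4 (λ i d c e → i :- i :* (con 1ℚ :- d) :* c :- con 0ℚ :* e := i :* (con 1ℚ :- (con 1ℚ :- d) :* c)) refl
      l₂ : ∀ i d c j f e → i * (1ℚ - d) * c + (f * j - i + j * ((1ℚ - f) * (1ℚ - e))) ≡ j * (1ℚ - (1ℚ - f) * e) - (i - i * (1ℚ - d) * c - 0ℚ * e)
      l₂ = solve 6 (λ i d c j f e → i :* (con 1ℚ :- d) :* c :+ (f :* j :- i :+ j :* ((con 1ℚ :- f) :* (con 1ℚ :- e)))
          := j :* (con 1ℚ :- (con 1ℚ :- f) :* e) :- (i :- i :* (con 1ℚ :- d) :* c :- con 0ℚ :* e)) refl

    -- This linear minorant agrees with the minimum of the residual capacities whenever at most one
    -- end is covered.
    Ψ₁≤ : d hi * i hi ≤ i lo → W.Ψ₁ ≤ Ψ e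
    Ψ₁≤ h = Ψ-≥ e lo hi (i lo) (i lo * (1ℚ - d lo)) (i lo - d hi * i hi) (λ S' → ψ-glb S' _
        (by-gap (gap h ⊗ 0≤cov S' hi) (l₁ (i lo) (d lo) (cov S' lo) (d hi * i hi) (cov S' hi)))
        (by-gap ((0≤i lo ⊗ gap (d≤1 lo)) ⊗ 0≤cov S' lo ⊕ gap i≤ ⊗ gap (cov≤1 S' hi)) (l₂ (i lo) (d lo) (cov S' lo) (i hi) (d hi) (cov S' hi))))
      where
      l₁ : ∀ i d c x e → (i - x) * e ≡ i * (1ℚ - (1ℚ - d) * c) - (i - i * (1ℚ - d) * c - (i - x) * e)
      l₁ = solve 5 (λ i d c x e → (i :- x) :* e := i :* (con 1ℚ :- (con 1ℚ :- d) :* c) :- (i :- i :* (con 1ℚ :- d) :* c :- (i :- x) :* e)) refl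
      l₂ : ∀ i d c j f e → i * (1ℚ - d) * c + (j - i) * (1ℚ - e) ≡ j * (1ℚ - (1ℚ - f) * e) - (i - i * (1ℚ - d) * c - (i - f * j) * e)
      l₂ = solve 6 (λ i d c j f e → i :* (con 1ℚ :- d) :* c :+ (j :- i) :* (con 1ℚ :- e)
          := j :* (con 1ℚ :- (con 1ℚ :- f) :* e) :- (i :- i :* (con 1ℚ :- d) :* c :- (i :- f :* j) :* e)) refl

    -- This linear minorant agrees with the minimum whenever at least one end is covered.
    Ψ₂≤ : d hi * i hi ≤ i lo → W.Ψ₂ ≤ Ψ e
    Ψ₂≤ h = ≤-trans (≡⇒≤ (l₀ (d hi * i hi) (d lo * i lo) (c lo) (c hi))) (Ψ-≥ e lo hi (d hi * i hi) (d hi * i hi - d lo * i lo) 0ℚ (λ S' → ψ-glb S' _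
        (by-gap (gap h ⊗ gap (cov≤1 S' lo)) (l₁ (i lo) (d lo) (cov S' lo) (d hi * i hi) (cov S' hi)))
        (by-gap (gap di≤ ⊗ 0≤cov S' lo ⊕ 0≤i hi ⊗ gap (d≤1 hi) ⊗ gap (cov≤1 S' hi)) (l₂ (d lo * i lo) (cov S' lo) (i hi) (d hi) (cov S' hi)))))
      where
      l₀ : ∀ x y c e → x - (x - y) * c ≡ x - (x - y) * c - 0ℚ * e
      l₀ = solve 4 (λ x y c e → x :- (x :- y) :* c := x :- (x :- y) :* c :- con 0ℚ :* e) refl
      l₁ : ∀ i d c x e → (i - x) * (1ℚ - c) ≡ i * (1ℚ - (1ℚ - d) * c) - (x - (x - d * i) * c - 0ℚ * e)
      l₁ = solve 5 (λ i d c x e → (i :- x) :* (con 1ℚ :- c) := i :* (con 1ℚ :- (con 1ℚ :- d) :* c) :- (x :- (x :- d :* i) :* c :- con 0ℚ :* e)) refl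
      l₂ : ∀ y c j f e → (f * j - y) * c + j * ((1ℚ - f) * (1ℚ - e)) ≡ j * (1ℚ - (1ℚ - f) * e) - (f * j - (f * j - y) * c - 0ℚ * e)
      l₂ = solve 5 (λ y c j f e → (f :* j :- y) :* c :+ j :* ((con 1ℚ :- f) :* (con 1ℚ :- e))
          := j :* (con 1ℚ :- (con 1ℚ :- f) :* e) :- (f :* j :- (f :* j :- y) :* c :- con 0ℚ :* e)) refl

    low : d lo * i lo ≤ Ψ e
    low = go (i lo ≤? d hi * i hi)
      where
      l₁ : ∀ i d c → i * ((1ℚ - d) * (1ℚ - c)) ≡ i - i * (1ℚ - d) * c - d * i
      l₁ = solve 3 (λ i d c → i :* ((con 1ℚ :- d) :* (con 1ℚ :- c)) := i :- i :* (con 1ℚ :- d) :* c :- d :* i) refl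
      l₂ : ∀ x y c → (x - y) * (1ℚ - c) ≡ x - (x - y) * c - y
      l₂ = solve 3 (λ x y c → (x :- y) :* (con 1ℚ :- c) := x :- (x :- y) :* c :- y) refl
      go : Dec (i lo ≤ d hi * i hi) → d lo * i lo ≤ Ψ e
      go (yes h) = ≤-trans (by-gap (0≤i lo ⊗ gap (d≤1 lo) ⊗ gap (c≤1 lo)) (l₁ (i lo) (d lo) (c lo))) (Ψ₃≤ h)
      go (no h)  = ≤-trans (by-gap (gap di≤ ⊗ gap (c≤1 lo)) (l₂ (d hi * i hi) (d lo * i lo) (c lo))) (Ψ₂≤ (<⇒≤ (≰⇒> h)))

    ok : T₀ ≤ mix₀ (Ψ e) (t e * ι (large e))
    ok = go (c hi + c lo ≤? ℤ.+ 19 / 10)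
      where
      ordinary : T₀ ≤ mix₀ (Ψ e) (t e)
      ordinary = pick (i lo ≤? d hi * i hi) (c hi + c lo ≤? 1ℚ)
        where
        pick : Dec (i lo ≤ d hi * i hi) → Dec (c hi + c lo ≤ 1ℚ) → T₀ ≤ mix₀ (Ψ e) (t e)
        pick (yes h) _       = ≤-trans W.case₃ (mix₀-mono {W.Ψ₃} {Ψ e} {W.T-half} {t e} (Ψ₃≤ h) t-half)
        pick (no h)  (yes k) = ≤-trans (W.case₁ k) (mix₀-mono {W.Ψ₁} {Ψ e} {W.T-half} {t e} (Ψ₁≤ (<⇒≤ (≰⇒> h))) t-half)
        pick (no h)  (no k)  = ≤-trans (W.case₂ (<⇒≤ (≰⇒> k))) (mix₀-mono {W.Ψ₂} {Ψ e} {W.T-half} {t e} (Ψ₂≤ (<⇒≤ (≰⇒> h))) t-half)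
      go : Dec (c hi + c lo ≤ ℤ.+ 19 / 10) → T₀ ≤ mix₀ (Ψ e) (t e * ι (large e))
      go (no h) = ≤-trans (W.case₄ (<⇒≤ (≰⇒> h)) (Ψ e) low) (mix₀-mono {Ψ e} {Ψ e} {0ℚ} {t e * ι (large e)} ≤-refl (0≤t e ⊗ 0≤ι (large e)))
      go (yes h) = ≤-trans ordinary (mix₀-mono {Ψ e} {Ψ e} {t e} {t e * ι (large e)} ≤-refl (≡⇒≤ (sym (trans (cong (λ b
          → t e * ι b) is-large) (*-identityʳ (t e))))))
        where
        F-large : ℤ.+ 1 / 20 ≤ F e
        F-large = ≤-trans (by-gap (0≤½ ⊗ gap h) (eq₀ (c hi) (c lo))) F≥
          where
          eq₀ : ∀ a b → ½ * (ℤ.+ 19 / 10 - (a + b)) ≡ 1ℚ - ½ * (b + a) - ℤ.+ 1 / 20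
          eq₀ = solve 2 (λ a b → con ½ :* (con (ℤ.+ 19 / 10) :- (a :+ b)) := con 1ℚ :- con ½ :* (b :+ a) :- con (ℤ.+ 1 / 20)) refl
        is-large : large e ≡ true
        is-large = at (ℤ.+ 1 / 20 ≤? F e)
          where
          at : (d : Dec (ℤ.+ 1 / 20 ≤ F e)) → does d ≡ true
          at (yes _) = refl
          at (no k)  = ⊥-elim (k F-large)

  ψ-glb : ∀ e S' y → y ≤ r S' (end₁ I e) → y ≤ r S' (end₂ I e) → y ≤ ψ S' e
  ψ-glb e S' y p q = ⊓-glb {y} {r S' (end₁ I e)} {r S' (end₂ I e)} p q

  t-glb : ∀ e y → y ≤ t₀ (end₁ I e) → y ≤ t₀ (end₂ I e) → y ≤ t e
  t-glb e y p q = ⊓-glb {y} {t₀ (end₁ I e)} {t₀ (end₂ I e)} p q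

  F-sym : ∀ e → 1ℚ - ½ * (c (end₂ I e) + c (end₁ I e)) ≤ F e
  F-sym e = ≤-trans (≡⇒≤ (cong (λ z → 1ℚ - ½ * z) (+-comm (c (end₂ I e)) (c (end₁ I e))))) (F-≥ e)

  minor-ok : ∀ e → T₀ ≤ mix₀ (Ψ e) (t e * ι (large e))
  minor-ok e = go (≤-total (c (end₁ I e)) (c (end₂ I e)))
    where
    go : (c (end₁ I e) ≤ c (end₂ I e)) ⊎ (c (end₂ I e) ≤ c (end₁ I e)) → T₀ ≤ mix₀ (Ψ e) (t e * ι (large e))
    go (inj₁ h) = Pair.ok e (end₁ I e) (end₂ I e) h (ψ-glb e) (t-glb e) (F-≥ e)
    go (inj₂ h) = Pair.ok e (end₂ I e) (end₁ I e) h (λ S' y p q → ψ-glb e S' y q p) (λ y p q → t-glb e y q p) (F-sym e)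

  0≤Ψ : ∀ e → 0ℚ ≤ Ψ e
  0≤Ψ e = E-nn real (λ S' → 0≤ψ S' e)

  goal : ℚ
  goal = ℤ.+ 681 / 1000

  per-edge : ∀ e → goal * (x e * w I e) ≤
    (ℤ.+ 2 / 3) * (xC e * θ e * w I e + Ψ e * w I e * shrunk (xN e)) +
    (ℤ.+ 1 / 3) * (share-of e * w I e + damp * w I e * shrunk ((1ℚ - ε) * (xN e * (t e * ι (large e)))))
  per-edge e = ≤-trans (≡⇒≤ (trans (cong (λ z → goal * (z * w I e)) (sym (x-split e))) (l₀ goal (xC e) (xN e) (w I e))))
    (≤-trans (+-mono-≤ crucial-part minor-part) (≡⇒≤ (sym (regroup (xC e * θ e * w I e) (Ψ e * w I e * shrunk (xN e)) (share-of e * w I e)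
        (damp * w I e * shrunk ((1ℚ - ε) * (xN e * (t e * ι (large e)))))))))
    where
    y : ℚ
    y = t e * ι (large e)
    l₀ : ∀ g a b w → g * ((a + b) * w) ≡ g * (a * w) + g * (b * w)
    l₀ = solve 4 (λ g a b w → g :* ((a :+ b) :* w) := g :* (a :* w) :+ g :* (b :* w)) refl
    regroup : ∀ a b c d → (ℤ.+ 2 / 3) * (a + b) + (ℤ.+ 1 / 3) * (c + d) ≡ ((ℤ.+ 2 / 3) * a + (ℤ.+ 1 / 3) * c) + ((ℤ.+ 2 / 3) * b + (ℤ.+ 1 / 3) * d)
    regroup = solve 4 (λ a b c d → con (ℤ.+ 2 / 3) :* (a :+ b) :+ con (ℤ.+ 1 / 3) :* (c :+ d)
        := (con (ℤ.+ 2 / 3) :* a :+ con (ℤ.+ 1 / 3) :* c) :+ (con (ℤ.+ 2 / 3) :* b :+ con (ℤ.+ 1 / 3) :* d)) refl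
    crucial-part : goal * (xC e * w I e) ≤ (ℤ.+ 2 / 3) * (xC e * θ e * w I e) + (ℤ.+ 1 / 3) * (share-of e * w I e)
    -- The end loads cancel in the mixture, and 11/16 exceeds 0.681 by 13/2000.
    crucial-part = by-gap (nonNegative⁻¹ (ℤ.+ 13 / 2000) ⊗ 0≤xC e ⊗ w-nonneg I e) (eq₀ (xC e) (c (end₁ I e) + c (end₂ I e)) (w I e))
      where
      eq₀ : ∀ x s w → ℤ.+ 13 / 2000 * (x * w) ≡ (ℤ.+ 2 / 3) * (x * (ℤ.+ 25 / 32 + (ℤ.+ 1 / 32) * s) * w)
          + (ℤ.+ 1 / 3) * (x * (½ - (ℤ.+ 1 / 16) * s) * w) - goal * (x * w)
      eq₀ = solve 3 (λ x s w → con (ℤ.+ 13 / 2000) :* (x :* w) := con (ℤ.+ 2 / 3) :* (x :* (con (ℤ.+ 25 / 32) :+ con (ℤ.+ 1 / 32) :* s) :* w)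
          :+ con (ℤ.+ 1 / 3) :* (x :* (con ½ :- con (ℤ.+ 1 / 16) :* s) :* w) :- con goal :* (x :* w)) refl
    minor-part : goal * (xN e * w I e) ≤ (ℤ.+ 2 / 3) * (Ψ e * w I e * shrunk (xN e)) + (ℤ.+ 1 / 3) * (damp * w I e * shrunk ((1ℚ - ε) * (xN e * y)))
    minor-part = ≤-trans (*-monoˡ-nn (xN e * w I e) (0≤xN e ⊗ w-nonneg I e) enough)
      (≤-trans (by-gap ((0≤xN e ⊗ w-nonneg I e) ⊗ (nonNegative⁻¹ ρ⁴ ⊗ gap (minor-ok e) ⊕ nonNegative⁻¹ slack ⊗ 0≤Ψ e)) (eq₀ (Ψ e) y (xN e) (w I e)))
        (≡⇒≤ (numerals (1ℚ - ε) damp (Ψ e) y (xN e) (w I e) (cong (λ z → 1ℚ - z) ε≡) (cong (λ z → 1ℚ - ℤ.+ 4 / 1 * z) γ≡))))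
      where
      ρ ρ⁴ slack : ℚ
      ρ = ℤ.+ 1999 / 2000
      ρ⁴ = ρ * (ρ * (ρ * ρ))
      -- The first scheme loses three factors `ρ` and the second four; charging four to both leaves
      -- this surplus.
      slack = (ℤ.+ 2 / 3) * (ρ * (ρ * ρ) - ρ⁴)
      -- Stated for variables `r` and `δ` so that the two equations can be matched by `refl`; the
      -- parameters themselves are still abstract here.
      numerals : ∀ r δ Ψ y x w → r ≡ ρ → δ ≡ damp₀ →
        (ℤ.+ 2 / 3) * (Ψ * w * (ρ * (ρ * (ρ * x)))) + (ℤ.+ 1 / 3) * (damp₀ * w * (ρ * (ρ * (ρ * (ρ * (x * y)))))) ≡
        (ℤ.+ 2 / 3) * (Ψ * w * (r * (r * (r * x)))) + (ℤ.+ 1 / 3) * (δ * w * (r * (r * (r * (r * (x * y))))))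
      numerals r δ Ψ y x w refl refl = refl
      enough : goal ≤ ρ⁴ * T₀
      enough = toWitness {a? = goal ≤? ρ⁴ * T₀} _
      eq₀ : ∀ Ψ y x w → x * w * (ρ⁴ * (mix₀ Ψ y - T₀) + slack * Ψ) ≡ (ℤ.+ 2 / 3) * (Ψ * w * (ρ * (ρ * (ρ * x))))
          + (ℤ.+ 1 / 3) * (damp₀ * w * (ρ * (ρ * (ρ * (ρ * (x * y)))))) - ρ⁴ * T₀ * (x * w)
      eq₀ = solve 4 (λ Ψ y x w → x :* w :* (con ρ⁴ :* (con (ℤ.+ 2 / 3) :* Ψ :+ con (ℤ.+ 1 / 3) :* (con damp₀ :* y) :- con T₀) :+ con slack :* Ψ)
            := con (ℤ.+ 2 / 3) :* (Ψ :* w :* (con ρ :* (con ρ :* (con ρ :* x)))) :+ con (ℤ.+ 1 / 3) :* (con damp₀ :* w :* (con ρ :* (con ρ :*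
                (con ρ :* (con ρ :* (x :* y)))))) :- con ρ⁴ :* con T₀ :* (x :* w)) refl

  bound : goal * E real (mwm I) ≤ V
  bound = ≤-trans (≡⇒≤ (trans (cong (λ z → goal * z) OPT) (sym (∑-*ˡ goal (λ e → x e * w I e)))))
    (≤-trans (∑-mono per-edge) (≤-trans (≡⇒≤ total) (≤-trans (+-mono-≤
        (*-monoʳ-nn (ℤ.+ 2 / 3) (nonNegative⁻¹ (ℤ.+ 2 / 3)) crucial-first)
        (*-monoʳ-nn (ℤ.+ 1 / 3) (nonNegative⁻¹ (ℤ.+ 1 / 3)) proposals-first)) (≡⇒≤ (whole V)))))
    where
    whole : ∀ v → (ℤ.+ 2 / 3) * v + (ℤ.+ 1 / 3) * v ≡ v
    whole = solve 1 (λ v → con (ℤ.+ 2 / 3) :* v :+ con (ℤ.+ 1 / 3) :* v := v) refl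
    a₁ a₂ b₁ b₂ : Fin (m I) → ℚ
    a₁ e = xC e * θ e * w I e
    a₂ e = Ψ e * w I e * shrunk (xN e)
    b₁ e = share-of e * w I e
    b₂ e = damp * w I e * shrunk ((1ℚ - ε) * (xN e * (t e * ι (large e))))
    total : ∑ (λ e → (ℤ.+ 2 / 3) * (a₁ e + a₂ e) + (ℤ.+ 1 / 3) * (b₁ e + b₂ e)) ≡ (ℤ.+ 2 / 3) * (∑ a₁ + ∑ a₂) + (ℤ.+ 1 / 3) * (∑ b₁ + ∑ b₂)
    total = trans (∑-+ (λ e → (ℤ.+ 2 / 3) * (a₁ e + a₂ e)) (λ e → (ℤ.+ 1 / 3) * (b₁ e + b₂ e)))
      (cong₂ _+_ (trans (∑-*ˡ (ℤ.+ 2 / 3) (λ e → a₁ e + a₂ e)) (cong (λ z → (ℤ.+ 2 / 3) * z) (∑-+ a₁ a₂)))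
        (trans (∑-*ˡ (ℤ.+ 1 / 3) (λ e → b₁ e + b₂ e)) (cong (λ z → (ℤ.+ 1 / 3) * z) (∑-+ b₁ b₂))))

-- The best subgraph of bounded degree

argmax : {X : Set} {P : X → Set} (P? : ∀ y → Dec (P y)) (f : X → ℚ) (xs : List X) (x₀ : X) → P x₀ →
         Σ X λ x → P x × (∀ y → y ∈ xs → P y → f y ≤ f x)
argmax P? f []      x₀ p₀ = x₀ , p₀ , λ _ ()
argmax {X} {P} P? f (y ∷ xs) x₀ p₀ = go (argmax P? f xs x₀ p₀) (P? y)
  where
  go : (Σ X λ x → P x × (∀ y → y ∈ xs → P y → f y ≤ f x)) → Dec (P y) → Σ X λ x → P x × (∀ z → z ∈ (y ∷ xs) → P z → f z ≤ f x)
  go (x , p , h) (no ¬q) = x , p , λ { z (here refl) q → ⊥-elim (¬q q) ; z (there k) q → h z k q }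
  go (x , p , h) (yes q) with ≤-total (f x) (f y)
  ... | inj₁ le = y , q , λ { z (here refl) _ → ≤-refl ; z (there k) r → ≤-trans (h z k r) le }
  ... | inj₂ ge = x , p , λ { z (here refl) _ → ge ; z (there k) r → h z k r }

module Choice (params : Parameters) (0<γ : 0ℚ < Parameters.γ params) (1≤S : 1ℚ ≤ Parameters.S params)
  (wide : ℤ.+ 20 / 1 ≤ Parameters.S params * (Parameters.γ params + Parameters.γ params + Parameters.γ params))
  (tiny : Parameters.κ params * (ℤ.+ 64000 / 1 * (Parameters.S params * Parameters.τ params)) ≤ Parameters.ε params)
  (γ≡ : Parameters.γ params ≡ ℤ.+ 1 / 1000) (ε≡ : Parameters.ε params ≡ ℤ.+ 1 / 2000)
  (C₀ : ℚ) (enough : 1ℚ + Parameters.L params ≤ Parameters.τ params * C₀) (I : Instance) where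

  open Parameters params
  open Sparse params I

  Bounded : EdgeSet (m I) → Set
  Bounded H = ∀ u → ℕtoℚ (degree I H u) * pmin I ≤ C₀

  Bounded? : ∀ H → Dec (Bounded H)
  Bounded? H = all? (λ u → ℕtoℚ (degree I H u) * pmin I ≤? C₀)

  yield-of : EdgeSet (m I) → ℚ
  yield-of H = E real (λ R → mwm I (H ∩ₑ R))

  Q-bounded : ∀ B → Bounded (Q B)
  Q-bounded B u = *-cancel τ 0<τ (≤-trans (≡⇒≤ (*-comm τ (ℕtoℚ (degree I (Q B) u) * pmin I))) (≤-trans (Q-degree B u) enough))

  best : Σ (EdgeSet (m I)) λ H → Bounded H × (∀ H' → H' ∈ allEdgeSets (m I) → Bounded H' → yield-of H' ≤ yield-of H)
  -- The search starts from the candidate of the empty query, which consists of the crucial edges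
  -- alone.
  best = argmax Bounded? yield-of (allEdgeSets (m I)) (Q (Data.Vec.replicate (m I) false)) (Q-bounded (Data.Vec.replicate (m I) false))

  alg : EdgeSet (m I)
  alg = proj₁ best

  -- Probabilistic method: every outcome of the queries is an admissible candidate, so the average
  -- yield is at most that of the best one.
  good-enough : (ℤ.+ 681 / 1000) * E real (mwm I) ≤ yield-of alg
  good-enough = ≤-trans (Bound.bound params 0<γ 1≤S wide tiny γ≡ ε≡ I) (E-≤ queries (yield-of alg) (λ B
      → proj₂ (proj₂ best) (Q B) (allEdgeSets-complete (Q B)) (Q-bounded B)))

-- `γ` and `ε` are set by the room between 0.683 and 0.681. `L` makes the pruning loss half of `ε`,
-- and `S` exceeds `20 / (3 γ)`, a bound for the scaling in the proposal scheme. Finally `τ` is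
-- taken so small that the variance terms, multiples of `κ * (S * τ)`, are negligible.
params : Parameters
params = record
  { γ = ℤ.+ 1 / 1000 ; κ = ℤ.+ 1000000 / 1 ; τ = ℤ.+ 1 / 100000000000000000000 ; S = ℤ.+ 10000 / 1
  ; L = ℤ.+ 16000 / 1 ; Λ = ℤ.+ 1 / 16000 ; ε = ℤ.+ 1 / 2000
  ; 0≤γ = toWitness {a? = 0ℚ ≤? ℤ.+ 1 / 1000} _
  ; γ≤  = toWitness {a? = ℤ.+ 4 / 1 * (ℤ.+ 1 / 1000) ≤? 1ℚ} _
  ; 0≤κ = toWitness {a? = 0ℚ ≤? ℤ.+ 1000000 / 1} _
  ; κγ  = refl
  ; 0<τ = toWitness {a? = 0ℚ <? ℤ.+ 1 / 100000000000000000000} _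
  ; 0≤S = toWitness {a? = 0ℚ ≤? ℤ.+ 10000 / 1} _
  ; Sτ≤ = toWitness {a? = ℤ.+ 2 / 1 * (ℤ.+ 10000 / 1) * (ℤ.+ 1 / 100000000000000000000) ≤? 1ℚ} _
  ; 0≤Λ = toWitness {a? = 0ℚ ≤? ℤ.+ 1 / 16000} _
  ; ΛL  = refl
  ; ε≤1 = toWitness {a? = ℤ.+ 1 / 2000 ≤? 1ℚ} _
  ; 0≤L = toWitness {a? = 0ℚ ≤? ℤ.+ 16000 / 1} _
  ; τ≤1 = toWitness {a? = ℤ.+ 1 / 100000000000000000000 ≤? 1ℚ} _
  ; small = toWitness {a? = ℤ.+ 1000000 / 1 * (ℤ.+ 64 / 1 * (ℤ.+ 2 / 1 * (ℤ.+ 10000 / 1) * (ℤ.+ 1 / 100000000000000000000)))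
      + ℤ.+ 4 / 1 * (ℤ.+ 1 / 16000) ≤? ℤ.+ 1 / 2000} _
  }

open Parameters params

0<γ : 0ℚ < γ
0<γ = toWitness {a? = 0ℚ <? ℤ.+ 1 / 1000} _

1≤S : 1ℚ ≤ S
1≤S = toWitness {a? = 1ℚ ≤? ℤ.+ 10000 / 1} _

wide : ℤ.+ 20 / 1 ≤ S * (γ + γ + γ)
wide = toWitness {a? = ℤ.+ 20 / 1 ≤? S * (γ + γ + γ)} _

tiny : κ * (ℤ.+ 64000 / 1 * (S * τ)) ≤ ε
tiny = toWitness {a? = κ * (ℤ.+ 64000 / 1 * (S * τ)) ≤? ε} _

-- This is `(1 + L) / τ`.
C₀ : ℚ
C₀ = ℤ.+ 1600100000000000000000000 / 1

enough : 1ℚ + L ≤ τ * C₀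
enough = toWitness {a? = 1ℚ + L ≤? τ * C₀} _

module Chosen = Choice params 0<γ 1≤S wide tiny refl refl C₀ enough

open import Data.Integer using (+_)

theorem1p1 : Σ ℚ λ C → (0ℚ < C) ×
    Σ ((I : Instance) → EdgeSet (m I)) λ alg → (I : Instance) →
    ((x : Fin (n I)) → ℕtoℚ (degree I (alg I) x) * pmin I ≤ C)
    × ((+ 681 / 1000) * 𝔼 I (mwm I) ≤ 𝔼 I (λ R → mwm I (alg I ∩ₑ R)))
theorem1p1 = C₀ , toWitness {a? = 0ℚ <? C₀} _ , Chosen.alg , λ I → proj₁ (proj₂ (Chosen.best I)) ,
  ≤-resp (cong (λ z → (+ 681 / 1000) * z) (sym (𝔼-E I (mwm I)))) (sym (𝔼-E I (λ R → mwm I (Chosen.alg I ∩ₑ R)))) (Chosen.good-enough I)
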